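{- Let $k\ge 4$ be a fixed integer. There is a set $S$ of positive integers of asymptotic density $1$ such that for every $n\in S$, \[ n \text{ is } k\text{ -free} \iff s(n) \text{ is } k\text{ -free}. \]
   Context: For a positive integer $n$, $s(n):=\sum_{d\mid n,\ d<n} d$ is the sum of the proper divisors of $n$ (so $s(n)=\sigma(n)-n$, where $\sigma$ is the sum-of-divisors function). An integer is called $k$-free ($k$th-power-free) if it is not divisible by the $k$th power of any integer larger than $1$. -}

module Defs where

open import Data.Nat using (ℕ; zero; suc; _+_; _*_; _∸_; _^_; _≤_; _<_)
open import Data.Nat.Divisibility using (_∣_; _∣?_)
open import Data.List using (List; upTo; filter)
open import Data.Nat.ListAction using (sum)
open import Data.Bool using (Bool; true; false; if_then_else_)
open import Relation.Nullary using (¬_)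
open import Data.Product using (∃-syntax)

-- s(n) = sum of proper divisors d ∣ n with d < n  (d = 0 contributes nothing)
s : ℕ → ℕ
s n = sum (filter (_∣? n) (upTo n))

KFree : ℕ → ℕ → Set
KFree k n = ∀ m → 1 < m → ¬ (m ^ k ∣ n)

count : (ℕ → Bool) → ℕ → ℕ
count S zero = zero
count S (suc x) = (if S (suc x) then 1 else 0) + count S x

-- S has asymptotic density 1: count S x / x → 1, i.e. for every m ≥ 1 there is N
-- such that for all x ≥ N, x - count S x ≤ x / m  (written m * (x ∸ count S x) ≤ x)
Density1 : (ℕ → Bool) → Set
Density1 S = ∀ m → 1 ≤ m → ∃[ N ] (∀ x → N ≤ x → m * (x ∸ count S x) ≤ x)

-- If exactly one of n and s(n) is k-free, then p^k divides exactly one of them for some prime p. Let y be a large constant.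
-- Case p ≤ y. For almost all n there are k primes q ≡ −1 modulo p with q ∥ n, so p^k divides σ(n) = n + s(n), and p^k divides
-- both or neither of n and s(n). This rests on the divergence of Σ 1/q over the primes q ≡ −1 modulo p, and on Chebyshev's
-- inequality for the number of prime factors of n in a given set. The divergence comes from elements of the real subring of ℤ[ζ_p]
-- whose norm is ≡ −1 modulo p. Such a norm has a prime factor q ≢ 1, and prime factors q ≢ ±1 divide it at least twice, so they
-- are rare.
-- Case p > y. For almost all n no square of an integer above y divides n, so p⁴ divides s(n). Almost every n is m P with a prime P
-- in a window above p², and s(n) = P s(m) + σ(m) fixes P modulo a power of p in terms of m, so such n are rare. The windows for
-- 2^(8L) < p ≤ 2^(16L) with L = 2^j deal with all p up to a small power of n. For larger p, either p ∣ n, and then a prime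
-- factor Q of n leaves few choices for p given n / Q, or σ(n) ≡ n modulo p⁴, and then a prime P > p dividing n, or a unitary
-- odd squarefree divisor u of n with p < u < p², is determined by p and the cofactor.

module Submission where

open import Defs
open import Data.Nat using (ℕ; zero; suc; pred; _+_; _*_; _∸_; _^_; _≤_; _<_; z≤n; s≤s; NonZero; >-nonZero; >-nonZero⁻¹; ≢-nonZero; ≢-nonZero⁻¹; nonTrivial⇒n>1; _≤?_; _<?_; _≟_; _!)
open import Data.Nat.Properties
open import Data.Nat.Divisibility
open import Data.Nat.DivMod
open import Data.Nat.Primality using (Prime; prime?; euclidsLemma; prime⇒nonZero; prime⇒nonTrivial; prime⇒irreducible; prime[2]; ¬prime[1]; ¬prime[0])
open import Data.Nat.Primality.Factorisation using (PrimeFactorisation; factorise; factorisationHasAllPrimeFactors)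
open import Data.Nat.Coprimality using (Coprime; coprime-divisor; coprime-Bézout)
open import Data.Nat.GCD using (module Bézout)
open import Data.Nat.ListAction using (sum; product)
open import Data.Nat.ListAction.Properties using (product-++; sum-++)
open import Data.Nat.Tactic.RingSolver using (solve-∀)
open import Data.Nat.Induction using (<-wellFounded)
open import Induction.WellFounded using (Acc; acc)
open import Data.Integer as ℤ using (ℤ; -[1+_]; ∣_∣; 0ℤ; 1ℤ)
import Data.Integer.Properties as ℤₚ
open import Data.Integer.Divisibility.Signed as Signed using () renaming (_∣_ to _∣ˢ_)
open import Algebra.Bundles using (CommutativeSemiring; CommutativeRing)
open import Level using (0ℓ)
import Algebra.Properties.CommutativeSemiring.Binomial as Binomial
import Algebra.Properties.Semiring.Exp as Exp
import Algebra.Properties.CommutativeSemiring.Exp as CommExp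
import Algebra.Properties.Semiring.Mult as Mult
import Algebra.Properties.CommutativeMonoid.Sum as MonoidSum
open import Data.Nat.Combinatorics using (nCn≡1; nCk+nC[k+1]≡[n+1]C[k+1]; k![n∸k]!∣n!) renaming (_C_ to _choose_)
open import Data.Nat.Combinatorics.Specification using (nCk≡n!/k![n-k]!)
import Data.Vec.Functional as Vector
open import Data.Fin.Permutation using (Permutation; permutation)
import Relation.Binary.Reasoning.Setoid as SetoidReasoning
import Data.Integer.Tactic.RingSolver as ℤSolver
open import Data.Fin using (Fin; inject₁; inject≤; toℕ; fromℕ<) renaming (zero to fzero; suc to fsuc)
import Data.Fin.Properties as Fin
import Data.Bool as Bool
open import Data.Bool using (Bool; true; false; if_then_else_)
open import Data.List using (List; []; _∷_; _++_; length; filter; upTo; lookup)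
open import Data.List.Properties using (upTo-∷ʳ; filter-++; filter-accept; filter-reject)
open import Data.List.Relation.Unary.All as All using (All; []; _∷_)
open import Data.List.Relation.Unary.AllPairs using ([]; _∷_)
open import Data.List.Relation.Unary.Any using (here; there)
open import Data.List.Relation.Unary.Unique.Propositional using (Unique)
import Data.List.Relation.Unary.Unique.Propositional.Properties as Unique
import Data.List.Relation.Unary.All.Properties as All
open import Data.List.Membership.Propositional using (_∈_)
open import Data.List.Membership.Propositional.Properties using (∈-lookup)
open import Data.Product using (Σ; ∃-syntax; _×_; _,_; proj₁; proj₂)
open import Data.Sum using (_⊎_; inj₁; inj₂; [_,_]′)
open import Data.Empty using (⊥; ⊥-elim)
open import Data.Unit using (⊤; tt)
open import Function using (_∘_; id)
open import Function.Bundles using (_⇔_; mk⇔)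
open import Relation.Nullary using (¬_; Dec; yes; no; contradiction)
open import Relation.Nullary.Decidable using (⌊_⌋; _×-dec_; ¬?)
open import Relation.Binary.Definitions using (tri<; tri≈; tri>)
open import Relation.Binary.PropositionalEquality using (_≡_; _≢_; refl; sym; trans; cong; cong₂; subst; subst₂; module ≡-Reasoning)

-- Finite sums and bounds on the number of integers with a property

-- Norms come from the real subring because an element ≡ A modulo p has there a norm ≡ A^((p-1)/2),
-- which is -1 for a quadratic nonresidue A, whereas norms from ℤ[ζ_p] that are prime to p are all ≡
-- 1. The family used has B^m members with norms at most a constant times B^m. Up to that size there
-- are only o(B^m) primes, so a rounding error of boundedly many members per prime is harmless. For
-- p > y the obstacle is uniformity: one exceptional set must serve all p. To have a prime factor in
-- a window for all but a proportion O(1/L) of the integers, the window stretches from 2^b to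
-- 2^(64^(2L) b). Hence the doubly exponential scales, at which the proportions O(1/L) with L = 2^j
-- form a convergent series. The scales end when their windows outgrow n. For the largest p the
-- exponent 4 is decisive: the candidates u, u′ satisfy σ(u) u′ < p⁴, so a congruence modulo p⁴
-- becomes an equation.

∑ : ℕ → (ℕ → ℕ) → ℕ
∑ zero f = 0
∑ (suc n) f = ∑ n f + f (suc n)

𝟙 : ∀ {P : Set} → Dec P → ℕ
𝟙 (yes _) = 1
𝟙 (no _) = 0

∑-cong : ∀ n {f g} → (∀ i → 1 ≤ i → i ≤ n → f i ≡ g i) → ∑ n f ≡ ∑ n g
∑-cong zero h = refl
∑-cong (suc n) h = cong₂ _+_ (∑-cong n (λ i 1≤i i≤n → h i 1≤i (m≤n⇒m≤1+n i≤n))) (h (suc n) (s≤s z≤n) ≤-refl)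

∑-mono : ∀ n {f g} → (∀ i → 1 ≤ i → i ≤ n → f i ≤ g i) → ∑ n f ≤ ∑ n g
∑-mono zero h = z≤n
∑-mono (suc n) h = +-mono-≤ (∑-mono n (λ i 1≤i i≤n → h i 1≤i (m≤n⇒m≤1+n i≤n))) (h (suc n) (s≤s z≤n) ≤-refl)

∑-zero : ∀ n → ∑ n (λ _ → 0) ≡ 0
∑-zero zero = refl
∑-zero (suc n) = cong (_+ 0) (∑-zero n)

∑-const : ∀ n c → ∑ n (λ _ → c) ≡ n * c
∑-const zero c = refl
∑-const (suc n) c = trans (cong (_+ c) (∑-const n c)) (+-comm (n * c) c)

∑-+ : ∀ n f g → ∑ n (λ i → f i + g i) ≡ ∑ n f + ∑ n g
∑-+ zero f g = refl
∑-+ (suc n) f g = trans (cong (_+ (f (suc n) + g (suc n))) (∑-+ n f g)) (interchange (∑ n f) _ _ _)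
  where
  interchange : ∀ a b c d → (a + b) + (c + d) ≡ (a + c) + (b + d)
  interchange = solve-∀

∑-* : ∀ n c f → ∑ n (λ i → c * f i) ≡ c * ∑ n f
∑-* zero c f = sym (*-zeroʳ c)
∑-* (suc n) c f = trans (cong (_+ c * f (suc n)) (∑-* n c f)) (sym (*-distribˡ-+ c (∑ n f) (f (suc n))))

∑-swap : ∀ m n (f : ℕ → ℕ → ℕ) → ∑ m (λ i → ∑ n (f i)) ≡ ∑ n (λ j → ∑ m (λ i → f i j))
∑-swap zero n f = sym (∑-zero n)
∑-swap (suc m) n f = trans (cong (_+ ∑ n (f (suc m))) (∑-swap m n f)) (sym (∑-+ n (λ j → ∑ m (λ i → f i j)) (f (suc m))))

∑-≤ : ∀ n c {f} → (∀ i → 1 ≤ i → i ≤ n → f i ≤ c) → ∑ n f ≤ n * c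
∑-≤ n c h = ≤-trans (∑-mono n h) (≤-reflexive (∑-const n c))

term≤∑ : ∀ {n i} f → 1 ≤ i → i ≤ n → f i ≤ ∑ n f
term≤∑ {zero} f 1≤i i≤0 = contradiction (≤-trans 1≤i i≤0) λ ()
term≤∑ {suc n} {i} f 1≤i i≤n with i ≟ suc n
... | yes refl = m≤n+m (f (suc n)) (∑ n f)
... | no i≢ = ≤-trans (term≤∑ f 1≤i (≤-pred (≤∧≢⇒< i≤n i≢))) (m≤m+n _ _)

∑-split : ∀ m n f → ∑ (m + n) f ≡ ∑ m f + ∑ n (λ i → f (m + i))
∑-split m zero f = trans (cong (λ k → ∑ k f) (+-identityʳ m)) (sym (+-identityʳ _))
∑-split m (suc n) f = trans (cong (λ k → ∑ k f) (+-suc m n))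
  (trans (cong₂ _+_ (∑-split m n f) (cong f (sym (+-suc m n)))) (+-assoc (∑ m f) _ _))

omit : ℕ → (ℕ → ℕ) → ℕ → ℕ
omit a g n with n ≟ a
... | yes _ = 0
... | no _ = g n

omit-≢ : ∀ {a} g {n} → a ≢ n → omit a g n ≡ g n
omit-≢ {a} g {n} a≢n with n ≟ a
... | yes n≡a = contradiction (sym n≡a) a≢n
... | no _ = refl

∑-omit : ∀ n {a} g → 1 ≤ a → a ≤ n → ∑ n g ≡ g a + ∑ n (omit a g)
∑-omit zero g 1≤a a≤0 = contradiction (≤-trans 1≤a a≤0) λ ()
∑-omit (suc n) {a} g 1≤a a≤n with suc n ≟ a
... | yes refl = trans (+-comm (∑ n g) _)
      (cong (_+_ (g a)) (trans (∑-cong n (λ i 1≤i i≤n → sym (omit-≢ g (λ a≡i → <⇒≢ (s≤s i≤n) (sym a≡i))))) (sym (+-identityʳ _))))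
... | no sn≢a = trans (cong (_+ g (suc n)) (∑-omit n g 1≤a (≤-pred (≤∧≢⇒< a≤n (λ e → sn≢a (sym e)))))) (+-assoc (g a) _ _)

-- Counting by duplicate-free lists makes sense for properties without a decision procedure, such as
-- the existential statements about primes below, and unions simply add the bounds.
Few : (ℕ → Set) → ℕ → Set
Few P K = ∀ l → Unique l → All P l → length l ≤ K

few-mono : ∀ {P K K′} → K ≤ K′ → Few P K → Few P K′
few-mono K≤K′ few l u a = ≤-trans (few l u a) K≤K′

few-⊆ : ∀ {P Q K} → (∀ n → P n → Q n) → Few Q K → Few P K
few-⊆ sub few l u a = few l u (All.map (λ {n} → sub n) a)

few-∅ : ∀ {P} → (∀ n → ¬ P n) → Few P 0
few-∅ empty [] u a = z≤n
few-∅ empty (n ∷ l) u (p ∷ a) = contradiction p (empty n)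

few-single : ∀ {P} → (∀ m n → P m → P n → m ≡ n) → Few P 1
few-single same [] u a = z≤n
few-single same (m ∷ []) u a = ≤-refl
few-single same (m ∷ n ∷ l) ((m≢n ∷ _) ∷ _) (pm ∷ pn ∷ _) = contradiction (same m n pm pn) m≢n

private
  -- The fields `keepˡ` and `keepʳ` pass any property of all entries on to the sublists; with R = (n
  -- ≢_) they keep the sublists duplicate-free in the induction.
  record Partition (P Q : ℕ → Set) (l : List ℕ) : Set₁ where
    field
      ls rs : List ℕ
      lengths : length l ≡ length ls + length rs
      uniqueˡ : Unique ls
      uniqueʳ : Unique rs
      allˡ : All P ls
      allʳ : All Q rs
      keepˡ : ∀ {R : ℕ → Set} → All R l → All R ls
      keepʳ : ∀ {R : ℕ → Set} → All R l → All R rs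

  partition : ∀ {P Q} l → Unique l → All (λ n → P n ⊎ Q n) l → Partition P Q l
  partition [] u a = record
    { ls = [] ; rs = [] ; lengths = refl ; uniqueˡ = [] ; uniqueʳ = [] ; allˡ = [] ; allʳ = []
    ; keepˡ = λ _ → [] ; keepʳ = λ _ → [] }
  partition (n ∷ l) (n∉l ∷ u) (inj₁ p ∷ a) = record
    { ls = n ∷ ls ; rs = rs ; lengths = cong suc lengths ; uniqueˡ = keepˡ n∉l ∷ uniqueˡ ; uniqueʳ = uniqueʳ
    ; allˡ = p ∷ allˡ ; allʳ = allʳ ; keepˡ = λ { (r ∷ rs) → r ∷ keepˡ rs } ; keepʳ = λ { (_ ∷ rs) → keepʳ rs } }
    where open Partition (partition l u a)
  partition (n ∷ l) (n∉l ∷ u) (inj₂ q ∷ a) = record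
    { ls = ls ; rs = n ∷ rs ; lengths = trans (cong suc lengths) (sym (+-suc (length ls) (length rs)))
    ; uniqueˡ = uniqueˡ ; uniqueʳ = keepʳ n∉l ∷ uniqueʳ
    ; allˡ = allˡ ; allʳ = q ∷ allʳ ; keepˡ = λ { (_ ∷ rs) → keepˡ rs } ; keepʳ = λ { (r ∷ rs) → r ∷ keepʳ rs } }
    where open Partition (partition l u a)

few-⊎ : ∀ {P Q K M} → Few P K → Few Q M → Few (λ n → P n ⊎ Q n) (K + M)
few-⊎ fewP fewQ l u a = ≤-trans (≤-reflexive lengths) (+-mono-≤ (fewP ls uniqueˡ allˡ) (fewQ rs uniqueʳ allʳ))
  where open Partition (partition l u a)

few-⋃ : ∀ {P : ℕ → ℕ → Set} I {K} → (∀ i → 1 ≤ i → i ≤ I → Few (P i) (K i)) →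
  Few (λ n → ∃[ i ] (1 ≤ i × i ≤ I × P i n)) (∑ I K)
few-⋃ zero h = few-∅ λ { n (i , 1≤i , i≤0 , _) → contradiction (≤-trans 1≤i i≤0) λ () }
few-⋃ {P} (suc I) h = few-⊆ last (few-⊎ (few-⋃ I (λ i 1≤i i≤I → h i 1≤i (m≤n⇒m≤1+n i≤I))) (h (suc I) (s≤s z≤n) ≤-refl))
  where
  last : ∀ n → ∃[ i ] (1 ≤ i × i ≤ suc I × P i n) → ∃[ i ] (1 ≤ i × i ≤ I × P i n) ⊎ P (suc I) n
  last n (i , 1≤i , i≤I , p) with i ≟ suc I
  ... | yes refl = inj₂ p
  ... | no i≢ = inj₁ (i , 1≤i , ≤-pred (≤∧≢⇒< i≤I i≢) , p)

-- `R i n` reads "n has the code i". A relation instead of a function lets the code come from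
-- witnesses inside the proof of `P n`.
few-coded : ∀ {P} (R : ℕ → ℕ → Set) K → (∀ n → P n → ∃[ i ] (1 ≤ i × i ≤ K × R i n)) →
  (∀ i m n → P m → P n → R i m → R i n → m ≡ n) → Few P K
few-coded {P} R K code inj = few-⊆ (λ n p → let (i , a , b , r) = code n p in i , a , b , p , r)
  (few-mono (≤-reflexive (trans (∑-const K 1) (*-identityʳ K)))
    (few-⋃ {λ i n → P n × R i n} K (λ i _ _ → few-single (λ { m n (pm , rm) (pn , rn) → inj i m n pm pn rm rn }))))

few-upTo : ∀ x → Few (λ n → 1 ≤ n × n ≤ x) x
few-upTo x = few-coded _≡_ x (λ { n (a , b) → n , a , b , refl }) (λ { i m n _ _ refl refl → refl })

m*n≤o⇒m≤o/n : ∀ m n o .{{_ : NonZero n}} → m * n ≤ o → m ≤ o / n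
m*n≤o⇒m≤o/n m n o h = subst (_≤ o / n) (m*n/n≡m m n) (/-monoˡ-≤ n h)

-- Two members in the same block of length r differ by less than r, while r divides their
-- difference. The last block may be incomplete, whence the summand 1.
few-spaced : ∀ {P} a H r .{{_ : NonZero r}} → (∀ n → P n → a < n × n ≤ a + H) →
  (∀ m n → P m → P n → m < n → r ∣ n ∸ m) → Few P (1 + H / r)
few-spaced {P} a H r range spaced = few-coded R (1 + H / r) code inj
  where
  R : ℕ → ℕ → Set
  R i n = (n ∸ suc a) / r ≡ pred i
  code : ∀ n → P n → ∃[ i ] (1 ≤ i × i ≤ 1 + H / r × R i n)
  code n p = suc ((n ∸ suc a) / r) , s≤s z≤n , s≤s (/-monoˡ-≤ r (≤-trans (∸-monoˡ-≤ (suc a) (proj₂ (range n p))) (≤-trans (∸-monoʳ-≤ (a + H) (n≤1+n a)) (≤-reflexive (m+n∸m≡n a H))))) , refl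
  ordered : ∀ i m n → P m → P n → R i m → R i n → ¬ m < n
  ordered i m n pm pn rm rn m<n = <-irrefl refl (<-≤-trans upper lower)
    where
    m′ = m ∸ suc a
    n′ = n ∸ suc a
    k = pred i
    diff : n ∸ m ≤ n′ ∸ m′
    diff = ≤-reflexive (sym ([m∸o]∸[n∸o]≡m∸n n (proj₁ (range m pm)) (<⇒≤ m<n)))
      where
      [m∸o]∸[n∸o]≡m∸n : ∀ n {m o} → o ≤ m → m ≤ n → (n ∸ o) ∸ (m ∸ o) ≡ n ∸ m
      [m∸o]∸[n∸o]≡m∸n n {m} {o} o≤m m≤n = trans (∸-+-assoc n o (m ∸ o)) (cong (n ∸_) (m+[n∸m]≡n o≤m))
    r≤diff : r ≤ n ∸ m
    r≤diff = ∣⇒≤ {{>-nonZero (m<n⇒0<n∸m m<n)}} (spaced m n pm pn m<n)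
    kr≤m′ : k * r ≤ m′
    kr≤m′ = subst (λ z → z * r ≤ m′) rm (m/n*n≤m m′ r)
    n′<skr : n′ < suc k * r
    n′<skr = subst (λ z → n′ < suc z * r) rn (m<[1+m/n]*n n′ r)
      where
      m<[1+m/n]*n : ∀ m n .{{_ : NonZero n}} → m < suc (m / n) * n
      m<[1+m/n]*n m n = begin-strict
        m                    ≡⟨ m≡m%n+[m/n]*n m n ⟩
        m % n + (m / n) * n  <⟨ +-monoˡ-< ((m / n) * n) (m%n<n m n) ⟩
        n + (m / n) * n      ∎
        where open ≤-Reasoning
    lower : r + k * r ≤ n′
    lower = ≤-trans (+-mono-≤ (≤-trans r≤diff diff) kr≤m′) (≤-reflexive (m∸n+n≡m (∸-monoˡ-≤ (suc a) (<⇒≤ m<n))))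
    upper : suc n′ ≤ r + k * r
    upper = n′<skr
  inj : ∀ i m n → P m → P n → R i m → R i n → m ≡ n
  inj i m n pm pn rm rn with <-cmp m n
  ... | tri< m<n _ _ = contradiction m<n (ordered i m n pm pn rm rn)
  ... | tri≈ _ m≡n _ = m≡n
  ... | tri> _ _ n<m = contradiction n<m (ordered i n m pn pm rn rm)

-- Markov's inequality. Once the head of the list is counted, `omit` sets its weight to zero, so the
-- induction can go on with the whole sum.
few-weight : ∀ {P : ℕ → Set} x c g → (∀ n → P n → 1 ≤ n × n ≤ x × c ≤ g n) → ∀ l → Unique l → All P l → length l * c ≤ ∑ x g
few-weight x c g h l u a = go g l u (All.map (λ {n} → h n) a)
  where
  go : ∀ g l → Unique l → All (λ n → 1 ≤ n × n ≤ x × c ≤ g n) l → length l * c ≤ ∑ x g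
  go g [] u a = z≤n
  go g (m ∷ l) (m∉l ∷ u) ((1≤m , m≤x , c≤gm) ∷ a) = ≤-trans
    (+-mono-≤ c≤gm (go (omit m g) l u (All.map (λ { (m≢n , 1≤n , n≤x , c≤gn) → 1≤n , n≤x , subst (c ≤_) (sym (omit-≢ g m≢n)) c≤gn }) (All.zip (m∉l , a)))))
    (≤-reflexive (sym (∑-omit x g 1≤m m≤x)))

∑-𝟙-few : ∀ {P : ℕ → Set} (P? : ∀ n → Dec (P n)) x {K} → Few (λ n → 1 ≤ n × n ≤ x × P n) K → ∑ x (λ n → 𝟙 (P? n)) ≤ K
∑-𝟙-few {P} P? x {K} few = let (l , u , a , eq) = list x in subst (_≤ K) eq (few l u a)
  where
  list : ∀ x → ∃[ l ] (Unique l × All (λ n → 1 ≤ n × n ≤ x × P n) l × length l ≡ ∑ x (λ n → 𝟙 (P? n)))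
  list zero = [] , [] , [] , refl
  list (suc x) with list x | P? (suc x)
  ... | l , u , a , eq | no _ = l , u , All.map (λ { (b , c , d) → b , m≤n⇒m≤1+n c , d }) a , trans eq (sym (+-identityʳ _))
  ... | l , u , a , eq | yes p = suc x ∷ l , All.map (λ { (b , c , d) refl → <-irrefl refl c }) a ∷ u
        , (s≤s z≤n , ≤-refl , p) ∷ All.map (λ { (b , c , d) → b , m≤n⇒m≤1+n c , d }) a
        , trans (cong suc eq) (sym (+-comm (∑ x _) 1))

few-covers : ∀ {P : ℕ → Set} x {K} → (∀ n → 1 ≤ n → n ≤ x → P n) → Few P K → x ≤ K
few-covers {P} x {K} all few = subst (_≤ K) (trans (∑-const x 1) (*-identityʳ x))
  (∑-𝟙-few {λ _ → ⊤} (λ _ → yes tt) x (few-⊆ (λ { n (a , b , _) → all n a b }) few))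

-- Integers without a prime factor in a given set

cancelˡ-≤ : ∀ {a b} c → 1 ≤ c → c * a ≤ c * b → a ≤ b
cancelˡ-≤ (suc c) _ h = *-cancelˡ-≤ (suc c) h

2ab≤a²+b² : ∀ a b → 2 * (a * b) ≤ a * a + b * b
2ab≤a²+b² a b with ≤-total a b
... | inj₁ a≤b = subst (λ z → 2 * (a * z) ≤ a * a + z * z) (m+[n∸m]≡n a≤b) (ordered a (b ∸ a))
  where
  identity : ∀ a c → a * a + (a + c) * (a + c) ≡ 2 * (a * (a + c)) + c * c
  identity = solve-∀
  ordered : ∀ a c → 2 * (a * (a + c)) ≤ a * a + (a + c) * (a + c)
  ordered a c = subst (2 * (a * (a + c)) ≤_) (sym (identity a c)) (m≤m+n _ _)
... | inj₂ b≤a = subst (λ z → 2 * (z * b) ≤ z * z + b * b) (m+[n∸m]≡n b≤a) (ordered b (a ∸ b))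
  where
  identity : ∀ b c → (b + c) * (b + c) + b * b ≡ 2 * ((b + c) * b) + c * c
  identity = solve-∀
  ordered : ∀ b c → 2 * ((b + c) * b) ≤ (b + c) * (b + c) + b * b
  ordered b c = subst (2 * ((b + c) * b) ≤_) (sym (identity b c)) (m≤m+n _ _)

-- For d ≥ 1 this is ⌊x / d⌋; as a sum of indicators it lends itself to exchanging summations.
multiples : ℕ → ℕ → ℕ
multiples x d = ∑ x (λ n → 𝟙 (d ∣? n))

multiples-spec : ∀ x d → 1 ≤ d → ∃[ r ] (r < d × x ≡ r + d * multiples x d)
multiples-spec zero d 1≤d = 0 , 1≤d , sym (*-zeroʳ d)
multiples-spec (suc x) d 1≤d with multiples-spec x d 1≤d
... | r , r<d , eq with d ∣? suc x
... | yes d∣sx = 0 , 1≤d , trans (cong suc eq) (trans (cong (_+ d * M) sr≡d) (sym (trans (cong (d *_) (+-comm M 1)) (*-suc d M))))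
  where
  M = multiples x d
  d∣sr : d ∣ suc r
  d∣sr = ∣m+n∣m⇒∣n (subst (d ∣_) (trans (cong suc eq) (+-comm (suc r) (d * M))) d∣sx) (m∣m*n M)
  sr≡d : suc r ≡ d
  sr≡d = ≤-antisym r<d (∣⇒≤ d∣sr)
... | no d∤sx = suc r , ≤∧≢⇒< r<d sr≢d , trans (cong suc eq) (cong (λ z → suc r + d * z) (sym (+-identityʳ M)))
  where
  M = multiples x d
  sr≢d : suc r ≢ d
  sr≢d refl = d∤sx (subst (suc r ∣_) (cong suc (sym eq)) (∣m∣n⇒∣m+n ∣-refl (m∣m*n M)))

multiples-lower : ∀ x d → 1 ≤ d → x ≤ d * multiples x d + d
multiples-lower x d 1≤d = let (r , r<d , eq) = multiples-spec x d 1≤d in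
  ≤-trans (≤-reflexive (trans eq (+-comm r _))) (+-monoʳ-≤ _ (<⇒≤ r<d))

multiples-upper : ∀ x d → 1 ≤ d → d * multiples x d ≤ x
multiples-upper x d 1≤d = let (r , r<d , eq) = multiples-spec x d 1≤d in
  ≤-trans (m≤n+m _ r) (≤-reflexive (sym eq))

-- recip T / product T is the sum of the reciprocals of the entries of T.
recip : List ℕ → ℕ
recip [] = 0
recip (q ∷ T) = product T + q * recip T

prime≥1 : ∀ {p} → Prime p → 1 ≤ p
prime≥1 pp = >-nonZero⁻¹ _ {{prime⇒nonZero pp}}

prime≥2 : ∀ {p} → Prime p → 2 ≤ p
prime≥2 pp = nonTrivial⇒n>1 _ {{prime⇒nonTrivial pp}}

prime∣prime : ∀ {p q} → Prime p → Prime q → p ∣ q → p ≡ q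
prime∣prime pp pq p∣q with prime⇒irreducible pq p∣q
... | inj₁ refl = contradiction pp ¬prime[1]
... | inj₂ p≡q = p≡q

*-∣-prime : ∀ {p n m} → Prime p → p ∣ n → m ∣ n → ¬ p ∣ m → p * m ∣ n
*-∣-prime {p} {n} {m} pp p∣n (divides c refl) p∤m with euclidsLemma c m pp p∣n
... | inj₁ (divides e refl) = divides e (*-assoc e p m)
... | inj₂ p∣m = contradiction p∣m p∤m

product≥1 : ∀ {T} → All Prime T → 1 ≤ product T
product≥1 [] = ≤-refl
product≥1 (pq ∷ pT) = *-mono-≤ (prime≥1 pq) (product≥1 pT)

hits : List ℕ → ℕ → ℕ
hits [] n = 0
hits (q ∷ T) n = 𝟙 (q ∣? n) + hits T n

hits-0 : ∀ T n → All (λ q → ¬ q ∣ n) T → hits T n ≡ 0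
hits-0 [] n a = refl
hits-0 (q ∷ T) n (q∤n ∷ a) with q ∣? n
... | yes q∣n = contradiction q∣n q∤n
... | no _ = hits-0 T n a

-- Rounding x / q down loses at most 1 for each entry. The factor `product T` clears the
-- denominators.
hits-mean : ∀ x T → All Prime T → x * recip T ≤ product T * ∑ x (hits T) + length T * product T
hits-mean x [] [] = ≤-trans (≤-reflexive (*-zeroʳ x)) z≤n
hits-mean x (q ∷ T) (pq ∷ pT) = begin
  x * (Q + q * R)                                          ≡⟨ expand x Q q R ⟩
  x * Q + q * (x * R)                                      ≤⟨ +-mono-≤ (*-monoˡ-≤ Q (multiples-lower x q (prime≥1 pq))) (*-monoʳ-≤ q (hits-mean x T pT)) ⟩
  (q * M + q) * Q + q * (Q * F + length T * Q)             ≡⟨ collect q M Q F (length T) ⟩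
  q * Q * (M + F) + suc (length T) * (q * Q)               ≡⟨ cong (λ z → q * Q * z + suc (length T) * (q * Q)) (sym (∑-+ x (λ n → 𝟙 (q ∣? n)) (hits T))) ⟩
  q * Q * ∑ x (hits (q ∷ T)) + suc (length T) * (q * Q)    ∎
  where
  open ≤-Reasoning
  Q = product T
  R = recip T
  M = multiples x q
  F = ∑ x (hits T)
  expand : ∀ x Q q R → x * (Q + q * R) ≡ x * Q + q * (x * R)
  expand = solve-∀
  collect : ∀ q M Q F l → (q * M + q) * Q + q * (Q * F + l * Q) ≡ q * Q * (M + F) + suc l * (q * Q)
  collect = solve-∀

𝟙-*-≤ : ∀ {p q n} → Prime q → ¬ p ≡ q → Prime p → 𝟙 (p ∣? n) * 𝟙 (q ∣? n) ≤ 𝟙 (p * q ∣? n)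
𝟙-*-≤ {p} {q} {n} pq p≢q pp with p ∣? n | q ∣? n | p * q ∣? n
... | no _ | _ | _ = z≤n
... | yes _ | no _ | _ = z≤n
... | yes _ | yes _ | yes _ = ≤-refl
... | yes p∣n | yes q∣n | no pq∤n = contradiction (*-∣-prime pp p∣n q∣n (λ p∣q → p≢q (prime∣prime pp pq p∣q))) pq∤n

-- Distinct primes that both divide n have a product dividing n, and there are at most x / (q q′)
-- such n.
hits-cross : ∀ x q T → Prime q → All (q ≢_) T → All Prime T →
  q * product T * ∑ x (λ n → 𝟙 (q ∣? n) * hits T n) ≤ x * recip T
hits-cross x q [] pq [] [] = ≤-trans (≤-reflexive (trans (cong (q * 1 *_) (trans (∑-cong x (λ n _ _ → *-zeroʳ (𝟙 (q ∣? n)))) (∑-zero x))) (*-zeroʳ (q * 1)))) z≤n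
hits-cross x q (q′ ∷ T) pq (q≢q′ ∷ q∉T) (pq′ ∷ pT) = begin
  q * (q′ * Q) * ∑ x (λ n → 𝟙 (q ∣? n) * (𝟙 (q′ ∣? n) + hits T n))
    ≡⟨ cong (q * (q′ * Q) *_) (trans (∑-cong x (λ n _ _ → *-distribˡ-+ (𝟙 (q ∣? n)) (𝟙 (q′ ∣? n)) (hits T n))) (∑-+ x _ _)) ⟩
  q * (q′ * Q) * (∑ x (λ n → 𝟙 (q ∣? n) * 𝟙 (q′ ∣? n)) + S)
    ≤⟨ *-monoʳ-≤ (q * (q′ * Q)) (+-monoˡ-≤ S (∑-mono x (λ n _ _ → 𝟙-*-≤ {q} {q′} {n} pq′ q≢q′ pq))) ⟩
  q * (q′ * Q) * (M + S)
    ≡⟨ regroup q q′ Q M S ⟩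
  Q * (q * q′ * M) + q′ * (q * Q * S)
    ≤⟨ +-mono-≤ (*-monoʳ-≤ Q (multiples-upper x (q * q′) (*-mono-≤ (prime≥1 pq) (prime≥1 pq′)))) (*-monoʳ-≤ q′ (hits-cross x q T pq q∉T pT)) ⟩
  Q * x + q′ * (x * R)
    ≡⟨ collect Q x q′ R ⟩
  x * (Q + q′ * R) ∎
  where
  open ≤-Reasoning
  Q = product T
  R = recip T
  M = multiples x (q * q′)
  S = ∑ x (λ n → 𝟙 (q ∣? n) * hits T n)
  regroup : ∀ q q′ Q M S → q * (q′ * Q) * (M + S) ≡ Q * (q * q′ * M) + q′ * (q * Q * S)
  regroup = solve-∀
  collect : ∀ Q x q′ R → Q * x + q′ * (x * R) ≡ x * (Q + q′ * R)
  collect = solve-∀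

𝟙-idem : ∀ {P : Set} (d : Dec P) → 𝟙 d * 𝟙 d ≡ 𝟙 d
𝟙-idem (yes _) = refl
𝟙-idem (no _) = refl

-- Pairs of distinct entries contribute at most the square of the mean, and the diagonal, where 𝟙² =
-- 𝟙, contributes the mean itself. Rounding only helps in an upper bound.
hits-square : ∀ x T → All Prime T → Unique T →
  product T * product T * ∑ x (λ n → hits T n * hits T n) ≤ x * (recip T * recip T + product T * recip T)
hits-square x [] [] [] = ≤-trans (≤-reflexive (trans (*-identityˡ (∑ x (λ _ → 0))) (∑-zero x))) z≤n
hits-square x (q ∷ T) (pq ∷ pT) (q∉T ∷ uT) = begin
  q * Q * (q * Q) * ∑ x (λ n → (𝟙 (q ∣? n) + hits T n) * (𝟙 (q ∣? n) + hits T n))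
    ≡⟨ cong (q * Q * (q * Q) *_) (trans (∑-cong x (λ n _ _ → square n)) (trans (∑-+ x _ _) (cong₂ _+_ (trans (∑-+ x _ _) (cong (M +_) (∑-* x 2 _))) refl))) ⟩
  q * Q * (q * Q) * (M + 2 * C + S)
    ≡⟨ regroup q Q M C S ⟩
  q * Q * Q * (q * M) + 2 * (q * Q * (q * Q * C)) + q * q * (Q * Q * S)
    ≤⟨ +-mono-≤ (+-mono-≤ (*-monoʳ-≤ (q * Q * Q) (multiples-upper x q (prime≥1 pq))) (*-monoʳ-≤ 2 (*-monoʳ-≤ (q * Q) (hits-cross x q T pq q∉T pT)))) (*-monoʳ-≤ (q * q) (hits-square x T pT uT)) ⟩
  q * Q * Q * x + 2 * (q * Q * (x * R)) + q * q * (x * (R * R + Q * R))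
    ≤⟨ m≤m+n _ (x * (Q * Q)) ⟩
  q * Q * Q * x + 2 * (q * Q * (x * R)) + q * q * (x * (R * R + Q * R)) + x * (Q * Q)
    ≡⟨ collect q Q x R ⟩
  x * ((Q + q * R) * (Q + q * R) + q * Q * (Q + q * R)) ∎
  where
  open ≤-Reasoning
  Q = product T
  R = recip T
  M = multiples x q
  C = ∑ x (λ n → 𝟙 (q ∣? n) * hits T n)
  S = ∑ x (λ n → hits T n * hits T n)
  expand : ∀ a b → (a + b) * (a + b) ≡ a * a + 2 * (a * b) + b * b
  expand = solve-∀
  square : ∀ n → (𝟙 (q ∣? n) + hits T n) * (𝟙 (q ∣? n) + hits T n) ≡ 𝟙 (q ∣? n) + 2 * (𝟙 (q ∣? n) * hits T n) + hits T n * hits T n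
  square n = trans (expand (𝟙 (q ∣? n)) (hits T n)) (cong (λ z → z + 2 * (𝟙 (q ∣? n) * hits T n) + hits T n * hits T n) (𝟙-idem (q ∣? n)))
  regroup : ∀ q Q M C S → q * Q * (q * Q) * (M + 2 * C + S) ≡ q * Q * Q * (q * M) + 2 * (q * Q * (q * Q * C)) + q * q * (Q * Q * S)
  regroup = solve-∀
  collect : ∀ q Q x R → q * Q * Q * x + 2 * (q * Q * (x * R)) + q * q * (x * (R * R + Q * R)) + x * (Q * Q) ≡ x * ((Q + q * R) * (Q + q * R) + q * Q * (Q + q * R))
  collect = solve-∀

-- Chebyshev's inequality for the number of divisors in T, whose mean is about recip T / product T ≥ L.
few-unhit : ∀ x T L → All Prime T → Unique T → length T ≤ x → L * product T ≤ recip T → 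
  ∀ l → Unique l → All (λ n → (1 ≤ n × n ≤ x) × All (λ q → ¬ q ∣ n) T) l → length l * L ≤ 3 * x
few-unhit x T zero pT uT T≤x heavy l ul al = ≤-trans (≤-reflexive (*-zeroʳ (length l))) z≤n
few-unhit x T L@(suc _) pT uT T≤x heavy l ul al = cancelˡ-≤ Q Q≥1 (begin
  Q * (Z * L)    ≡⟨ swap Q Z L ⟩
  Z * (L * Q)    ≤⟨ *-monoʳ-≤ Z heavy ⟩
  Z * R          ≤⟨ cancelˡ-≤ R R≥1 ZRR≤ ⟩
  Q * (3 * x)    ∎)
  where
  open ≤-Reasoning
  Q = product T
  R = recip T
  Z = length l
  F = ∑ x (hits T)
  Q≥1 = product≥1 pT
  R≥1 : 1 ≤ R
  R≥1 = ≤-trans (*-mono-≤ {1} {L} {1} {Q} (s≤s z≤n) Q≥1) heavy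
  -- The square of Q · hits - R without negative numbers; where no entry of T divides n, it equals
  -- R².
  g : ℕ → ℕ
  g n = (Q * hits T n) * (Q * hits T n) + R * R ∸ 2 * ((Q * hits T n) * R)
  swap : ∀ Q Z L → Q * (Z * L) ≡ Z * (L * Q)
  swap = solve-∀
  g-unhit : ∀ n → (1 ≤ n × n ≤ x) × All (λ q → ¬ q ∣ n) T → 1 ≤ n × n ≤ x × R * R ≤ g n
  g-unhit n ((1≤n , n≤x) , un) = 1≤n , n≤x , ≤-reflexive (sym (trans (cong (λ h → (Q * h) * (Q * h) + R * R ∸ 2 * ((Q * h) * R)) (hits-0 T n un))
    (cong (λ z → z * z + R * R ∸ 2 * (z * R)) (*-zeroʳ Q))))
  ∑g : ∑ x g + 2 * Q * R * F ≡ Q * Q * ∑ x (λ n → hits T n * hits T n) + x * (R * R)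
  ∑g = trans (cong (_+_ (∑ x g)) (sym (∑-* x (2 * Q * R) (hits T)))) (trans (sym (∑-+ x g (λ n → 2 * Q * R * hits T n)))
    (trans (∑-cong x (λ n _ _ → pointwise n)) (trans (∑-+ x (λ n → Q * Q * (hits T n * hits T n)) (λ _ → R * R)) (cong₂ _+_ (∑-* x (Q * Q) _) (∑-const x (R * R))))))
    where
    move : ∀ Q R h → 2 * Q * R * h ≡ 2 * ((Q * h) * R)
    move = solve-∀
    sq : ∀ Q R h → (Q * h) * (Q * h) + R * R ≡ Q * Q * (h * h) + R * R
    sq = solve-∀
    pointwise : ∀ n → g n + 2 * Q * R * hits T n ≡ Q * Q * (hits T n * hits T n) + R * R
    pointwise n = trans (cong (g n +_) (move Q R (hits T n))) (trans (m∸n+n≡m (2ab≤a²+b² (Q * hits T n) R)) (sq Q R (hits T n)))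
  -- With 2R · xR added to both sides, the lower bound for the mean can be used on the left. In the
  -- factor 3, one unit is the diagonal of the second moment and two come from rounding the mean.
  ZRR≤ : R * (Z * R) ≤ R * (Q * (3 * x))
  ZRR≤ = +-cancelʳ-≤ (2 * R * (x * R)) _ _ (begin
    R * (Z * R) + 2 * R * (x * R)
      ≤⟨ +-mono-≤ (≤-reflexive (assoc R Z)) (*-monoʳ-≤ (2 * R) (hits-mean x T pT)) ⟩
    Z * (R * R) + 2 * R * (Q * F + length T * Q)
      ≤⟨ +-monoˡ-≤ _ (few-weight x (R * R) g g-unhit l ul al) ⟩
    ∑ x g + 2 * R * (Q * F + length T * Q)
      ≡⟨ distribute (∑ x g) R Q F (length T) ⟩
    (∑ x g + 2 * Q * R * F) + 2 * R * (length T * Q)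
      ≡⟨ cong (_+ 2 * R * (length T * Q)) ∑g ⟩
    Q * Q * ∑ x (λ n → hits T n * hits T n) + x * (R * R) + 2 * R * (length T * Q)
      ≤⟨ +-mono-≤ (+-monoˡ-≤ (x * (R * R)) (hits-square x T pT uT)) (*-monoʳ-≤ (2 * R) (*-monoˡ-≤ Q T≤x)) ⟩
    x * (R * R + Q * R) + x * (R * R) + 2 * R * (x * Q)
      ≡⟨ collect x R Q ⟩
    R * (Q * (3 * x)) + 2 * R * (x * R) ∎)
    where
    assoc : ∀ R Z → R * (Z * R) ≡ Z * (R * R)
    assoc = solve-∀
    distribute : ∀ G R Q F l → G + 2 * R * (Q * F + l * Q) ≡ (G + 2 * Q * R * F) + 2 * R * (l * Q)
    distribute = solve-∀
    collect : ∀ x R Q → x * (R * R + Q * R) + x * (R * R) + 2 * R * (x * Q) ≡ R * (Q * (3 * x)) + 2 * R * (x * R)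
    collect = solve-∀

multiples-max : ∀ {c Y} q → 1 ≤ q → c * q ≤ Y → c ≤ multiples Y q
multiples-max {c} {Y} q 1≤q cq≤Y with multiples-spec Y q 1≤q
... | r , r<q , eq = ≮⇒≥ (λ M<c → <-irrefl refl (begin-strict
  Y                                  ≡⟨ eq ⟩
  r + q * multiples Y q              <⟨ +-monoˡ-< (q * multiples Y q) r<q ⟩
  q + q * multiples Y q              ≡⟨ sym (*-suc q (multiples Y q)) ⟩
  q * suc (multiples Y q)            ≤⟨ *-monoʳ-≤ q M<c ⟩
  q * c                              ≡⟨ *-comm q c ⟩
  c * q                              ≤⟨ cq≤Y ⟩
  Y                                  ∎))
  where open ≤-Reasoning

few-multiples : ∀ x d → 1 ≤ d → Few (λ n → 1 ≤ n × n ≤ x × d ∣ n) (multiples x d)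
few-multiples x d 1≤d = few-coded (λ i n → n ≡ i * d) (multiples x d) code (λ { i m n _ _ refl refl → refl })
  where
  code : ∀ n → 1 ≤ n × n ≤ x × d ∣ n → ∃[ i ] (1 ≤ i × i ≤ multiples x d × n ≡ i * d)
  code n (1≤n , n≤x , divides zero refl) = contradiction 1≤n λ ()
  code n (1≤n , n≤x , divides (suc i) eq) = suc i , s≤s z≤n , multiples-max d 1≤d (subst (_≤ x) eq n≤x) , eq

module _ {P : ℕ → Set} (P? : ∀ n → Dec (P n)) where

  select : ℕ → List ℕ
  select zero = []
  select (suc n) with P? (suc n)
  ... | yes _ = suc n ∷ select n
  ... | no _ = select n

  select-all : ∀ n → All (λ q → 1 ≤ q × q ≤ n × P q) (select n)
  select-all zero = []
  select-all (suc n) with P? (suc n)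
  ... | yes p = (s≤s z≤n , ≤-refl , p) ∷ All.map (λ { (a , b , c) → a , m≤n⇒m≤1+n b , c }) (select-all n)
  ... | no _ = All.map (λ { (a , b , c) → a , m≤n⇒m≤1+n b , c }) (select-all n)

  select-unique : ∀ n → Unique (select n)
  select-unique zero = []
  select-unique (suc n) with P? (suc n)
  ... | yes _ = All.map (λ { (a , b , c) refl → <-irrefl refl b }) (select-all n) ∷ select-unique n
  ... | no _ = select-unique n

  select-complete : ∀ n {q} → 1 ≤ q → q ≤ n → P q → q ∈ select n
  select-complete zero 1≤q q≤0 p = contradiction (≤-trans 1≤q q≤0) λ ()
  select-complete (suc n) {q} 1≤q q≤n p with q ≟ suc n | P? (suc n)
  ... | yes refl | yes _ = here refl
  ... | yes refl | no ¬p = contradiction p ¬p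
  ... | no q≢ | yes _ = there (select-complete n 1≤q (≤-pred (≤∧≢⇒< q≤n q≢)) p)
  ... | no q≢ | no _ = select-complete n 1≤q (≤-pred (≤∧≢⇒< q≤n q≢)) p

  -- As ⌊Y / q⌋ ≤ Y / q, a lower bound for the number of multiples of the selected entries turns
  -- into one for their reciprocal sum.
  select-recip : ∀ n Y → product (select n) * ∑ n (λ q → 𝟙 (P? q) * multiples Y q) ≤ Y * recip (select n)
  select-recip zero Y = ≤-trans (≤-reflexive (*-zeroʳ 1)) z≤n
  select-recip (suc n) Y with P? (suc n)
  ... | no _ = ≤-trans (≤-reflexive (cong (product (select n) *_) (+-identityʳ _))) (select-recip n Y)
  ... | yes _ = begin
    suc n * Q * (S + (M + 0))                ≡⟨ expand (suc n) Q S M ⟩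
    suc n * (Q * S) + Q * (suc n * M)        ≤⟨ +-mono-≤ (*-monoʳ-≤ (suc n) (select-recip n Y)) (*-monoʳ-≤ Q (multiples-upper Y (suc n) (s≤s z≤n))) ⟩
    suc n * (Y * R) + Q * Y                  ≡⟨ collect (suc n) Y R Q ⟩
    Y * (Q + suc n * R)                      ∎
    where
    open ≤-Reasoning
    Q = product (select n)
    R = recip (select n)
    S = ∑ n (λ q → 𝟙 (P? q) * multiples Y q)
    M = multiples Y (suc n)
    expand : ∀ k Q S M → k * Q * (S + (M + 0)) ≡ k * (Q * S) + Q * (k * M)
    expand = solve-∀
    collect : ∀ k Y R Q → k * (Y * R) + Q * Y ≡ Y * (Q + k * R)
    collect = solve-∀

-- Telescoping: 1/(q q) ≤ 1/(q − 1) − 1/q for q > y.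
∑-inverse-squares : ∀ X y k → 1 ≤ y → y * ∑ k (λ i → multiples X ((y + i) * (y + i))) ≤ X
∑-inverse-squares X y k 1≤y = cancelˡ-≤ (y + k) (≤-trans 1≤y (m≤m+n y k)) (≤-trans (telescope k) (≤-trans (*-monoʳ-≤ X (m≤n+m k y)) (≤-reflexive (*-comm X (y + k)))))
  where
  open ≤-Reasoning
  S : ℕ → ℕ
  S k = ∑ k (λ i → multiples X ((y + i) * (y + i)))
  telescope : ∀ k → (y + k) * (y * S k) ≤ X * k
  telescope zero = ≤-reflexive (trans (cong ((y + 0) *_) (*-zeroʳ y)) (trans (*-zeroʳ (y + 0)) (sym (*-zeroʳ X))))
  telescope (suc k) = cancelˡ-≤ (y + k) (≤-trans 1≤y (m≤m+n y k)) (begin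
    (y + k) * ((y + suc k) * (y * (S k + t)))                             ≡⟨ expand (y + k) (y + suc k) y (S k) t ⟩
    (y + suc k) * ((y + k) * (y * S k)) + y * ((y + k) * (y + suc k) * t) ≤⟨ +-mono-≤ (*-monoʳ-≤ (y + suc k) (telescope k)) (*-monoʳ-≤ y last) ⟩
    (y + suc k) * (X * k) + y * X                                         ≡⟨ collect y k X ⟩
    (y + k) * (X * suc k)                                                 ∎)
    where
    t = multiples X ((y + suc k) * (y + suc k))
    pos : 1 ≤ (y + suc k) * (y + suc k)
    pos = *-mono-≤ {1} {y + suc k} {1} {y + suc k} (≤-trans 1≤y (m≤m+n y _)) (≤-trans 1≤y (m≤m+n y _))
    last : (y + k) * (y + suc k) * t ≤ X
    last = ≤-trans (*-monoˡ-≤ t (*-monoˡ-≤ (y + suc k) (+-monoʳ-≤ y (n≤1+n k)))) (multiples-upper X _ pos)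
    expand : ∀ a b y S t → a * (b * (y * (S + t))) ≡ b * (a * (y * S)) + y * (a * b * t)
    expand = solve-∀
    collect : ∀ y k X → (y + suc k) * (X * k) + y * X ≡ (y + k) * (X * suc k)
    collect = solve-∀

search : ∀ {P : ℕ → Set} → (∀ n → Dec (P n)) → ∀ n → (∃[ i ] (1 ≤ i × i ≤ n × P i)) ⊎ (∀ i → 1 ≤ i → i ≤ n → ¬ P i)
search P? zero = inj₂ λ i 1≤i i≤0 → contradiction (≤-trans 1≤i i≤0) λ ()
search P? (suc n) with search P? n | P? (suc n)
... | inj₁ (i , a , b , p) | _ = inj₁ (i , a , m≤n⇒m≤1+n b , p)
... | inj₂ none | yes p = inj₁ (suc n , s≤s z≤n , ≤-refl , p)
... | inj₂ none | no ¬p = inj₂ none′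
  where
  none′ : ∀ i → 1 ≤ i → i ≤ suc n → ¬ _
  none′ i 1≤i i≤n p with i ≟ suc n
  ... | yes refl = ¬p p
  ... | no i≢ = none i 1≤i (≤-pred (≤∧≢⇒< i≤n i≢)) p

-- Binomial coefficients modulo a prime

prime∤! : ∀ {q} → Prime q → ∀ k → k < q → ¬ q ∣ k !
prime∤! pq zero k<q q∣1 = <-irrefl refl (≤-trans (prime≥2 pq) (∣⇒≤ q∣1))
prime∤! pq (suc k) k<q q∣ with euclidsLemma (suc k) (k !) pq q∣
... | inj₁ q∣sk = <-irrefl refl (<-≤-trans k<q (∣⇒≤ q∣sk))
... | inj₂ q∣k! = prime∤! pq k (<-trans (n<1+n k) k<q) q∣k!

prime∣C : ∀ {q} → Prime q → ∀ k → 1 ≤ k → k < q → q ∣ (q choose k)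
prime∣C {q} pq k 1≤k k<q with euclidsLemma (q choose k) (k ! * (q ∸ k) !) pq q∣C*
  where
  instance _ = k !* (q ∸ k) !≢0
  C*≡q! : (q choose k) * (k ! * (q ∸ k) !) ≡ q !
  C*≡q! = trans (cong (_* (k ! * (q ∸ k) !)) (nCk≡n!/k![n-k]! (<⇒≤ k<q))) (m/n*n≡m (k![n∸k]!∣n! (<⇒≤ k<q)))
  q∣q! : q ∣ q !
  q∣q! = q∣! q (prime≥1 pq)
    where
    q∣! : ∀ q → 1 ≤ q → q ∣ q !
    q∣! (suc q) _ = m∣m*n (q !)
  q∣C* : q ∣ (q choose k) * (k ! * (q ∸ k) !)
  q∣C* = subst (q ∣_) (sym C*≡q!) q∣q!
... | inj₁ q∣C = q∣C
... | inj₂ q∣* with euclidsLemma (k !) ((q ∸ k) !) pq q∣*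
... | inj₁ q∣k! = contradiction q∣k! (prime∤! pq k k<q)
... | inj₂ q∣[q∸k]! = contradiction q∣[q∸k]! (prime∤! pq (q ∸ k) (∸-monoʳ-< 1≤k (<⇒≤ k<q)))

module Freshman (S : CommutativeSemiring 0ℓ 0ℓ) where
  open CommutativeSemiring S using (_≈_; 0#; 1#; setoid; semiring; +-commutativeMonoid) renaming (Carrier to A; _+_ to _⊕_; _*_ to _⊗_; refl to ≈-refl; sym to ≈-sym; trans to ≈-trans; +-cong to ⊕-cong; +-comm to ⊕-comm; +-identityˡ to ⊕-identityˡ; +-identityʳ to ⊕-identityʳ; *-identityˡ to ⊗-identityˡ; *-identityʳ to ⊗-identityʳ)
  open Exp semiring using () renaming (_^_ to _↑_)
  open Mult semiring using (×-assocˡ; ×-homo-1; ×-congˡ; ×-congʳ) renaming (_×_ to _·_)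
  open MonoidSum +-commutativeMonoid using (sum-init-last; sum-cong-≋; sum-replicate-zero) renaming (sum to ⨁)

  -- The inner binomial coefficients are divisible by q. The ring in question will be ℤ[ζ] modulo q.
  freshman : ∀ {q} → Prime q → (∀ x → q · x ≈ 0#) → ∀ x y → (x ⊕ y) ↑ q ≈ (x ↑ q) ⊕ (y ↑ q)
  freshman {zero} pq _ x y = contradiction pq ¬prime[0]
  freshman {suc q} pq char x y = begin
    (x ⊕ y) ↑ suc q                                               ≈⟨ Binomial.theorem S (suc q) x y ⟩
    t fzero ⊕ ⨁ {suc q} (t ∘ fsuc)                                ≈⟨ ⊕-cong first (sum-init-last (t ∘ fsuc)) ⟩
    y ↑ suc q ⊕ (⨁ (Vector.init (t ∘ fsuc)) ⊕ Vector.last (t ∘ fsuc))   ≈⟨ ⊕-cong ≈-refl (⊕-cong (≈-trans (sum-cong-≋ middle) (sum-replicate-zero q)) last) ⟩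
    y ↑ suc q ⊕ (0# ⊕ x ↑ suc q)                                  ≈⟨ ⊕-cong ≈-refl (⊕-identityˡ _) ⟩
    y ↑ suc q ⊕ x ↑ suc q                                         ≈⟨ ⊕-comm _ _ ⟩
    x ↑ suc q ⊕ y ↑ suc q                                         ∎
    where
    open SetoidReasoning setoid
    t : Fin (suc (suc q)) → A
    t = Binomial.binomialTerm S x y (suc q)
    first : t fzero ≈ y ↑ suc q
    first = ≈-trans (×-homo-1 _) (⊗-identityˡ _)
    last : Vector.last (t ∘ fsuc) ≈ x ↑ suc q
    last = ≈-trans (subst (λ k → (suc q choose suc k) · (x ↑ suc k ⊗ y ↑ (q ∸ k)) ≈ (suc q choose suc q) · (x ↑ suc q ⊗ y ↑ (q ∸ q))) (sym (Fin.toℕ-fromℕ q)) ≈-refl)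
      (≈-trans (×-congˡ (nCn≡1 (suc q))) (≈-trans (×-homo-1 _) (≈-trans (subst (λ z → x ↑ suc q ⊗ y ↑ z ≈ x ↑ suc q ⊗ 1#) (sym (n∸n≡0 q)) ≈-refl) (⊗-identityʳ _))))
    middle : ∀ i → Vector.init (t ∘ fsuc) i ≈ 0#
    middle i = vanish (x ↑ suc k ⊗ y ↑ (q ∸ k)) (prime∣C pq (suc k) (s≤s z≤n) (s≤s (subst (_< q) (sym (Fin.toℕ-inject₁ i)) (Fin.toℕ<n i))))
      where
      k = toℕ (inject₁ i)
      vanish : ∀ {c} z → suc q ∣ c → c · z ≈ 0#
      vanish z (divides e refl) = ≈-trans (≈-trans (×-congˡ (*-comm e (suc q))) (≈-sym (×-assocˡ z (suc q) e))) (char (e · z))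

-- Chebyshev estimates

choose≤2^ : ∀ n k → (n choose k) ≤ 2 ^ n
choose≤2^ zero zero = ≤-refl
choose≤2^ zero (suc k) = z≤n
choose≤2^ (suc n) zero = m^n>0 2 (suc n)
choose≤2^ (suc n) (suc k) = ≤-trans (≤-reflexive (sym (nCk+nC[k+1]≡[n+1]C[k+1] n k)))
  (+-mono-≤ (choose≤2^ n k) (≤-trans (choose≤2^ n (suc k)) (≤-reflexive (sym (+-identityʳ (2 ^ n))))))

prime∣! : ∀ {q} n → 1 ≤ q → q ≤ n → q ∣ n !
prime∣! zero 1≤q q≤0 = contradiction (≤-trans 1≤q q≤0) λ ()
prime∣! {q} (suc n) 1≤q q≤n with q ≟ suc n
... | yes refl = m∣m*n (n !)
... | no q≢ = ∣n⇒∣m*n (suc n) (prime∣! n 1≤q (≤-pred (≤∧≢⇒< q≤n q≢)))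

prime∣central : ∀ {q} → Prime q → ∀ N → N < q → q ≤ N + N → q ∣ ((N + N) choose N)
prime∣central {q} pq N N<q q≤2N = [ id , (λ h → contradiction h (λ h → [ prime∤! pq N N<q , (λ h → prime∤! pq N N<q (subst (λ k → q ∣ k !) (m+n∸n≡m N N) h)) ]′ (euclidsLemma (N !) ((N + N ∸ N) !) pq h))) ]′
  (euclidsLemma ((N + N) choose N) (N ! * (N + N ∸ N) !) pq (subst (q ∣_) (sym product≡) (prime∣! (N + N) (prime≥1 pq) q≤2N)))
  where
  instance _ = N !* (N + N ∸ N) !≢0
  product≡ : ((N + N) choose N) * (N ! * (N + N ∸ N) !) ≡ (N + N) !
  product≡ = trans (cong (_* (N ! * (N + N ∸ N) !)) (nCk≡n!/k![n-k]! (m≤m+n N N))) (m/n*n≡m (k![n∸k]!∣n! (m≤m+n N N)))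

prime∤product : ∀ {q T} → Prime q → All Prime T → All (q ≢_) T → ¬ q ∣ product T
prime∤product pq [] [] q∣1 = <-irrefl refl (≤-trans (prime≥2 pq) (∣⇒≤ q∣1))
prime∤product {q} {r ∷ T} pq (pr ∷ pT) (q≢r ∷ q∉T) h with euclidsLemma r (product T) pq h
... | inj₁ q∣r = q≢r (prime∣prime pq pr q∣r)
... | inj₂ q∣T = prime∤product pq pT q∉T q∣T

product∣ : ∀ {T n} → All Prime T → Unique T → All (_∣ n) T → product T ∣ n
product∣ [] [] [] = 1∣ _
product∣ (pq ∷ pT) (q∉T ∷ uT) (q∣n ∷ T∣n) = *-∣-prime pq q∣n (product∣ pT uT T∣n) (prime∤product pq pT q∉T)

^-≤-cancel : ∀ {a b} → 2 ^ a ≤ 2 ^ b → a ≤ b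
^-≤-cancel {a} {b} h = ≮⇒≥ (λ b<a → <⇒≱ (^-monoʳ-< 2 (s≤s (s≤s z≤n)) b<a) h)

above? : ∀ z q → Dec (Prime q × z < q)
above? z q = prime? q ×-dec (z <? q)

-- The primes in (2^t, 2^(t+1)] all divide a binomial coefficient that is at most 4^(2^t).
dyadic-primes : ∀ t → length (select (above? (2 ^ t)) (2 ^ t + 2 ^ t)) * t ≤ 2 * 2 ^ t
dyadic-primes t = ^-≤-cancel (begin
  2 ^ (length T * t)              ≡⟨ cong (2 ^_) (*-comm (length T) t) ⟩
  2 ^ (t * length T)              ≡⟨ sym (^-*-assoc 2 t (length T)) ⟩
  N ^ length T                    ≤⟨ product-lower T (All.map (λ (_ , _ , _ , N<q) → <⇒≤ N<q) all) ⟩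
  product T                       ≤⟨ ∣⇒≤ {{≢-nonZero central≢0}} (product∣ (All.map (λ (_ , _ , pq , _) → pq) all) (select-unique (above? N) (N + N)) (All.map (λ (_ , q≤ , pq , N<q) → prime∣central pq N N<q q≤) all)) ⟩
  (N + N) choose N                ≤⟨ choose≤2^ (N + N) N ⟩
  2 ^ (N + N)                     ≡⟨ cong (λ k → 2 ^ (N + k)) (sym (+-identityʳ N)) ⟩
  2 ^ (2 * N)                     ∎)
  where
  open ≤-Reasoning
  N = 2 ^ t
  T = select (above? N) (N + N)
  all = select-all (above? N) (N + N)
  product-lower : ∀ T → All (N ≤_) T → N ^ length T ≤ product T
  product-lower [] [] = ≤-refl
  product-lower (q ∷ T) (N≤q ∷ a) = *-mono-≤ N≤q (product-lower T a)
  central≢0 : (N + N) choose N ≢ 0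
  central≢0 e = contradiction (trans (sym (trans (cong (_* (N ! * (N + N ∸ N) !)) (nCk≡n!/k![n-k]! (m≤m+n N N))) (m/n*n≡m (k![n∸k]!∣n! (m≤m+n N N))))) (cong (_* (N ! * (N + N ∸ N) !)) e)) (λ e → ≢-nonZero⁻¹ ((N + N) !) {{(N + N) !≢0}} e)
    where instance _ = N !* (N + N ∸ N) !≢0

-- The binary logarithm of n, rounded up and capped at the first argument.
log : ℕ → ℕ → ℕ
log zero n = 0
log (suc t) n with n ≤? 2 ^ t
... | yes _ = log t n
... | no _ = suc t

≤2^log : ∀ t n → n ≤ 2 ^ t → n ≤ 2 ^ log t n
≤2^log zero n h = h
≤2^log (suc t) n h with n ≤? 2 ^ t
... | yes n≤ = ≤2^log t n n≤
... | no _ = h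

log≤ : ∀ t n s → n ≤ 2 ^ s → log t n ≤ s
log≤ zero n s h = z≤n
log≤ (suc t) n s h with n ≤? 2 ^ t
... | yes _ = log≤ t n s h
... | no n≰ = ≰⇒> (λ s≤t → n≰ (≤-trans h (^-monoʳ-≤ 2 s≤t)))

-- The exponent of q in n, capped at A. Being a sum of indicators, it can be averaged over n by
-- exchanging summations.
valuation : ℕ → ℕ → ℕ → ℕ
valuation A q n = ∑ A (λ a → 𝟙 (q ^ a ∣? n))

𝟙-yes : ∀ {P : Set} (d : Dec P) → P → 𝟙 d ≡ 1
𝟙-yes (yes _) p = refl
𝟙-yes (no ¬p) p = contradiction p ¬p

𝟙-no : ∀ {P : Set} (d : Dec P) → ¬ P → 𝟙 d ≡ 0
𝟙-no (yes p) ¬p = contradiction p ¬p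
𝟙-no (no _) ¬p = refl

𝟙-mono : ∀ {P Q : Set} (d : Dec P) (e : Dec Q) → (P → Q) → 𝟙 d ≤ 𝟙 e
𝟙-mono (yes p) e f = ≤-reflexive (sym (𝟙-yes e (f p)))
𝟙-mono (no _) e f = z≤n

valuation-mono : ∀ A q {m n} → m ∣ n → valuation A q m ≤ valuation A q n
valuation-mono A q m∣n = ∑-mono A (λ a _ _ → 𝟙-mono (_ ∣? _) (_ ∣? _) (λ h → ∣-trans h m∣n))

≤valuation : ∀ A {q n} a → a ≤ A → q ^ a ∣ n → a ≤ valuation A q n
≤valuation A {q} {n} a a≤A h = begin
  a                                                   ≡⟨ sym (trans (∑-const a 1) (*-identityʳ a)) ⟩
  ∑ a (λ _ → 1)                                       ≤⟨ ∑-mono a (λ i _ i≤a → ≤-reflexive (sym (𝟙-yes (q ^ i ∣? n) (∣-trans (m≤n⇒m^a∣m^n i≤a) h)))) ⟩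
  ∑ a (λ i → 𝟙 (q ^ i ∣? n))                          ≤⟨ m≤m+n _ _ ⟩
  ∑ a (λ i → 𝟙 (q ^ i ∣? n)) + ∑ (A ∸ a) (λ i → 𝟙 (q ^ (a + i) ∣? n))  ≡⟨ sym (∑-split a (A ∸ a) (λ i → 𝟙 (q ^ i ∣? n))) ⟩
  ∑ (a + (A ∸ a)) (λ i → 𝟙 (q ^ i ∣? n))              ≡⟨ cong (λ k → ∑ k (λ i → 𝟙 (q ^ i ∣? n))) (m+[n∸m]≡n a≤A) ⟩
  valuation A q n                                     ∎
  where
  open ≤-Reasoning
  m≤n⇒m^a∣m^n : ∀ {i} → i ≤ a → q ^ i ∣ q ^ a
  m≤n⇒m^a∣m^n {i} i≤a = divides (q ^ (a ∸ i)) (trans (cong (q ^_) (sym (m∸n+n≡m i≤a))) (^-distribˡ-+-* q (a ∸ i) i))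

strip-prime : ∀ q n → 2 ≤ q → 1 ≤ n → ∃[ a ] ∃[ m ] (n ≡ q ^ a * m × ¬ q ∣ m × 1 ≤ m)
strip-prime q n 2≤q = go n (<-wellFounded n)
  where
  go : ∀ n → Acc _<_ n → 1 ≤ n → ∃[ a ] ∃[ m ] (n ≡ q ^ a * m × ¬ q ∣ m × 1 ≤ m)
  go n (acc rec) 1≤n with q ∣? n
  ... | no q∤n = 0 , n , sym (+-identityʳ n) , q∤n , 1≤n
  ... | yes (divides zero refl) = contradiction 1≤n λ ()
  ... | yes (divides k@(suc _) refl) with go k (rec (m<m*n k q 2≤q)) (s≤s z≤n)
  ...   | a , m , eq , q∤m , 1≤m = suc a , m , trans (*-comm k q) (trans (cong (q *_) eq) (sym (*-assoc q (q ^ a) m))) , q∤m , 1≤m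

prime-factor : ∀ n → 2 ≤ n → ∃[ q ] (Prime q × q ∣ n)
prime-factor n 2≤n with factorise n {{>-nonZero (≤-trans (s≤s z≤n) 2≤n)}}
... | record { factors = [] ; isFactorisation = refl } = contradiction 2≤n λ { (s≤s ()) }
... | record { factors = q ∷ l ; isFactorisation = eq ; factorsPrime = pq ∷ _ } = q , pq , subst (q ∣_) (sym eq) (m∣m*n (product l))

-- The binary logarithm of the factorisation, with each logarithm rounded up. The induction strips
-- off the largest admissible prime, and n ≤ 2^A makes the cap on the exponents ineffective.
smooth-size : ∀ A t z n → z ≤ 2 ^ t → 1 ≤ n → n ≤ 2 ^ A → (∀ q → Prime q → q ∣ n → q ≤ z) →
  n ≤ 2 ^ ∑ z (λ q → 𝟙 (prime? q) * (log t q * valuation A q n))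
smooth-size A t zero n z≤ 1≤n n≤ smooth with n ≟ 1
... | yes refl = ≤-refl
... | no n≢1 = let (q , pq , q∣n) = prime-factor n (≤∧≢⇒< 1≤n (λ e → n≢1 (sym e))) in contradiction (≤-trans (prime≥1 pq) (smooth q pq q∣n)) λ ()
smooth-size A t (suc z) n z≤ 1≤n n≤ smooth with prime? (suc z)
... | no ¬pq = ≤-trans (smooth-size A t z n (≤-trans (n≤1+n z) z≤) 1≤n n≤ (λ q pq q∣n → ≤-pred (≤∧≢⇒< (smooth q pq q∣n) (λ { refl → ¬pq pq }))))
      (≤-reflexive (cong (2 ^_) (sym (+-identityʳ (∑ z (λ q → 𝟙 (prime? q) * (log t q * valuation A q n)))))))
... | yes pq with strip-prime (suc z) n (prime≥2 pq) 1≤n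
...   | a , m , refl , q∤m , 1≤m = begin
  suc z ^ a * m                                     ≤⟨ *-mono-≤ (^-monoˡ-≤ a (≤2^log t (suc z) z≤)) (smooth-size A t z m (≤-trans (n≤1+n z) z≤) 1≤m (≤-trans (m≤n*m m (suc z ^ a) {{m^n≢0 (suc z) a}}) n≤) smooth′) ⟩
  (2 ^ ℓ) ^ a * 2 ^ W m                             ≡⟨ cong (_* 2 ^ W m) (^-*-assoc 2 ℓ a) ⟩
  2 ^ (ℓ * a) * 2 ^ W m                             ≡⟨ sym (^-distribˡ-+-* 2 (ℓ * a) (W m)) ⟩
  2 ^ (ℓ * a + W m)                                 ≤⟨ ^-monoʳ-≤ 2 (≤-trans (≤-reflexive (+-comm (ℓ * a) (W m))) (+-mono-≤ W-mono (≤-trans (*-monoʳ-≤ ℓ (≤valuation A {suc z} {suc z ^ a * m} a a≤A (m∣m*n m))) (≤-reflexive (sym (+-identityʳ _)))))) ⟩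
  2 ^ (W (suc z ^ a * m) + 1 * (ℓ * valuation A (suc z) (suc z ^ a * m))) ∎
  where
  open ≤-Reasoning
  ℓ = log t (suc z)
  W : ℕ → ℕ
  W n = ∑ z (λ q → 𝟙 (prime? q) * (log t q * valuation A q n))
  W-mono : W m ≤ W (suc z ^ a * m)
  W-mono = ∑-mono z (λ q _ _ → *-monoʳ-≤ (𝟙 (prime? q)) (*-monoʳ-≤ (log t q) (valuation-mono A q (n∣m*n (suc z ^ a)))))
  smooth′ : ∀ q → Prime q → q ∣ m → q ≤ z
  smooth′ q pq′ q∣m = ≤-pred (≤∧≢⇒< (smooth q pq′ (∣n⇒∣m*n (suc z ^ a) q∣m)) (λ { refl → q∤m q∣m }))
  a≤A : a ≤ A
  a≤A = ^-≤-cancel (≤-trans (^-monoˡ-≤ a (prime≥2 pq)) (≤-trans (m≤m*n (suc z ^ a) m {{>-nonZero 1≤m}}) n≤))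

-- From q^a to q^(a+1) the number of multiples at least halves, so the series is at most twice its
-- first term.
∑-valuation : ∀ X A q → 2 ≤ q → ∑ X (valuation A q) ≤ 2 * multiples X q
∑-valuation X A q 2≤q = ≤-trans (≤-reflexive (∑-swap X A (λ n a → 𝟙 (q ^ a ∣? n)))) (≤-trans (geometric A) (*-monoʳ-≤ 2 (≤-reflexive (cong (multiples X) (*-identityʳ q)))))
  where
  M : ℕ → ℕ
  M a = multiples X (q ^ a)
  q^≥1 : ∀ a → 1 ≤ q ^ a
  q^≥1 a = m^n>0 q {{>-nonZero (≤-trans (s≤s z≤n) 2≤q)}} a
  halve : ∀ a → 2 * M (suc a) ≤ M a
  halve a = ≤-trans (*-monoˡ-≤ (M (suc a)) 2≤q) (multiples-max (q ^ a) (q^≥1 a) (≤-trans (≤-reflexive (regroup q (M (suc a)) (q ^ a))) (multiples-upper X (q ^ suc a) (q^≥1 (suc a)))))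
    where
    regroup : ∀ q M x → q * M * x ≡ q * x * M
    regroup = solve-∀
  geometric′ : ∀ A → ∑ (suc A) M + M (suc A) ≤ 2 * M 1
  geometric′ zero = ≤-reflexive (cong (M 1 +_) (sym (+-identityʳ (M 1))))
  geometric′ (suc A) = ≤-trans (≤-reflexive (regroup (∑ (suc A) M) (M (suc (suc A))))) (≤-trans (+-monoʳ-≤ (∑ (suc A) M) (halve (suc A))) (geometric′ A))
    where
    regroup : ∀ s m → s + m + m ≡ s + 2 * m
    regroup = solve-∀
  geometric : ∀ A → ∑ A M ≤ 2 * M 1
  geometric zero = z≤n
  geometric (suc A) = ≤-trans (m≤m+n _ _) (geometric′ A)

length-select-∑ : ∀ {P : ℕ → Set} (P? : ∀ n → Dec (P n)) n → length (select P? n) ≡ ∑ n (λ q → 𝟙 (P? q))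
length-select-∑ P? zero = refl
length-select-∑ P? (suc n) with P? (suc n)
... | yes _ = trans (cong suc (length-select-∑ P? n)) (sym (+-comm (∑ n _) 1))
... | no _ = trans (length-select-∑ P? n) (sym (+-identityʳ _))

𝟙≤1 : ∀ {P : Set} (d : Dec P) → 𝟙 d ≤ 1
𝟙≤1 (yes _) = ≤-refl
𝟙≤1 (no _) = z≤n

multiples-anti : ∀ X {a b} → 1 ≤ a → a ≤ b → multiples X b ≤ multiples X a
multiples-anti X {a} {b} 1≤a a≤b = multiples-max a 1≤a (≤-trans (*-monoʳ-≤ (multiples X b) a≤b)
  (≤-trans (≤-reflexive (*-comm (multiples X b) b)) (multiples-upper X b (≤-trans 1≤a a≤b))))

2^suc : ∀ b → 2 ^ suc b ≡ 2 ^ b + 2 ^ b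
2^suc b = cong (2 ^ b +_) (+-identityʳ (2 ^ b))

-- By `dyadic-primes` the block (2^b, 2^(b+1)] has at most 2 · 2^b / b primes, each of logarithm at
-- most b + 1 and with at most X / 2^b multiples, so it contributes at most 4X.
weighted-primes : ∀ X t b → 1 ≤ b → ∑ (2 ^ b) (λ q → 𝟙 (prime? q) * (log t q * multiples X q)) ≤ 4 * b * X
weighted-primes X t (suc zero) _ = begin
  0 + 𝟙 (prime? 1) * (log t 1 * multiples X 1) + 𝟙 (prime? 2) * (log t 2 * multiples X 2)
    ≤⟨ +-mono-≤ (*-mono-≤ (𝟙≤1 (prime? 1)) (*-monoˡ-≤ (multiples X 1) (log≤ t 1 0 ≤-refl))) (*-mono-≤ (𝟙≤1 (prime? 2)) (*-mono-≤ (log≤ t 2 1 ≤-refl) (≤-trans (m≤m+n _ _) (multiples-upper X 2 (s≤s z≤n))))) ⟩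
  1 * (1 * X)
    ≡⟨ trans (*-identityˡ (1 * X)) (*-identityˡ X) ⟩
  X ≤⟨ m≤m+n X _ ⟩
  4 * 1 * X ∎
  where open ≤-Reasoning
weighted-primes X t (suc b@(suc _)) _ = begin
  ∑ (2 ^ suc b) f                           ≡⟨ cong (λ k → ∑ k f) (2^suc b) ⟩
  ∑ (N + N) f                               ≡⟨ ∑-split N N f ⟩
  ∑ N f + ∑ N (λ i → f (N + i))             ≤⟨ +-mono-≤ (weighted-primes X t b (s≤s z≤n)) block ⟩
  4 * b * X + 4 * X                         ≡⟨ collect b X ⟩
  4 * suc b * X                             ∎
  where
  open ≤-Reasoning
  N = 2 ^ b
  f : ℕ → ℕ
  f q = 𝟙 (prime? q) * (log t q * multiples X q)
  collect : ∀ b X → 4 * b * X + 4 * X ≡ 4 * suc b * X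
  collect = solve-∀
  c = length (select (above? N) (N + N))
  w = suc b * multiples X N
  block≤ : ∑ N (λ i → f (N + i)) ≤ c * w
  block≤ = begin
    ∑ N (λ i → f (N + i))
      ≤⟨ ∑-mono N (λ i 1≤i i≤N → *-mono-≤ (𝟙-mono (prime? (N + i)) (above? N (N + i)) (λ pq → pq , ≤-trans (≤-reflexive (+-comm 1 N)) (+-monoʳ-≤ N 1≤i)))
           (*-mono-≤ (log≤ t (N + i) (suc b) (≤-trans (+-monoʳ-≤ N i≤N) (≤-reflexive (sym (2^suc b))))) (multiples-anti X (m^n>0 2 b) (m≤m+n N i)))) ⟩
    ∑ N (λ i → 𝟙 (above? N (N + i)) * w)
      ≡⟨ trans (∑-cong N (λ i _ _ → *-comm (𝟙 (above? N (N + i))) w)) (∑-* N w _) ⟩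
    w * ∑ N (λ i → 𝟙 (above? N (N + i)))
      ≤⟨ *-monoʳ-≤ w (≤-trans (m≤n+m _ (∑ N (λ q → 𝟙 (above? N q)))) (≤-reflexive (sym (∑-split N N (λ q → 𝟙 (above? N q)))))) ⟩
    w * ∑ (N + N) (λ q → 𝟙 (above? N q))
      ≡⟨ trans (cong (w *_) (sym (length-select-∑ (above? N) (N + N)))) (*-comm w c) ⟩
    c * w ∎
  block : ∑ N (λ i → f (N + i)) ≤ 4 * X
  block = cancelˡ-≤ b (s≤s z≤n) (begin
    b * ∑ N (λ i → f (N + i))          ≤⟨ *-monoʳ-≤ b block≤ ⟩
    b * (c * (suc b * multiples X N))  ≡⟨ regroup b c (suc b) (multiples X N) ⟩
    (c * b) * (suc b * multiples X N)  ≤⟨ *-monoˡ-≤ (suc b * multiples X N) (dyadic-primes b) ⟩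
    2 * N * (suc b * multiples X N)    ≡⟨ regroup′ N (suc b) (multiples X N) ⟩
    2 * suc b * (N * multiples X N)    ≤⟨ *-monoʳ-≤ (2 * suc b) (multiples-upper X N (m^n>0 2 b)) ⟩
    2 * suc b * X                      ≤⟨ *-monoˡ-≤ X (*-monoʳ-≤ 2 (+-monoˡ-≤ b (s≤s (z≤n {pred b})))) ⟩
    2 * (b + b) * X                    ≡⟨ regroup″ b X ⟩
    b * (4 * X)                        ∎)
    where
    regroup : ∀ b c s m → b * (c * (s * m)) ≡ (c * b) * (s * m)
    regroup = solve-∀
    regroup′ : ∀ N s m → 2 * N * (s * m) ≡ 2 * s * (N * m)
    regroup′ = solve-∀
    regroup″ : ∀ b X → 2 * (b + b) * X ≡ b * (4 * X)
    regroup″ = solve-∀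

-- An integer n ≤ 2^(64b) without prime factors above 2^b has Σ log q · v_q(n) of order 64 b,
-- whereas by Chebyshev's bound the mean of this sum over n is at most 8 b.
reciprocal-window : ∀ b → 1 ≤ b → product (select (above? (2 ^ b)) (2 ^ (64 * b))) ≤ 2 * recip (select (above? (2 ^ b)) (2 ^ (64 * b)))
reciprocal-window b 1≤b = cancelˡ-≤ X X≥1 (begin
  X * Q                     ≤⟨ *-monoˡ-≤ Q X≤2S ⟩
  2 * S * Q                 ≡⟨ regroup S Q ⟩
  2 * (Q * S)               ≤⟨ *-monoʳ-≤ 2 (select-recip (above? z) X X) ⟩
  2 * (X * R)               ≡⟨ regroup′ X R ⟩
  X * (2 * R)               ∎)
  where
  open ≤-Reasoning
  z = 2 ^ b
  A = 64 * b
  X = 2 ^ A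
  X≥1 : 1 ≤ X
  X≥1 = m^n>0 2 A
  T = select (above? z) X
  Q = product T
  R = recip T
  S = ∑ X (λ q → 𝟙 (above? z q) * multiples X q)
  regroup : ∀ S Q → 2 * S * Q ≡ 2 * (Q * S)
  regroup = solve-∀
  regroup′ : ∀ X R → 2 * (X * R) ≡ X * (2 * R)
  regroup′ = solve-∀
  Smooth : ℕ → Set
  Smooth n = ∀ q → Prime q → q ∣ n → q ≤ z
  w : ℕ → ℕ
  w n = ∑ z (λ q → 𝟙 (prime? q) * (log b q * valuation A q n))
  ∑w : ∑ X w ≤ 8 * (b * X)
  ∑w = begin
    ∑ X w                                                                      ≡⟨ ∑-swap X z _ ⟩
    ∑ z (λ q → ∑ X (λ n → 𝟙 (prime? q) * (log b q * valuation A q n)))         ≤⟨ ∑-mono z (λ q _ _ → per-prime q) ⟩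
    ∑ z (λ q → 2 * (𝟙 (prime? q) * (log b q * multiples X q)))                 ≡⟨ ∑-* z 2 _ ⟩
    2 * ∑ z (λ q → 𝟙 (prime? q) * (log b q * multiples X q))                   ≤⟨ *-monoʳ-≤ 2 (weighted-primes X b b 1≤b) ⟩
    2 * (4 * b * X)                                                            ≡⟨ collect b X ⟩
    8 * (b * X)                                                                ∎
    where
    collect : ∀ b X → 2 * (4 * b * X) ≡ 8 * (b * X)
    collect = solve-∀
    per-prime : ∀ q → ∑ X (λ n → 𝟙 (prime? q) * (log b q * valuation A q n)) ≤ 2 * (𝟙 (prime? q) * (log b q * multiples X q))
    per-prime q with prime? q
    ... | no _ = ≤-trans (≤-reflexive (∑-zero X)) z≤n
    ... | yes pq = begin
      ∑ X (λ n → 1 * (log b q * valuation A q n))  ≡⟨ ∑-cong X (λ n _ _ → *-identityˡ _) ⟩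
      ∑ X (λ n → log b q * valuation A q n)        ≡⟨ ∑-* X (log b q) _ ⟩
      log b q * ∑ X (valuation A q)                ≤⟨ *-monoʳ-≤ (log b q) (∑-valuation X A q (prime≥2 pq)) ⟩
      log b q * (2 * multiples X q)                ≡⟨ swap (log b q) (multiples X q) ⟩
      2 * (1 * (log b q * multiples X q))          ∎
      where
      swap : ∀ l m → l * (2 * m) ≡ 2 * (1 * (l * m))
      swap = solve-∀
  -- A smooth n ≥ X / 8 has weight at least 64b - 3 ≥ 61b, and 8bX / (61b) is below X / 4.
  few-smooth : Few (λ n → (1 ≤ n × n ≤ X) × Smooth n × X ≤ 8 * n) (multiples X 4)
  few-smooth l ul al = multiples-max {length l} {X} 4 (s≤s z≤n) (*-cancelˡ-≤ 8 (begin
    8 * (length l * 4)       ≡⟨ collect (length l) ⟩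
    32 * length l            ≤⟨ *-monoˡ-≤ (length l) (m≤m+n 32 29) ⟩
    61 * length l            ≤⟨ cancelˡ-≤ b 1≤b (≤-trans (≤-reflexive (collect′ b (length l))) (≤-trans (few-weight X (61 * b) w heavy l ul al) (≤-trans ∑w (≤-reflexive (collect″ b X))))) ⟩
    8 * X                    ∎))
    where
    collect : ∀ l → 8 * (l * 4) ≡ 32 * l
    collect = solve-∀
    collect′ : ∀ b l → b * (61 * l) ≡ l * (61 * b)
    collect′ = solve-∀
    collect″ : ∀ b X → 8 * (b * X) ≡ b * (8 * X)
    collect″ = solve-∀
    heavy : ∀ n → (1 ≤ n × n ≤ X) × Smooth n × X ≤ 8 * n → 1 ≤ n × n ≤ X × 61 * b ≤ w n
    heavy n ((1≤n , n≤X) , smooth , X≤8n) = 1≤n , n≤X , +-cancelˡ-≤ 3 _ _ (begin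
      3 + 61 * b        ≤⟨ +-monoˡ-≤ (61 * b) (m≤m*n 3 b {{>-nonZero 1≤b}}) ⟩
      3 * b + 61 * b    ≡⟨ sym (*-distribʳ-+ b 3 61) ⟩
      64 * b            ≤⟨ ^-≤-cancel (≤-trans X≤8n (≤-trans (*-monoʳ-≤ 8 (smooth-size A b z n ≤-refl 1≤n n≤X smooth)) (≤-reflexive (sym (^-distribˡ-+-* 2 3 (w n)))))) ⟩
      3 + w n           ∎)
  few-hit : Few (λ n → ∃[ q ] (1 ≤ q × q ≤ X × (1 ≤ n × n ≤ X) × (Prime q × z < q) × q ∣ n)) S
  few-hit = few-⋃ X per-prime
    where
    per-prime : ∀ q → 1 ≤ q → q ≤ X → Few (λ n → (1 ≤ n × n ≤ X) × (Prime q × z < q) × q ∣ n) (𝟙 (above? z q) * multiples X q)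
    per-prime q 1≤q _ with above? z q
    ... | yes _ = few-mono (≤-reflexive (sym (+-identityʳ _))) (few-⊆ (λ { n ((a , b) , _ , c) → a , b , c }) (few-multiples X q 1≤q))
    ... | no ¬a = few-∅ (λ { n (_ , a , _) → ¬a a })
  classify : ∀ n → 1 ≤ n → n ≤ X → ((1 ≤ n × n ≤ multiples X 8) ⊎ ((1 ≤ n × n ≤ X) × Smooth n × X ≤ 8 * n)) ⊎ ∃[ q ] (1 ≤ q × q ≤ X × (1 ≤ n × n ≤ X) × (Prime q × z < q) × q ∣ n)
  classify n 1≤n n≤X with search (λ q → above? z q ×-dec (q ∣? n)) X | ≤-total (8 * n) X
  ... | inj₁ (q , 1≤q , q≤X , a , q∣n) | _ = inj₂ (q , 1≤q , q≤X , (1≤n , n≤X) , a , q∣n)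
  ... | inj₂ none | inj₁ 8n≤X = inj₁ (inj₁ (1≤n , multiples-max 8 (s≤s z≤n) (≤-trans (≤-reflexive (*-comm n 8)) 8n≤X)))
  ... | inj₂ none | inj₂ X≤8n = inj₁ (inj₂ ((1≤n , n≤X) , (λ q pq q∣n → ≮⇒≥ (λ z<q → none q (prime≥1 pq) (≤-trans (∣⇒≤ {{>-nonZero 1≤n}} q∣n) n≤X) ((pq , z<q) , q∣n))) , X≤8n))
  -- From X ≤ X / 8 + X / 4 + S.
  X≤2S : X ≤ 2 * S
  X≤2S = *-cancelˡ-≤ 4 (+-cancelˡ-≤ (4 * X) _ _ (begin
    4 * X + 4 * X                                        ≡⟨ double X ⟩
    8 * X                                                ≤⟨ *-monoʳ-≤ 8 (few-covers X classify (few-⊎ (few-⊎ (few-upTo (multiples X 8)) few-smooth) few-hit)) ⟩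
    8 * (multiples X 8 + multiples X 4 + S)              ≡⟨ expand (multiples X 8) (multiples X 4) S ⟩
    8 * multiples X 8 + 2 * (4 * multiples X 4) + 8 * S  ≤⟨ +-monoˡ-≤ (8 * S) (+-mono-≤ (multiples-upper X 8 (s≤s z≤n)) (*-monoʳ-≤ 2 (multiples-upper X 4 (s≤s z≤n)))) ⟩
    X + 2 * X + 8 * S                                    ≤⟨ +-monoˡ-≤ (8 * S) (m≤m+n (X + 2 * X) X) ⟩
    X + 2 * X + X + 8 * S                                ≡⟨ collect X S ⟩
    4 * X + 4 * (2 * S)                                  ∎))
    where
    double : ∀ X → 4 * X + 4 * X ≡ 8 * X
    double = solve-∀
    expand : ∀ a b c → 8 * (a + b + c) ≡ 8 * a + 2 * (4 * b) + 8 * c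
    expand = solve-∀
    collect : ∀ X S → X + 2 * X + X + 8 * S ≡ 4 * X + 4 * (2 * S)
    collect = solve-∀

-- Adjacent windows of primes

recip-++ : ∀ S T → recip (S ++ T) ≡ recip S * product T + product S * recip T
recip-++ [] T = sym (+-identityʳ (recip T))
recip-++ (q ∷ S) T = trans (cong₂ _+_ (product-++ S T) (cong (q *_) (recip-++ S T))) (collect (product S) (product T) q (recip S) (recip T))
  where
  collect : ∀ S T q s t → S * T + q * (s * T + S * t) ≡ (S + q * s) * T + q * S * t
  collect = solve-∀

heavy-++ : ∀ a b k S T → a * product S ≤ k * recip S → b * product T ≤ k * recip T → (a + b) * product (S ++ T) ≤ k * recip (S ++ T)
heavy-++ a b k S T hS hT = begin
  (a + b) * product (S ++ T)                                    ≡⟨ cong ((a + b) *_) (product-++ S T) ⟩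
  (a + b) * (product S * product T)                             ≡⟨ expand a b (product S) (product T) ⟩
  a * product S * product T + product S * (b * product T)       ≤⟨ +-mono-≤ (*-monoˡ-≤ (product T) hS) (*-monoʳ-≤ (product S) hT) ⟩
  k * recip S * product T + product S * (k * recip T)           ≡⟨ collect k (recip S) (product T) (product S) (recip T) ⟩
  k * (recip S * product T + product S * recip T)               ≡⟨ cong (k *_) (sym (recip-++ S T)) ⟩
  k * recip (S ++ T)                                            ∎
  where
  open ≤-Reasoning
  expand : ∀ a b S T → (a + b) * (S * T) ≡ a * S * T + S * (b * T)
  expand = solve-∀
  collect : ∀ k s T S t → k * s * T + S * (k * t) ≡ k * (s * T + S * t)
  collect = solve-∀

unique-++ : ∀ {S T : List ℕ} c → Unique S → Unique T → All (_≤ c) S → All (c <_) T → Unique (S ++ T)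
unique-++ c uS uT S≤ <T = Unique.++⁺ uS uT (λ { (x∈S , x∈T) → <⇒≱ (All.lookup <T x∈T) (All.lookup S≤ x∈S) })

-- Each of the r windows has reciprocal sum at least 1/2. A sum of L therefore takes 2L windows and
-- leads from the exponent b to 64^(2L) b, an expression that governs all later ranges.
windows : ℕ → ℕ → List ℕ
windows zero b = []
windows (suc r) b = select (above? (2 ^ b)) (2 ^ (64 * b)) ++ windows r (64 * b)

windows-range : ∀ r b → All (λ q → Prime q × 2 ^ b < q × q ≤ 2 ^ (64 ^ r * b)) (windows r b)
windows-range zero b = []
windows-range (suc r) b = All.++⁺
  (All.map (λ { (_ , q≤ , pq , z<q) → pq , z<q , ≤-trans q≤ (^-monoʳ-≤ 2 (*-monoˡ-≤ b (m≤m*n 64 (64 ^ r) {{m^n≢0 64 r}}))) }) (select-all (above? (2 ^ b)) (2 ^ (64 * b))))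
  (All.map (λ { (pq , z<q , q≤) → pq , ≤-<-trans (^-monoʳ-≤ 2 (m≤n*m b 64)) z<q , ≤-trans q≤ (^-monoʳ-≤ 2 (≤-reflexive (regroup (64 ^ r) b))) }) (windows-range r (64 * b)))
  where
  regroup : ∀ x b → x * (64 * b) ≡ 64 * x * b
  regroup = solve-∀

windows-unique : ∀ r b → Unique (windows r b)
windows-unique zero b = []
windows-unique (suc r) b = unique-++ (2 ^ (64 * b)) (select-unique (above? (2 ^ b)) (2 ^ (64 * b))) (windows-unique r (64 * b))
  (All.map (λ { (_ , q≤ , _) → q≤ }) (select-all (above? (2 ^ b)) (2 ^ (64 * b)))) (All.map (λ { (_ , z<q , _) → z<q }) (windows-range r (64 * b)))

windows-heavy : ∀ r b → 1 ≤ b → r * product (windows r b) ≤ 2 * recip (windows r b)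
windows-heavy zero b 1≤b = z≤n
windows-heavy (suc r) b 1≤b = heavy-++ 1 r 2 (select (above? (2 ^ b)) (2 ^ (64 * b))) (windows r (64 * b))
  (≤-trans (≤-reflexive (*-identityˡ _)) (reciprocal-window b 1≤b)) (windows-heavy r (64 * b) (≤-trans 1≤b (m≤n*m b 64)))

few-without-prime : ∀ L b x → 1 ≤ L → 1 ≤ b → 2 ^ (64 ^ (2 * L) * b) ≤ x →
  Few (λ n → (1 ≤ n × n ≤ x) × (∀ q → Prime q → 2 ^ b < q → q ≤ 2 ^ (64 ^ (2 * L) * b) → ¬ q ∣ n)) (multiples (3 * x) L)
few-without-prime L b x 1≤L 1≤b top≤x l ul al = multiples-max L 1≤L (few-unhit x T L (All.map proj₁ range) (windows-unique (2 * L) b)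
  (few-upTo x T (windows-unique (2 * L) b) (All.map (λ { (pq , _ , q≤) → prime≥1 pq , ≤-trans q≤ top≤x }) range))
  (*-cancelˡ-≤ 2 (≤-trans (≤-reflexive (sym (*-assoc 2 L (product T)))) (windows-heavy (2 * L) b 1≤b)))
  l ul (All.map (λ { (r , unhit) → r , All.map (λ { (pq , z<q , q≤) → unhit _ pq z<q q≤ }) range }) al))
  where
  T = windows (2 * L) b
  range = windows-range (2 * L) b

-- A prime above 2^c has no prime factor in (2, 2^c], so `few-without-prime` admits at most 3z / L =
-- z / (2K) of them. The other half of z / K absorbs the numbers up to 2^c.
primes-sparse : ∀ K → 1 ≤ K → ∃[ z₀ ] (∀ z → z₀ ≤ z → K * ∑ z (λ q → 𝟙 (prime? q)) ≤ z)
primes-sparse K 1≤K = 2 * (K * 2 ^ c) , bound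
  where
  open ≤-Reasoning
  L = 6 * K
  c = 64 ^ (2 * L) * 1
  bound : ∀ z → 2 * (K * 2 ^ c) ≤ z → K * ∑ z (λ q → 𝟙 (prime? q)) ≤ z
  bound z z≥ = *-cancelˡ-≤ 2 (begin
    2 * (K * ∑ z (λ q → 𝟙 (prime? q)))          ≤⟨ *-monoʳ-≤ 2 (*-monoʳ-≤ K (∑-𝟙-few prime? z (few-⊆ classify (few-⊎ (few-upTo (2 ^ c)) (few-without-prime L 1 z 1≤L ≤-refl 2^c≤z))))) ⟩
    2 * (K * (2 ^ c + multiples (3 * z) L))     ≡⟨ expand K (2 ^ c) (multiples (3 * z) L) ⟩
    2 * (K * 2 ^ c) + 2 * K * multiples (3 * z) L   ≤⟨ +-mono-≤ z≥ (*-cancelˡ-≤ 3 (≤-trans (≤-reflexive (collect K (multiples (3 * z) L))) (multiples-upper (3 * z) L 1≤L))) ⟩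
    z + z                                       ≡⟨ cong (z +_) (sym (+-identityʳ z)) ⟩
    2 * z                                       ∎)
    where
    1≤L : 1 ≤ L
    1≤L = ≤-trans 1≤K (m≤n*m K 6)
    2^c≤z : 2 ^ c ≤ z
    2^c≤z = ≤-trans (≤-trans (m≤n*m (2 ^ c) K {{>-nonZero 1≤K}}) (m≤n*m (K * 2 ^ c) 2)) z≥
    expand : ∀ K x y → 2 * (K * (x + y)) ≡ 2 * (K * x) + 2 * K * y
    expand = solve-∀
    collect : ∀ K m → 3 * (2 * K * m) ≡ 6 * K * m
    collect = solve-∀
    classify : ∀ n → 1 ≤ n × n ≤ z × Prime n → (1 ≤ n × n ≤ 2 ^ c) ⊎ ((1 ≤ n × n ≤ z) × (∀ q → Prime q → 2 ^ 1 < q → q ≤ 2 ^ c → ¬ q ∣ n))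
    classify n (1≤n , n≤z , pn) with n ≤? 2 ^ c
    ... | yes n≤ = inj₁ (1≤n , n≤)
    ... | no n≰ = inj₂ ((1≤n , n≤z) , λ q pq _ q≤ q∣n → n≰ (subst (_≤ 2 ^ c) (prime∣prime pq pn q∣n) q≤))

-- The ring ℤ[ζ] for a p-th root of unity ζ

infixl 6 _⊕_
infixl 7 _⊗_
infix 8 ⊖_

-- Integer polynomials in an unknown ζ, acting on integer sequences with ζ as the shift.
data Expr : Set where
  𝟏 ζ : Expr
  _⊕_ _⊗_ : Expr → Expr → Expr
  ⊖_ : Expr → Expr

act : Expr → (ℕ → ℤ) → ℕ → ℤ
act 𝟏 u n = u n
act ζ u n = u (suc n)
act (a ⊕ b) u n = act a u n ℤ.+ act b u n
act (a ⊗ b) u n = act a (act b u) n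
act (⊖ a) u n = ℤ.- act a u n

𝟎 : Expr
𝟎 = 𝟏 ⊕ ⊖ 𝟏

act-𝟎 : ∀ u n → act 𝟎 u n ≡ 0ℤ
act-𝟎 u n = ℤₚ.+-inverseʳ (u n)

act-cong : ∀ e {u v} → (∀ n → u n ≡ v n) → ∀ n → act e u n ≡ act e v n
act-cong 𝟏 h n = h n
act-cong ζ h n = h (suc n)
act-cong (a ⊕ b) h n = cong₂ ℤ._+_ (act-cong a h n) (act-cong b h n)
act-cong (a ⊗ b) h n = act-cong a (act-cong b h) n
act-cong (⊖ a) h n = cong ℤ.-_ (act-cong a h n)

act-+ : ∀ e u v n → act e (λ n → u n ℤ.+ v n) n ≡ act e u n ℤ.+ act e v n
act-+ 𝟏 u v n = refl
act-+ ζ u v n = refl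
act-+ (a ⊕ b) u v n = trans (cong₂ ℤ._+_ (act-+ a u v n) (act-+ b u v n)) (interchange (act a u n) (act a v n) (act b u n) (act b v n))
  where
  interchange : ∀ x y z w → (x ℤ.+ y) ℤ.+ (z ℤ.+ w) ≡ (x ℤ.+ z) ℤ.+ (y ℤ.+ w)
  interchange = ℤSolver.solve-∀
act-+ (a ⊗ b) u v n = trans (act-cong a (act-+ b u v) n) (act-+ a (act b u) (act b v) n)
act-+ (⊖ a) u v n = trans (cong ℤ.-_ (act-+ a u v n)) (ℤₚ.neg-distrib-+ (act a u n) (act a v n))

act-* : ∀ e c u n → act e (λ n → c ℤ.* u n) n ≡ c ℤ.* act e u n
act-* 𝟏 c u n = refl
act-* ζ c u n = refl
act-* (a ⊕ b) c u n = trans (cong₂ ℤ._+_ (act-* a c u n) (act-* b c u n)) (sym (ℤₚ.*-distribˡ-+ c (act a u n) (act b u n)))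
act-* (a ⊗ b) c u n = trans (act-cong a (act-* b c u) n) (act-* a c (act b u) n)
act-* (⊖ a) c u n = trans (cong ℤ.-_ (act-* a c u n)) (ℤₚ.neg-distribʳ-* c (act a u n))

act-neg : ∀ e u n → act e (λ n → ℤ.- u n) n ≡ ℤ.- act e u n
act-neg e u n = trans (act-cong e (λ n → sym (ℤₚ.-1*i≡-i (u n))) n) (trans (act-* e ℤ.-1ℤ u n) (ℤₚ.-1*i≡-i _))

act-- : ∀ e u v n → act e (λ n → u n ℤ.- v n) n ≡ act e u n ℤ.- act e v n
act-- e u v n = trans (act-+ e u (λ n → ℤ.- v n) n) (cong (ℤ._+_ (act e u n)) (act-neg e v n))

act-zero : ∀ e n → act e (λ _ → 0ℤ) n ≡ 0ℤ
act-zero e n = act-* e 0ℤ (λ _ → 0ℤ) n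

act-shift : ∀ e k u n → act e (λ n → u (k + n)) n ≡ act e u (k + n)
act-shift 𝟏 k u n = refl
act-shift ζ k u n = cong u (+-suc k n)
act-shift (a ⊕ b) k u n = cong₂ ℤ._+_ (act-shift a k u n) (act-shift b k u n)
act-shift (a ⊗ b) k u n = trans (act-cong a (act-shift b k u) n) (act-shift a k (act b u) n)
act-shift (⊖ a) k u n = cong ℤ.-_ (act-shift a k u n)

act-comm : ∀ a b u n → act a (act b u) n ≡ act b (act a u) n
act-comm 𝟏 b u n = refl
act-comm ζ b u n = sym (act-shift b 1 u n)
act-comm (a₁ ⊕ a₂) b u n = trans (cong₂ ℤ._+_ (act-comm a₁ b u n) (act-comm a₂ b u n)) (sym (act-+ b (act a₁ u) (act a₂ u) n))
act-comm (a₁ ⊗ a₂) b u n = trans (act-cong a₁ (act-comm a₂ b u) n) (act-comm a₁ b (act a₂ u) n)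
act-comm (⊖ a) b u n = trans (cong ℤ.-_ (act-comm a b u n)) (sym (act-neg b (act a u) n))

act-∣ : ∀ e m u → (∀ n → m ∣ˢ u n) → ∀ n → m ∣ˢ act e u n
act-∣ 𝟏 m u h n = h n
act-∣ ζ m u h n = h (suc n)
act-∣ (a ⊕ b) m u h n = Signed.∣m∣n⇒∣m+n (act-∣ a m u h n) (act-∣ b m u h n)
act-∣ (a ⊗ b) m u h n = act-∣ a m (act b u) (act-∣ b m u h) n
act-∣ (⊖ a) m u h n = Signed.∣m⇒∣-m (act-∣ a m u h n)

-- The number of terms after expansion without cancellation. It bounds the action on bounded
-- sequences and is the same for all conjugates.
‖_‖ : Expr → ℕ
‖ 𝟏 ‖ = 1
‖ ζ ‖ = 1
‖ a ⊕ b ‖ = ‖ a ‖ + ‖ b ‖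
‖ a ⊗ b ‖ = ‖ a ‖ * ‖ b ‖
‖ ⊖ a ‖ = ‖ a ‖

act-bound : ∀ e u B → (∀ n → ∣ u n ∣ ≤ B) → ∀ n → ∣ act e u n ∣ ≤ ‖ e ‖ * B
act-bound 𝟏 u B h n = ≤-trans (h n) (≤-reflexive (sym (*-identityˡ B)))
act-bound ζ u B h n = ≤-trans (h (suc n)) (≤-reflexive (sym (*-identityˡ B)))
act-bound (a ⊕ b) u B h n = ≤-trans (ℤₚ.∣i+j∣≤∣i∣+∣j∣ (act a u n) (act b u n))
  (≤-trans (+-mono-≤ (act-bound a u B h n) (act-bound b u B h n)) (≤-reflexive (sym (*-distribʳ-+ B ‖ a ‖ ‖ b ‖))))
act-bound (a ⊗ b) u B h n = ≤-trans (act-bound a (act b u) (‖ b ‖ * B) (act-bound b u B h) n) (≤-reflexive (sym (*-assoc ‖ a ‖ ‖ b ‖ B)))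
act-bound (⊖ a) u B h n = ≤-trans (≤-reflexive (ℤₚ.∣-i∣≡∣i∣ (act a u n))) (act-bound a u B h n)

∑ℤ : ℕ → (ℕ → ℤ) → ℤ
∑ℤ zero f = 0ℤ
∑ℤ (suc n) f = ∑ℤ n f ℤ.+ f n

∑ℤ-cong : ∀ n {f g} → (∀ i → i < n → f i ≡ g i) → ∑ℤ n f ≡ ∑ℤ n g
∑ℤ-cong zero h = refl
∑ℤ-cong (suc n) h = cong₂ ℤ._+_ (∑ℤ-cong n (λ i i<n → h i (m≤n⇒m≤1+n i<n))) (h n ≤-refl)

∑ℤ-zero : ∀ n → ∑ℤ n (λ _ → 0ℤ) ≡ 0ℤ
∑ℤ-zero zero = refl
∑ℤ-zero (suc n) = cong (ℤ._+ 0ℤ) (∑ℤ-zero n)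

∑ℤ-const : ∀ n c → ∑ℤ n (λ _ → c) ≡ (ℤ.+ n) ℤ.* c
∑ℤ-const zero c = refl
∑ℤ-const (suc n) c = trans (cong (ℤ._+ c) (∑ℤ-const n c)) (trans (ℤₚ.+-comm _ c) (sym (ℤₚ.suc-* (ℤ.+ n) c)))

∑ℤ-- : ∀ n f g → ∑ℤ n (λ i → f i ℤ.- g i) ≡ ∑ℤ n f ℤ.- ∑ℤ n g
∑ℤ-- zero f g = refl
∑ℤ-- (suc n) f g = trans (cong (ℤ._+ (f n ℤ.- g n)) (∑ℤ-- n f g)) (interchange (∑ℤ n f) (∑ℤ n g) (f n) (g n))
  where
  interchange : ∀ x y z w → (x ℤ.- y) ℤ.+ (z ℤ.- w) ≡ (x ℤ.+ z) ℤ.- (y ℤ.+ w)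
  interchange = ℤSolver.solve-∀

∑ℤ-shift : ∀ n f → ∑ℤ n (f ∘ suc) ℤ.+ f 0 ≡ ∑ℤ n f ℤ.+ f n
∑ℤ-shift zero f = refl
∑ℤ-shift (suc n) f = trans (swap (∑ℤ n (f ∘ suc)) (f (suc n)) (f 0)) (cong (ℤ._+ f (suc n)) (∑ℤ-shift n f))
  where
  swap : ∀ x y z → (x ℤ.+ y) ℤ.+ z ≡ (x ℤ.+ z) ℤ.+ y
  swap = ℤSolver.solve-∀

act-∑ℤ : ∀ e k (f : ℕ → ℕ → ℤ) n → act e (λ n → ∑ℤ k (λ i → f i n)) n ≡ ∑ℤ k (λ i → act e (f i) n)
act-∑ℤ e zero f n = act-zero e n
act-∑ℤ e (suc k) f n = trans (act-+ e _ (f k) n) (cong (ℤ._+ act e (f k) n) (act-∑ℤ e k f n))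

ζ^_ : ℕ → Expr
ζ^ zero = 𝟏
ζ^ suc t = ζ ⊗ ζ^ t

act-ζ^ : ∀ t u n → act (ζ^ t) u n ≡ u (n + t)
act-ζ^ zero u n = cong u (sym (+-identityʳ n))
act-ζ^ (suc t) u n = trans (act-ζ^ t u (suc n)) (cong u (sym (+-suc n t)))

-- The substitution ζ ↦ ζ^t, which becomes a Galois automorphism of ℤ[ζ_p] when p does not divide t.
σ : ℕ → Expr → Expr
σ t 𝟏 = 𝟏
σ t ζ = ζ^ t
σ t (a ⊕ b) = σ t a ⊕ σ t b
σ t (a ⊗ b) = σ t a ⊗ σ t b
σ t (⊖ a) = ⊖ σ t a

dilate : ℕ → ℕ → (ℕ → ℤ) → ℕ → ℤ
dilate t n u i = u (n + t * i)

σ-dilate : ∀ t e u n j → act (σ t e) u (n + t * j) ≡ act e (dilate t n u) j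
σ-dilate t 𝟏 u n j = refl
σ-dilate t ζ u n j = trans (act-ζ^ t u (n + t * j)) (cong u (step n t j))
  where
  step : ∀ n t j → n + t * j + t ≡ n + t * suc j
  step = solve-∀
σ-dilate t (a ⊕ b) u n j = cong₂ ℤ._+_ (σ-dilate t a u n j) (σ-dilate t b u n j)
σ-dilate t (a ⊗ b) u n j = trans (σ-dilate t a (act (σ t b) u) n j) (act-cong a (σ-dilate t b u n) j)
σ-dilate t (⊖ a) u n j = cong ℤ.-_ (σ-dilate t a u n j)

-- Statements about conjugates become statements about the original element acting on the
-- subsequence along n, n + t, n + 2t and so on.
act-σ : ∀ t e u n → act (σ t e) u n ≡ act e (dilate t n u) 0
act-σ t e u n = trans (cong (act (σ t e) u) (sym (trans (cong (n +_) (*-zeroʳ t)) (+-identityʳ n)))) (σ-dilate t e u n 0)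

‖ζ^‖ : ∀ t → ‖ ζ^ t ‖ ≡ 1
‖ζ^‖ zero = refl
‖ζ^‖ (suc t) = trans (*-identityˡ _) (‖ζ^‖ t)

‖σ‖ : ∀ t e → ‖ σ t e ‖ ≡ ‖ e ‖
‖σ‖ t 𝟏 = refl
‖σ‖ t ζ = ‖ζ^‖ t
‖σ‖ t (a ⊕ b) = cong₂ _+_ (‖σ‖ t a) (‖σ‖ t b)
‖σ‖ t (a ⊗ b) = cong₂ _*_ (‖σ‖ t a) (‖σ‖ t b)
‖σ‖ t (⊖ a) = ‖σ‖ t a

σ-∘ : ∀ s t e u n → act (σ s (σ t e)) u n ≡ act (σ (s * t) e) u n
σ-∘ s t e u n = trans (act-σ s (σ t e) u n) (trans (act-σ t e (dilate s n u) 0)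
  (trans (act-cong e (λ i → cong (λ k → u (n + k)) (sym (*-assoc s t i))) 0) (sym (act-σ (s * t) e u n))))

σ-1 : ∀ e u n → act (σ 1 e) u n ≡ act e u n
σ-1 e u n = trans (act-σ 1 e u n) (trans (act-cong e (λ i → cong (λ k → u (n + k)) (*-identityˡ i)) 0)
  (trans (act-shift e n u 0) (cong (act e u) (+-identityʳ n))))

Π : ∀ {k} → (Fin k → Expr) → Expr
Π = Vector.foldr _⊗_ 𝟏

act-Π-commonˡ : ∀ {k} c (f : Fin k → Expr) (g : Fin k → Expr) u n → (∀ i v n → act (g i) v n ≡ c ℤ.* act (f i) v n) →
  act (Π g) u n ≡ c ℤ.^ k ℤ.* act (Π f) u n
act-Π-commonˡ {zero} c f g u n h = sym (ℤₚ.*-identityˡ (u n))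
act-Π-commonˡ {suc k} c f g u n h = trans (h fzero (act (Π (g ∘ fsuc)) u) n)
  (trans (cong (c ℤ.*_) (trans (act-cong (f fzero) (λ n → act-Π-commonˡ c (f ∘ fsuc) (g ∘ fsuc) u n (h ∘ fsuc)) n)
      (act-* (f fzero) (c ℤ.^ k) (act (Π (f ∘ fsuc)) u) n)))
    (sym (ℤₚ.*-assoc c (c ℤ.^ k) _)))

‖Π‖ : ∀ {k} (f : Fin k → Expr) s → (∀ i → ‖ f i ‖ ≤ s) → ‖ Π f ‖ ≤ s ^ k
‖Π‖ {zero} f s h = ≤-refl
‖Π‖ {suc k} f s h = *-mono-≤ (h fzero) (‖Π‖ (f ∘ fsuc) s (h ∘ fsuc))

σ-Π : ∀ s {k} (f : Fin k → Expr) → σ s (Π f) ≡ Π (σ s ∘ f)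
σ-Π s {zero} f = refl
σ-Π s {suc k} f = cong (σ s (f fzero) ⊗_) (σ-Π s (f ∘ fsuc))

nat : ℕ → Expr
nat zero = 𝟎
nat (suc n) = 𝟏 ⊕ nat n

act-nat : ∀ c u n → act (nat c) u n ≡ ℤ.+ c ℤ.* u n
act-nat zero u n = act-𝟎 u n
act-nat (suc c) u n = trans (cong (ℤ._+_ (u n)) (act-nat c u n)) (sym (ℤₚ.suc-* (ℤ.+ c) (u n)))

int : ℤ → Expr
int (ℤ.+ n) = nat n
int -[1+ n ] = ⊖ nat (suc n)

act-int : ∀ c u n → act (int c) u n ≡ c ℤ.* u n
act-int (ℤ.+ c) u n = act-nat c u n
act-int -[1+ c ] u n = trans (cong ℤ.-_ (act-nat (suc c) u n)) (ℤₚ.neg-distribˡ-* (ℤ.+ suc c) (u n))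

-- The size of int c cannot be ∣ c ∣, because 𝟎 has size 2.
‖nat‖ : ∀ c → ‖ nat c ‖ ≡ c + 2
‖nat‖ zero = refl
‖nat‖ (suc c) = cong suc (‖nat‖ c)

‖int‖ : ∀ c → ‖ int c ‖ ≡ ∣ c ∣ + 2
‖int‖ (ℤ.+ c) = ‖nat‖ c
‖int‖ -[1+ c ] = ‖nat‖ (suc c)

-- The value at ζ = 1. Taken modulo p, it is the residue map at the prime 1 - ζ above p.
aug : Expr → ℤ
aug 𝟏 = 1ℤ
aug ζ = 1ℤ
aug (a ⊕ b) = aug a ℤ.+ aug b
aug (a ⊗ b) = aug a ℤ.* aug b
aug (⊖ a) = ℤ.- aug a

aug-nat : ∀ c → aug (nat c) ≡ ℤ.+ c
aug-nat zero = refl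
aug-nat (suc c) = cong (ℤ._+_ (1ℤ)) (aug-nat c)

aug-int : ∀ c → aug (int c) ≡ c
aug-int (ℤ.+ c) = aug-nat c
aug-int -[1+ c ] = cong ℤ.-_ (aug-nat (suc c))

aug-ζ^ : ∀ t → aug (ζ^ t) ≡ 1ℤ
aug-ζ^ zero = refl
aug-ζ^ (suc t) = trans (ℤₚ.*-identityˡ _) (aug-ζ^ t)

aug-σ : ∀ t e → aug (σ t e) ≡ aug e
aug-σ t 𝟏 = refl
aug-σ t ζ = aug-ζ^ t
aug-σ t (a ⊕ b) = cong₂ ℤ._+_ (aug-σ t a) (aug-σ t b)
aug-σ t (a ⊗ b) = cong₂ ℤ._*_ (aug-σ t a) (aug-σ t b)
aug-σ t (⊖ a) = cong ℤ.-_ (aug-σ t a)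

aug-Π : ∀ {k} c (f : Fin k → Expr) → (∀ i → aug (f i) ≡ c) → aug (Π f) ≡ c ℤ.^ k
aug-Π {zero} c f h = refl
aug-Π {suc k} c f h = cong₂ ℤ._*_ (h fzero) (aug-Π c (f ∘ fsuc) (h ∘ fsuc))

Δ : (ℕ → ℤ) → ℕ → ℤ
Δ u n = u n ℤ.- u (suc n)

-- `Δ` is multiplication by 1 - ζ, and ζ ≡ 1 modulo 1 - ζ. For a product, the quotient comes from ab
-- = aug a · b + (a - aug a) b.
aug-split : ∀ e → ∃[ e′ ] (∀ u n → act e u n ≡ aug e ℤ.* u n ℤ.+ act e′ (Δ u) n)
aug-split 𝟏 = 𝟎 , λ u n → sym (trans (cong₂ ℤ._+_ (ℤₚ.*-identityˡ (u n)) (act-𝟎 (Δ u) n)) (ℤₚ.+-identityʳ (u n)))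
aug-split ζ = ⊖ 𝟏 , λ u n → identity (u n) (u (suc n))
  where
  identity : ∀ x y → y ≡ 1ℤ ℤ.* x ℤ.+ ℤ.- (x ℤ.- y)
  identity = ℤSolver.solve-∀
aug-split (a ⊕ b) with aug-split a | aug-split b
... | a′ , ha | b′ , hb = a′ ⊕ b′ , λ u n → trans (cong₂ ℤ._+_ (ha u n) (hb u n)) (identity (aug a) (aug b) (u n) (act a′ (Δ u) n) (act b′ (Δ u) n))
  where
  identity : ∀ x y z v w → (x ℤ.* z ℤ.+ v) ℤ.+ (y ℤ.* z ℤ.+ w) ≡ (x ℤ.+ y) ℤ.* z ℤ.+ (v ℤ.+ w)
  identity = ℤSolver.solve-∀
aug-split (a ⊗ b) with aug-split a | aug-split b
... | a′ , ha | b′ , hb = int (aug a) ⊗ b′ ⊕ a′ ⊗ b , λ u n →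
  trans (ha (act b u) n) (trans (cong₂ ℤ._+_ (cong (aug a ℤ.*_) (hb u n))
      (act-cong a′ (λ n → sym (trans (act-- b u (λ n → u (suc n)) n) (cong (ℤ._-_ (act b u n)) (act-shift b 1 u n)))) n))
    (trans (identity (aug a) (aug b) (u n) (act b′ (Δ u) n) (act a′ (act b (Δ u)) n))
      (cong (λ z → aug a ℤ.* aug b ℤ.* u n ℤ.+ (z ℤ.+ act a′ (act b (Δ u)) n)) (sym (act-int (aug a) (act b′ (Δ u)) n)))))
  where
  identity : ∀ x y z v w → x ℤ.* (y ℤ.* z ℤ.+ v) ℤ.+ w ≡ x ℤ.* y ℤ.* z ℤ.+ (x ℤ.* v ℤ.+ w)
  identity = ℤSolver.solve-∀
aug-split (⊖ a) with aug-split a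
... | a′ , ha = ⊖ a′ , λ u n → trans (cong ℤ.-_ (ha u n)) (identity (aug a) (u n) (act a′ (Δ u) n))
  where
  identity : ∀ x z v → ℤ.- (x ℤ.* z ℤ.+ v) ≡ (ℤ.- x) ℤ.* z ℤ.+ ℤ.- v
  identity = ℤSolver.solve-∀

+ℤ-cancelʳ : ∀ k x y → x ℤ.+ k ≡ y ℤ.+ k → x ≡ y
+ℤ-cancelʳ k x y h = trans (identity x k) (trans (cong (ℤ._- k) h) (sym (identity y k)))
  where
  identity : ∀ x k → x ≡ x ℤ.+ k ℤ.- k
  identity = ℤSolver.solve-∀

-- The module over ℤ[ζ_p] and congruences in the ring

module Cyclotomic (d : ℕ) (p-prime : Prime (suc (d + d))) where

  p : ℕ
  p = suc (d + d)

  lam : Expr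
  lam = 𝟏 ⊕ ⊖ ζ

  -- The sequences on which 1 + ζ + … + ζ^(p-1) acts as zero: the module over ℤ[ζ_p].
  record M (u : ℕ → ℤ) : Set where
    constructor mkM
    field sum≡0 : ∀ n → ∑ℤ p (λ i → u (n + i)) ≡ 0ℤ
  open M

  M-act : ∀ e {u} → M u → M (act e u)
  M-act e {u} mu = mkM λ n → begin
    ∑ℤ p (λ i → act e u (n + i))          ≡⟨ ∑ℤ-cong p (λ i _ → trans (cong (act e u) (+-comm n i)) (sym (act-shift e i u n))) ⟩
    ∑ℤ p (λ i → act e (λ m → u (i + m)) n) ≡⟨ sym (act-∑ℤ e p (λ i m → u (i + m)) n) ⟩
    act e (λ m → ∑ℤ p (λ i → u (i + m))) n ≡⟨ act-cong e (λ m → trans (∑ℤ-cong p (λ i _ → cong u (+-comm i m))) (sum≡0 mu m)) n ⟩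
    act e (λ _ → 0ℤ) n                     ≡⟨ act-zero e n ⟩
    0ℤ                                     ∎
    where open ≡-Reasoning

  periodic : ∀ {u} → M u → ∀ n → u (n + p) ≡ u n
  periodic {u} mu n = sym (begin
    u n                                            ≡⟨ cong u (sym (+-identityʳ n)) ⟩
    u (n + 0)                                      ≡⟨ sym (ℤₚ.+-identityˡ _) ⟩
    0ℤ ℤ.+ u (n + 0)                               ≡⟨ cong (ℤ._+ u (n + 0)) (sym (trans (∑ℤ-cong p (λ i _ → cong u (+-suc n i))) (sum≡0 mu (suc n)))) ⟩
    ∑ℤ p (λ i → u (n + suc i)) ℤ.+ u (n + 0)       ≡⟨ ∑ℤ-shift p (λ i → u (n + i)) ⟩
    ∑ℤ p (λ i → u (n + i)) ℤ.+ u (n + p)           ≡⟨ cong (ℤ._+ u (n + p)) (sum≡0 mu n) ⟩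
    0ℤ ℤ.+ u (n + p)                               ≡⟨ ℤₚ.+-identityˡ _ ⟩
    u (n + p)                                      ∎)
    where open ≡-Reasoning

  periodic* : ∀ {u} → M u → ∀ k n → u (n + k * p) ≡ u n
  periodic* {u} mu zero n = cong u (+-identityʳ n)
  periodic* {u} mu (suc k) n = trans (cong u (trans (cong (n +_) (+-comm p (k * p))) (sym (+-assoc n (k * p) p)))) (trans (periodic mu (n + k * p)) (periodic* mu k n))

  geo : ℕ → ℕ → Expr
  geo t zero = 𝟎
  geo t (suc k) = geo t k ⊕ ζ^ (t * k)

  act-geo : ∀ t k u n → act (geo t k) u n ≡ ∑ℤ k (λ i → u (n + t * i))
  act-geo t zero u n = act-𝟎 u n
  act-geo t (suc k) u n = cong₂ ℤ._+_ (act-geo t k u n) (act-ζ^ (t * k) u n)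

  ∤⇒coprime : ∀ {t} → ¬ p ∣ t → Coprime t p
  ∤⇒coprime p∤t (i∣t , i∣p) with prime⇒irreducible p-prime i∣p
  ... | inj₁ i≡1 = i≡1
  ... | inj₂ refl = contradiction i∣t p∤t

  -- The sum is invariant under n ↦ n + t and n ↦ n + p, hence constant, and p times it vanishes.
  ∑-dilate : ∀ {u} → M u → ∀ t → ¬ p ∣ t → ∀ n → ∑ℤ p (λ i → u (n + t * i)) ≡ 0ℤ
  ∑-dilate {u} mu t p∤t n = trans (sym (act-geo t p u n)) vanish
    where
    v : ℕ → ℤ
    v = act (geo t p) u
    mv : M v
    mv = M-act (geo t p) mu
    step-t : ∀ m → v (m + t) ≡ v m
    step-t m = trans (act-geo t p u (m + t)) (trans (+ℤ-cancelʳ (u (m + t * 0)) _ _ (begin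
      ∑ℤ p (λ i → u (m + t + t * i)) ℤ.+ u (m + t * 0)   ≡⟨ cong (ℤ._+ u (m + t * 0)) (∑ℤ-cong p (λ i _ → cong u (shift m t i))) ⟩
      ∑ℤ p (λ i → u (m + t * suc i)) ℤ.+ u (m + t * 0)   ≡⟨ ∑ℤ-shift p (λ i → u (m + t * i)) ⟩
      ∑ℤ p (λ i → u (m + t * i)) ℤ.+ u (m + t * p)       ≡⟨ cong (ℤ._+_ (∑ℤ p (λ i → u (m + t * i)))) (trans (periodic* mu t m) (cong u (sym (trans (cong (m +_) (*-zeroʳ t)) (+-identityʳ m))))) ⟩
      ∑ℤ p (λ i → u (m + t * i)) ℤ.+ u (m + t * 0)       ∎)) (sym (act-geo t p u m)))
      where
      open ≡-Reasoning
      shift : ∀ m t i → m + t + t * i ≡ m + t * suc i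
      shift = solve-∀
    steps-t : ∀ x m → v (m + x * t) ≡ v m
    steps-t zero m = cong v (+-identityʳ m)
    steps-t (suc x) m = trans (cong v (trans (cong (m +_) (+-comm t (x * t))) (sym (+-assoc m (x * t) t)))) (trans (step-t (m + x * t)) (steps-t x m))
    step-1 : ∀ m → v (suc m) ≡ v m
    step-1 m with coprime-Bézout (∤⇒coprime p∤t)
    ... | Bézout.Identity.+- x y eq = trans (sym (periodic* mv y (suc m))) (trans (cong v (trans (sym (+-suc m (y * p))) (cong (m +_) eq))) (steps-t x m))
    ... | Bézout.Identity.-+ x y eq = trans (sym (steps-t x (suc m))) (trans (cong v (trans (sym (+-suc m (x * t))) (cong (m +_) eq))) (periodic* mv y m))
    steps-1 : ∀ i m → v (m + i) ≡ v m
    steps-1 zero m = cong v (+-identityʳ m)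
    steps-1 (suc i) m = trans (cong v (+-suc m i)) (trans (step-1 (m + i)) (steps-1 i m))
    vanish : v n ≡ 0ℤ
    vanish with ℤₚ.i*j≡0⇒i≡0∨j≡0 (ℤ.+ p) (trans (sym (∑ℤ-const p (v n))) (trans (∑ℤ-cong p (λ i _ → sym (steps-1 i n))) (sum≡0 mv n)))
    ... | inj₂ v≡0 = v≡0

  -- By this, `σ t` respects congruences in ℤ[ζ_p] and not only identities between polynomials.
  M-dilate : ∀ {u} → M u → ∀ t → ¬ p ∣ t → ∀ n → M (dilate t n u)
  M-dilate {u} mu t p∤t n = mkM λ k → trans (∑ℤ-cong p (λ i _ → cong u (regroup n t k i))) (∑-dilate mu t p∤t (n + t * k))
    where
    regroup : ∀ n t k i → n + t * (k + i) ≡ n + t * k + t * i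
    regroup = solve-∀

  infix 4 _≈[_]_
  -- Congruence modulo m in ℤ[ζ_p], tested on the sequences of the module. The modulus 0 gives
  -- equality, so one construction covers the ring and its quotients.
  _≈[_]_ : Expr → ℤ → Expr → Set
  a ≈[ m ] b = ∀ u → M u → ∀ n → m ∣ˢ (act a u n ℤ.- act b u n)

  infix 4 _≐_
  _≐_ : Expr → Expr → Set
  a ≐ b = ∀ u → M u → ∀ n → act a u n ≡ act b u n

  ≡⇒∣- : ∀ m {x y} → x ≡ y → m ∣ˢ (x ℤ.- y)
  ≡⇒∣- m {x} refl = Signed.divides 0ℤ (ℤₚ.+-inverseʳ x)

  ≐⇒≈ : ∀ {a b} m → a ≐ b → a ≈[ m ] b
  ≐⇒≈ m h u mu n = ≡⇒∣- m (h u mu n)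

  ≈⇒≐ : ∀ {a b} → a ≈[ 0ℤ ] b → a ≐ b
  ≈⇒≐ {a} {b} h u mu n = ℤₚ.i-j≡0⇒i≡j (act a u n) (act b u n) (Signed.0∣⇒≡0 (h u mu n))

  ring : ℤ → CommutativeRing 0ℓ 0ℓ
  ring m = record
    { Carrier = Expr ; _≈_ = λ a b → a ≈[ m ] b ; _+_ = _⊕_ ; _*_ = _⊗_ ; -_ = ⊖_ ; 0# = 𝟎 ; 1# = 𝟏
    ; isCommutativeRing = record
      { isRing = record
        { +-isAbelianGroup = record
          { isGroup = record
            { isMonoid = record
              { isSemigroup = record
                { isMagma = record
                  { isEquivalence = record
                    { refl = λ {a} u mu n → ≡⇒∣- m {act a u n} refl
                    ; sym = λ {a} {b} h u mu n → subst (m ∣ˢ_) (flip- (act a u n) (act b u n)) (Signed.∣m⇒∣-m (h u mu n))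
                    ; trans = λ {a} {b} {c} h k u mu n → subst (m ∣ˢ_) (chain (act a u n) (act b u n) (act c u n)) (Signed.∣m∣n⇒∣m+n (h u mu n) (k u mu n)) }
                  ; ∙-cong = λ {a} {b} {c} {e} h k u mu n → subst (m ∣ˢ_) (interchange (act a u n) (act b u n) (act c u n) (act e u n)) (Signed.∣m∣n⇒∣m+n (h u mu n) (k u mu n)) }
                ; assoc = λ a b c → ≐⇒≈ {a ⊕ b ⊕ c} {a ⊕ (b ⊕ c)} m (λ u mu n → ℤₚ.+-assoc (act a u n) (act b u n) (act c u n)) }
              ; identity = (λ a → ≐⇒≈ {𝟎 ⊕ a} {a} m (λ u mu n → trans (cong (ℤ._+ act a u n) (act-𝟎 u n)) (ℤₚ.+-identityˡ _)))
                         , (λ a → ≐⇒≈ {a ⊕ 𝟎} {a} m (λ u mu n → trans (cong (ℤ._+_ (act a u n)) (act-𝟎 u n)) (ℤₚ.+-identityʳ _))) }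
            ; inverse = (λ a → ≐⇒≈ {⊖ a ⊕ a} {𝟎} m (λ u mu n → trans (ℤₚ.+-inverseˡ (act a u n)) (sym (act-𝟎 u n))))
                      , (λ a → ≐⇒≈ {a ⊕ ⊖ a} {𝟎} m (λ u mu n → trans (ℤₚ.+-inverseʳ (act a u n)) (sym (act-𝟎 u n))))
            ; ⁻¹-cong = λ {a} {b} h u mu n → subst (m ∣ˢ_) (neg- (act a u n) (act b u n)) (Signed.∣m⇒∣-m (h u mu n)) }
          ; comm = λ a b → ≐⇒≈ {a ⊕ b} {b ⊕ a} m (λ u mu n → ℤₚ.+-comm (act a u n) (act b u n)) }
        ; *-cong = λ {a} {b} {c} {e} → ⊗-cong {a} {b} {c} {e}
        ; *-assoc = λ a b c → ≐⇒≈ {a ⊗ b ⊗ c} {a ⊗ (b ⊗ c)} m (λ u mu n → refl)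
        ; *-identity = (λ a → ≐⇒≈ {𝟏 ⊗ a} {a} m (λ u mu n → refl)) , (λ a → ≐⇒≈ {a ⊗ 𝟏} {a} m (λ u mu n → refl))
        ; distrib = (λ a b c → ≐⇒≈ {a ⊗ (b ⊕ c)} {a ⊗ b ⊕ a ⊗ c} m (λ u mu n → act-+ a (act b u) (act c u) n))
                  , (λ a b c → ≐⇒≈ {(b ⊕ c) ⊗ a} {b ⊗ a ⊕ c ⊗ a} m (λ u mu n → refl)) }
      ; *-comm = λ a b → ≐⇒≈ {a ⊗ b} {b ⊗ a} m (λ u mu n → act-comm a b u n) } }
    where
    flip- : ∀ x y → ℤ.- (x ℤ.- y) ≡ y ℤ.- x
    flip- = ℤSolver.solve-∀
    chain : ∀ x y z → (x ℤ.- y) ℤ.+ (y ℤ.- z) ≡ x ℤ.- z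
    chain = ℤSolver.solve-∀
    interchange : ∀ x y z w → (x ℤ.- y) ℤ.+ (z ℤ.- w) ≡ (x ℤ.+ z) ℤ.- (y ℤ.+ w)
    interchange = ℤSolver.solve-∀
    neg- : ∀ x y → ℤ.- (x ℤ.- y) ≡ (ℤ.- x) ℤ.- (ℤ.- y)
    neg- = ℤSolver.solve-∀
    ⊗-cong : ∀ {a b c e} → a ≈[ m ] b → c ≈[ m ] e → a ⊗ c ≈[ m ] b ⊗ e
    ⊗-cong {a} {b} {c} {e} h k u mu n = subst (m ∣ˢ_) (chain (act a (act c u) n) (act a (act e u) n) (act b (act e u) n))
      (Signed.∣m∣n⇒∣m+n (subst (m ∣ˢ_) (act-- a (act c u) (act e u) n) (act-∣ a m (λ n → act c u n ℤ.- act e u n) (k u mu) n)) (h (act e u) (M-act e mu) n))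

  module R (m : ℤ) where
    open CommutativeRing (ring m) public using (setoid; semiring; commutativeSemiring; *-commutativeMonoid) renaming (refl to ≈-refl; sym to ≈-sym; trans to ≈-trans; +-cong to ⊕-cong; *-cong to ⊗-cong; -‿cong to ⊖-cong; *-assoc to ⊗-assoc; *-comm to ⊗-comm; *-identityˡ to ⊗-identityˡ; *-identityʳ to ⊗-identityʳ; zeroˡ to ⊗-zeroˡ; zeroʳ to ⊗-zeroʳ; distribˡ to ⊗-distribˡ)
    open Exp semiring public using (^-congˡ; ^-assocʳ; ^-homo-*) renaming (_^_ to _↑_)
    open CommExp commutativeSemiring public using (^-distrib-*)
    module Prod = MonoidSum *-commutativeMonoid

  infixr 9 _↑_
  _↑_ : Expr → ℕ → Expr
  _↑_ = R._↑_ 0ℤ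

  ≈[]-σ : ∀ m t {a b} → ¬ p ∣ t → a ≈[ m ] b → σ t a ≈[ m ] σ t b
  ≈[]-σ m t {a} {b} p∤t h u mu n = subst₂ (λ x y → m ∣ˢ (x ℤ.- y)) (sym (act-σ t a u n)) (sym (act-σ t b u n)) (h (dilate t n u) (M-dilate mu t p∤t n) 0)

  -- For l ≠ 0 the sequence `act b u` divided by l lies in the module again, because ℤ has no zero
  -- divisors, and the divisibility of a by k can be applied to it.
  ∣-⊗ : ∀ {k l a b} → a ≈[ k ] 𝟎 → b ≈[ l ] 𝟎 → a ⊗ b ≈[ k ℤ.* l ] 𝟎
  ∣-⊗ {k} {l} {a} {b} ha hb u mu n = subst (k ℤ.* l ∣ˢ_) (sym (trans (cong (ℤ._-_ (act a (act b u) n)) (act-𝟎 u n)) (ℤₚ.+-identityʳ _))) divisible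
    where
    torsion : ∀ c e {u} → c ∣ˢ (act e u n ℤ.- act 𝟎 u n) → c ∣ˢ act e u n
    torsion c e {u} = subst (c ∣ˢ_) (trans (cong (ℤ._-_ (act e u n)) (act-𝟎 u n)) (ℤₚ.+-identityʳ _))
    v : ℕ → ℤ
    v i = Signed._∣_.quotient (hb u mu i)
    b≡ : ∀ i → act b u i ≡ l ℤ.* v i
    b≡ i = trans (sym (trans (cong (ℤ._-_ (act b u i)) (act-𝟎 u i)) (ℤₚ.+-identityʳ _))) (trans (Signed._∣_.equality (hb u mu i)) (ℤₚ.*-comm (v i) l))
    divisible : k ℤ.* l ∣ˢ act a (act b u) n
    divisible with l ℤ.≟ 0ℤ
    ... | yes refl = subst (k ℤ.* 0ℤ ∣ˢ_) (sym (trans (act-cong a (λ i → trans (b≡ i) (ℤₚ.*-zeroˡ (v i))) n) (act-zero a n))) (Signed.divides 0ℤ refl)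
    ... | no l≢0 = subst (k ℤ.* l ∣ˢ_) (sym (trans (act-cong a b≡ n) (act-* a l v n)))
        (subst (k ℤ.* l ∣ˢ_) (ℤₚ.*-comm (act a v n) l) (Signed.*-monoˡ-∣ l (torsion k a (ha v mv n))))
      where
      mv : M v
      mv = mkM vanish
        where
        vanish : ∀ i → ∑ℤ p (λ j → v (i + j)) ≡ 0ℤ
        vanish i with ℤₚ.i*j≡0⇒i≡0∨j≡0 l {∑ℤ p (λ j → v (i + j))} (trans (sym (∑ℤ-* p)) (trans (∑ℤ-cong p (λ j _ → sym (b≡ (i + j)))) (sum≡0 (M-act b mu) i)))
          where
          ∑ℤ-* : ∀ k → ∑ℤ k (λ j → l ℤ.* v (i + j)) ≡ l ℤ.* ∑ℤ k (λ j → v (i + j))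
          ∑ℤ-* zero = sym (ℤₚ.*-zeroʳ l)
          ∑ℤ-* (suc k) = trans (cong (ℤ._+ l ℤ.* v (i + k)) (∑ℤ-* k)) (sym (ℤₚ.*-distribˡ-+ l _ _))
        ... | inj₁ l≡0 = contradiction l≡0 l≢0
        ... | inj₂ z = z

  δ : ℕ → ℤ
  δ n = ℤ.+ 𝟙 (p ∣? n)

  δ-yes : ∀ {n} → p ∣ n → δ n ≡ 1ℤ
  δ-yes {n} p∣n with p ∣? n
  ... | yes _ = refl
  ... | no p∤n = contradiction p∣n p∤n

  δ-no : ∀ {n} → ¬ p ∣ n → δ n ≡ 0ℤ
  δ-no {n} p∤n with p ∣? n
  ... | yes p∣n = contradiction p∣n p∤n
  ... | no _ = refl

  -- The indicator δ has period sum 1, and multiplication by 1 - ζ moves it into the module. The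
  -- result has the value 1 at 0 and is bounded by 1, so it serves to read off integers and to
  -- estimate them.
  u₁ : ℕ → ℤ
  u₁ = Δ δ

  M-u₁ : M u₁
  M-u₁ = mkM λ n → trans (∑ℤ-- p (λ i → δ (n + i)) (λ i → δ (suc (n + i)))) (trans (cong (λ z → ∑ℤ p (λ i → δ (n + i)) ℤ.- z) (sym (same n))) (ℤₚ.+-inverseʳ (∑ℤ p (λ i → δ (n + i)))))
    where
    δ-periodic : ∀ n → δ (n + p) ≡ δ (n + 0)
    δ-periodic n with p ∣? (n + 0)
    ... | yes p∣n = δ-yes (∣m∣n⇒∣m+n (subst (p ∣_) (+-identityʳ n) p∣n) ∣-refl)
    ... | no p∤n = δ-no (λ p∣n+p → p∤n (subst (p ∣_) (sym (+-identityʳ n)) (∣m+n∣m⇒∣n (subst (p ∣_) (+-comm n p) p∣n+p) ∣-refl)))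
    same : ∀ n → ∑ℤ p (λ i → δ (n + i)) ≡ ∑ℤ p (λ i → δ (suc (n + i)))
    same n = sym (+ℤ-cancelʳ (δ (n + 0)) _ _ (trans (cong (ℤ._+ δ (n + 0)) (∑ℤ-cong p (λ i _ → cong δ (sym (+-suc n i)))))
      (trans (∑ℤ-shift p (λ i → δ (n + i))) (cong (ℤ._+_ (∑ℤ p (λ i → δ (n + i)))) (δ-periodic n)))))

  p≥2 : 2 ≤ p
  p≥2 = prime≥2 p-prime

  ∤-small : ∀ {n} → 1 ≤ n → n < p → ¬ p ∣ n
  ∤-small 1≤n n<p p∣n = <-irrefl refl (<-≤-trans n<p (∣⇒≤ {{>-nonZero 1≤n}} p∣n))

  u₁-0 : u₁ 0 ≡ 1ℤ
  u₁-0 = cong₂ ℤ._-_ (δ-yes {0} (p ∣0)) (δ-no {1} (∤-small ≤-refl p≥2))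

  u₁-bound : ∀ n → ∣ u₁ n ∣ ≤ 1
  u₁-bound n with p ∣? n | p ∣? suc n
  ... | yes _ | yes _ = z≤n
  ... | yes _ | no _ = ≤-refl
  ... | no _ | yes _ = ≤-refl
  ... | no _ | no _ = z≤n

  -- Averaging over the Galois group turns an invariant element into a multiple of a trace.
  invariant⇒integer : ∀ γ → (∀ s → ¬ p ∣ s → σ s γ ≐ γ) → ∀ u → M u → ∀ n → act γ u n ≡ act γ u₁ 0 ℤ.* u n
  invariant⇒integer γ inv u mu n = ℤₚ.*-cancelˡ-≡ (ℤ.+ (d + d)) _ _ {{nz}} (begin
    ℤ.+ (d + d) ℤ.* act γ u n                 ≡⟨ trace u mu n ⟩
    u n ℤ.* act γ h 0                         ≡⟨ cong (ℤ._*_ (u n)) (sym (trans (trace u₁ M-u₁ 0) (trans (cong (ℤ._* act γ h 0) u₁-0) (ℤₚ.*-identityˡ _)))) ⟩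
    u n ℤ.* (ℤ.+ (d + d) ℤ.* act γ u₁ 0)      ≡⟨ swap (u n) (ℤ.+ (d + d)) (act γ u₁ 0) ⟩
    ℤ.+ (d + d) ℤ.* (act γ u₁ 0 ℤ.* u n)      ∎)
    where
    open ≡-Reasoning
    swap : ∀ x y z → x ℤ.* (y ℤ.* z) ≡ y ℤ.* (z ℤ.* x)
    swap = ℤSolver.solve-∀
    nz : ℤ.NonZero (ℤ.+ (d + d))
    nz = ≢-nonZero {d + d} (λ e → <-irrefl (sym e) (≤-pred p≥2))
    -- This is the trace of ζ^i: p - 1 if p divides i, and -1 otherwise.
    h : ℕ → ℤ
    h i = ℤ.+ p ℤ.* δ i ℤ.- 1ℤ
    orbit : ∀ u → M u → ∀ n i → ∑ℤ (d + d) (λ s → u (n + suc s * i)) ≡ u n ℤ.* h i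
    orbit u mu n i = +ℤ-cancelʳ (u (n + 0)) _ _ (trans (∑ℤ-shift (d + d) (λ s → u (n + s * i))) (trans total (trans (identity (u n) (ℤ.+ p) (δ i)) (cong (λ k → u n ℤ.* h i ℤ.+ u k) (sym (+-identityʳ n))))))
      where
      identity : ∀ x y z → y ℤ.* z ℤ.* x ≡ x ℤ.* (y ℤ.* z ℤ.- 1ℤ) ℤ.+ x
      identity = ℤSolver.solve-∀
      total : ∑ℤ p (λ s → u (n + s * i)) ≡ ℤ.+ p ℤ.* δ i ℤ.* u n
      total with p ∣? i
      ... | yes (divides k refl) = trans (∑ℤ-cong p (λ s _ → trans (cong (λ z → u (n + z)) (sym (*-assoc s k p))) (periodic* mu (s * k) n))) (trans (∑ℤ-const p (u n)) (cong (ℤ._* u n) (sym (ℤₚ.*-identityʳ (ℤ.+ p)))))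
      ... | no p∤i = trans (∑ℤ-cong p (λ s _ → cong (λ z → u (n + z)) (*-comm s i))) (trans (∑-dilate mu i p∤i n) (sym (trans (cong (ℤ._* u n) (ℤₚ.*-zeroʳ (ℤ.+ p))) (ℤₚ.*-zeroˡ (u n)))))
    trace : ∀ u → M u → ∀ n → ℤ.+ (d + d) ℤ.* act γ u n ≡ u n ℤ.* act γ h 0
    trace u mu n = begin
      ℤ.+ (d + d) ℤ.* act γ u n                                      ≡⟨ sym (∑ℤ-const (d + d) (act γ u n)) ⟩
      ∑ℤ (d + d) (λ s → act γ u n)                                   ≡⟨ ∑ℤ-cong (d + d) (λ s s<2d → trans (sym (inv (suc s) (∤-small (s≤s z≤n) (s≤s s<2d)) u mu n)) (act-σ (suc s) γ u n)) ⟩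
      ∑ℤ (d + d) (λ s → act γ (dilate (suc s) n u) 0)                ≡⟨ sym (act-∑ℤ γ (d + d) (λ s → dilate (suc s) n u) 0) ⟩
      act γ (λ i → ∑ℤ (d + d) (λ s → u (n + suc s * i))) 0           ≡⟨ act-cong γ (orbit u mu n) 0 ⟩
      act γ (λ i → u n ℤ.* h i) 0                                    ≡⟨ act-* γ (u n) h 0 ⟩
      u n ℤ.* act γ h 0                                              ∎

-- Frobenius congruences and the norm from the real subring

module CyclotomicNorm (d : ℕ) (p-prime : Prime (suc (d + d))) where
  open Cyclotomic d p-prime

  ↑-independent : ∀ m x n → R._↑_ m x n ≡ x ↑ n
  ↑-independent m x zero = refl
  ↑-independent m x (suc n) = cong (x ⊗_) (↑-independent m x n)

  act-multiple : ∀ m k x u n → act (Mult._×_ (R.semiring m) k x) u n ≡ ℤ.+ k ℤ.* act x u n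
  act-multiple m zero x u n = act-𝟎 u n
  act-multiple m (suc k) x u n = trans (cong (ℤ._+_ (act x u n)) (act-multiple m k x u n)) (sym (ℤₚ.suc-* (ℤ.+ k) (act x u n)))

  ∣⇒≈𝟎 : ∀ {m e} → (∀ u → M u → ∀ n → m ∣ˢ act e u n) → e ≈[ m ] 𝟎
  ∣⇒≈𝟎 {m} {e} h u mu n = subst (m ∣ˢ_) (sym (trans (cong (ℤ._-_ (act e u n)) (act-𝟎 u n)) (ℤₚ.+-identityʳ _))) (h u mu n)

  ≈𝟎⇒∣ : ∀ {m e} → e ≈[ m ] 𝟎 → ∀ u → M u → ∀ n → m ∣ˢ act e u n
  ≈𝟎⇒∣ {m} {e} h u mu n = subst (m ∣ˢ_) (trans (cong (ℤ._-_ (act e u n)) (act-𝟎 u n)) (ℤₚ.+-identityʳ _)) (h u mu n)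

  -- Modulo q both sides are ring homomorphisms in x that send ζ to ζ^q, so induction on the
  -- expression applies.
  frobenius : ∀ {q} → Prime q → ∀ x → x ↑ q ≈[ ℤ.+ q ] σ q x
  frobenius {q} pq x = subst (λ z → z ≈[ ℤ.+ q ] σ q x) (↑-independent (ℤ.+ q) x q) (go x)
    where
    open R (ℤ.+ q) using (⊕-cong; ⊗-cong; ^-congˡ; ^-distrib-*; setoid; commutativeSemiring; semiring; ≈-trans; ≈-sym; ≈-refl; ⊗-zeroˡ) renaming (_↑_ to _↟_)
    char : ∀ x → Mult._×_ semiring q x ≈[ ℤ.+ q ] 𝟎
    char x = ∣⇒≈𝟎 {ℤ.+ q} {Mult._×_ semiring q x} (λ u mu n → subst (ℤ.+ q ∣ˢ_) (sym (act-multiple (ℤ.+ q) q x u n)) (Signed.∣m⇒∣m*n _ Signed.∣-refl))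
    additive : ∀ x y → (x ⊕ y) ↟ q ≈[ ℤ.+ q ] (x ↟ q) ⊕ (y ↟ q)
    additive = Freshman.freshman commutativeSemiring pq char
    𝟏↟ : ∀ n → (𝟏 ↟ n) ≈[ ℤ.+ q ] 𝟏
    𝟏↟ zero = ≈-refl {𝟏}
    𝟏↟ (suc n) = 𝟏↟ n
    𝟎↟ : ∀ n → 1 ≤ n → (𝟎 ↟ n) ≈[ ℤ.+ q ] 𝟎
    𝟎↟ (suc n) _ = ⊗-zeroˡ (𝟎 ↟ n)
    ζ↟ : ∀ n → (ζ ↟ n) ≡ ζ^ n
    ζ↟ zero = refl
    ζ↟ (suc n) = cong (ζ ⊗_) (ζ↟ n)
    go : ∀ x → (x ↟ q) ≈[ ℤ.+ q ] σ q x
    go 𝟏 = 𝟏↟ q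
    go ζ = subst (λ z → z ≈[ ℤ.+ q ] ζ^ q) (sym (ζ↟ q)) (≈-refl {ζ^ q})
    go (a ⊕ b) = ≈-trans {(a ⊕ b) ↟ q} {(a ↟ q) ⊕ (b ↟ q)} {σ q a ⊕ σ q b} (additive a b) (⊕-cong {a ↟ q} {σ q a} {b ↟ q} {σ q b} (go a) (go b))
    go (a ⊗ b) = ≈-trans {(a ⊗ b) ↟ q} {(a ↟ q) ⊗ (b ↟ q)} {σ q a ⊗ σ q b} (^-distrib-* a b q) (⊗-cong {a ↟ q} {σ q a} {b ↟ q} {σ q b} (go a) (go b))
    -- Additivity applied to -a + a = 0 treats q = 2 and odd q alike.
    go (⊖ a) u mu n = subst (ℤ.+ q ∣ˢ_) (identity (act ((⊖ a) ↟ q) u n) (act (a ↟ q) u n) (act (σ q a) u n)) (Signed.∣m∣n⇒∣m-n sum-zero (go a u mu n))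
      where
      identity : ∀ x y z → (x ℤ.+ y) ℤ.- (y ℤ.- z) ≡ x ℤ.- (ℤ.- z)
      identity = ℤSolver.solve-∀
      cancel : (⊖ a ⊕ a) ≈[ ℤ.+ q ] 𝟎
      cancel = ≐⇒≈ {⊖ a ⊕ a} {𝟎} (ℤ.+ q) (λ u mu n → trans (ℤₚ.+-inverseˡ (act a u n)) (sym (act-𝟎 u n)))
      sum-zero : ℤ.+ q ∣ˢ (act ((⊖ a) ↟ q) u n ℤ.+ act (a ↟ q) u n)
      sum-zero = ≈𝟎⇒∣ {ℤ.+ q} {((⊖ a) ↟ q) ⊕ (a ↟ q)}
        (≈-trans {((⊖ a) ↟ q) ⊕ (a ↟ q)} {(⊖ a ⊕ a) ↟ q} {𝟎} (≈-sym {(⊖ a ⊕ a) ↟ q} {((⊖ a) ↟ q) ⊕ (a ↟ q)} (additive (⊖ a) a))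
          (≈-trans {(⊖ a ⊕ a) ↟ q} {𝟎 ↟ q} {𝟎} (^-congˡ q {⊖ a ⊕ a} {𝟎} cancel) (𝟎↟ q (prime≥1 pq)))) u mu n

  M-mod : ∀ {u} → M u → ∀ a b → ℤ.+ p ∣ˢ (ℤ.+ a ℤ.- ℤ.+ b) → u a ≡ u b
  M-mod {u} mu a b h with ≤-total b a
  ... | inj₁ b≤a = ordered a b b≤a (subst (p ∣_) (cong ∣_∣ (trans (ℤₚ.m-n≡m⊖n a b) (ℤₚ.⊖-≥ b≤a))) (Signed.∣⇒∣ᵤ h))
    where
    ordered : ∀ a b → b ≤ a → p ∣ a ∸ b → u a ≡ u b
    ordered a b b≤a (divides k eq) = trans (cong u (trans (sym (m+[n∸m]≡n b≤a)) (cong (b +_) eq))) (periodic* mu k b)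
  ... | inj₂ a≤b = sym (ordered b a a≤b (subst (p ∣_) (cong ∣_∣ (trans (ℤₚ.m-n≡m⊖n b a) (ℤₚ.⊖-≥ a≤b))) (subst (p ∣_) (trans (sym (ℤₚ.∣-i∣≡∣i∣ (ℤ.+ a ℤ.- ℤ.+ b))) (cong ∣_∣ (flip- (ℤ.+ a) (ℤ.+ b)))) (Signed.∣⇒∣ᵤ h))))
    where
    flip- : ∀ x y → ℤ.- (x ℤ.- y) ≡ y ℤ.- x
    flip- = ℤSolver.solve-∀
    ordered : ∀ a b → b ≤ a → p ∣ a ∸ b → u a ≡ u b
    ordered a b b≤a (divides k eq) = trans (cong u (trans (sym (m+[n∸m]≡n b≤a)) (cong (b +_) eq))) (periodic* mu k b)

  infix 4 _∼_
  -- Congruence modulo p up to sign. Its classes prime to p index the Galois group of the real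
  -- subfield and are represented by 1, ..., d.
  data _∼_ (s t : ℕ) : Set where
    minus : ℤ.+ p ∣ˢ (ℤ.+ s ℤ.- ℤ.+ t) → s ∼ t
    plus : ℤ.+ p ∣ˢ (ℤ.+ s ℤ.+ ℤ.+ t) → s ∼ t

  ∼-sym : ∀ {s t} → s ∼ t → t ∼ s
  ∼-sym {s} {t} (minus h) = minus (subst (ℤ.+ p ∣ˢ_) (flip- (ℤ.+ s) (ℤ.+ t)) (Signed.∣m⇒∣-m h))
    where
    flip- : ∀ x y → ℤ.- (x ℤ.- y) ≡ y ℤ.- x
    flip- = ℤSolver.solve-∀
  ∼-sym {s} {t} (plus h) = plus (subst (ℤ.+ p ∣ˢ_) (ℤₚ.+-comm (ℤ.+ s) (ℤ.+ t)) h)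

  ∼-trans : ∀ {r s t} → r ∼ s → s ∼ t → r ∼ t
  ∼-trans {r} {s} {t} (minus h) (minus k) = minus (subst (ℤ.+ p ∣ˢ_) (identity (ℤ.+ r) (ℤ.+ s) (ℤ.+ t)) (Signed.∣m∣n⇒∣m+n h k))
    where
    identity : ∀ x y z → (x ℤ.- y) ℤ.+ (y ℤ.- z) ≡ x ℤ.- z
    identity = ℤSolver.solve-∀
  ∼-trans {r} {s} {t} (minus h) (plus k) = plus (subst (ℤ.+ p ∣ˢ_) (identity (ℤ.+ r) (ℤ.+ s) (ℤ.+ t)) (Signed.∣m∣n⇒∣m+n h k))
    where
    identity : ∀ x y z → (x ℤ.- y) ℤ.+ (y ℤ.+ z) ≡ x ℤ.+ z
    identity = ℤSolver.solve-∀
  ∼-trans {r} {s} {t} (plus h) (minus k) = plus (subst (ℤ.+ p ∣ˢ_) (identity (ℤ.+ r) (ℤ.+ s) (ℤ.+ t)) (Signed.∣m∣n⇒∣m-n h k))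
    where
    identity : ∀ x y z → (x ℤ.+ y) ℤ.- (y ℤ.- z) ≡ x ℤ.+ z
    identity = ℤSolver.solve-∀
  ∼-trans {r} {s} {t} (plus h) (plus k) = minus (subst (ℤ.+ p ∣ˢ_) (identity (ℤ.+ r) (ℤ.+ s) (ℤ.+ t)) (Signed.∣m∣n⇒∣m-n h k))
    where
    identity : ∀ x y z → (x ℤ.+ y) ℤ.- (y ℤ.+ z) ≡ x ℤ.- z
    identity = ℤSolver.solve-∀

  ∼-* : ∀ c {s t} → s ∼ t → c * s ∼ c * t
  ∼-* c {s} {t} (minus h) = minus (subst (ℤ.+ p ∣ˢ_) (trans (identity (ℤ.+ c) (ℤ.+ s) (ℤ.+ t)) (sym (cong₂ ℤ._-_ (ℤₚ.pos-* c s) (ℤₚ.pos-* c t)))) (Signed.∣n⇒∣m*n (ℤ.+ c) h))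
    where
    identity : ∀ c x y → c ℤ.* (x ℤ.- y) ≡ c ℤ.* x ℤ.- c ℤ.* y
    identity = ℤSolver.solve-∀
  ∼-* c {s} {t} (plus h) = plus (subst (ℤ.+ p ∣ˢ_) (trans (identity (ℤ.+ c) (ℤ.+ s) (ℤ.+ t)) (sym (cong₂ ℤ._+_ (ℤₚ.pos-* c s) (ℤₚ.pos-* c t)))) (Signed.∣n⇒∣m*n (ℤ.+ c) h))
    where
    identity : ∀ c x y → c ℤ.* (x ℤ.+ y) ≡ c ℤ.* x ℤ.+ c ℤ.* y
    identity = ℤSolver.solve-∀

  ∼-by-difference : ∀ {s t} k → s ≡ t + k * p → s ∼ t
  ∼-by-difference {s} {t} k refl = minus (Signed.divides (ℤ.+ k) (trans (identity (ℤ.+ t) (ℤ.+ (k * p))) (ℤₚ.pos-* k p)))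
    where
    identity : ∀ x y → x ℤ.+ y ℤ.- x ≡ y
    identity = ℤSolver.solve-∀

  ∼-by-sum : ∀ {s t} k → s + t ≡ k * p → s ∼ t
  ∼-by-sum {s} {t} k eq = plus (Signed.divides (ℤ.+ k) (trans (cong ℤ.+_ eq) (ℤₚ.pos-* k p)))

  ∼-unique : ∀ (i j : Fin d) → suc (toℕ i) ∼ suc (toℕ j) → i ≡ j
  ∼-unique i j (plus h) = contradiction (Signed.∣⇒∣ᵤ h) (∤-small (s≤s z≤n) (≤-trans (s≤s (+-mono-≤ (Fin.toℕ<n i) (Fin.toℕ<n j))) ≤-refl))
  ∼-unique i j (minus h) with toℕ i ≟ toℕ j
  ... | yes e = Fin.toℕ-injective e
  ... | no i≢j = contradiction (Signed.∣⇒∣ᵤ h) (∤-small (n≢0⇒n>0 nonzero) small)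
    where
    nonzero : ∣ ℤ.+ suc (toℕ i) ℤ.- ℤ.+ suc (toℕ j) ∣ ≢ 0
    nonzero e = i≢j (suc-injective (ℤₚ.+-injective (ℤₚ.i-j≡0⇒i≡j (ℤ.+ suc (toℕ i)) (ℤ.+ suc (toℕ j)) (ℤₚ.∣i∣≡0⇒i≡0 e))))
    small : ∣ ℤ.+ suc (toℕ i) ℤ.- ℤ.+ suc (toℕ j) ∣ < p
    small = s≤s (≤-trans (ℤₚ.∣i-j∣≤∣i∣+∣j∣ (ℤ.+ suc (toℕ i)) (ℤ.+ suc (toℕ j))) (+-mono-≤ (Fin.toℕ<n i) (Fin.toℕ<n j)))

  representative : ∀ s → ¬ p ∣ s → ∃[ i ] s ∼ suc (toℕ {d} i)
  representative s p∤s with s % p in eq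
  ... | zero = contradiction (m%n≡0⇒n∣m s p eq) p∤s
  ... | suc r with r <? d
  ...   | yes r<d = fromℕ< r<d , subst (λ z → s ∼ suc z) (sym (Fin.toℕ-fromℕ< r<d)) (∼-by-difference (s / p) (trans (m≡m%n+[m/n]*n s p) (cong (_+ s / p * p) eq)))
  ...   | no r≮d = fromℕ< t<d , subst (λ z → s ∼ suc z) (sym (Fin.toℕ-fromℕ< t<d)) (∼-by-sum (suc (s / p)) (begin
        s + suc (d + d ∸ suc r)                       ≡⟨ cong (_+ suc (d + d ∸ suc r)) (trans (m≡m%n+[m/n]*n s p) (cong (_+ s / p * p) eq)) ⟩
        suc r + s / p * p + suc (d + d ∸ suc r)       ≡⟨ regroup (suc r) (s / p * p) (d + d ∸ suc r) ⟩
        suc (suc r + (d + d ∸ suc r)) + s / p * p     ≡⟨ cong (λ z → suc z + s / p * p) (m+[n∸m]≡n sr≤2d) ⟩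
        suc (d + d) + s / p * p                       ∎))
    where
    open ≡-Reasoning
    regroup : ∀ x y z → x + y + suc z ≡ suc (x + z) + y
    regroup = solve-∀
    sr≤2d : suc r ≤ d + d
    sr≤2d = ≤-pred (subst (_< p) eq (m%n<n s p))
    t<d : d + d ∸ suc r < d
    t<d = +-cancelˡ-≤ (suc r) _ _ (≤-trans (≤-reflexive (trans (+-suc (suc r) _) (cong suc (m+[n∸m]≡n sr≤2d)))) (s≤s (+-monoˡ-≤ d (≮⇒≥ r≮d))))

  inverse∼ : ∀ s → ¬ p ∣ s → ∃[ s′ ] (s′ * s ∼ 1)
  inverse∼ s p∤s with coprime-Bézout (∤⇒coprime p∤s)
  ... | Bézout.Identity.+- x y eq = x , ∼-by-difference y (sym eq)
  ... | Bézout.Identity.-+ x y eq = x , ∼-by-sum y (trans (+-comm (x * s) 1) eq)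

  ∼1⇒∤ : ∀ {s} s′ → s′ * s ∼ 1 → ¬ p ∣ s′
  ∼1⇒∤ {s} s′ h p∣s′ = ∤-small ≤-refl p≥2 (p∣1 h)
    where
    p∣s′s : ℤ.+ p ∣ˢ ℤ.+ (s′ * s)
    p∣s′s = Signed.∣ᵤ⇒∣ (∣m⇒∣m*n s p∣s′)
    p∣1 : s′ * s ∼ 1 → p ∣ 1
    p∣1 (minus h) = Signed.∣⇒∣ᵤ (Signed.∣m+n∣m⇒∣n {m = ℤ.+ (s′ * s)} {n = ℤ.-1ℤ} h p∣s′s)
    p∣1 (plus h) = Signed.∣⇒∣ᵤ (Signed.∣m+n∣m⇒∣n {m = ℤ.+ (s′ * s)} {n = 1ℤ} h p∣s′s)

  index∤ : ∀ (i : Fin d) → ¬ p ∣ suc (toℕ i)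
  index∤ i = ∤-small (s≤s z≤n) (s≤s (≤-trans (Fin.toℕ<n i) (m≤m+n d d)))

  ∤-* : ∀ {s t} → ¬ p ∣ s → ¬ p ∣ t → ¬ p ∣ s * t
  ∤-* {s} {t} p∤s p∤t h with euclidsLemma s t p-prime h
  ... | inj₁ p∣s = p∤s p∣s
  ... | inj₂ p∣t = p∤t p∣t

  translate : ∀ s → ¬ p ∣ s → Fin d → Fin d
  translate s p∤s i = proj₁ (representative (s * suc (toℕ i)) (∤-* p∤s (index∤ i)))

  translate-∼ : ∀ s p∤s i → s * suc (toℕ i) ∼ suc (toℕ (translate s p∤s i))
  translate-∼ s p∤s i = proj₂ (representative (s * suc (toℕ i)) (∤-* p∤s (index∤ i)))

  translate-inverse : ∀ s s′ p∤s p∤s′ → s′ * s ∼ 1 → ∀ i → translate s′ p∤s′ (translate s p∤s i) ≡ i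
  translate-inverse s s′ p∤s p∤s′ h i = ∼-unique _ _ (∼-trans (∼-sym (translate-∼ s′ p∤s′ (translate s p∤s i)))
    (∼-trans (∼-* s′ (∼-sym (translate-∼ s p∤s i)))
      (subst₂ _∼_ (regroup s′ s (suc (toℕ i))) (*-identityʳ _) (∼-* (suc (toℕ i)) h))))
    where
    regroup : ∀ x y z → z * (x * y) ≡ x * (y * z)
    regroup = solve-∀

  translation : ∀ s → ¬ p ∣ s → Permutation d d
  translation s p∤s = permutation (translate s p∤s) (translate s′ p∤s′)
    (translate-inverse s′ s p∤s′ p∤s (subst (_∼ 1) (*-comm s′ s) h)) (translate-inverse s s′ p∤s p∤s′ h)
    where
    s′ = proj₁ (inverse∼ s p∤s)
    h = proj₂ (inverse∼ s p∤s)
    p∤s′ = ∼1⇒∤ s′ h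

  -- Membership in the real subfield, expressed by conjugates that depend only on the index up to
  -- sign.
  Even : Expr → Set
  Even e = ∀ s t → s ∼ t → σ s e ≐ σ t e

  -- For even e this is the norm from the real subfield to ℚ, with one conjugate for each class up
  -- to sign.
  𝐍 : Expr → Expr
  𝐍 e = Π {d} (λ i → σ (suc (toℕ i)) e)

  -- As u₁ has the value 1 at 0, this is the integer by which `𝐍 e` acts when e is even; see
  -- `act-𝐍`.
  norm : Expr → ℤ
  norm e = act (𝐍 e) u₁ 0

  𝐍-invariant : ∀ {e} → Even e → ∀ s → ¬ p ∣ s → σ s (𝐍 e) ≐ 𝐍 e
  𝐍-invariant {e} ev s p∤s = ≈⇒≐ {σ s (𝐍 e)} {𝐍 e} (subst (λ z → z ≈[ 0ℤ ] 𝐍 e) (sym (σ-Π s (λ i → σ (suc (toℕ {d} i)) e)))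
    (R.≈-trans 0ℤ {Π (λ i → σ s (σ (suc (toℕ {d} i)) e))} {Π (λ i → σ (suc (toℕ (translate s p∤s i))) e)} {𝐍 e}
      (R.Prod.sum-cong-≋ 0ℤ {x = λ i → σ s (σ (suc (toℕ {d} i)) e)} {y = λ i → σ (suc (toℕ (translate s p∤s i))) e} (λ i → ≐⇒≈ {σ s (σ (suc (toℕ i)) e)} {σ (suc (toℕ (translate s p∤s i))) e} 0ℤ
        (λ u mu n → trans (σ-∘ s (suc (toℕ i)) e u n) (ev _ _ (translate-∼ s p∤s i) u mu n))))
      (R.≈-sym 0ℤ {𝐍 e} {Π (λ i → σ (suc (toℕ (translate s p∤s i))) e)} (R.Prod.sum-permute 0ℤ (λ i → σ (suc (toℕ {d} i)) e) (translation s p∤s)))))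

  act-𝐍 : ∀ {e} → Even e → ∀ u → M u → ∀ n → act (𝐍 e) u n ≡ norm e ℤ.* u n
  act-𝐍 {e} ev = invariant⇒integer (𝐍 e) (𝐍-invariant {e} ev)

  𝐍-⊗ : ∀ m a b → 𝐍 (a ⊗ b) ≈[ m ] 𝐍 a ⊗ 𝐍 b
  𝐍-⊗ m a b = R.Prod.∑-distrib-+ m (λ i → σ (suc (toℕ {d} i)) a) (λ i → σ (suc (toℕ {d} i)) b)

  𝐍-cong : ∀ m {a b} → a ≈[ m ] b → 𝐍 a ≈[ m ] 𝐍 b
  𝐍-cong m {a} {b} h = R.Prod.sum-cong-≋ m {x = λ i → σ (suc (toℕ {d} i)) a} {y = λ i → σ (suc (toℕ {d} i)) b} (λ i → ≈[]-σ m (suc (toℕ i)) {a} {b} (index∤ i) h)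

  norm-cong : ∀ m {a b} → a ≈[ m ] b → m ∣ˢ (norm a ℤ.- norm b)
  norm-cong m {a} {b} h = 𝐍-cong m {a} {b} h u₁ M-u₁ 0

  norm-bound : ∀ e → ∣ norm e ∣ ≤ ‖ e ‖ ^ d
  norm-bound e = ≤-trans (act-bound (𝐍 e) u₁ 1 u₁-bound 0) (≤-trans (≤-reflexive (*-identityʳ _)) (‖Π‖ {d} (λ i → σ (suc (toℕ i)) e) ‖ e ‖ (λ i → ≤-reflexive (‖σ‖ (suc (toℕ i)) e))))

  norm-scale : ∀ c a b → (∀ u n → act a u n ≡ c ℤ.* act b u n) → norm a ≡ c ℤ.^ d ℤ.* norm b
  norm-scale c a b h = act-Π-commonˡ {d} c (λ i → σ (suc (toℕ i)) b) (λ i → σ (suc (toℕ i)) a) u₁ 0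
    (λ i v n → trans (act-σ (suc (toℕ i)) a v n) (trans (h (dilate (suc (toℕ i)) n v) 0) (cong (ℤ._*_ c) (sym (act-σ (suc (toℕ i)) b v n)))))

prime∣ᶻ* : ∀ {q} → Prime q → ∀ x y → ℤ.+ q ∣ˢ (x ℤ.* y) → ℤ.+ q ∣ˢ x ⊎ ℤ.+ q ∣ˢ y
prime∣ᶻ* {q} pq x y h with euclidsLemma ∣ x ∣ ∣ y ∣ pq (subst (q ∣_) (ℤₚ.abs-* x y) (Signed.∣⇒∣ᵤ h))
... | inj₁ k = inj₁ (Signed.∣ᵤ⇒∣ k)
... | inj₂ k = inj₂ (Signed.∣ᵤ⇒∣ k)

prime∤ᶻ1 : ∀ {q} → Prime q → ¬ ℤ.+ q ∣ˢ 1ℤ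
prime∤ᶻ1 pq h = <-irrefl refl (≤-trans (prime≥2 pq) (∣⇒≤ (Signed.∣⇒∣ᵤ h)))

prime∣ᶻ^ : ∀ {q} → Prime q → ∀ x k → ℤ.+ q ∣ˢ (x ℤ.^ k) → ℤ.+ q ∣ˢ x
prime∣ᶻ^ pq x zero h = contradiction h (prime∤ᶻ1 pq)
prime∣ᶻ^ pq x (suc k) h with prime∣ᶻ* pq x (x ℤ.^ k) h
... | inj₁ h′ = h′
... | inj₂ h′ = prime∣ᶻ^ pq x k h′

n<2^n : ∀ n → n < 2 ^ n
n<2^n zero = s≤s z≤n
n<2^n (suc n) = begin-strict
  suc n            <⟨ +-mono-≤-< (m^n>0 2 n) (n<2^n n) ⟩
  2 ^ n + 2 ^ n    ≡⟨ cong (2 ^ n +_) (sym (+-identityʳ (2 ^ n))) ⟩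
  2 ^ suc n        ∎
  where open ≤-Reasoning

n<m^n : ∀ {m} n → 2 ≤ m → n < m ^ n
n<m^n n 2≤m = <-≤-trans (n<2^n n) (^-monoˡ-≤ n 2≤m)

-- Nonvanishing of norms, and conjugates with a common factor modulo q

module CyclotomicField (d : ℕ) (p-prime : Prime (suc (d + d))) where
  open Cyclotomic d p-prime
  open CyclotomicNorm d p-prime

  𝔭 : ℤ
  𝔭 = ℤ.+ p

  act-σ-int : ∀ t c u n → act (σ t (int c)) u n ≡ c ℤ.* u n
  act-σ-int t c u n = trans (act-σ t (int c) u n) (trans (act-int c (dilate t n u) 0) (cong (λ k → c ℤ.* u k) (trans (cong (n +_) (*-zeroʳ t)) (+-identityʳ n))))

  σ-p-lam : ∀ u → M u → ∀ n → act (σ p lam) u n ≡ 0ℤ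
  σ-p-lam u mu n = trans (cong (ℤ._-_ (u n)) (trans (act-ζ^ p u n) (periodic mu n))) (ℤₚ.+-inverseʳ (u n))

  ↑-cong : ∀ m k {a b} → a ≈[ m ] b → a ↑ k ≈[ m ] b ↑ k
  ↑-cong m k {a} {b} h = subst₂ (λ x y → x ≈[ m ] y) (↑-independent m a k) (↑-independent m b k) (R.^-congˡ m k {a} {b} h)

  -- If a ≡ λ x modulo p for an integer a, then a ≡ a^p ≡ λ^p x^p ≡ 0 modulo p.
  ≈𝟎⇒∣aug : ∀ {e} → e ≈[ 𝔭 ] 𝟎 → 𝔭 ∣ˢ aug e
  ≈𝟎⇒∣aug {e} h = subst (𝔭 ∣ˢ_) (trans (act-int (aug e) u₁ 0) (trans (cong (ℤ._*_ (aug e)) u₁-0) (ℤₚ.*-identityʳ (aug e)))) (≈𝟎⇒∣ {𝔭} {a} a≈𝟎 u₁ M-u₁ 0)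
    where
    e′ = proj₁ (aug-split e)
    a = int (aug e)
    y = ⊖ (lam ⊗ e′)
    a≈y : a ≈[ 𝔭 ] y
    a≈y u mu n = subst (𝔭 ∣ˢ_) (trans (proj₂ (aug-split e) u n) (trans (cong₂ ℤ._+_ (sym (act-int (aug e) u n)) (sym (act-comm lam e′ u n)))
      (cong (ℤ._+_ (act a u n)) (sym (ℤₚ.neg-involutive (act lam (act e′ u) n)))))) (≈𝟎⇒∣ {𝔭} {e} h u mu n)
    y↑p≈𝟎 : y ↑ p ≈[ 𝔭 ] 𝟎
    y↑p≈𝟎 = R.≈-trans 𝔭 {y ↑ p} {σ p y} {𝟎} (frobenius p-prime y) (≐⇒≈ {σ p y} {𝟎} 𝔭 (λ u mu n → trans (cong ℤ.-_ (σ-p-lam (act (σ p e′) u) (M-act (σ p e′) mu) n)) (sym (act-𝟎 u n))))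
    a≈𝟎 : a ≈[ 𝔭 ] 𝟎
    a≈𝟎 = R.≈-trans 𝔭 {a} {σ p a} {𝟎} (≐⇒≈ {a} {σ p a} 𝔭 (λ u mu n → trans (act-int (aug e) u n) (sym (act-σ-int p (aug e) u n))))
      (R.≈-trans 𝔭 {σ p a} {a ↑ p} {𝟎} (R.≈-sym 𝔭 {a ↑ p} {σ p a} (frobenius p-prime a)) (R.≈-trans 𝔭 {a ↑ p} {y ↑ p} {𝟎} (↑-cong 𝔭 p {a} {y} a≈y) y↑p≈𝟎))

  aug-𝐍 : ∀ e → aug (𝐍 e) ≡ aug e ℤ.^ d
  aug-𝐍 e = aug-Π {d} (aug e) (λ i → σ (suc (toℕ i)) e) (λ i → aug-σ (suc (toℕ i)) e)

  fermat : ∀ a → 𝔭 ∣ˢ (a ℤ.^ p ℤ.- a)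
  fermat a = subst (𝔭 ∣ˢ_) (cong₂ ℤ._-_ (trans (aug-↑ p) (cong (ℤ._^ p) (aug-int a))) (aug-int a)) (≈𝟎⇒∣aug {int a ↑ p ⊕ ⊖ int a} (λ u mu n →
      subst (𝔭 ∣ˢ_) (trans (cong (ℤ._-_ (act (int a ↑ p) u n)) (trans (act-σ-int p a u n) (sym (act-int a u n)))) (trans (sym (ℤₚ.+-identityʳ _)) (cong (ℤ._-_ (act (int a ↑ p) u n ℤ.- act (int a) u n)) (sym (act-𝟎 u n)))))
        (frobenius p-prime (int a) u mu n)))
    where
    aug-↑ : ∀ k → aug (int a ↑ k) ≡ aug (int a) ℤ.^ k
    aug-↑ zero = refl
    aug-↑ (suc k) = cong (ℤ._*_ (aug (int a))) (aug-↑ k)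

  act-geo-Δ : ∀ k u n → act (geo 1 k) (Δ u) n ≡ u n ℤ.- u (n + k)
  act-geo-Δ zero u n = trans (act-𝟎 (Δ u) n) (sym (trans (cong (λ k → u n ℤ.- u k) (+-identityʳ n)) (ℤₚ.+-inverseʳ (u n))))
  act-geo-Δ (suc k) u n = trans (cong₂ ℤ._+_ (act-geo-Δ k u n) (trans (act-ζ^ (1 * k) (Δ u) n) (cong (λ j → Δ u (n + j)) (*-identityˡ k))))
    (trans (identity (u n) (u (n + k)) (u (suc (n + k)))) (cong (λ j → u n ℤ.- u j) (sym (+-suc n k))))
    where
    identity : ∀ x y z → (x ℤ.- y) ℤ.+ (y ℤ.- z) ≡ x ℤ.- z
    identity = ℤSolver.solve-∀

  -- p = λ · cofactor p, because p is the sum of the p elements 1 − ζ^i.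
  cofactor : ℕ → Expr
  cofactor zero = 𝟎
  cofactor (suc k) = cofactor k ⊕ geo 1 k

  act-cofactor : ∀ k u n → act (cofactor k) (Δ u) n ≡ ℤ.+ k ℤ.* u n ℤ.- ∑ℤ k (λ i → u (n + i))
  act-cofactor zero u n = act-𝟎 (Δ u) n
  act-cofactor (suc k) u n = trans (cong₂ ℤ._+_ (act-cofactor k u n) (act-geo-Δ k u n)) (trans (identity (ℤ.+ k ℤ.* u n) (∑ℤ k (λ i → u (n + i))) (u n) (u (n + k)))
    (cong (λ z → z ℤ.- (∑ℤ k (λ i → u (n + i)) ℤ.+ u (n + k))) (sym (ℤₚ.suc-* (ℤ.+ k) (u n)))))
    where
    identity : ∀ x y z w → (x ℤ.- y) ℤ.+ (z ℤ.- w) ≡ (z ℤ.+ x) ℤ.- (y ℤ.+ w)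
    identity = ℤSolver.solve-∀

  cofactor-lam : ∀ u → M u → ∀ n → act (cofactor p) (Δ u) n ≡ 𝔭 ℤ.* u n
  cofactor-lam u mu n = trans (act-cofactor p u n) (trans (cong (ℤ._-_ (𝔭 ℤ.* u n)) (M.sum≡0 mu n)) (ℤₚ.+-identityʳ _))

  act-𝐍-integer : ∀ c e → (∀ u n → act e u n ≡ c ℤ.* u n) → ∀ u n → act (𝐍 e) u n ≡ c ℤ.^ d ℤ.* u n
  act-𝐍-integer c e h u n = trans (act-Π-commonˡ {d} c (λ _ → 𝟏) (λ i → σ (suc (toℕ i)) e) u n
      (λ i v n → trans (act-σ (suc (toℕ i)) e v n) (trans (h _ 0) (cong (λ k → c ℤ.* v k) (trans (cong (n +_) (*-zeroʳ (suc (toℕ i)))) (+-identityʳ n))))))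
    (cong (ℤ._*_ (c ℤ.^ d)) (ones d))
    where
    ones : ∀ k → act (Π {k} (λ _ → 𝟏)) u n ≡ u n
    ones zero = refl
    ones (suc k) = ones k

  ^≢0 : ∀ x k → x ≢ 0ℤ → x ℤ.^ k ≢ 0ℤ
  ^≢0 x zero x≢0 ()
  ^≢0 x (suc k) x≢0 e with ℤₚ.i*j≡0⇒i≡0∨j≡0 x e
  ... | inj₁ x≡0 = x≢0 x≡0
  ... | inj₂ x^k≡0 = ^≢0 x k x≢0 x^k≡0

  ≢0-cancel : ∀ x y → x ≢ 0ℤ → x ℤ.* y ≡ 0ℤ → y ≡ 0ℤ
  ≢0-cancel x y x≢0 e with ℤₚ.i*j≡0⇒i≡0∨j≡0 x {y} e
  ... | inj₁ x≡0 = contradiction x≡0 x≢0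
  ... | inj₂ y≡0 = y≡0

  -- Infinite descent at λ = 1 - ζ. The augmentation of the norm is the d-th power of aug γ, so p
  -- divides aug γ and λ divides γ. The norm of the quotient vanishes too, because the norm of λ
  -- divides p^d, which is not a zero divisor.
  descent : ∀ γ → 𝐍 γ ≐ 𝟎 → ∃[ γ′ ] (γ ≐ lam ⊗ γ′ × 𝐍 γ′ ≐ 𝟎)
  descent γ h = γ′ , γ≐ , 𝐍γ′≐𝟎
    where
    p∣aug : 𝔭 ∣ˢ aug γ
    p∣aug = prime∣ᶻ^ p-prime (aug γ) d (subst (𝔭 ∣ˢ_) (aug-𝐍 γ) (≈𝟎⇒∣aug {𝐍 γ} (≐⇒≈ {𝐍 γ} {𝟎} 𝔭 h)))
    c = Signed._∣_.quotient p∣aug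
    e′ = proj₁ (aug-split γ)
    γ′ = int c ⊗ cofactor p ⊕ e′
    γ≐ : γ ≐ lam ⊗ γ′
    γ≐ u mu n = trans (proj₂ (aug-split γ) u n) (trans (cong (ℤ._+ act e′ (Δ u) n) (trans (cong (ℤ._* u n) (Signed._∣_.equality p∣aug))
        (trans (ℤₚ.*-assoc c 𝔭 (u n)) (trans (cong (ℤ._*_ c) (sym (cofactor-lam u mu n))) (sym (act-int c (act (cofactor p) (Δ u)) n))))))
      (sym (act-comm lam γ′ u n)))
    𝐍lam-kills : 𝐍 lam ⊗ 𝐍 γ′ ≐ 𝟎
    𝐍lam-kills u mu n = trans (sym (≈⇒≐ {𝐍 (lam ⊗ γ′)} {𝐍 lam ⊗ 𝐍 γ′} (𝐍-⊗ 0ℤ lam γ′) u mu n))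
      (trans (sym (≈⇒≐ {𝐍 γ} {𝐍 (lam ⊗ γ′)} (𝐍-cong 0ℤ {γ} {lam ⊗ γ′} (≐⇒≈ {γ} {lam ⊗ γ′} 0ℤ γ≐)) u mu n)) (h u mu n))
    p^d-kills : ∀ u → M u → ∀ n → 𝔭 ℤ.^ d ℤ.* act (𝐍 γ′) u n ≡ 0ℤ
    p^d-kills u mu n = begin
      𝔭 ℤ.^ d ℤ.* act (𝐍 γ′) u n                       ≡⟨ sym (act-𝐍-integer 𝔭 (nat p) (act-nat p) (act (𝐍 γ′) u) n) ⟩
      act (𝐍 (nat p)) (act (𝐍 γ′) u) n                  ≡⟨ ≈⇒≐ {𝐍 (nat p)} {𝐍 (cofactor p ⊗ lam)} (𝐍-cong 0ℤ {nat p} {cofactor p ⊗ lam} (≐⇒≈ {nat p} {cofactor p ⊗ lam} 0ℤ (λ u mu n → trans (act-nat p u n) (sym (cofactor-lam u mu n))))) (act (𝐍 γ′) u) (M-act (𝐍 γ′) mu) n ⟩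
      act (𝐍 (cofactor p ⊗ lam)) (act (𝐍 γ′) u) n       ≡⟨ ≈⇒≐ {𝐍 (cofactor p ⊗ lam)} {𝐍 (cofactor p) ⊗ 𝐍 lam} (𝐍-⊗ 0ℤ (cofactor p) lam) (act (𝐍 γ′) u) (M-act (𝐍 γ′) mu) n ⟩
      act (𝐍 (cofactor p)) (act (𝐍 lam) (act (𝐍 γ′) u)) n ≡⟨ act-cong (𝐍 (cofactor p)) (λ n → trans (𝐍lam-kills u mu n) (act-𝟎 u n)) n ⟩
      act (𝐍 (cofactor p)) (λ _ → 0ℤ) n                 ≡⟨ act-zero (𝐍 (cofactor p)) n ⟩
      0ℤ                                                ∎
      where open ≡-Reasoning
    𝐍γ′≐𝟎 : 𝐍 γ′ ≐ 𝟎
    𝐍γ′≐𝟎 u mu n = trans (≢0-cancel (𝔭 ℤ.^ d) (act (𝐍 γ′) u n) (^≢0 𝔭 d (λ ())) (p^d-kills u mu n)) (sym (act-𝟎 u n))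

  descent* : ∀ k γ → 𝐍 γ ≐ 𝟎 → ∃[ γ′ ] (γ ≐ lam ↑ k ⊗ γ′ × 𝐍 γ′ ≐ 𝟎)
  descent* zero γ h = γ , (λ u mu n → refl) , h
  descent* (suc k) γ h = extend (descent γ h)
    where
    extend : ∃[ γ′ ] (γ ≐ lam ⊗ γ′ × 𝐍 γ′ ≐ 𝟎) → ∃[ γ′ ] (γ ≐ lam ↑ suc k ⊗ γ′ × 𝐍 γ′ ≐ 𝟎)
    extend (γ₁ , γ≐ , h₁) = let (γ₂ , γ₁≐ , h₂) = descent* k γ₁ h₁ in
      γ₂ , (λ u mu n → trans (γ≐ u mu n) (act-cong lam (γ₁≐ u mu) n)) , h₂

  lam↑p≈𝟎 : lam ↑ p ≈[ 𝔭 ] 𝟎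
  lam↑p≈𝟎 = R.≈-trans 𝔭 {lam ↑ p} {σ p lam} {𝟎} (frobenius p-prime lam) (≐⇒≈ {σ p lam} {𝟎} 𝔭 (λ u mu n → trans (σ-p-lam u mu n) (sym (act-𝟎 u n))))

  -- Every p steps of the descent yield a factor p, since λ^p ≡ 1 - ζ^p = 0 modulo p.
  𝐍≐𝟎⇒≈𝟎 : ∀ k γ → 𝐍 γ ≐ 𝟎 → γ ≈[ 𝔭 ℤ.^ k ] 𝟎
  𝐍≐𝟎⇒≈𝟎 zero γ h = ∣⇒≈𝟎 {1ℤ} {γ} (λ u mu n → Signed.divides (act γ u n) (sym (ℤₚ.*-identityʳ (act γ u n))))
  𝐍≐𝟎⇒≈𝟎 (suc k) γ h = let (γ′ , γ≐ , h′) = descent* p γ h in R.≈-trans (𝔭 ℤ.^ suc k) {γ} {lam ↑ p ⊗ γ′} {𝟎} (≐⇒≈ {γ} {lam ↑ p ⊗ γ′} (𝔭 ℤ.^ suc k) γ≐)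
      (∣-⊗ {𝔭} {𝔭 ℤ.^ k} {lam ↑ p} {γ′} lam↑p≈𝟎 (𝐍≐𝟎⇒≈𝟎 k γ′ h′))

  abs-^ : ∀ k → ∣ 𝔭 ℤ.^ k ∣ ≡ p ^ k
  abs-^ zero = refl
  abs-^ (suc k) = trans (ℤₚ.abs-* 𝔭 (𝔭 ℤ.^ k)) (cong (p *_) (abs-^ k))

  -- An integer divisible by all powers of p is 0; the power p^K with K its absolute value already
  -- exceeds it. This takes the place of the irreducibility of the cyclotomic polynomial.
  norm≡0⇒≐𝟎 : ∀ γ → Even γ → norm γ ≡ 0ℤ → ∀ u → M u → ∀ n → act γ u n ≡ 0ℤ
  norm≡0⇒≐𝟎 γ ev norm≡0 u mu n = ℤₚ.∣i∣≡0⇒i≡0 (small (n<m^n K p≥2) (subst (_∣ K) (abs-^ K) (Signed.∣⇒∣ᵤ (≈𝟎⇒∣ {𝔭 ℤ.^ K} {γ} (𝐍≐𝟎⇒≈𝟎 K γ 𝐍≐𝟎) u mu n))))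
    where
    K = ∣ act γ u n ∣
    𝐍≐𝟎 : 𝐍 γ ≐ 𝟎
    𝐍≐𝟎 u mu n = trans (act-𝐍 {γ} ev u mu n) (trans (cong (ℤ._* u n) norm≡0) (trans (ℤₚ.*-zeroˡ (u n)) (sym (act-𝟎 u n))))
    small : ∀ {a b} → a < b → b ∣ a → a ≡ 0
    small {zero} a<b b∣a = refl
    small {suc a} a<b b∣a = contradiction (∣⇒≤ b∣a) (<⇒≱ a<b)

  ∣-Π : ∀ {m e} → ∀ {k} (f : Fin k → Expr) t → e ⊗ f t ≈[ m ] 𝟎 → e ⊗ Π f ≈[ m ] 𝟎
  ∣-Π {m} {e} f fzero h = ∣⇒≈𝟎 {m} {e ⊗ Π f} (λ u mu n → ≈𝟎⇒∣ {m} {e ⊗ f fzero} h (act (Π (f ∘ fsuc)) u) (M-act (Π (f ∘ fsuc)) mu) n)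
  ∣-Π {m} {e} f (fsuc t) h = ∣⇒≈𝟎 {m} {e ⊗ Π f} (λ u mu n → subst (m ∣ˢ_) (act-comm (f fzero) e (act (Π (f ∘ fsuc)) u) n)
    (act-∣ (f fzero) m (act e (act (Π (f ∘ fsuc)) u)) (≈𝟎⇒∣ {m} {e ⊗ Π (f ∘ fsuc)} (∣-Π {m} {e} (f ∘ fsuc) t h) u mu) n))

  ∣-multiple : ∀ {m e z e′} x → e′ ≈[ m ] e ⊗ z → e ⊗ x ≈[ m ] 𝟎 → e′ ⊗ x ≈[ m ] 𝟎
  ∣-multiple {m} {e} {z} {e′} x h k = ∣⇒≈𝟎 {m} {e′ ⊗ x} (λ u mu n → Signed.∣m+n∣n⇒∣m {m = act e′ (act x u) n}
    (h (act x u) (M-act x mu) n)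
    (Signed.∣m⇒∣-m (subst (m ∣ˢ_) (sym (act-comm e z (act x u) n)) (act-∣ z m (act e (act x u)) (≈𝟎⇒∣ {m} {e ⊗ x} k u mu) n))))

  -- A maximal product e of conjugates of the α i that is nonzero modulo q. Each α i has a conjugate annihilating e,
  -- and two of the α i share the index of that conjugate. This replaces the choice of a prime ideal above q.
  module _ {q : ℕ} (pq : Prime q) where
    private 𝔮 = ℤ.+ q

    -- The form with continuations stands for the case distinction whether a product vanishes modulo
    -- q, which is never decided.
    annihilated-factor : ∀ {k} (f : Fin k → Expr) e → ¬ e ≈[ 𝔮 ] 𝟎 → e ⊗ Π f ≈[ 𝔮 ] 𝟎 →
      (∀ t e′ → ¬ e′ ≈[ 𝔮 ] 𝟎 → ∃[ z ] (e′ ≈[ 𝔮 ] e ⊗ z) → e′ ⊗ f t ≈[ 𝔮 ] 𝟎 → ⊥) → ⊥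
    annihilated-factor {zero} f e ne h k = ne h
    annihilated-factor {suc n} f e ne h k = annihilated-factor (f ∘ fsuc) (e ⊗ f fzero)
      (λ z → k fzero e ne (𝟏 , R.≈-refl 𝔮 {e}) z) h
      (λ { t e′ ne′ (z , hz) ann → k (fsuc t) e′ ne′ (f fzero ⊗ z , hz) ann })

    annihilators : ∀ n (α : Fin n → Expr) → (∀ i → 𝐍 (α i) ≈[ 𝔮 ] 𝟎) → ∀ e → ¬ e ≈[ 𝔮 ] 𝟎 →
      (∀ (τ : Fin n → Fin d) e′ → ¬ e′ ≈[ 𝔮 ] 𝟎 → ∃[ z ] (e′ ≈[ 𝔮 ] e ⊗ z) → (∀ i → e′ ⊗ σ (suc (toℕ (τ i))) (α i) ≈[ 𝔮 ] 𝟎) → ⊥) → ⊥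
    annihilators zero α h e ne k = k (λ ()) e ne (𝟏 , R.≈-refl 𝔮 {e}) (λ ())
    annihilators (suc n) α h e ne k = annihilated-factor (λ t → σ (suc (toℕ {d} t)) (α fzero)) e ne
      (∣⇒≈𝟎 {𝔮} {e ⊗ 𝐍 (α fzero)} (λ u mu n → act-∣ e 𝔮 (act (𝐍 (α fzero)) u) (≈𝟎⇒∣ {𝔮} {𝐍 (α fzero)} (h fzero) u mu) n))
      (λ { t e₁ ne₁ (z₁ , h₁) ann₁ → annihilators n (α ∘ fsuc) (h ∘ fsuc) e₁ ne₁
        (λ { τ e′ ne′ (z , hz) ann → k (λ { fzero → t ; (fsuc i) → τ i }) e′ ne′
            (z₁ ⊗ z , R.≈-trans 𝔮 {e′} {e₁ ⊗ z} {e ⊗ (z₁ ⊗ z)} hz (λ u mu n → h₁ (act z u) (M-act z mu) n))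
            (λ { fzero → ∣-multiple {𝔮} {e₁} {z} {e′} (σ (suc (toℕ t)) (α fzero)) hz ann₁ ; (fsuc i) → ann i }) }) })

    norm-difference : ∀ (α : Fin (suc d) → Expr) → (∀ i j → Even (α i ⊕ ⊖ α j)) → (∀ i → 𝐍 (α i) ≈[ 𝔮 ] 𝟎) →
      (∀ i j → toℕ i < toℕ j → ¬ 𝔮 ∣ˢ norm (α i ⊕ ⊖ α j)) → ⊥
    norm-difference α ev h indivisible = annihilators (suc d) α h 𝟏 (λ 𝟏≈𝟎 → prime∤ᶻ1 pq (subst (𝔮 ∣ˢ_) u₁-0 (≈𝟎⇒∣ {𝔮} {𝟏} 𝟏≈𝟎 u₁ M-u₁ 0)))
      (λ τ e ne _ ann → let (i , j , i<j , τi≡τj) = Fin.pigeonhole ≤-refl τ in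
        ne (∣⇒≈𝟎 {𝔮} {e} (λ u mu n → cancel i j i<j e u mu n (subst (λ t → e ⊗ σ (suc (toℕ t)) (α i) ≈[ 𝔮 ] 𝟎) τi≡τj (ann i)) (ann j))))
      where
      -- If e annihilates the t-th conjugates of α i and α j, it annihilates that of their
      -- difference and hence its norm. As q does not divide this integer, e would vanish modulo q.
      cancel : ∀ i j → toℕ i < toℕ j → ∀ e u → M u → ∀ n {t} → e ⊗ σ (suc (toℕ {d} t)) (α i) ≈[ 𝔮 ] 𝟎 → e ⊗ σ (suc (toℕ t)) (α j) ≈[ 𝔮 ] 𝟎 → 𝔮 ∣ˢ act e u n
      cancel i j i<j e u mu n {t} hi hj = [ (λ q∣norm → contradiction q∣norm (indivisible i j i<j)) , id ]′
          (prime∣ᶻ* pq (norm β) (act e u n) (subst (𝔮 ∣ˢ_) (trans (act-cong e (act-𝐍 {β} (ev i j) u mu) n) (act-* e (norm β) u n)) (≈𝟎⇒∣ {𝔮} {e ⊗ 𝐍 β} e𝐍≈𝟎 u mu n)))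
        where
        β = α i ⊕ ⊖ α j
        e𝐍≈𝟎 : e ⊗ 𝐍 β ≈[ 𝔮 ] 𝟎
        e𝐍≈𝟎 = ∣-Π {𝔮} {e} (λ s → σ (suc (toℕ {d} s)) β) t (∣⇒≈𝟎 {𝔮} {e ⊗ σ (suc (toℕ t)) β} (λ u mu n →
          subst (𝔮 ∣ˢ_) (sym (act-- e (act (σ (suc (toℕ t)) (α i)) u) (act (σ (suc (toℕ t)) (α j)) u) n))
            (Signed.∣m∣n⇒∣m-n (≈𝟎⇒∣ {𝔮} {e ⊗ σ (suc (toℕ t)) (α i)} hi u mu n) (≈𝟎⇒∣ {𝔮} {e ⊗ σ (suc (toℕ t)) (α j)} hj u mu n))))

-- Prime factors of norms outside the classes ±1

module CyclotomicCount (d : ℕ) (p-prime : Prime (suc (d + d))) where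
  open Cyclotomic d p-prime
  open CyclotomicNorm d p-prime
  open CyclotomicField d p-prime

  σ-mod : ∀ {s t} → 𝔭 ∣ˢ (ℤ.+ s ℤ.- ℤ.+ t) → ∀ e → σ s e ≐ σ t e
  σ-mod {s} {t} h e u mu n = trans (act-σ s e u n) (trans (act-cong e (λ i → M-mod mu (n + s * i) (n + t * i) (subst (𝔭 ∣ˢ_) (identity′ i) (Signed.∣m⇒∣m*n (ℤ.+ i) h))) 0) (sym (act-σ t e u n)))
    where
    identity : ∀ x y z w → (x ℤ.- y) ℤ.* z ≡ (w ℤ.+ x ℤ.* z) ℤ.- (w ℤ.+ y ℤ.* z)
    identity = ℤSolver.solve-∀
    identity′ : ∀ i → (ℤ.+ s ℤ.- ℤ.+ t) ℤ.* ℤ.+ i ≡ ℤ.+ (n + s * i) ℤ.- ℤ.+ (n + t * i)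
    identity′ i = trans (identity (ℤ.+ s) (ℤ.+ t) (ℤ.+ i) (ℤ.+ n)) (cong₂ ℤ._-_ (cong (ℤ._+_ (ℤ.+ n)) (sym (ℤₚ.pos-* s i))) (cong (ℤ._+_ (ℤ.+ n)) (sym (ℤₚ.pos-* t i))))

  square≡1 : ∀ {r} → r ∼ 1 → 𝔭 ∣ˢ (ℤ.+ (r * r) ℤ.- ℤ.+ 1)
  square≡1 {r} h = subst (𝔭 ∣ˢ_) (trans (identity (ℤ.+ r)) (cong (ℤ._- 1ℤ) (sym (ℤₚ.pos-* r r)))) (both h)
    where
    identity : ∀ x → (x ℤ.- 1ℤ) ℤ.* (x ℤ.+ 1ℤ) ≡ x ℤ.* x ℤ.- 1ℤ
    identity = ℤSolver.solve-∀
    both : r ∼ 1 → 𝔭 ∣ˢ ((ℤ.+ r ℤ.- 1ℤ) ℤ.* (ℤ.+ r ℤ.+ 1ℤ))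
    both (minus h) = Signed.∣m⇒∣m*n (ℤ.+ r ℤ.+ 1ℤ) h
    both (plus h) = Signed.∣n⇒∣m*n (ℤ.+ r ℤ.- 1ℤ) h

  module Unramified {q : ℕ} (pq : Prime q) (p∤q : ¬ p ∣ q) where
    private 𝔮 = ℤ.+ q

    -- y^q ≡ σ_q y, and σ_q is invertible since p does not divide q. This is where q ≠ p, the
    -- unramified case, enters.
    reduced : ∀ y → y ↑ q ≈[ 𝔮 ] 𝟎 → y ≈[ 𝔮 ] 𝟎
    reduced y h = R.≈-trans 𝔮 {y} {σ r (σ r y)} {𝟎} (≐⇒≈ {y} {σ r (σ r y)} 𝔮 (λ u mu n → sym (trans (σ-∘ r r y u n) (trans (σ-mod {r * r} {1} (square≡1 r∼1) y u mu n) (σ-1 y u n)))))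
        (≈[]-σ 𝔮 r {σ r y} {𝟎} p∤r σry≈𝟎)
      where
      q⁻¹ = proj₁ (inverse∼ q p∤q)
      -- Only r ≡ ±1 modulo p is known, so σ_r is applied twice to recover y, using r² ≡ 1.
      r = q⁻¹ * q
      r∼1 : r ∼ 1
      r∼1 = proj₂ (inverse∼ q p∤q)
      p∤q⁻¹ = ∼1⇒∤ q⁻¹ r∼1
      p∤r : ¬ p ∣ r
      p∤r = ∤-* p∤q⁻¹ p∤q
      σqy≈𝟎 : σ q y ≈[ 𝔮 ] 𝟎
      σqy≈𝟎 = R.≈-trans 𝔮 {σ q y} {y ↑ q} {𝟎} (R.≈-sym 𝔮 {y ↑ q} {σ q y} (frobenius pq y)) h
      σry≈𝟎 : σ r y ≈[ 𝔮 ] 𝟎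
      σry≈𝟎 = R.≈-trans 𝔮 {σ r y} {σ q⁻¹ (σ q y)} {𝟎} (≐⇒≈ {σ r y} {σ q⁻¹ (σ q y)} 𝔮 (λ u mu n → sym (σ-∘ q⁻¹ q y u n))) (≈[]-σ 𝔮 q⁻¹ {σ q y} {𝟎} p∤q⁻¹ σqy≈𝟎)

    nilpotent⇒≈𝟎 : ∀ x n → x ↑ n ≈[ 𝔮 ] 𝟎 → x ≈[ 𝔮 ] 𝟎
    nilpotent⇒≈𝟎 x n h = strip n (subst (λ k → x ↑ k ≈[ 𝔮 ] 𝟎) (m∸n+n≡m (<⇒≤ (n<m^n n (prime≥2 pq)))) (grow (q ^ n ∸ n)))
      where
      grow : ∀ k → x ↑ (k + n) ≈[ 𝔮 ] 𝟎
      grow zero = h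
      grow (suc k) = ∣⇒≈𝟎 {𝔮} {x ⊗ x ↑ (k + n)} (λ u mu m → act-∣ x 𝔮 (act (x ↑ (k + n)) u) (≈𝟎⇒∣ {𝔮} {x ↑ (k + n)} (grow k) u mu) m)
      strip : ∀ j → x ↑ (q ^ j) ≈[ 𝔮 ] 𝟎 → x ≈[ 𝔮 ] 𝟎
      strip zero h = h
      strip (suc j) h = strip j (reduced (x ↑ (q ^ j)) (R.≈-trans 𝔮 {(x ↑ (q ^ j)) ↑ q} {x ↑ (q ^ j * q)} {𝟎}
        (subst₂ (λ a b → a ≈[ 𝔮 ] b) (trans (cong (λ z → R._↑_ 𝔮 z q) (↑-independent 𝔮 x (q ^ j))) (↑-independent 𝔮 (x ↑ (q ^ j)) q)) (↑-independent 𝔮 x (q ^ j * q)) (R.^-assocʳ 𝔮 x (q ^ j) q))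
        (subst (λ k → x ↑ k ≈[ 𝔮 ] 𝟎) (*-comm q (q ^ j)) h)))

    Π-factor : ∀ {k} (f : Fin k → Expr) t → ∃[ z ] (Π f ≈[ 𝔮 ] f t ⊗ z)
    Π-factor f fzero = Π (f ∘ fsuc) , R.≈-refl 𝔮 {Π f}
    Π-factor f (fsuc t) = let (z , h) = Π-factor (f ∘ fsuc) t in f fzero ⊗ z , R.≈-trans 𝔮 {Π f} {f fzero ⊗ (f (fsuc t) ⊗ z)} {f (fsuc t) ⊗ (f fzero ⊗ z)}
          (R.⊗-cong 𝔮 {f fzero} {f fzero} {Π (f ∘ fsuc)} {f (fsuc t) ⊗ z} (R.≈-refl 𝔮 {f fzero}) h)
          (≐⇒≈ {f fzero ⊗ (f (fsuc t) ⊗ z)} {f (fsuc t) ⊗ (f fzero ⊗ z)} 𝔮 (λ u mu n → act-comm (f fzero) (f (fsuc t)) (act z u) n))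

    power-multiple : ∀ {k} x (f : Fin k → Expr) → (∀ t → ∃[ z ] (x ≈[ 𝔮 ] f t ⊗ z)) → ∃[ z ] (x ↑ k ≈[ 𝔮 ] z ⊗ Π f)
    power-multiple {zero} x f h = 𝟏 , R.≈-refl 𝔮 {𝟏}
    power-multiple {suc k} x f h = let (z , hz) = h fzero ; (w , hw) = power-multiple x (f ∘ fsuc) (h ∘ fsuc) in z ⊗ w , R.≈-trans 𝔮 {x ⊗ x ↑ k} {f fzero ⊗ z ⊗ (w ⊗ Π (f ∘ fsuc))} {z ⊗ w ⊗ Π f}
          (R.⊗-cong 𝔮 {x} {f fzero ⊗ z} {x ↑ k} {w ⊗ Π (f ∘ fsuc)} hz hw)
          (≐⇒≈ {f fzero ⊗ z ⊗ (w ⊗ Π (f ∘ fsuc))} {z ⊗ w ⊗ Π f} 𝔮 (λ u mu n → act-comm (f fzero) (z ⊗ w) (act (Π (f ∘ fsuc)) u) n))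

    -- The factors σ_t α of the norm are split according to whether multiplication by q raises or lowers the index t.
    -- Each half contains a factor from every orbit of q, and by Frobenius the factors in an orbit divide each other.
    module _ (q≁1 : ¬ q ∼ 1) (α : Expr) (even : Even α) (q∣norm : 𝔮 ∣ˢ norm α) where
      private
        π : Fin d → Fin d
        π = translate q p∤q

        factor : Fin d → Expr
        factor t = σ (suc (toℕ t)) α

        raised lowered : Fin d → Expr
        raised t = if ⌊ toℕ t <? toℕ (π t) ⌋ then factor t else 𝟏
        lowered t = if ⌊ toℕ t <? toℕ (π t) ⌋ then 𝟏 else factor t

        π-moves : ∀ t → toℕ (π t) ≢ toℕ t
        π-moves t e = q≁1 (subst (_∼ 1) (*-identityʳ q) q∼1)
          where
          a = suc (toℕ t)
          b = proj₁ (inverse∼ a (index∤ t))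
          b*a∼1 : b * a ∼ 1
          b*a∼1 = proj₂ (inverse∼ a (index∤ t))
          qa∼a : q * a ∼ a
          qa∼a = subst (λ k → q * a ∼ suc k) e (translate-∼ q p∤q t)
          q∼1 : q * 1 ∼ 1
          q∼1 = ∼-trans (∼-sym (∼-* q b*a∼1)) (∼-trans (subst (_∼ b * a) (regroup b q a) (∼-* b qa∼a)) b*a∼1)
            where
            regroup : ∀ b q a → b * (q * a) ≡ q * (b * a)
            regroup = solve-∀

        factor-π : ∀ t → ∃[ z ] (factor (π t) ≈[ 𝔮 ] factor t ⊗ z)
        factor-π t = factor t ↑ pred q , subst (λ k → factor (π t) ≈[ 𝔮 ] factor t ↑ k) (sym (suc-pred q {{prime⇒nonZero pq}}))
          (R.≈-trans 𝔮 {factor (π t)} {σ q (factor t)} {factor t ↑ q}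
            (≐⇒≈ {factor (π t)} {σ q (factor t)} 𝔮 (λ u mu n → trans (even _ _ (∼-sym (translate-∼ q p∤q t)) u mu n) (sym (σ-∘ q (suc (toℕ t)) α u n))))
            (R.≈-sym 𝔮 {factor t ↑ q} {σ q (factor t)} (frobenius pq (factor t))))

        via-π : ∀ x t → ∃[ z ] (x ≈[ 𝔮 ] factor (π t) ⊗ z) → ∃[ z ] (x ≈[ 𝔮 ] factor t ⊗ z)
        via-π x t (z , hz) = let (w , hw) = factor-π t in w ⊗ z , R.≈-trans 𝔮 {x} {factor (π t) ⊗ z} {factor t ⊗ (w ⊗ z)} hz (λ u mu n → hw (act z u) (M-act z mu) n)

        raised-yes : ∀ t → toℕ t < toℕ (π t) → raised t ≡ factor t
        raised-yes t t<πt with toℕ t <? toℕ (π t)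
        ... | yes _ = refl
        ... | no t≮πt = contradiction t<πt t≮πt

        lowered-no : ∀ t → ¬ toℕ t < toℕ (π t) → lowered t ≡ factor t
        lowered-no t t≮πt with toℕ t <? toℕ (π t)
        ... | yes t<πt = contradiction t<πt t≮πt
        ... | no _ = refl

        -- As long as π lowers the index, pass to the next factor of the orbit. This ends at an
        -- index that π raises, because π fixes none.
        raised-multiple : ∀ t → Acc _<_ (toℕ t) → ∃[ z ] (Π raised ≈[ 𝔮 ] factor t ⊗ z)
        raised-multiple t (acc rec) = by-cases (toℕ t <? toℕ (π t))
          where
          by-cases : Dec (toℕ t < toℕ (π t)) → ∃[ z ] (Π raised ≈[ 𝔮 ] factor t ⊗ z)
          by-cases (yes t<πt) = subst (λ e → ∃[ z ] (Π raised ≈[ 𝔮 ] e ⊗ z)) (raised-yes t t<πt) (Π-factor raised t)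
          by-cases (no t≮πt) = via-π (Π raised) t (raised-multiple (π t) (rec (≤∧≢⇒< (≮⇒≥ t≮πt) (π-moves t))))

        lowered-multiple : ∀ t → Acc _<_ (d ∸ toℕ t) → ∃[ z ] (Π lowered ≈[ 𝔮 ] factor t ⊗ z)
        lowered-multiple t (acc rec) = by-cases (toℕ t <? toℕ (π t))
          where
          by-cases : Dec (toℕ t < toℕ (π t)) → ∃[ z ] (Π lowered ≈[ 𝔮 ] factor t ⊗ z)
          by-cases (no t≮πt) = subst (λ e → ∃[ z ] (Π lowered ≈[ 𝔮 ] e ⊗ z)) (lowered-no t t≮πt) (Π-factor lowered t)
          by-cases (yes t<πt) = via-π (Π lowered) t (lowered-multiple (π t) (rec (∸-monoʳ-< t<πt (<⇒≤ (Fin.toℕ<n (π t))))))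

        𝐍≈𝟎 : 𝐍 α ≈[ 𝔮 ] 𝟎
        𝐍≈𝟎 = ∣⇒≈𝟎 {𝔮} {𝐍 α} (λ u mu n → subst (𝔮 ∣ˢ_) (sym (act-𝐍 {α} even u mu n)) (Signed.∣m⇒∣m*n (u n) q∣norm))

        -- The d-th power of a common multiple of all d factors is a multiple of the norm and so 0
        -- modulo q, and there are no nilpotents.
        half≈𝟎 : ∀ x → (∀ t → ∃[ z ] (x ≈[ 𝔮 ] factor t ⊗ z)) → x ≈[ 𝔮 ] 𝟎
        half≈𝟎 x h = let (z , hz) = power-multiple x factor h in nilpotent⇒≈𝟎 x d (R.≈-trans 𝔮 {x ↑ d} {z ⊗ 𝐍 α} {𝟎} hz (∣⇒≈𝟎 {𝔮} {z ⊗ 𝐍 α} (λ u mu n → act-∣ z 𝔮 (act (𝐍 α) u) (≈𝟎⇒∣ {𝔮} {𝐍 α} 𝐍≈𝟎 u mu) n)))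

        halves : 𝐍 α ≐ Π raised ⊗ Π lowered
        halves = ≈⇒≐ {𝐍 α} {Π raised ⊗ Π lowered} (R.≈-trans 0ℤ {𝐍 α} {Π (λ t → raised t ⊗ lowered t)} {Π raised ⊗ Π lowered}
          (R.Prod.sum-cong-≋ 0ℤ {x = factor} {y = λ t → raised t ⊗ lowered t} pointwise) (R.Prod.∑-distrib-+ 0ℤ raised lowered))
          where
          pointwise : ∀ t → factor t ≈[ 0ℤ ] raised t ⊗ lowered t
          pointwise t with toℕ t <? toℕ (π t)
          ... | yes _ = R.≈-refl 0ℤ {factor t}
          ... | no _ = R.≈-refl 0ℤ {factor t}

      square∣norm : 𝔮 ℤ.* 𝔮 ∣ˢ norm α
      square∣norm = subst (𝔮 ℤ.* 𝔮 ∣ˢ_) (sym (halves u₁ M-u₁ 0)) (≈𝟎⇒∣ {𝔮 ℤ.* 𝔮} {Π raised ⊗ Π lowered}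
        (∣-⊗ {𝔮} {𝔮} {Π raised} {Π lowered} (half≈𝟎 (Π raised) (λ t → raised-multiple t (<-wellFounded _))) (half≈𝟎 (Π lowered) (λ t → lowered-multiple t (<-wellFounded _)))) u₁ M-u₁ 0)

-- Primes congruent to −1 modulo p

bit : ℕ → ℕ → ℕ
bit zero r = r % 2
bit (suc i) r = bit i (r / 2)

bit≤1 : ∀ i r → bit i r ≤ 1
bit≤1 zero r = ≤-pred (m%n<n r 2)
bit≤1 (suc i) r = bit≤1 i (r / 2)

n%2+2[n/2] : ∀ n → n ≡ n % 2 + 2 * (n / 2)
n%2+2[n/2] n = trans (m≡m%n+[m/n]*n n 2) (cong (n % 2 +_) (*-comm (n / 2) 2))

bits-injective : ∀ d r r′ → r < 2 ^ d → r′ < 2 ^ d → (∀ i → i < d → bit i r ≡ bit i r′) → r ≡ r′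
bits-injective zero zero zero _ _ h = refl
bits-injective zero (suc r) r′ (s≤s ()) _ h
bits-injective zero zero (suc r′) _ (s≤s ()) h
bits-injective (suc d) r r′ r< r′< h = trans (n%2+2[n/2] r) (trans (cong₂ (λ a b → a + 2 * b) (h 0 (s≤s z≤n))
  (bits-injective d (r / 2) (r′ / 2) (half r r<) (half r′ r′<) (λ i i<d → h (suc i) (s≤s i<d)))) (sym (n%2+2[n/2] r′)))
  where
  half : ∀ r → r < 2 ^ suc d → r / 2 < 2 ^ d
  half r r< = m<n*o⇒m/o<n (subst (r <_) (*-comm 2 (2 ^ d)) r<)

module Digits (d : ℕ) where

  B : ℕ
  B = 2 ^ d

  instance
    B≢0 : NonZero B
    B≢0 = m^n≢0 2 d

  -- The base-B digits of b interleave the binary digits of d coordinates, so that an interval of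
  -- length B^j aligned at a multiple of B^j becomes a cube of side 2^j.
  coord : ℕ → ℕ → ℕ → ℕ
  coord zero b i = 0
  coord (suc m) b i = bit i (b % B) + 2 * coord m (b / B) i

  coord-bound : ∀ m b i → coord m b i < 2 ^ m
  coord-bound zero b i = s≤s z≤n
  coord-bound (suc m) b i = begin-strict
    bit i (b % B) + 2 * coord m (b / B) i   <⟨ +-monoˡ-< (2 * coord m (b / B) i) (s≤s (bit≤1 i (b % B))) ⟩
    2 + 2 * coord m (b / B) i               ≡⟨ sym (*-suc 2 (coord m (b / B) i)) ⟩
    2 * suc (coord m (b / B) i)             ≤⟨ *-monoʳ-≤ 2 (coord-bound m (b / B) i) ⟩
    2 ^ suc m                               ∎
    where open ≤-Reasoning

  cell : ℕ → ℕ → ℕ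
  cell zero b = b
  cell (suc j) b = cell j (b / B)

  quotient-bound : ∀ m b → b < B ^ suc m → b / B < B ^ m
  quotient-bound m b b< = m<n*o⇒m/o<n (subst (b <_) (*-comm B (B ^ m)) b<)

  cell-bound : ∀ m j b → j ≤ m → b < B ^ m → cell j b < B ^ (m ∸ j)
  cell-bound m zero b _ b< = b<
  cell-bound (suc m) (suc j) b (s≤s j≤m) b< = cell-bound m j (b / B) j≤m (quotient-bound m b b<)

  coord-close : ∀ m j b b′ i → cell j b ≡ cell j b′ → coord m b i < coord m b′ i + 2 ^ j
  coord-close zero j b b′ i e = m^n>0 2 j
  coord-close (suc m) zero b b′ i refl = ≤-reflexive (+-comm 1 _)
  coord-close (suc m) (suc j) b b′ i e = begin-strict
    bit i (b % B) + 2 * coord m (b / B) i      <⟨ +-monoˡ-< _ (s≤s (bit≤1 i (b % B))) ⟩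
    2 + 2 * coord m (b / B) i                  ≡⟨ sym (*-suc 2 (coord m (b / B) i)) ⟩
    2 * suc (coord m (b / B) i)                ≤⟨ *-monoʳ-≤ 2 (coord-close m j (b / B) (b′ / B) i e) ⟩
    2 * (coord m (b′ / B) i + 2 ^ j)           ≤⟨ m≤n+m _ (bit i (b′ % B)) ⟩
    bit i (b′ % B) + 2 * (coord m (b′ / B) i + 2 ^ j) ≡⟨ regroup (bit i (b′ % B)) (coord m (b′ / B) i) (2 ^ j) ⟩
    bit i (b′ % B) + 2 * coord m (b′ / B) i + 2 ^ suc j ∎
    where
    open ≤-Reasoning
    regroup : ∀ x y z → x + 2 * (y + z) ≡ x + 2 * y + 2 * z
    regroup = solve-∀

  coord-injective : ∀ m b b′ → b < B ^ m → b′ < B ^ m → (∀ i → i < d → coord m b i ≡ coord m b′ i) → b ≡ b′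
  coord-injective zero zero zero _ _ h = refl
  coord-injective zero (suc b) b′ (s≤s ()) _ h
  coord-injective zero zero (suc b′) _ (s≤s ()) h
  coord-injective (suc m) b b′ b< b′< h = trans (m≡m%n+[m/n]*n b B) (trans (cong₂ (λ x y → x + y * B)
    (bits-injective d (b % B) (b′ % B) (m%n<n b B) (m%n<n b′ B) (λ i i<d → proj₁ (parts i i<d)))
    (coord-injective m (b / B) (b′ / B) (quotient-bound m b b<) (quotient-bound m b′ b′<) (λ i i<d → proj₂ (parts i i<d)))) (sym (m≡m%n+[m/n]*n b′ B)))
    where
    unique : ∀ x x′ y y′ → x ≤ 1 → x′ ≤ 1 → x + 2 * y ≡ x′ + 2 * y′ → x ≡ x′ × y ≡ y′
    unique x x′ y y′ x≤1 x′≤1 e = trans (sym (rem x y x≤1)) (trans (cong (_% 2) e) (rem x′ y′ x′≤1)) , trans (sym (quo x y x≤1)) (trans (cong (_/ 2) e) (quo x′ y′ x′≤1))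
      where
      rem : ∀ x y → x ≤ 1 → (x + 2 * y) % 2 ≡ x
      rem x y x≤1 = trans (cong (λ z → (x + z) % 2) (*-comm 2 y)) (trans ([m+kn]%n≡m%n x y 2) (m<n⇒m%n≡m (s≤s x≤1)))
      quo : ∀ x y → x ≤ 1 → (x + 2 * y) / 2 ≡ y
      quo x y x≤1 = trans (cong (λ z → (x + z) / 2) (*-comm 2 y)) (trans (+-distrib-/-∣ʳ x (divides y refl)) (cong₂ _+_ (m<n⇒m/n≡0 (s≤s x≤1)) (m*n/n≡m y 2)))
    parts : ∀ i → i < d → bit i (b % B) ≡ bit i (b′ % B) × coord m (b / B) i ≡ coord m (b′ / B) i
    parts i i<d = unique _ _ _ _ (bit≤1 i (b % B)) (bit≤1 i (b′ % B)) (h i i<d)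

lookup-distinct : ∀ {A : Set} {l : List A} → Unique l → ∀ i j → toℕ i < toℕ j → lookup l i ≢ lookup l j
lookup-distinct {l = x ∷ l} (x∉l ∷ u) fzero (fsuc j) _ e = All.lookup x∉l (∈-lookup j) e
lookup-distinct {l = x ∷ l} (x∉l ∷ u) (fsuc i) (fsuc j) (s≤s i<j) e = lookup-distinct u i j i<j e

-- Coordinates in the real subring

module RealSubfield (d : ℕ) (p-prime : Prime (suc (d + d))) where
  open Cyclotomic d p-prime
  open CyclotomicNorm d p-prime
  open CyclotomicField d p-prime
  open CyclotomicCount d p-prime
  open Digits d

  -- The two exponents add up to p, so this is ζ^(k+1) + ζ^(-(k+1)).
  η : ℕ → Expr
  η k = ζ^ (suc k) ⊕ ζ^ (d + d ∸ k)

  lin : ℕ → (ℕ → ℤ) → Expr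
  lin zero c = 𝟎
  lin (suc k) c = lin k c ⊕ int (c k) ⊗ η k

  act-η : ∀ k u n → act (η k) u n ≡ u (n + suc k) ℤ.+ u (n + (d + d ∸ k))
  act-η k u n = cong₂ ℤ._+_ (act-ζ^ (suc k) u n) (act-ζ^ (d + d ∸ k) u n)

  act-lin : ∀ k c u n → act (lin k c) u n ≡ ∑ℤ k (λ j → c j ℤ.* act (η j) u n)
  act-lin zero c u n = act-𝟎 u n
  act-lin (suc k) c u n = cong₂ ℤ._+_ (act-lin k c u n) (act-int (c k) (act (η k) u) n)

  ‖lin‖ : ∀ k c L → (∀ j → ∣ c j ∣ ≤ L) → ‖ lin k c ‖ ≤ 2 + k * ((L + 2) * 2)
  ‖lin‖ zero c L h = ≤-refl
  ‖lin‖ (suc k) c L h = ≤-trans (+-mono-≤ (‖lin‖ k c L h) (*-mono-≤ (≤-trans (≤-reflexive (‖int‖ (c k))) (+-monoˡ-≤ 2 (h k))) (≤-reflexive (cong₂ _+_ (‖ζ^‖ (suc k)) (‖ζ^‖ (d + d ∸ k))))))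
    (≤-reflexive (cong (2 +_) (+-comm (k * ((L + 2) * 2)) ((L + 2) * 2))))

  even-⊕ : ∀ {a b} → Even a → Even b → Even (a ⊕ b)
  even-⊕ ea eb s t s∼t u mu n = cong₂ ℤ._+_ (ea s t s∼t u mu n) (eb s t s∼t u mu n)

  even-⊖ : ∀ {a} → Even a → Even (⊖ a)
  even-⊖ ea s t s∼t u mu n = cong ℤ.-_ (ea s t s∼t u mu n)

  even-⊗ : ∀ {a b} → Even a → Even b → Even (a ⊗ b)
  even-⊗ {a} {b} ea eb s t s∼t u mu n = trans (ea s t s∼t (act (σ s b) u) (M-act (σ s b) mu) n) (act-cong (σ t a) (eb s t s∼t u mu) n)

  even-int : ∀ c → Even (int c)
  even-int c s t _ u mu n = trans (act-σ-int s c u n) (sym (act-σ-int t c u n))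

  even-nat : ∀ c → Even (nat c)
  even-nat c = even-int (ℤ.+ c)

  even-η : ∀ k → k < d → Even (η k)
  even-η k k<d s t (minus h) = σ-mod {s} {t} h (η k)
  even-η k k<d s t (plus h) u mu n = trans (act-σ s (η k) u n) (trans (act-η k (dilate s n u) 0)
    (trans (cong₂ ℤ._+_ (M-mod mu (n + s * suc k) (n + t * (d + d ∸ k)) (shift n s t h (suc k) (d + d ∸ k) sum≡p))
                        (M-mod mu (n + s * (d + d ∸ k)) (n + t * suc k) (shift n s t h (d + d ∸ k) (suc k) (trans (+-comm (d + d ∸ k) (suc k)) sum≡p))))
      (trans (ℤₚ.+-comm (u (n + t * (d + d ∸ k))) (u (n + t * suc k))) (trans (sym (act-η k (dilate t n u) 0)) (sym (act-σ t (η k) u n))))))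
    where
    sum≡p : suc k + (d + d ∸ k) ≡ p
    sum≡p = cong suc (m+[n∸m]≡n (≤-trans (<⇒≤ k<d) (m≤m+n d d)))
    shift : ∀ n s t → 𝔭 ∣ˢ (ℤ.+ s ℤ.+ ℤ.+ t) → ∀ a b → a + b ≡ p → 𝔭 ∣ˢ (ℤ.+ (n + s * a) ℤ.- ℤ.+ (n + t * b))
    shift n s t h a b a+b≡p = subst (𝔭 ∣ˢ_) (trans (identity (ℤ.+ n) (ℤ.+ s) (ℤ.+ t) (ℤ.+ a) (ℤ.+ b)) (cong₂ ℤ._-_ (cong (ℤ._+_ (ℤ.+ n)) (sym (ℤₚ.pos-* s a))) (cong (ℤ._+_ (ℤ.+ n)) (sym (ℤₚ.pos-* t b)))))
      (Signed.∣m∣n⇒∣m-n (Signed.∣m⇒∣m*n (ℤ.+ a) h) (Signed.∣n⇒∣m*n (ℤ.+ t) (subst (𝔭 ∣ˢ_) (cong ℤ.+_ (sym a+b≡p)) Signed.∣-refl)))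
      where
      identity : ∀ n s t a b → (s ℤ.+ t) ℤ.* a ℤ.- t ℤ.* (a ℤ.+ b) ≡ (n ℤ.+ s ℤ.* a) ℤ.- (n ℤ.+ t ℤ.* b)
      identity = ℤSolver.solve-∀

  even-lin : ∀ k c → k ≤ d → Even (lin k c)
  even-lin zero c k≤d = even-⊕ {𝟏} {⊖ 𝟏} (λ s t _ u mu n → refl) (λ s t _ u mu n → refl)
  even-lin (suc k) c k<d = even-⊕ {lin k c} {int (c k) ⊗ η k} (even-lin k c (<⇒≤ k<d)) (even-⊗ {int (c k)} {η k} (even-int (c k)) (even-η k k<d))

  ∑ℤ-single : ∀ k f j → j < k → (∀ i → i < k → i ≢ j → f i ≡ 0ℤ) → ∑ℤ k f ≡ f j
  ∑ℤ-single (suc k) f j j<k h with j ≟ k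
  ... | yes refl = trans (cong (ℤ._+ f k) (trans (∑ℤ-cong k (λ i i<k → h i (m≤n⇒m≤1+n i<k) (<⇒≢ i<k))) (∑ℤ-zero k))) (ℤₚ.+-identityˡ (f k))
  ... | no j≢k = trans (cong₂ ℤ._+_ (∑ℤ-single k f j (≤∧≢⇒< (≤-pred j<k) j≢k) (λ i i<k → h i (m≤n⇒m≤1+n i<k))) (h k ≤-refl (≢-sym j≢k))) (ℤₚ.+-identityʳ (f j))
    where
    ≢-sym : ∀ {a b : ℕ} → a ≢ b → b ≢ a
    ≢-sym a≢b e = a≢b (sym e)

  -- The functional reading off the coefficient of η j is evaluation at 0 of the sequence δ (n + (p − j − 1)) − δ n.
  lin-injective : ∀ c → (∀ u → M u → ∀ n → act (lin d c) u n ≡ 0ℤ) → ∀ j → j < d → c j ≡ 0ℤ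
  lin-injective c h j j<d = trans (sym (trans (∑ℤ-single d (λ k → c k ℤ.* act (η k) v 0) j j<d
      (λ k k<d k≢j → trans (cong (ℤ._*_ (c k)) (trans (η-v k k<d) (δ-no (other k k<d k≢j)))) (ℤₚ.*-zeroʳ (c k))))
      (trans (cong (ℤ._*_ (c j)) (trans (η-v j j<d) (δ-yes (subst (p ∣_) (sym j+a≡p) ∣-refl)))) (ℤₚ.*-identityʳ (c j)))))
    (trans (sym (act-lin d c v 0)) (h v (M-act (⊖ geo 1 a) M-u₁) 0))
    where
    a = d + d ∸ j
    j≤2d : j ≤ d + d
    j≤2d = ≤-trans (<⇒≤ j<d) (m≤m+n d d)
    j+a≡p : suc j + a ≡ p
    j+a≡p = cong suc (m+[n∸m]≡n j≤2d)
    v : ℕ → ℤ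
    v = act (⊖ geo 1 a) u₁
    v≡ : ∀ n → v n ≡ δ (n + a) ℤ.- δ n
    v≡ n = trans (cong ℤ.-_ (act-geo-Δ a δ n)) (flip- (δ n) (δ (n + a)))
      where
      flip- : ∀ x y → ℤ.- (x ℤ.- y) ≡ y ℤ.- x
      flip- = ℤSolver.solve-∀
    v-nonzero : ∀ n → 1 ≤ n → n < p → v n ≡ δ (n + a)
    v-nonzero n 1≤n n<p = trans (v≡ n) (trans (cong (ℤ._-_ (δ (n + a))) (δ-no (∤-small 1≤n n<p))) (ℤₚ.+-identityʳ _))
    d≤2d∸ : ∀ k → k < d → d < d + d ∸ k
    d≤2d∸ k k<d = +-cancelʳ-≤ k _ _ (≤-trans (≤-reflexive (sym (+-suc d k))) (≤-trans (+-monoʳ-≤ d k<d) (≤-reflexive (sym (m∸n+n≡m (≤-trans (<⇒≤ k<d) (m≤m+n d d)))))))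
    η-v : ∀ k → k < d → act (η k) v 0 ≡ δ (suc k + a)
    η-v k k<d = trans (act-η k v 0) (trans (cong₂ ℤ._+_ (v-nonzero (suc k) (s≤s z≤n) (s≤s (≤-trans k<d (m≤m+n d d))))
        (trans (v-nonzero (d + d ∸ k) (≤-trans (s≤s z≤n) (d≤2d∸ k k<d)) (s≤s (m∸n≤m (d + d) k))) (δ-no high)))
      (ℤₚ.+-identityʳ _))
      where
      high : ¬ p ∣ d + d ∸ k + a
      high h = ∤-small {suc k + suc j} (s≤s z≤n) (s≤s (≤-trans (+-mono-≤ k<d j<d) ≤-refl)) (∣m+n∣m⇒∣n (subst (p ∣_) total (∣m∣n⇒∣m+n ∣-refl ∣-refl)) h)
        where
        total : p + p ≡ d + d ∸ k + a + (suc k + suc j)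
        total = trans (cong₂ _+_ (sym (cong suc (m+[n∸m]≡n (≤-trans (<⇒≤ k<d) (m≤m+n d d))))) (sym j+a≡p)) (regroup k (d + d ∸ k) j a)
          where
          regroup : ∀ k x j a → suc k + x + (suc j + a) ≡ x + a + (suc k + suc j)
          regroup = solve-∀
    other : ∀ k → k < d → k ≢ j → ¬ p ∣ suc k + a
    other k k<d k≢j h with <-cmp k j
    ... | tri≈ _ k≡j _ = k≢j k≡j
    ... | tri< k<j _ _ = ∤-small {suc k + a} (s≤s z≤n) (<-≤-trans (+-monoˡ-< a (s≤s k<j)) (≤-reflexive j+a≡p)) h
    ... | tri> _ _ j<k = ∤-small {k ∸ j} (m<n⇒0<n∸m j<k) (≤-trans (s≤s (≤-trans (m∸n≤m k j) (<⇒≤ k<d))) (s≤s (m≤m+n d d)))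
          (∣m+n∣m⇒∣n (subst (p ∣_) (trans (cong suc (trans (cong (_+ a) (sym (m+[n∸m]≡n (<⇒≤ j<k)))) (regroup j (k ∸ j) a))) (cong (_+ (k ∸ j)) j+a≡p)) h) ∣-refl)
      where
      regroup : ∀ x y z → x + y + z ≡ x + z + y
      regroup = solve-∀

*-^ : ∀ d a b → (a * b) ^ d ≡ a ^ d * b ^ d
*-^ zero a b = refl
*-^ (suc d) a b = trans (cong (a * b *_) (*-^ d a b)) (interchange a b (a ^ d) (b ^ d))
  where
  interchange : ∀ a b x y → a * b * (x * y) ≡ a * x * (b * y)
  interchange = solve-∀

abs-difference : ∀ {a b e} → a ≤ b + e → b ≤ a + e → ∣ ℤ.+ a ℤ.- ℤ.+ b ∣ ≤ e
abs-difference {a} {b} {e} a≤ b≤ with ≤-total b a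
... | inj₁ b≤a = subst (_≤ e) (sym (cong ∣_∣ (trans (ℤₚ.m-n≡m⊖n a b) (ℤₚ.⊖-≥ b≤a)))) (m≤n+o⇒m∸n≤o a b a≤)
... | inj₂ a≤b = subst (_≤ e) (sym (trans (cong ∣_∣ (trans (ℤₚ.m-n≡m⊖n a b) (ℤₚ.⊖-≤ a≤b))) (ℤₚ.∣-i∣≡∣i∣ (ℤ.+ (b ∸ a))))) (m≤n+o⇒m∸n≤o b a b≤)

-- How often a prime divides the norms of a family

module NormFamily (d : ℕ) (p-prime : Prime (suc (d + d))) where
  open Cyclotomic d p-prime
  open CyclotomicNorm d p-prime
  open CyclotomicField d p-prime
  open CyclotomicCount d p-prime
  open RealSubfield d p-prime
  open Digits d

  -- The elements η k have total size 2d; the remaining 2 + 4d pays for the two units of size that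
  -- `𝟎` and each `int` add.
  κ : ℕ
  κ = 2 + 6 * d

  K₀ : ℕ
  K₀ = κ ^ d

  K₀≥1 : 1 ≤ K₀
  K₀≥1 = m^n>0 κ d

  κ-bound : ∀ j → (κ * 2 ^ j) ^ d ≡ K₀ * B ^ j
  κ-bound j = trans (*-^ d κ (2 ^ j)) (cong (K₀ *_) (trans (^-*-assoc 2 j d) (trans (cong (2 ^_) (*-comm j d)) (sym (^-*-assoc 2 d j)))))

  ‖lin‖-bound : ∀ c j → (∀ i → ∣ c i ∣ ≤ 2 ^ j) → ‖ lin d c ‖ ≤ κ * 2 ^ j
  ‖lin‖-bound c j h = ≤-trans (‖lin‖ d c (2 ^ j) h) (begin
    2 + d * ((2 ^ j + 2) * 2)             ≡⟨ expand d (2 ^ j) ⟩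
    (2 + 4 * d) * 1 + 2 * d * 2 ^ j       ≤⟨ +-monoˡ-≤ _ (*-monoʳ-≤ (2 + 4 * d) (m^n>0 2 j)) ⟩
    (2 + 4 * d) * 2 ^ j + 2 * d * 2 ^ j   ≡⟨ collect d (2 ^ j) ⟩
    κ * 2 ^ j                             ∎)
    where
    open ≤-Reasoning
    expand : ∀ d x → 2 + d * ((x + 2) * 2) ≡ (2 + 4 * d) * 1 + 2 * d * x
    expand = solve-∀
    collect : ∀ d x → (2 + 4 * d) * x + 2 * d * x ≡ (2 + 6 * d) * x
    collect = solve-∀

  module _ (A V m : ℕ) where

    point : ℕ → Expr
    point b = lin d (λ i → ℤ.+ coord m b i)

    -- A and V fix the residue A^d of the norm modulo V, while the d coordinates of b vary freely.
    α : ℕ → Expr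
    α b = nat A ⊕ nat V ⊗ point b

    β : ℕ → ℕ → Expr
    β b b′ = lin d (λ i → ℤ.+ coord m b i ℤ.- ℤ.+ coord m b′ i)

    even-α : ∀ b → Even (α b)
    even-α b = even-⊕ {nat A} {nat V ⊗ point b} (even-nat A) (even-⊗ {nat V} {point b} (even-nat V) (even-lin d _ ≤-refl))

    even-β : ∀ b b′ → Even (β b b′)
    even-β b b′ = even-lin d _ ≤-refl

    act-β : ∀ b b′ u n → act (β b b′) u n ≡ act (point b) u n ℤ.- act (point b′) u n
    act-β b b′ u n = trans (act-lin d _ u n) (trans (∑ℤ-cong d (λ j _ → distrib (ℤ.+ coord m b j) (ℤ.+ coord m b′ j) (act (η j) u n)))
      (trans (∑ℤ-- d _ _) (sym (cong₂ ℤ._-_ (act-lin d _ u n) (act-lin d _ u n)))))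
      where
      distrib : ∀ x y z → (x ℤ.- y) ℤ.* z ≡ x ℤ.* z ℤ.- y ℤ.* z
      distrib = ℤSolver.solve-∀

    act-α- : ∀ b b′ u n → act (α b ⊕ ⊖ α b′) u n ≡ ℤ.+ V ℤ.* act (β b b′) u n
    act-α- b b′ u n = trans (cong (λ z → act (nat A) u n ℤ.+ act (nat V) (act (point b) u) n ℤ.- (act (nat A) u n ℤ.+ z)) (act-nat V (act (point b′) u) n))
      (trans (cong (λ z → act (nat A) u n ℤ.+ z ℤ.- (act (nat A) u n ℤ.+ ℤ.+ V ℤ.* act (point b′) u n)) (act-nat V (act (point b) u) n))
        (trans (identity (act (nat A) u n) (ℤ.+ V) (act (point b) u n) (act (point b′) u n)) (cong (ℤ._*_ (ℤ.+ V)) (sym (act-β b b′ u n)))))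
      where
      identity : ∀ a v x y → a ℤ.+ v ℤ.* x ℤ.- (a ℤ.+ v ℤ.* y) ≡ v ℤ.* (x ℤ.- y)
      identity = ℤSolver.solve-∀

    norm-α- : ∀ b b′ → norm (α b ⊕ ⊖ α b′) ≡ (ℤ.+ V) ℤ.^ d ℤ.* norm (β b b′)
    norm-α- b b′ = norm-scale (ℤ.+ V) (α b ⊕ ⊖ α b′) (β b b′) (act-α- b b′)

    norm-β≢0 : ∀ b b′ → b < B ^ m → b′ < B ^ m → b ≢ b′ → norm (β b b′) ≢ 0ℤ
    norm-β≢0 b b′ b< b′< b≢b′ e = b≢b′ (coord-injective m b b′ b< b′< (λ i i<d →
      ℤₚ.+-injective (ℤₚ.i-j≡0⇒i≡j (ℤ.+ coord m b i) (ℤ.+ coord m b′ i) (lin-injective _ (norm≡0⇒≐𝟎 (β b b′) (even-β b b′) e) i i<d))))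

    norm-β-bound : ∀ j b b′ → cell j b ≡ cell j b′ → ∣ norm (β b b′) ∣ ≤ K₀ * B ^ j
    norm-β-bound j b b′ e = ≤-trans (norm-bound (β b b′)) (≤-trans (^-monoˡ-≤ d (‖lin‖-bound _ j (λ i →
      abs-difference (<⇒≤ (coord-close m j b b′ i e)) (<⇒≤ (coord-close m j b′ b i (sym e)))))) (≤-reflexive (κ-bound j)))

    module _ {q : ℕ} (pq : Prime q) (q∤V : ¬ q ∣ V) (Q : ℕ) (lift : ∀ b b′ → ℤ.+ q ∣ˢ norm (β b b′) → Q ∣ ∣ norm (β b b′) ∣) where

      -- Two points in a cell of side 2^j have a difference whose norm is nonzero and below Q, hence
      -- by `lift` prime to q. Now `norm-difference` excludes d + 1 points with norms divisible by
      -- q. Q will be q itself, or q² for q ≢ ±1.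
      few-in-cell : ∀ j c → K₀ * B ^ j < Q → Few (λ b → b < B ^ m × cell j b ≡ c × ℤ.+ q ∣ˢ norm (α b)) d
      few-in-cell j c small l ul al = ≮⇒≥ λ d<l → norm-difference pq (λ i → α (at d<l i))
          (λ i i′ → even-⊕ {α (at d<l i)} {⊖ α (at d<l i′)} (even-α (at d<l i)) (even-⊖ {α (at d<l i′)} (even-α (at d<l i′))))
          (λ i → ∣⇒≈𝟎 {ℤ.+ q} {𝐍 (α (at d<l i))} (λ u mu n → subst (ℤ.+ q ∣ˢ_) (sym (act-𝐍 {α (at d<l i)} (even-α (at d<l i)) u mu n)) (Signed.∣m⇒∣m*n (u n) (proj₂ (proj₂ (props d<l i))))))
          (indivisible d<l)
        where
        at : d < length l → Fin (suc d) → ℕ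
        at d<l i = lookup l (inject≤ i d<l)
        props : ∀ d<l i → at d<l i < B ^ m × cell j (at d<l i) ≡ c × ℤ.+ q ∣ˢ norm (α (at d<l i))
        props d<l i = All.lookup al (∈-lookup (inject≤ i d<l))
        indivisible : ∀ d<l i i′ → toℕ i < toℕ i′ → ¬ ℤ.+ q ∣ˢ norm (α (at d<l i) ⊕ ⊖ α (at d<l i′))
        indivisible d<l i i′ i<i′ h = <-irrefl refl (<-≤-trans small (≤-trans (∣⇒≤ {{≢-nonZero (λ e → norm≢0 (ℤₚ.∣i∣≡0⇒i≡0 e))}} (lift b b′ q∣normβ)) (norm-β-bound j b b′ (trans (proj₁ (proj₂ (props d<l i))) (sym (proj₁ (proj₂ (props d<l i′))))))))
          where
          b = at d<l i
          b′ = at d<l i′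
          norm≢0 : norm (β b b′) ≢ 0ℤ
          norm≢0 = norm-β≢0 b b′ (proj₁ (props d<l i)) (proj₁ (props d<l i′))
            (lookup-distinct ul (inject≤ i d<l) (inject≤ i′ d<l) (subst₂ _<_ (sym (Fin.toℕ-inject≤ i d<l)) (sym (Fin.toℕ-inject≤ i′ d<l)) i<i′))
          q∣normβ : ℤ.+ q ∣ˢ norm (β b b′)
          q∣normβ = [ (λ q∣V^d → contradiction (Signed.∣⇒∣ᵤ (prime∣ᶻ^ pq (ℤ.+ V) d q∣V^d)) q∤V) , id ]′
            (prime∣ᶻ* pq ((ℤ.+ V) ℤ.^ d) (norm (β b b′)) (subst (ℤ.+ q ∣ˢ_) (norm-α- b b′) h))

      few-divisible-cells : ∀ j → j ≤ m → K₀ * B ^ j < Q → Few (λ b → b < B ^ m × ℤ.+ q ∣ˢ norm (α b)) (B ^ (m ∸ j) * d)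
      few-divisible-cells j j≤m small = few-⊆ (λ { b (b< , h) → suc (cell j b) , s≤s z≤n , cell-bound m j b j≤m b< , b< , refl , h })
        (few-mono (≤-reflexive (∑-const (B ^ (m ∸ j)) d)) (few-⋃ {λ i b → b < B ^ m × cell j b ≡ pred i × ℤ.+ q ∣ˢ norm (α b)} (B ^ (m ∸ j)) (λ i _ _ → few-in-cell j (pred i) small)))

      largest-cell : ∀ k → K₀ < Q → ∃[ j ] (j ≤ k × K₀ * B ^ j < Q × (j ≡ k ⊎ Q ≤ K₀ * B ^ suc j))
      largest-cell zero K₀<Q = 0 , z≤n , subst (_< Q) (sym (*-identityʳ K₀)) K₀<Q , inj₁ refl
      largest-cell (suc k) K₀<Q with largest-cell k K₀<Q
      ... | j , j≤k , small , inj₂ big = j , m≤n⇒m≤1+n j≤k , small , inj₂ big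
      ... | j , j≤k , small , inj₁ refl with K₀ * B ^ suc j <? Q
      ...   | yes small′ = suc j , ≤-refl , small′ , inj₁ refl
      ...   | no big = j , n≤1+n j , small , inj₂ (≮⇒≥ big)

      -- For the largest admissible side, either one cell contains everything or Q ≤ K₀ B^(j+1),
      -- which bounds the number of cells. Up to constants this is the number of multiples of Q
      -- among B^m integers.
      few-divisible : K₀ < Q → Few (λ b → b < B ^ m × ℤ.+ q ∣ˢ norm (α b)) (d * (1 + multiples (K₀ * B * B ^ m) Q))
      few-divisible K₀<Q with largest-cell m K₀<Q
      ... | j , j≤m , small , big = few-mono (≤-trans (≤-reflexive (*-comm (B ^ (m ∸ j)) d)) (*-monoʳ-≤ d (bound big))) (few-divisible-cells j j≤m small)
        where
        open ≤-Reasoning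
        bound : j ≡ m ⊎ Q ≤ K₀ * B ^ suc j → B ^ (m ∸ j) ≤ 1 + multiples (K₀ * B * B ^ m) Q
        bound (inj₁ refl) = ≤-trans (≤-reflexive (cong (B ^_) (n∸n≡0 j))) (s≤s z≤n)
        bound (inj₂ Q≤) = m≤n⇒m≤1+n (multiples-max Q (≤-trans K₀≥1 (<⇒≤ K₀<Q)) (begin
          B ^ (m ∸ j) * Q                    ≤⟨ *-monoʳ-≤ (B ^ (m ∸ j)) Q≤ ⟩
          B ^ (m ∸ j) * (K₀ * (B * B ^ j))   ≡⟨ regroup (B ^ (m ∸ j)) K₀ B (B ^ j) ⟩
          K₀ * B * (B ^ (m ∸ j) * B ^ j)     ≡⟨ cong (K₀ * B *_) (trans (sym (^-distribˡ-+-* B (m ∸ j) j)) (cong (B ^_) (m∸n+n≡m j≤m))) ⟩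
          K₀ * B * B ^ m                     ∎))
          where
          regroup : ∀ x k b y → x * (k * (b * y)) ≡ k * b * (x * y)
          regroup = solve-∀

-- A residue with d-th power -1, and positivity of norms

module MinusOneClass (d : ℕ) (p-prime : Prime (suc (d + d))) where
  open Cyclotomic d p-prime
  open CyclotomicNorm d p-prime
  open CyclotomicField d p-prime
  open CyclotomicCount d p-prime
  open NormFamily d p-prime
  open Digits d

  d≥1 : 1 ≤ d
  d≥1 = n≢0⇒n>0 λ { refl → ¬prime[1] p-prime }

  data Monic : ℕ → (ℤ → ℤ) → Set where
    one : ∀ {f} → (∀ x → f x ≡ 1ℤ) → Monic 0 f
    horner : ∀ {k f} g c → Monic k g → (∀ x → f x ≡ x ℤ.* g x ℤ.+ c) → Monic (suc k) f

  monic-factor : ∀ {k f} → Monic (suc k) f → ∀ a → ∃[ h ] (Monic k h × (∀ x → f x ℤ.- f a ≡ (x ℤ.- a) ℤ.* h x))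
  monic-factor {zero} {f} (horner g c (one g≡1) f≡) a = g , one g≡1 , λ x → trans (cong₂ ℤ._-_ (trans (f≡ x) (cong (λ z → x ℤ.* z ℤ.+ c) (g≡1 x))) (trans (f≡ a) (cong (λ z → a ℤ.* z ℤ.+ c) (g≡1 a))))
    (trans (identity x a c) (cong (ℤ._*_ (x ℤ.- a)) (sym (g≡1 x))))
    where
    identity : ∀ x a c → (x ℤ.* 1ℤ ℤ.+ c) ℤ.- (a ℤ.* 1ℤ ℤ.+ c) ≡ (x ℤ.- a) ℤ.* 1ℤ
    identity = ℤSolver.solve-∀
  monic-factor {suc k} {f} (horner g c mg f≡) a = let (h , mh , h≡) = monic-factor mg a in
    (λ x → x ℤ.* h x ℤ.+ g a) , horner h (g a) mh (λ x → refl) , λ x → trans (cong₂ ℤ._-_ (f≡ x) (f≡ a)) (trans (split x a c (g x) (g a)) (trans (cong (λ z → x ℤ.* z ℤ.+ (x ℤ.- a) ℤ.* g a) (h≡ x)) (collect x a (h x) (g a))))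
    where
    split : ∀ x a c gx ga → (x ℤ.* gx ℤ.+ c) ℤ.- (a ℤ.* ga ℤ.+ c) ≡ x ℤ.* (gx ℤ.- ga) ℤ.+ (x ℤ.- a) ℤ.* ga
    split = ℤSolver.solve-∀
    collect : ∀ x a h ga → x ℤ.* ((x ℤ.- a) ℤ.* h) ℤ.+ (x ℤ.- a) ℤ.* ga ≡ (x ℤ.- a) ℤ.* (x ℤ.* h ℤ.+ ga)
    collect = ℤSolver.solve-∀

  -- Lagrange's argument for consecutive roots: once a is split off, the other roots differ from it
  -- by less than p and remain roots of the quotient.
  too-many-roots : ∀ {k f} → Monic k f → ∀ a → k < p → (∀ i → i ≤ k → 𝔭 ∣ˢ f (ℤ.+ (a + i))) → ⊥
  too-many-roots {zero} {f} (one f≡1) a _ roots = prime∤ᶻ1 p-prime (subst (𝔭 ∣ˢ_) (f≡1 _) (roots 0 z≤n))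
  too-many-roots {suc k} {f} mf a k<p roots = let (h , mh , h≡) = monic-factor mf (ℤ.+ a) in
    too-many-roots mh (suc a) (<-trans (n<1+n k) k<p) (λ i i≤k → [ (λ p∣i → contradiction (Signed.∣⇒∣ᵤ p∣i) (∤-small {suc i} (s≤s z≤n) (<-≤-trans (s≤s (s≤s i≤k)) k<p))) , id ]′
      (prime∣ᶻ* p-prime (ℤ.+ suc i) (h (ℤ.+ (suc a + i))) (subst (𝔭 ∣ˢ_) (step h h≡ i) (Signed.∣m∣n⇒∣m-n (roots (suc i) (s≤s i≤k)) (subst (λ z → 𝔭 ∣ˢ f (ℤ.+ z)) (+-identityʳ a) (roots 0 z≤n))))))
    where
    step : ∀ h → (∀ x → f x ℤ.- f (ℤ.+ a) ≡ (x ℤ.- ℤ.+ a) ℤ.* h x) → ∀ i → f (ℤ.+ (a + suc i)) ℤ.- f (ℤ.+ a) ≡ ℤ.+ suc i ℤ.* h (ℤ.+ (suc a + i))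
    step h h≡ i = trans (h≡ _) (cong₂ ℤ._*_ (identity (ℤ.+ a) (ℤ.+ suc i)) (cong (h ∘ ℤ.+_) (+-suc a i)))
      where
      identity : ∀ x y → x ℤ.+ y ℤ.- x ≡ y
      identity = ℤSolver.solve-∀

  monic-power : ∀ k → Monic k (λ x → x ℤ.^ k)
  monic-power zero = one (λ x → refl)
  monic-power (suc k) = horner (ℤ._^ k) 0ℤ (monic-power k) (λ x → sym (ℤₚ.+-identityʳ _))

  monic-power-1 : ∀ k → 1 ≤ k → Monic k (λ x → x ℤ.^ k ℤ.- 1ℤ)
  monic-power-1 (suc k) _ = horner (ℤ._^ k) ℤ.-1ℤ (monic-power k) (λ x → refl)

  -- The polynomial x^d - 1 has at most d roots modulo p, so some g ≤ d + 1 is not among them.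
  -- Fermat's theorem gives g^(2d) ≡ 1, which leaves g^d ≡ -1.
  nonresidue : ∃[ g ] (1 ≤ g × 𝔭 ∣ˢ ((ℤ.+ g) ℤ.^ d ℤ.+ 1ℤ))
  nonresidue with search (λ i → ¬? (𝔭 Signed.∣? ((ℤ.+ i) ℤ.^ d ℤ.- 1ℤ))) (suc d)
  ... | inj₂ none = ⊥-elim (too-many-roots (monic-power-1 d d≥1) 1 (s≤s (m≤m+n d d)) (λ i i≤d → stable (none (suc i) (s≤s z≤n) (s≤s i≤d))))
    where
    stable : ∀ {z} → ¬ ¬ 𝔭 ∣ˢ z → 𝔭 ∣ˢ z
    stable {z} ¬¬h with 𝔭 Signed.∣? z
    ... | yes h = h
    ... | no ¬h = contradiction ¬h ¬¬h
  ... | inj₁ (g , 1≤g , g≤ , ¬residue) = g , 1≤g , [ (λ h → contradiction h ¬residue) , id ]′ (prime∣ᶻ* p-prime (x ℤ.- 1ℤ) (x ℤ.+ 1ℤ)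
      ([ (λ p∣g → contradiction (Signed.∣⇒∣ᵤ p∣g) (∤-small {g} 1≤g (<-≤-trans (s≤s g≤) (s≤s (+-monoˡ-≤ d d≥1))))) , id ]′
        (prime∣ᶻ* p-prime (ℤ.+ g) ((x ℤ.- 1ℤ) ℤ.* (x ℤ.+ 1ℤ)) (subst (𝔭 ∣ˢ_) (trans (cong (λ z → ℤ.+ g ℤ.* z ℤ.- ℤ.+ g) (ℤₚ.^-distribˡ-+-* (ℤ.+ g) d d)) (identity (ℤ.+ g) x)) (fermat (ℤ.+ g))))))
    where
    x = (ℤ.+ g) ℤ.^ d
    identity : ∀ g x → g ℤ.* (x ℤ.* x) ℤ.- g ≡ g ℤ.* ((x ℤ.- 1ℤ) ℤ.* (x ℤ.+ 1ℤ))
    identity = ℤSolver.solve-∀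

  ∣-power : ∀ {m} x y k → m ∣ˢ (x ℤ.- y) → m ∣ˢ (x ℤ.^ k ℤ.- y ℤ.^ k)
  ∣-power x y zero h = Signed.divides 0ℤ refl
  ∣-power {m} x y (suc k) h = subst (m ∣ˢ_) (identity x y (x ℤ.^ k) (y ℤ.^ k)) (Signed.∣m∣n⇒∣m+n (Signed.∣m⇒∣m*n (x ℤ.^ k) h) (Signed.∣n⇒∣m*n y (∣-power x y k h)))
    where
    identity : ∀ x y a b → (x ℤ.- y) ℤ.* a ℤ.+ y ℤ.* (a ℤ.- b) ≡ x ℤ.* a ℤ.- y ℤ.* b
    identity = ℤSolver.solve-∀

  -- Expanding the product of the A + f i, all terms but A^k add up to at most (A + s)^k - A^k. The
  -- second bound supports the induction.
  Π-close : ∀ {k} (f g : Fin k → Expr) A s → (∀ i v n → act (g i) v n ≡ ℤ.+ A ℤ.* v n ℤ.+ act (f i) v n) → (∀ i → ‖ f i ‖ ≤ s) →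
    ∀ u → (∀ n → ∣ u n ∣ ≤ 1) → ∀ n → ∣ act (Π g) u n ℤ.- (ℤ.+ A) ℤ.^ k ℤ.* u n ∣ + A ^ k ≤ (A + s) ^ k × ∣ act (Π g) u n ∣ ≤ (A + s) ^ k
  Π-close {zero} f g A s h f≤ u u≤1 n = ≤-reflexive (cong (λ z → ∣ z ∣ + 1) (identity (u n))) , u≤1 n
    where
    identity : ∀ x → x ℤ.- 1ℤ ℤ.* x ≡ 0ℤ
    identity = ℤSolver.solve-∀
  Π-close {suc k} f g A s h f≤ u u≤1 n = close , size
    where
    open ≤-Reasoning
    v = act (Π (g ∘ fsuc)) u
    IH : ∀ n → ∣ v n ℤ.- (ℤ.+ A) ℤ.^ k ℤ.* u n ∣ + A ^ k ≤ (A + s) ^ k × ∣ v n ∣ ≤ (A + s) ^ k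
    IH = Π-close (f ∘ fsuc) (g ∘ fsuc) A s (h ∘ fsuc) (f≤ ∘ fsuc) u u≤1
    e = act (f fzero) v n
    e≤ : ∣ e ∣ ≤ s * (A + s) ^ k
    e≤ = ≤-trans (act-bound (f fzero) v ((A + s) ^ k) (λ n → proj₂ (IH n)) n) (*-monoˡ-≤ ((A + s) ^ k) (f≤ fzero))
    D = v n ℤ.- (ℤ.+ A) ℤ.^ k ℤ.* u n
    identity : ∀ a v e x u → a ℤ.* v ℤ.+ e ℤ.- a ℤ.* x ℤ.* u ≡ a ℤ.* (v ℤ.- x ℤ.* u) ℤ.+ e
    identity = ℤSolver.solve-∀
    close : ∣ act (g fzero) v n ℤ.- (ℤ.+ A) ℤ.^ suc k ℤ.* u n ∣ + A ^ suc k ≤ (A + s) ^ suc k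
    close = begin
      ∣ act (g fzero) v n ℤ.- (ℤ.+ A) ℤ.^ suc k ℤ.* u n ∣ + A ^ suc k
        ≡⟨ cong (λ z → ∣ z ∣ + A ^ suc k) (trans (cong (ℤ._- (ℤ.+ A) ℤ.^ suc k ℤ.* u n) (h fzero v n)) (identity (ℤ.+ A) (v n) e ((ℤ.+ A) ℤ.^ k) (u n))) ⟩
      ∣ ℤ.+ A ℤ.* D ℤ.+ e ∣ + A * A ^ k
        ≤⟨ +-monoˡ-≤ (A * A ^ k) (≤-trans (ℤₚ.∣i+j∣≤∣i∣+∣j∣ (ℤ.+ A ℤ.* D) e) (+-mono-≤ (≤-reflexive (ℤₚ.abs-* (ℤ.+ A) D)) e≤)) ⟩
      A * ∣ D ∣ + s * (A + s) ^ k + A * A ^ k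
        ≡⟨ regroup A ∣ D ∣ (s * (A + s) ^ k) (A ^ k) ⟩
      A * (∣ D ∣ + A ^ k) + s * (A + s) ^ k
        ≤⟨ +-monoˡ-≤ (s * (A + s) ^ k) (*-monoʳ-≤ A (proj₁ (IH n))) ⟩
      A * (A + s) ^ k + s * (A + s) ^ k
        ≡⟨ sym (*-distribʳ-+ ((A + s) ^ k) A s) ⟩
      (A + s) ^ suc k ∎
      where
      regroup : ∀ a x y z → a * x + y + a * z ≡ a * (x + z) + y
      regroup = solve-∀
    size : ∣ act (g fzero) v n ∣ ≤ (A + s) ^ suc k
    size = begin
      ∣ act (g fzero) v n ∣              ≡⟨ cong ∣_∣ (h fzero v n) ⟩
      ∣ ℤ.+ A ℤ.* v n ℤ.+ e ∣            ≤⟨ ℤₚ.∣i+j∣≤∣i∣+∣j∣ (ℤ.+ A ℤ.* v n) e ⟩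
      ∣ ℤ.+ A ℤ.* v n ∣ + ∣ e ∣          ≤⟨ +-mono-≤ (≤-trans (≤-reflexive (ℤₚ.abs-* (ℤ.+ A) (v n))) (*-monoʳ-≤ A (proj₂ (IH n)))) e≤ ⟩
      A * (A + s) ^ k + s * (A + s) ^ k  ≡⟨ sym (*-distribʳ-+ ((A + s) ^ k) A s) ⟩
      (A + s) ^ suc k                    ∎

  -- Bernoulli's inequality (1 + s/A)^k ≤ 1 / (1 - ks/A) for A = D + ks; each step of the induction
  -- moves one s into D.
  power-growth : ∀ s k D → (D + k * s + s) ^ k * D ≤ (D + k * s) ^ k * (D + k * s)
  power-growth s zero D = ≤-reflexive (cong (1 *_) (sym (+-identityʳ D)))
  power-growth s (suc k) D = begin
    (A + s) * (A + s) ^ k * D              ≡⟨ regroup (A + s) ((A + s) ^ k) D ⟩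
    (A + s) ^ k * ((A + s) * D)            ≤⟨ *-monoʳ-≤ ((A + s) ^ k) (≤-trans (≤-reflexive (*-distribʳ-+ D A s)) (≤-trans (+-monoʳ-≤ (A * D) (≤-trans (*-monoʳ-≤ s (m≤m+n D _)) (≤-reflexive (*-comm s A)))) (≤-reflexive (sym (*-distribˡ-+ A D s))))) ⟩
    (A + s) ^ k * (A * (D + s))            ≡⟨ regroup′ ((A + s) ^ k) A (D + s) ⟩
    A * ((A + s) ^ k * (D + s))            ≤⟨ *-monoʳ-≤ A (subst (λ z → (z + s) ^ k * (D + s) ≤ z ^ k * z) (shift D s (k * s)) (power-growth s k (D + s))) ⟩
    A * (A ^ k * A)                        ≡⟨ sym (*-assoc A (A ^ k) A) ⟩
    A ^ suc k * A                          ∎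
    where
    open ≤-Reasoning
    A = D + suc k * s
    regroup : ∀ x y z → x * y * z ≡ y * (x * z)
    regroup = solve-∀
    regroup′ : ∀ x y z → x * (y * z) ≡ y * (x * z)
    regroup′ = solve-∀
    shift : ∀ D s t → D + s + t ≡ D + (s + t)
    shift = solve-∀

  power-double : ∀ A s → 2 * (d * s) < A → (A + s) ^ d < 2 * A ^ d
  power-double A s h = *-cancelʳ-< D _ _ (begin-strict
    (A + s) ^ d * D         ≤⟨ subst (λ z → (z + s) ^ d * D ≤ z ^ d * z) D+ds≡A (power-growth s d D) ⟩
    A ^ d * A               <⟨ *-monoʳ-< (A ^ d) {{m^n≢0 A d {{>-nonZero (≤-<-trans z≤n h)}}}} A<2D ⟩
    A ^ d * (2 * D)         ≡⟨ regroup (A ^ d) D ⟩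
    2 * A ^ d * D           ∎)
    where
    open ≤-Reasoning
    D = A ∸ d * s
    ds≤A : d * s ≤ A
    ds≤A = ≤-trans (m≤m+n (d * s) _) (<⇒≤ h)
    D+ds≡A : D + d * s ≡ A
    D+ds≡A = m∸n+n≡m ds≤A
    A<2D : A < 2 * D
    A<2D = +-cancelʳ-< (2 * (d * s)) _ _ (begin-strict
      A + 2 * (d * s)           <⟨ +-monoʳ-< A h ⟩
      A + A                     ≡⟨ cong₂ _+_ (sym D+ds≡A) (sym D+ds≡A) ⟩
      D + d * s + (D + d * s)   ≡⟨ collect D (d * s) ⟩
      2 * D + 2 * (d * s)       ∎)
      where
      collect : ∀ D x → D + x + (D + x) ≡ 2 * D + 2 * x
      collect = solve-∀
    regroup : ∀ x D → x * (2 * D) ≡ 2 * x * D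
    regroup = solve-∀

  close⇒positive : ∀ z c → ∣ z ℤ.- ℤ.+ c ∣ < c → ∃[ N ] (z ≡ ℤ.+ N × 1 ≤ N)
  close⇒positive (ℤ.+ suc N) c h = suc N , refl , s≤s z≤n
  close⇒positive (ℤ.+ zero) c h = contradiction h (<-irrefl (trans (cong ∣_∣ (ℤₚ.+-identityˡ (ℤ.- ℤ.+ c))) (ℤₚ.∣-i∣≡∣i∣ (ℤ.+ c))))
  close⇒positive -[1+ n ] zero ()
  close⇒positive -[1+ n ] (suc c) h = contradiction (≤-<-trans (≤-trans (n≤1+n (suc c)) (s≤s (s≤s (m≤n+m c n)))) h) (<-irrefl refl)

  -- The sign matters: if the norm were -N ≡ -1, then N ≡ 1 might have prime factors ≡ 1 only. A
  -- dominates the rest, so the norm is within less than A^d of A^d.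
  large-norm-positive : ∀ A V m b s → ‖ nat V ⊗ point A V m b ‖ ≤ s → 2 * (d * s) < A → ∃[ N ] (norm (α A V m b) ≡ ℤ.+ N × 1 ≤ N)
  large-norm-positive A V m b s β≤s h = close⇒positive (norm (α A V m b)) (A ^ d) (+-cancelʳ-< (A ^ d) _ _ (begin-strict
      ∣ norm (α A V m b) ℤ.- ℤ.+ (A ^ d) ∣ + A ^ d                        ≡⟨ cong (λ z → ∣ norm (α A V m b) ℤ.- z ∣ + A ^ d) (sym (trans (cong (ℤ._*_ ((ℤ.+ A) ℤ.^ d)) u₁-0) (trans (ℤₚ.*-identityʳ _) (pos-^ d)))) ⟩
      ∣ norm (α A V m b) ℤ.- (ℤ.+ A) ℤ.^ d ℤ.* u₁ 0 ∣ + A ^ d             ≤⟨ proj₁ (Π-close {d} (λ i → σ (suc (toℕ i)) γ) (λ i → σ (suc (toℕ i)) (α A V m b)) A s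
          (λ i v n → cong (ℤ._+ act (σ (suc (toℕ i)) γ) v n) (act-σ-int (suc (toℕ i)) (ℤ.+ A) v n))
          (λ i → ≤-trans (≤-reflexive (‖σ‖ (suc (toℕ i)) γ)) β≤s) u₁ u₁-bound 0) ⟩
      (A + s) ^ d                                                         <⟨ power-double A s h ⟩
      2 * A ^ d                                                           ≡⟨ cong (A ^ d +_) (+-identityʳ (A ^ d)) ⟩
      A ^ d + A ^ d                                                       ∎))
    where
    open ≤-Reasoning
    γ = nat V ⊗ point A V m b
    pos-^ : ∀ k → (ℤ.+ A) ℤ.^ k ≡ ℤ.+ (A ^ k)
    pos-^ zero = refl
    pos-^ (suc k) = trans (cong (ℤ._*_ (ℤ.+ A)) (pos-^ k)) (sym (ℤₚ.pos-* A (A ^ k)))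

-- While a bound is proved, some element may be assumed to exist; it supplies facts contained in P,
-- such as the primality of a parameter.
few-inhabited : ∀ {P K} → (∀ n → P n → Few P K) → Few P K
few-inhabited h [] u a = z≤n
few-inhabited h (n ∷ l) u (p ∷ a) = h n p (n ∷ l) u (p ∷ a)

∑-tail-squares : ∀ Y y Z → 1 ≤ y → y * ∑ Z (λ q → 𝟙 (y <? q) * multiples Y (q * q)) ≤ Y
∑-tail-squares Y y Z 1≤y = begin
  y * ∑ Z f                                               ≤⟨ *-monoʳ-≤ y extend ⟩
  y * ∑ Z (λ i → multiples Y ((y + i) * (y + i)))         ≤⟨ ∑-inverse-squares Y y Z 1≤y ⟩
  Y                                                       ∎
  where
  open ≤-Reasoning
  f : ℕ → ℕ
  f q = 𝟙 (y <? q) * multiples Y (q * q)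
  extend : ∑ Z f ≤ ∑ Z (λ i → multiples Y ((y + i) * (y + i)))
  extend = begin
    ∑ Z f                                 ≤⟨ m≤m+n (∑ Z f) _ ⟩
    ∑ Z f + ∑ y (λ i → f (Z + i))         ≡⟨ sym (∑-split Z y f) ⟩
    ∑ (Z + y) f                           ≡⟨ cong (λ k → ∑ k f) (+-comm Z y) ⟩
    ∑ (y + Z) f                           ≡⟨ ∑-split y Z f ⟩
    ∑ y f + ∑ Z (λ i → f (y + i))         ≡⟨ cong (_+ ∑ Z (λ i → f (y + i))) (trans (∑-cong y (λ i _ i≤y → cong (_* multiples Y (i * i)) (𝟙-no (y <? i) (≤⇒≯ i≤y)))) (∑-zero y)) ⟩
    ∑ Z (λ i → f (y + i))                 ≤⟨ ∑-mono Z (λ i _ _ → ≤-trans (*-monoˡ-≤ _ (𝟙≤1 (y <? (y + i)))) (≤-reflexive (*-identityˡ _))) ⟩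
    ∑ Z (λ i → multiples Y ((y + i) * (y + i))) ∎

-- Of X, at most X / 8 goes to the primes, X / 8 to the squares and X / 4 to the summand 1, which
-- leaves X / 2 for d S.
main-term : ∀ d X π S s → 4 ≤ X → X ≤ d * (π + S + s) + 1 → 8 * (d * π) ≤ X → 8 * (d * s) ≤ X → X ≤ 2 * (d * S)
main-term d X π S s 4≤X X≤ π-small s-small = *-cancelˡ-≤ 4 (+-cancelʳ-≤ (4 * X) _ _ (begin
  4 * X + 4 * X                                               ≡⟨ double X ⟩
  8 * X                                                       ≤⟨ *-monoʳ-≤ 8 X≤ ⟩
  8 * (d * (π + S + s) + 1)                                   ≡⟨ expand d π S s ⟩
  8 * (d * π) + 4 * (2 * (d * S)) + 8 * (d * s) + 2 * 4       ≤⟨ +-mono-≤ (+-mono-≤ (+-monoˡ-≤ (4 * (2 * (d * S))) π-small) s-small) (*-monoʳ-≤ 2 4≤X) ⟩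
  X + 4 * (2 * (d * S)) + X + 2 * X                           ≡⟨ collect X (4 * (2 * (d * S))) ⟩
  4 * (2 * (d * S)) + 4 * X                                   ∎))
  where
  open ≤-Reasoning
  double : ∀ X → 4 * X + 4 * X ≡ 8 * X
  double = solve-∀
  expand : ∀ d π S s → 8 * (d * (π + S + s) + 1) ≡ 8 * (d * π) + 4 * (2 * (d * S)) + 8 * (d * s) + 2 * 4
  expand = solve-∀
  collect : ∀ X z → X + z + X + 2 * X ≡ z + 4 * X
  collect = solve-∀

-- Primes ≡ -1 from prime factors of norms

module MinusOnePrimes (d : ℕ) (p-prime : Prime (suc (d + d))) where
  open Cyclotomic d p-prime
  open CyclotomicNorm d p-prime
  open CyclotomicField d p-prime
  open CyclotomicCount d p-prime
  open NormFamily d p-prime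
  open MinusOneClass d p-prime
  open Digits d

  -- A product of primes ≡ 1 is ≡ 1, whereas N ≡ -1 and p > 2.
  non-unit-prime : ∀ N → 1 ≤ N → p ∣ suc N → ∃[ q ] (Prime q × q ∣ N × ¬ 𝔭 ∣ˢ (ℤ.+ q ℤ.- 1ℤ))
  non-unit-prime N 1≤N p∣sN = [ (λ (q , pq , q∣ , h) → q , pq , subst (q ∣_) (sym (PrimeFactorisation.isFactorisation F)) q∣ , h) , (λ h → contradiction h not-one) ]′ (scan (PrimeFactorisation.factors F) (PrimeFactorisation.factorsPrime F))
    where
    F = factorise N {{>-nonZero 1≤N}}
    scan : ∀ l → All Prime l → (∃[ q ] (Prime q × q ∣ product l × ¬ 𝔭 ∣ˢ (ℤ.+ q ℤ.- 1ℤ))) ⊎ 𝔭 ∣ˢ (ℤ.+ product l ℤ.- 1ℤ)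
    scan [] [] = inj₂ (Signed.divides 0ℤ refl)
    scan (q ∷ l) (pq ∷ pl) with 𝔭 Signed.∣? (ℤ.+ q ℤ.- 1ℤ) | scan l pl
    ... | no h | _ = inj₁ (q , pq , m∣m*n (product l) , h)
    ... | yes _ | inj₁ (r , pr , r∣ , h) = inj₁ (r , pr , ∣n⇒∣m*n q r∣ , h)
    ... | yes h | inj₂ k = inj₂ (subst (𝔭 ∣ˢ_) (trans (identity (ℤ.+ q) (ℤ.+ product l)) (cong (ℤ._- 1ℤ) (sym (ℤₚ.pos-* q (product l))))) (Signed.∣m∣n⇒∣m+n (Signed.∣m⇒∣m*n (ℤ.+ product l) h) k))
      where
      identity : ∀ x y → (x ℤ.- 1ℤ) ℤ.* y ℤ.+ (y ℤ.- 1ℤ) ≡ x ℤ.* y ℤ.- 1ℤ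
      identity = ℤSolver.solve-∀
    not-one : ¬ 𝔭 ∣ˢ (ℤ.+ product (PrimeFactorisation.factors F) ℤ.- 1ℤ)
    not-one h = ∤-small {2} (s≤s z≤n) (s≤s (+-mono-≤ d≥1 d≥1)) (Signed.∣⇒∣ᵤ (subst (𝔭 ∣ˢ_) (identity (ℤ.+ N)) (Signed.∣m∣n⇒∣m-n (Signed.∣ᵤ⇒∣ {𝔭} {ℤ.+ suc N} p∣sN) (subst (λ z → 𝔭 ∣ˢ (ℤ.+ z ℤ.- 1ℤ)) (sym (PrimeFactorisation.isFactorisation F)) h))))
      where
      identity : ∀ x → (1ℤ ℤ.+ x) ℤ.- (x ℤ.- 1ℤ) ≡ ℤ.+ 2
      identity = ℤSolver.solve-∀

  target? : ∀ y q → Dec (Prime q × y < q × p ∣ suc q)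
  target? y q = prime? q ×-dec ((y <? q) ×-dec (p ∣? suc q))

  -- Each norm is ≡ −1 modulo p, hence has a prime factor q ≢ 1, and if q ≢ ±1 then q² divides the norm. Norms with
  -- such a q > y are counted by Σ 1/q², which is small, so most norms have a prime factor q ≡ −1.
  module Count (y w A m Z : ℕ) (p∤w : ¬ p ∣ w) (w-multiple : ∀ j → 1 ≤ j → j ≤ y → ¬ p ∣ j → j ∣ w)
    (A≡1 : ℤ.+ w ∣ˢ (ℤ.+ A ℤ.- 1ℤ)) (A^d≡-1 : 𝔭 ∣ˢ ((ℤ.+ A) ℤ.^ d ℤ.+ 1ℤ))
    (positive : ∀ b → ∃[ N ] (norm (α A (p * w) m b) ≡ ℤ.+ N × 1 ≤ N)) (bounded : ∀ b → ∣ norm (α A (p * w) m b) ∣ ≤ Z)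
    (K₀≤y : K₀ ≤ y) where

    V = p * w
    X = B ^ m
    Y = K₀ * B * X

    n[_] : ℕ → ℤ
    n[ b ] = norm (α A V m b)

    norm-mod-V : ∀ b {e} → e ∣ V → ℤ.+ e ∣ˢ (n[ b ] ℤ.- (ℤ.+ A) ℤ.^ d)
    norm-mod-V b {e} e∣V = subst (λ z → ℤ.+ e ∣ˢ (n[ b ] ℤ.- z)) (trans (act-𝐍-integer (ℤ.+ A) (nat A) (act-nat A) u₁ 0) (trans (cong (ℤ._*_ ((ℤ.+ A) ℤ.^ d)) u₁-0) (ℤₚ.*-identityʳ _)))
      (norm-cong (ℤ.+ e) {α A V m b} {nat A} (λ u mu n → subst (ℤ.+ e ∣ˢ_) (sym (trans (cong (λ z → act (nat A) u n ℤ.+ z ℤ.- act (nat A) u n) (act-nat V (act (point A V m b) u) n)) (identity (act (nat A) u n) (ℤ.+ V) (act (point A V m b) u n))))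
        (Signed.∣m⇒∣m*n (act (point A V m b) u n) (Signed.∣ᵤ⇒∣ {ℤ.+ e} {ℤ.+ V} e∣V))))
      where
      identity : ∀ a v x → a ℤ.+ v ℤ.* x ℤ.- a ≡ v ℤ.* x
      identity = ℤSolver.solve-∀

    p∣sN : ∀ b N → n[ b ] ≡ ℤ.+ N → p ∣ suc N
    p∣sN b N eq = Signed.∣⇒∣ᵤ (subst (𝔭 ∣ˢ_) (trans (identity n[ b ] ((ℤ.+ A) ℤ.^ d)) (cong (ℤ._+_ 1ℤ) eq)) (Signed.∣m∣n⇒∣m+n (norm-mod-V b (m∣m*n {p} w)) A^d≡-1))
      where
      identity : ∀ n a → (n ℤ.- a) ℤ.+ (a ℤ.+ 1ℤ) ≡ 1ℤ ℤ.+ n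
      identity = ℤSolver.solve-∀

    -- The norm is ≡ -1 modulo p and ≡ A^d ≡ 1 modulo w. As w is a multiple of all numbers up to y
    -- prime to p, this pushes the prime factors of the norms above y.
    coprime-V : ∀ b N q → n[ b ] ≡ ℤ.+ N → Prime q → q ∣ N → ¬ q ∣ V
    coprime-V b N q eq pq q∣N q∣V = [ q∣p , q∣w ]′ (euclidsLemma p w pq q∣V)
      where
      q∣p : ¬ q ∣ p
      q∣p h = prime∤ᶻ1 pq (Signed.∣ᵤ⇒∣ {ℤ.+ q} {1ℤ} (∣m+n∣m⇒∣n {n = 1} (subst (q ∣_) (+-comm 1 N) (subst (_∣ suc N) (sym (prime∣prime pq p-prime h)) (p∣sN b N eq))) q∣N))
      q∣n : ℤ.+ q ∣ˢ n[ b ]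
      q∣n = subst (ℤ.+ q ∣ˢ_) (sym eq) (Signed.∣ᵤ⇒∣ {ℤ.+ q} {ℤ.+ N} q∣N)
      q∣A : ℤ.+ q ∣ˢ ℤ.+ A
      q∣A = prime∣ᶻ^ pq (ℤ.+ A) d (subst (ℤ.+ q ∣ˢ_) (identity n[ b ] ((ℤ.+ A) ℤ.^ d)) (Signed.∣m∣n⇒∣m-n q∣n (norm-mod-V b q∣V)))
        where
        identity : ∀ x y → x ℤ.- (x ℤ.- y) ≡ y
        identity = ℤSolver.solve-∀
      q∣w : ¬ q ∣ w
      q∣w h = prime∤ᶻ1 pq (subst (ℤ.+ q ∣ˢ_) (identity (ℤ.+ A)) (Signed.∣m∣n⇒∣m-n q∣A (Signed.∣-trans (Signed.∣ᵤ⇒∣ {ℤ.+ q} {ℤ.+ w} h) A≡1)))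
        where
        identity : ∀ x → x ℤ.- (x ℤ.- 1ℤ) ≡ 1ℤ
        identity = ℤSolver.solve-∀

    Divisor : ℕ → ℕ → Set
    Divisor q b = b < X × Prime q × y < q × ¬ q ∣ V × ℤ.+ q ∣ˢ n[ b ] × (p ∣ suc q ⊎ ¬ q ∼ 1)

    divisor : ∀ b → b < X → ∃[ q ] (1 ≤ q × q ≤ Z × Divisor q b)
    divisor b b<X = let (N , eq , 1≤N) = positive b ; (q , pq , q∣N , q≢1) = non-unit-prime N 1≤N (p∣sN b N eq) in
        from-prime N eq 1≤N q pq q∣N q≢1 (coprime-V b N q eq pq q∣N)
      where
      from-prime : ∀ N → n[ b ] ≡ ℤ.+ N → 1 ≤ N → ∀ q → Prime q → q ∣ N → ¬ 𝔭 ∣ˢ (ℤ.+ q ℤ.- 1ℤ) → ¬ q ∣ V → ∃[ q ] (1 ≤ q × q ≤ Z × Divisor q b)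
      from-prime N eq 1≤N q pq q∣N q≢1 q∤V = q , prime≥1 pq , ≤-trans (∣⇒≤ {{>-nonZero 1≤N}} q∣N) (subst (_≤ Z) (cong ∣_∣ eq) (bounded b))
            , b<X , pq , ≰⇒> small , q∤V , subst (ℤ.+ q ∣ˢ_) (sym eq) (Signed.∣ᵤ⇒∣ {ℤ.+ q} {ℤ.+ N} q∣N) , class (p ∣? suc q)
        where
        small : ¬ q ≤ y
        small q≤y = q∤V (∣n⇒∣m*n p (w-multiple q (prime≥1 pq) q≤y (λ p∣q → q∤V (subst (_∣ V) (prime∣prime p-prime pq p∣q) (m∣m*n w)))))
        class : Dec (p ∣ suc q) → p ∣ suc q ⊎ ¬ q ∼ 1
        class (yes h) = inj₁ h
        class (no h) = inj₂ λ { (minus k) → q≢1 k ; (plus k) → h (subst (p ∣_) (+-comm q 1) (Signed.∣⇒∣ᵤ k)) }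

    -- `few-divisible` allows d (1 + ⌊Y / Q⌋) members. The 1 is charged to every prime, ⌊Y / q⌋ to
    -- the primes q ≡ -1, and ⌊Y / q²⌋ to all q > y.
    weight : ℕ → ℕ
    weight q = d * (𝟙 (prime? q) + 𝟙 (target? y q) * multiples Y q + 𝟙 (y <? q) * multiples Y (q * q))

    few-divisor : ∀ q → Few (Divisor q) (weight q)
    few-divisor q = few-inhabited {Divisor q} λ { b (_ , pq , y<q , q∤V , _ , class) → by-class pq y<q q∤V (p ∣? suc q) class }
      where
      by-class : Prime q → y < q → ¬ q ∣ V → Dec (p ∣ suc q) → p ∣ suc q ⊎ ¬ q ∼ 1 → Few (Divisor q) (weight q)
      by-class pq y<q q∤V (yes h) _ = few-⊆ (λ { b (b<X , _ , _ , _ , q∣n , _) → b<X , q∣n })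
        (few-mono (*-monoʳ-≤ d (≤-trans (+-mono-≤ (≤-reflexive (sym (𝟙-yes (prime? q) pq))) (≤-trans (≤-reflexive (sym (*-identityˡ _))) (*-monoˡ-≤ (multiples Y q) (≤-reflexive (sym (𝟙-yes (target? y q) (pq , y<q , h))))))) (m≤m+n _ _)))
          (few-divisible A V m pq q∤V q (λ b b′ k → Signed.∣⇒∣ᵤ k) (≤-<-trans K₀≤y y<q)))
      by-class pq y<q q∤V (no ¬h) (inj₁ h) = contradiction h ¬h
      by-class pq y<q q∤V (no ¬h) (inj₂ q≁1) = few-⊆ (λ { b (b<X , _ , _ , _ , q∣n , _) → b<X , q∣n })
        (few-mono (*-monoʳ-≤ d (+-mono-≤ (≤-trans (≤-reflexive (sym (𝟙-yes (prime? q) pq))) (m≤m+n _ _)) (≤-trans (≤-reflexive (sym (*-identityˡ _))) (*-monoˡ-≤ (multiples Y (q * q)) (≤-reflexive (sym (𝟙-yes (y <? q) y<q)))))))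
          (few-divisible A V m pq q∤V (q * q) (λ b b′ k → subst (_∣ ∣ norm (β A V m b b′) ∣) (ℤₚ.abs-* (ℤ.+ q) (ℤ.+ q)) (Signed.∣⇒∣ᵤ (Unramified.square∣norm pq p∤q q≁1 (β A V m b b′) (even-β A V m b b′) k)))
            (<-≤-trans (≤-<-trans K₀≤y y<q) (m≤m*n q q {{prime⇒nonZero pq}}))))
        where
        p∤q : ¬ p ∣ q
        p∤q p∣q = q∤V (subst (_∣ V) (prime∣prime p-prime pq p∣q) (m∣m*n w))

    targets : List ℕ
    targets = select (target? y) Z

    S = ∑ Z (λ q → 𝟙 (target? y q) * multiples Y q)
    π = ∑ Z (λ q → 𝟙 (prime? q))
    squares = ∑ Z (λ q → 𝟙 (y <? q) * multiples Y (q * q))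

    -- The count runs from 1 to X - 1; the final 1 is for b = 0.
    X≤ : X ≤ d * (π + S + squares) + 1
    X≤ = ≤-trans (≤-trans (m≤n+m∸n X 1) (≤-reflexive (+-comm 1 (X ∸ 1)))) (+-monoˡ-≤ 1 (≤-trans
      (few-covers (X ∸ 1) (λ b 1≤b b≤ → divisor b (≤-<-trans b≤ (≤-reflexive (m+[n∸m]≡n {1} {X} X≥1)))) (few-⋃ {Divisor} Z (λ q _ _ → few-divisor q)))
      (≤-reflexive (trans (∑-* Z d _) (cong (d *_) (trans (∑-+ Z _ _) (cong (_+ squares) (∑-+ Z _ _))))))))
      where
      X≥1 : 1 ≤ X
      X≥1 = m^n>0 B m

    squares≤ : 1 ≤ y → y * squares ≤ Y
    squares≤ = ∑-tail-squares Y y Z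

    conclusion : 4 ≤ X → 8 * (d * (K₀ * B)) ≤ y → 8 * (d * π) ≤ X → product targets ≤ 2 * (d * (K₀ * B)) * recip targets
    conclusion 4≤X y-large π-small = cancelˡ-≤ X (≤-trans (s≤s z≤n) 4≤X) (begin
      X * Q                              ≤⟨ *-monoˡ-≤ Q X≤2dS ⟩
      2 * (d * S) * Q                    ≡⟨ regroup d S Q ⟩
      2 * d * (Q * S)                    ≤⟨ *-monoʳ-≤ (2 * d) (select-recip (target? y) Z Y) ⟩
      2 * d * (K₀ * B * X * R)           ≡⟨ regroup′ d (K₀ * B) X R ⟩
      X * (2 * (d * (K₀ * B)) * R)       ∎)
      where
      open ≤-Reasoning
      Q = product targets
      R = recip targets
      regroup : ∀ d S Q → 2 * (d * S) * Q ≡ 2 * d * (Q * S)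
      regroup = solve-∀
      regroup′ : ∀ d k X R → 2 * d * (k * X * R) ≡ X * (2 * (d * k) * R)
      regroup′ = solve-∀
      KB≥1 : 1 ≤ K₀ * B
      KB≥1 = *-mono-≤ {1} {K₀} {1} {B} K₀≥1 (m^n>0 2 d)
      y≥1 : 1 ≤ y
      y≥1 = ≤-trans K₀≥1 K₀≤y
      squares-small : 8 * (d * squares) ≤ X
      squares-small = cancelˡ-≤ (K₀ * B) KB≥1 (≤-trans (≤-reflexive (swap (K₀ * B) d squares)) (≤-trans (*-monoˡ-≤ squares y-large) (squares≤ y≥1)))
        where
        swap : ∀ k d s → k * (8 * (d * s)) ≡ 8 * (d * k) * s
        swap = solve-∀
      X≤2dS : X ≤ 2 * (d * S)
      X≤2dS = main-term d X π S squares 4≤X X≤ π-small squares-small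

  prime-to-p : ℕ → ℕ
  prime-to-p zero = 1
  prime-to-p (suc j) with p ∣? suc j
  ... | yes _ = prime-to-p j
  ... | no _ = suc j * prime-to-p j

  ∤prime-to-p : ∀ y → ¬ p ∣ prime-to-p y
  ∤prime-to-p zero = ∤-small ≤-refl p≥2
  ∤prime-to-p (suc y) with p ∣? suc y
  ... | yes _ = ∤prime-to-p y
  ... | no p∤ = ∤-* p∤ (∤prime-to-p y)

  ∣prime-to-p : ∀ y j → 1 ≤ j → j ≤ y → ¬ p ∣ j → j ∣ prime-to-p y
  ∣prime-to-p zero j 1≤j j≤0 _ = contradiction (≤-trans 1≤j j≤0) λ ()
  ∣prime-to-p (suc y) j 1≤j j≤y p∤j with p ∣? suc y | j ≟ suc y
  ... | yes p∣ | yes refl = contradiction p∣ p∤j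
  ... | yes _ | no j≢ = ∣prime-to-p y j 1≤j (≤-pred (≤∧≢⇒< j≤y j≢)) p∤j
  ... | no _ | yes refl = m∣m*n (prime-to-p y)
  ... | no _ | no j≢ = ∣n⇒∣m*n (suc y) (∣prime-to-p y j 1≤j (≤-pred (≤∧≢⇒< j≤y j≢)) p∤j)

  -- Chinese remainders: r is 0 modulo w and ±1 modulo p, so 1 + g r² is ≡ 1 modulo w and ≡ 1 + g,
  -- the nonresidue, modulo p. The square removes the sign, and multiples of p w allow A to be
  -- large.
  residue-lift : ∀ w → ¬ p ∣ w → ∃[ a ] (∀ t → ℤ.+ w ∣ˢ (ℤ.+ (suc a + p * w * t) ℤ.- 1ℤ) × 𝔭 ∣ˢ ((ℤ.+ (suc a + p * w * t)) ℤ.^ d ℤ.+ 1ℤ))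
  residue-lift w p∤w with nonresidue
  ... | suc g , _ , g^d≡-1 = g * (r * r) , λ t → mod-w t , mod-p t
    where
    w⁻¹ = proj₁ (inverse∼ w p∤w)
    r = w⁻¹ * w
    A : ℕ → ℕ
    A t = suc (g * (r * r)) + p * w * t
    mod-w : ∀ t → ℤ.+ w ∣ˢ (ℤ.+ A t ℤ.- 1ℤ)
    mod-w t = subst (ℤ.+ w ∣ˢ_) (sym (identity (ℤ.+ (g * (r * r) + p * w * t))))
      (Signed.∣ᵤ⇒∣ {ℤ.+ w} {ℤ.+ (g * (r * r) + p * w * t)} (∣m∣n⇒∣m+n (∣n⇒∣m*n g (∣n⇒∣m*n r (n∣m*n w⁻¹))) (∣m⇒∣m*n t (n∣m*n p))))
      where
      identity : ∀ x → 1ℤ ℤ.+ x ℤ.- 1ℤ ≡ x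
      identity = ℤSolver.solve-∀
    A≡g : ∀ t → 𝔭 ∣ˢ (ℤ.+ A t ℤ.- ℤ.+ suc g)
    A≡g t = subst (𝔭 ∣ˢ_) (trans (identity (ℤ.+ g) (ℤ.+ (r * r)) (ℤ.+ (p * w * t))) (cong (λ z → 1ℤ ℤ.+ z ℤ.+ ℤ.+ (p * w * t) ℤ.- (1ℤ ℤ.+ ℤ.+ g)) (sym (ℤₚ.pos-* g (r * r)))))
      (Signed.∣m∣n⇒∣m+n (Signed.∣n⇒∣m*n (ℤ.+ g) (square≡1 {r} (proj₂ (inverse∼ w p∤w)))) (Signed.∣ᵤ⇒∣ {𝔭} {ℤ.+ (p * w * t)} (∣m⇒∣m*n t (m∣m*n w))))
      where
      identity : ∀ g s v → g ℤ.* (s ℤ.- 1ℤ) ℤ.+ v ≡ 1ℤ ℤ.+ g ℤ.* s ℤ.+ v ℤ.- (1ℤ ℤ.+ g)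
      identity = ℤSolver.solve-∀
    mod-p : ∀ t → 𝔭 ∣ˢ ((ℤ.+ A t) ℤ.^ d ℤ.+ 1ℤ)
    mod-p t = subst (𝔭 ∣ˢ_) (identity ((ℤ.+ A t) ℤ.^ d) ((ℤ.+ suc g) ℤ.^ d)) (Signed.∣m∣n⇒∣m+n (∣-power (ℤ.+ A t) (ℤ.+ suc g) d (A≡g t)) g^d≡-1)
      where
      identity : ∀ x y → (x ℤ.- y) ℤ.+ (y ℤ.+ 1ℤ) ≡ x ℤ.+ 1ℤ
      identity = ℤSolver.solve-∀

  size-bound : ∀ a V d c t → 1 ≤ t → suc a + V * suc (2 * (d * ((V + 2) * (c * t)))) + 2 + (V + 2) * (c * t) ≤ (suc a + V + 2 + (V * (2 * d) + 1) * ((V + 2) * c)) * t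
  size-bound a V d c t 1≤t = begin
    suc a + V * suc (2 * (d * ((V + 2) * (c * t)))) + 2 + (V + 2) * (c * t)        ≡⟨ expand (suc a) V d c t ⟩
    (suc a + V + 2) * 1 + (V * (2 * d) + 1) * ((V + 2) * c) * t                    ≤⟨ +-monoˡ-≤ _ (*-monoʳ-≤ (suc a + V + 2) 1≤t) ⟩
    (suc a + V + 2) * t + (V * (2 * d) + 1) * ((V + 2) * c) * t                    ≡⟨ sym (*-distribʳ-+ t (suc a + V + 2) _) ⟩
    (suc a + V + 2 + (V * (2 * d) + 1) * ((V + 2) * c)) * t                        ∎
    where
    open ≤-Reasoning
    expand : ∀ a V d c t → a + V * suc (2 * (d * ((V + 2) * (c * t)))) + 2 + (V + 2) * (c * t) ≡ (a + V + 2) * 1 + (V * (2 * d) + 1) * ((V + 2) * c) * t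
    expand = solve-∀

  minus-one-primes : ∀ y₀ → ∃[ T ] (All (λ q → Prime q × y₀ < q × p ∣ suc q) T × Unique T × product T ≤ 2 * (d * (K₀ * B)) * recip T)
  minus-one-primes y₀ = Main.targets
      , All.map (λ { (_ , _ , pq , y<q , h) → pq , ≤-<-trans (m≤m+n y₀ _) y<q , h }) (select-all (target? y) Z)
      , select-unique (target? y) Z , Main.conclusion 4≤X (m≤n+m _ y₀) few-primes
    where
    y = y₀ + 8 * (d * (K₀ * B))
    w = prime-to-p y
    V = p * w
    lifted = residue-lift w (∤prime-to-p y)
    a = proj₁ lifted
    -- As A is of order 2^m, the size of every member is at most κ₁ 2^m, and its norm at most κ₂ X =
    -- Z.
    κ₁ = suc a + V + 2 + (V * (2 * d) + 1) * ((V + 2) * κ)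
    κ₂ = κ₁ ^ d
    -- m will be so large that at most X / (8d) primes lie below Z.
    sparse = primes-sparse (8 * (d * κ₂)) (*-mono-≤ {1} {8} {1} {d * κ₂} (s≤s z≤n) (*-mono-≤ {1} {d} {1} {κ₂} d≥1 (m^n>0 κ₁ d)))
    m = proj₁ sparse + 2
    X = B ^ m
    Z = κ₂ * X
    size = (V + 2) * (κ * 2 ^ m)
    t = suc (2 * (d * size))
    A = suc a + V * t
    B≥2 : 2 ≤ B
    B≥2 = ^-monoʳ-≤ 2 d≥1
    V≥1 : 1 ≤ V
    V≥1 = n≢0⇒n>0 (λ e → ∤prime-to-p y (subst (p ∣_) (sym (m*n≡0⇒n≡0 e)) (p ∣0)))
      where
      m*n≡0⇒n≡0 : p * w ≡ 0 → w ≡ 0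
      m*n≡0⇒n≡0 e = [ (λ ()) , id ]′ (m*n≡0⇒m≡0∨n≡0 p e)
    ‖point‖ : ∀ b → ‖ point A V m b ‖ ≤ κ * 2 ^ m
    ‖point‖ b = ‖lin‖-bound _ m (λ i → <⇒≤ (coord-bound m b i))
    ‖Vpoint‖ : ∀ b → ‖ nat V ⊗ point A V m b ‖ ≤ size
    ‖Vpoint‖ b = *-mono-≤ (≤-reflexive (‖nat‖ V)) (‖point‖ b)
    large : 2 * (d * size) < A
    large = ≤-trans (≤-trans (m≤n*m t V {{>-nonZero V≥1}}) (m≤n+m (V * t) a)) (n≤1+n _)
    bounded : ∀ b → ∣ norm (α A V m b) ∣ ≤ Z
    bounded b = ≤-trans (norm-bound (α A V m b)) (≤-trans (^-monoˡ-≤ d (≤-trans (+-mono-≤ (≤-reflexive (‖nat‖ A)) (‖Vpoint‖ b)) (size-bound a V d κ (2 ^ m) (m^n>0 2 m))))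
      (≤-reflexive (trans (*-^ d κ₁ (2 ^ m)) (cong (κ₂ *_) (trans (^-*-assoc 2 m d) (trans (cong (2 ^_) (*-comm m d)) (sym (^-*-assoc 2 d m))))))))
    4≤X : 4 ≤ X
    4≤X = ≤-trans (^-monoʳ-≤ 2 (m≤n+m 2 (proj₁ sparse))) (^-monoˡ-≤ m B≥2)
    z₀≤Z : proj₁ sparse ≤ Z
    z₀≤Z = ≤-trans (≤-trans (m≤m+n _ 2) (<⇒≤ (n<m^n m B≥2))) (m≤n*m X κ₂ {{>-nonZero (m^n>0 κ₁ d)}})
    few-primes : 8 * (d * ∑ Z (λ q → 𝟙 (prime? q))) ≤ X
    few-primes = cancelˡ-≤ κ₂ (m^n>0 κ₁ d) (≤-trans (≤-reflexive (swap κ₂ d (∑ Z (λ q → 𝟙 (prime? q))))) (proj₂ sparse Z z₀≤Z))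
      where
      swap : ∀ k d s → k * (8 * (d * s)) ≡ 8 * (d * k) * s
      swap = solve-∀
    K₀≤y : K₀ ≤ y
    K₀≤y = ≤-trans (≤-trans (m≤m*n K₀ B {{B≢0}}) (≤-trans (m≤n*m (K₀ * B) d {{>-nonZero d≥1}}) (m≤n*m (d * (K₀ * B)) 8))) (m≤n+m _ y₀)
    module Main = Count y w A m Z (∤prime-to-p y) (∣prime-to-p y) (proj₁ (proj₂ lifted t)) (proj₂ (proj₂ lifted t))
      (λ b → large-norm-positive A V m b size (‖Vpoint‖ b) large) bounded K₀≤y

-- Divergence of the reciprocal sum over primes ≡ -1

odd-prime : ∀ {p} → Prime p → p ≢ 2 → ∃[ d ] p ≡ suc (d + d)
odd-prime {p} pp p≢2 with p % 2 in eq
... | zero = contradiction (sym (prime∣prime prime[2] pp (m%n≡0⇒n∣m p 2 eq))) p≢2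
... | suc zero = p / 2 , trans (m≡m%n+[m/n]*n p 2) (trans (cong (_+ p / 2 * 2) eq) (cong suc (trans (*-comm (p / 2) 2) (cong (p / 2 +_) (+-identityʳ (p / 2))))))
... | suc (suc r) = contradiction (subst (_< 2) eq (m%n<n p 2)) λ { (s≤s (s≤s ())) }

2∣suc-odd : ∀ {q} → Prime q → 2 < q → 2 ∣ suc q
2∣suc-odd {q} pq 2<q with odd-prime pq (λ e → <-irrefl (sym e) 2<q)
... | d , refl = divides (suc d) (cong (suc ∘ suc) (trans (cong (d +_) (sym (+-identityʳ d))) (*-comm 2 d)))

all-≤sum : ∀ T → All (_≤ sum T) T
all-≤sum [] = []
all-≤sum (q ∷ T) = m≤m+n q (sum T) ∷ All.map (λ h → ≤-trans h (m≤n+m (sum T) q)) (all-≤sum T)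

-- Concatenating lists whose reciprocal sums are bounded below by 1/c.
accumulate : ∀ {P : ℕ → Set} c → (∀ y → ∃[ T ] (All (λ q → P q × y < q) T × Unique T × product T ≤ c * recip T)) →
  ∀ k y → ∃[ T ] (All (λ q → P q × y < q) T × Unique T × k * product T ≤ c * recip T)
accumulate c next zero y = [] , [] , [] , z≤n
accumulate c next (suc k) y =
  let (T , aT , uT , hT) = accumulate c next k y
      (S , aS , uS , hS) = next (y + sum T)
  in T ++ S , All.++⁺ aT (All.map (λ { (p , y<q) → p , ≤-<-trans (m≤m+n y (sum T)) y<q }) aS)
    , unique-++ (sum T) uT uS (all-≤sum T) (All.map (λ { (_ , y<q) → ≤-<-trans (m≤n+m (sum T) y) y<q }) aS)
    , subst (λ z → z * product (T ++ S) ≤ c * recip (T ++ S)) (+-comm k 1) (heavy-++ k 1 c T S hT (≤-trans (≤-reflexive (*-identityˡ _)) hS))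

-- For p = 2 all odd primes qualify and the windows suffice. For odd p, c L lists of reciprocal sum
-- at least 1/c are concatenated.
heavy-minus-one : ∀ {p} → Prime p → ∀ L y → ∃[ T ] (All (λ q → (Prime q × p ∣ suc q) × y < q) T × Unique T × L * product T ≤ recip T)
heavy-minus-one {p} pp L y with p ≟ 2
... | yes refl = T , All.map (λ { (pq , b<q , _) → (pq , 2∣suc-odd pq (≤-<-trans (m≤m*n 2 (2 ^ y) {{m^n≢0 2 y}}) b<q)) , <-trans (<-trans (n<1+n y) (n<2^n (suc y))) b<q }) (windows-range (2 * L) b)
      , windows-unique (2 * L) b , *-cancelˡ-≤ 2 (≤-trans (≤-reflexive (sym (*-assoc 2 L (product T)))) (windows-heavy (2 * L) b (s≤s z≤n)))
  where
  b = suc y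
  T = windows (2 * L) b
... | no p≢2 with odd-prime pp p≢2
...   | d , refl = let (T , aT , uT , hT) = accumulate c next (c * L) y in T , aT , uT , cancelˡ-≤ c c≥1 (≤-trans (≤-reflexive (sym (*-assoc c L (product T)))) hT)
  where
  open MinusOnePrimes d pp
  open NormFamily d pp using (K₀; K₀≥1)
  open MinusOneClass d pp using (d≥1)
  c = 2 * (d * (K₀ * 2 ^ d))
  c≥1 : 1 ≤ c
  c≥1 = *-mono-≤ {1} {2} {1} {d * (K₀ * 2 ^ d)} (s≤s z≤n) (*-mono-≤ {1} {d} {1} {K₀ * 2 ^ d} d≥1 (*-mono-≤ {1} {K₀} {1} {2 ^ d} K₀≥1 (m^n>0 2 d)))
  next : ∀ y → ∃[ T ] (All (λ q → (Prime q × suc (d + d) ∣ suc q) × y < q) T × Unique T × product T ≤ c * recip T)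
  next y = let (T , aT , uT , hT) = minus-one-primes y in T , All.map (λ { (pq , y<q , h) → (pq , h) , y<q }) aT , uT , hT

-- The sum of divisors

divisor-sum : ℕ → ℕ → ℕ
divisor-sum N n = ∑ N (λ d → 𝟙 (d ∣? n) * d)

sum-filter-upTo : ∀ n k → sum (filter (_∣? n) (upTo (suc k))) ≡ divisor-sum k n
sum-filter-upTo n zero = only-zero (0 ∣? n)
  where
  only-zero : Dec (0 ∣ n) → sum (filter (_∣? n) (0 ∷ [])) ≡ 0
  only-zero (yes h) = cong sum (filter-accept (_∣? n) {xs = []} h)
  only-zero (no ¬h) = cong sum (filter-reject (_∣? n) {xs = []} ¬h)
sum-filter-upTo n (suc k) = begin
  sum (filter (_∣? n) (upTo (suc (suc k))))                                        ≡⟨ cong (sum ∘ filter (_∣? n)) (sym (upTo-∷ʳ (suc k))) ⟩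
  sum (filter (_∣? n) (upTo (suc k) ++ suc k ∷ []))                                ≡⟨ cong sum (filter-++ (_∣? n) (upTo (suc k)) (suc k ∷ [])) ⟩
  sum (filter (_∣? n) (upTo (suc k)) ++ filter (_∣? n) (suc k ∷ []))               ≡⟨ sum-++ (filter (_∣? n) (upTo (suc k))) _ ⟩
  sum (filter (_∣? n) (upTo (suc k))) + sum (filter (_∣? n) (suc k ∷ []))          ≡⟨ cong₂ _+_ (sum-filter-upTo n k) (last-term (suc k ∣? n)) ⟩
  divisor-sum (suc k) n                                                            ∎
  where
  open ≡-Reasoning
  last-term : Dec (suc k ∣ n) → sum (filter (_∣? n) (suc k ∷ [])) ≡ 𝟙 (suc k ∣? n) * suc k
  last-term (yes h) = trans (cong sum (filter-accept (_∣? n) {xs = []} h)) (trans (+-identityʳ (suc k)) (sym (trans (cong (_* suc k) (𝟙-yes (suc k ∣? n) h)) (*-identityˡ (suc k)))))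
  last-term (no ¬h) = trans (cong sum (filter-reject (_∣? n) {xs = []} ¬h)) (sym (cong (_* suc k) (𝟙-no (suc k ∣? n) ¬h)))

σ₁ : ℕ → ℕ
σ₁ n = divisor-sum n n

s+n≡σ₁ : ∀ n → 1 ≤ n → s n + n ≡ σ₁ n
s+n≡σ₁ (suc n) _ = cong₂ _+_ (sum-filter-upTo (suc n) n) (sym (trans (cong (_* suc n) (𝟙-yes (suc n ∣? suc n) ∣-refl)) (*-identityˡ (suc n))))

divisor-sum-extend : ∀ k n → 1 ≤ n → divisor-sum (n + k) n ≡ σ₁ n
divisor-sum-extend k n 1≤n = trans (∑-split n k _) (trans (cong (σ₁ n +_) (trans (∑-cong k (λ i 1≤i _ → cong (_* (n + i)) (𝟙-no (n + i ∣? n) (λ h → <⇒≱ (m<m+n n 1≤i) (∣⇒≤ {{>-nonZero 1≤n}} h))))) (∑-zero k))) (+-identityʳ (σ₁ n)))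

∑-over-multiples : ∀ q m (g : ℕ → ℕ) → 1 ≤ q → ∑ (m * q) (λ d → 𝟙 (q ∣? d) * g d) ≡ ∑ m (λ e → g (e * q))
∑-over-multiples q zero g 1≤q = refl
∑-over-multiples q@(suc r) (suc m) g 1≤q = begin
  ∑ (q + m * q) f                                      ≡⟨ cong (λ k → ∑ k f) (+-comm q (m * q)) ⟩
  ∑ (m * q + q) f                                      ≡⟨ ∑-split (m * q) q f ⟩
  ∑ (m * q) f + (∑ r (λ i → f (m * q + i)) + f (m * q + q))   ≡⟨ cong₂ (λ a b → ∑ (m * q) f + (a + b)) (trans (∑-cong r (λ i 1≤i i≤r → cong (_* g (m * q + i)) (𝟙-no (q ∣? (m * q + i)) (λ h → <⇒≱ (s≤s i≤r) (∣⇒≤ {{>-nonZero 1≤i}} (∣m+n∣m⇒∣n h (n∣m*n m))))))) (∑-zero r))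
        (trans (cong (λ z → f z) (+-comm (m * q) q)) (trans (cong (_* g (suc m * q)) (𝟙-yes (q ∣? (suc m * q)) (n∣m*n (suc m)))) (*-identityˡ _))) ⟩
  ∑ (m * q) f + g (suc m * q)                          ≡⟨ cong (_+ g (suc m * q)) (∑-over-multiples q m g 1≤q) ⟩
  ∑ (suc m) (λ e → g (e * q))                          ∎
  where
  open ≡-Reasoning
  f : ℕ → ℕ
  f d = 𝟙 (q ∣? d) * g d

∣*-prime⇒∣ : ∀ {d m q} → Prime q → ¬ q ∣ d → d ∣ m * q → d ∣ m
∣*-prime⇒∣ {d} {m} {q} pq q∤d h = coprime-divisor (λ { (i∣d , i∣q) → [ id , (λ { refl → contradiction i∣d q∤d }) ]′ (prime⇒irreducible pq i∣q) }) (subst (d ∣_) (*-comm m q) h)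

-- The divisors of m q divisible by q are the e q with e ∣ m; the others are the divisors of m.
σ₁-*-prime : ∀ m q → 1 ≤ m → Prime q → ¬ q ∣ m → σ₁ (m * q) ≡ σ₁ m * suc q
σ₁-*-prime m q 1≤m pq q∤m = begin
  ∑ (m * q) (λ d → 𝟙 (d ∣? (m * q)) * d)
    ≡⟨ trans (∑-cong (m * q) (λ d _ _ → cases d)) (∑-+ (m * q) (λ d → 𝟙 (d ∣? m) * d) (λ d → 𝟙 (q ∣? d) * (𝟙 (d ∣? (m * q)) * d))) ⟩
  divisor-sum (m * q) m + ∑ (m * q) (λ d → 𝟙 (q ∣? d) * (𝟙 (d ∣? (m * q)) * d))
    ≡⟨ cong₂ _+_ (trans (cong (λ k → divisor-sum k m) (sym (m+[n∸m]≡n (m≤m*n m q {{prime⇒nonZero pq}})))) (divisor-sum-extend (m * q ∸ m) m 1≤m)) (∑-over-multiples q m (λ d → 𝟙 (d ∣? (m * q)) * d) (prime≥1 pq)) ⟩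
  σ₁ m + ∑ m (λ e → 𝟙 (e * q ∣? (m * q)) * (e * q))
    ≡⟨ cong (σ₁ m +_) (trans (∑-cong m (λ e _ _ → trans (cong (_* (e * q)) (same e)) (regroup (𝟙 (e ∣? m)) e q))) (∑-* m q _)) ⟩
  σ₁ m + q * σ₁ m
    ≡⟨ *-comm (suc q) (σ₁ m) ⟩
  σ₁ m * suc q ∎
  where
  open ≡-Reasoning
  regroup : ∀ x e q → x * (e * q) ≡ q * (x * e)
  regroup = solve-∀
  same : ∀ e → 𝟙 (e * q ∣? (m * q)) ≡ 𝟙 (e ∣? m)
  same e = ≤-antisym (𝟙-mono (e * q ∣? (m * q)) (e ∣? m) (*-cancelʳ-∣ q {{prime⇒nonZero pq}})) (𝟙-mono (e ∣? m) (e * q ∣? (m * q)) (*-monoˡ-∣ q))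
  cases : ∀ d → 𝟙 (d ∣? (m * q)) * d ≡ 𝟙 (d ∣? m) * d + 𝟙 (q ∣? d) * (𝟙 (d ∣? (m * q)) * d)
  cases d with q ∣? d
  ... | yes q∣d = sym (trans (cong (_+ 1 * (𝟙 (d ∣? (m * q)) * d)) (cong (_* d) (𝟙-no (d ∣? m) (λ d∣m → q∤m (∣-trans q∣d d∣m))))) (*-identityˡ _))
  ... | no q∤d = trans (cong (_* d) (≤-antisym (𝟙-mono (d ∣? (m * q)) (d ∣? m) (∣*-prime⇒∣ pq q∤d)) (𝟙-mono (d ∣? m) (d ∣? (m * q)) (∣m⇒∣m*n q)))) (sym (+-identityʳ _))

s-*-prime : ∀ m q → 1 ≤ m → Prime q → ¬ q ∣ m → s (m * q) ≡ s m * q + σ₁ m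
s-*-prime m q 1≤m pq q∤m = +-cancelʳ-≡ (m * q) _ _ (begin
  s (m * q) + m * q            ≡⟨ s+n≡σ₁ (m * q) (*-mono-≤ 1≤m (prime≥1 pq)) ⟩
  σ₁ (m * q)                   ≡⟨ σ₁-*-prime m q 1≤m pq q∤m ⟩
  σ₁ m * suc q                 ≡⟨ *-suc (σ₁ m) q ⟩
  σ₁ m + σ₁ m * q              ≡⟨ cong (λ z → σ₁ m + z * q) (sym (s+n≡σ₁ m 1≤m)) ⟩
  σ₁ m + (s m + m) * q         ≡⟨ regroup (σ₁ m) (s m) m q ⟩
  s m * q + σ₁ m + m * q       ∎)
  where
  open ≡-Reasoning
  regroup : ∀ a b m q → a + (b + m) * q ≡ b * q + a + m * q
  regroup = solve-∀

-- Each of the K dyadic blocks contributes at most x.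
harmonic : ∀ x K n → n < 2 ^ K → ∑ n (multiples x) ≤ K * x
harmonic x zero zero _ = z≤n
harmonic x zero (suc n) (s≤s ())
harmonic x (suc K) n n< with n <? 2 ^ K
... | yes n<2^K = ≤-trans (harmonic x K n n<2^K) (m≤n+m (K * x) x)
... | no n≮2^K = begin
  ∑ n (multiples x)                                            ≡⟨ cong (λ k → ∑ k (multiples x)) (sym (m+[n∸m]≡n a≤n)) ⟩
  ∑ (a + (n ∸ a)) (multiples x)                                ≡⟨ ∑-split a (n ∸ a) (multiples x) ⟩
  ∑ a (multiples x) + ∑ (n ∸ a) (λ i → multiples x (a + i))    ≤⟨ +-mono-≤ (harmonic x K a (≤-reflexive suc-a)) (∑-≤ (n ∸ a) (multiples x N) (λ i 1≤i _ → multiples-anti x (m^n>0 2 K) (≤-trans (≤-reflexive (trans (sym suc-a) (+-comm 1 a))) (+-monoʳ-≤ a 1≤i)))) ⟩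
  K * x + (n ∸ a) * multiples x N                              ≤⟨ +-monoʳ-≤ (K * x) (≤-trans (*-monoˡ-≤ (multiples x N) n∸a≤N) (multiples-upper x N (m^n>0 2 K))) ⟩
  K * x + x                                                    ≡⟨ +-comm (K * x) x ⟩
  suc K * x                                                    ∎
  where
  open ≤-Reasoning
  N = 2 ^ K
  a = pred N
  suc-a : suc a ≡ N
  suc-a = suc-pred N {{m^n≢0 2 K}}
  a≤n : a ≤ n
  a≤n = ≤-trans (n≤1+n a) (≤-trans (≤-reflexive suc-a) (≮⇒≥ n≮2^K))
  n∸a≤N : n ∸ a ≤ N
  n∸a≤N = m≤n+o⇒m∸n≤o n a (≤-pred (≤-trans n< (≤-reflexive (trans (2^suc K) (cong (_+ N) (sym suc-a))))))

-- A divisor is n / j for its cofactor j, so the harmonic sum of ⌊n / j⌋ is an upper bound.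
σ₁-bound : ∀ K n → n < 2 ^ K → σ₁ n ≤ K * n
σ₁-bound K n n< = begin
  ∑ n (λ d → 𝟙 (d ∣? n) * d)                               ≤⟨ ∑-mono n cofactor ⟩
  ∑ n (λ d → ∑ n (λ j → 𝟙 (d * j ≟ n) * multiples n j))    ≡⟨ ∑-swap n n _ ⟩
  ∑ n (λ j → ∑ n (λ d → 𝟙 (d * j ≟ n) * multiples n j))    ≤⟨ ∑-mono n (λ j 1≤j _ → per-cofactor j 1≤j) ⟩
  ∑ n (multiples n)                                        ≤⟨ harmonic n K n n< ⟩
  K * n                                                    ∎
  where
  open ≤-Reasoning
  cofactor : ∀ d → 1 ≤ d → d ≤ n → 𝟙 (d ∣? n) * d ≤ ∑ n (λ j → 𝟙 (d * j ≟ n) * multiples n j)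
  cofactor d 1≤d d≤n with d ∣? n
  ... | no _ = z≤n
  ... | yes (divides zero refl) = contradiction (≤-trans 1≤d d≤n) λ ()
  ... | yes (divides (suc j) eq) = ≤-trans (≤-reflexive (*-identityˡ d)) (≤-trans
          (≤-trans (multiples-max (suc j) (s≤s z≤n) (≤-reflexive dj≡n)) (≤-reflexive (sym (trans (cong (_* multiples n (suc j)) (𝟙-yes (d * suc j ≟ n) dj≡n)) (*-identityˡ _)))))
          (term≤∑ (λ j → 𝟙 (d * j ≟ n) * multiples n j) (s≤s z≤n) (≤-trans (m≤m*n (suc j) d {{>-nonZero 1≤d}}) (≤-reflexive (sym eq)))))
    where
    dj≡n : d * suc j ≡ n
    dj≡n = trans (*-comm d (suc j)) (sym eq)
  per-cofactor : ∀ j → 1 ≤ j → ∑ n (λ d → 𝟙 (d * j ≟ n) * multiples n j) ≤ multiples n j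
  per-cofactor j 1≤j = begin
    ∑ n (λ d → 𝟙 (d * j ≟ n) * multiples n j)   ≡⟨ trans (∑-cong n (λ d _ _ → *-comm (𝟙 (d * j ≟ n)) (multiples n j))) (∑-* n (multiples n j) _) ⟩
    multiples n j * ∑ n (λ d → 𝟙 (d * j ≟ n))   ≤⟨ *-monoʳ-≤ (multiples n j) (∑-𝟙-few (λ d → d * j ≟ n) n (few-single (λ { a b (_ , _ , e) (_ , _ , e′) → *-cancelʳ-≡ a b j {{>-nonZero 1≤j}} (trans e (sym e′)) }))) ⟩
    multiples n j * 1                           ≡⟨ *-identityʳ _ ⟩
    multiples n j                               ∎

-- Exceptional integers

few-image : ∀ {P Q : ℕ → Set} {K} (g : ℕ → ℕ) → (∀ n → P n → ∃[ k ] (Q k × n ≡ g k)) → Few Q K → Few P K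
few-image {P} {Q} g pre few l u a = let (ks , len , uk , ak , _) = preimages l u a in subst (_≤ _) len (few ks uk ak)
  where
  preimages : ∀ l → Unique l → All P l → ∃[ ks ] (length ks ≡ length l × Unique ks × All Q ks × (∀ {R : ℕ → Set} → All R l → All (R ∘ g) ks))
  preimages [] u a = [] , refl , [] , [] , λ _ → []
  preimages (n ∷ l) (n∉l ∷ u) (p ∷ a) with pre n p | preimages l u a
  ... | k , q , refl | ks , len , uk , ak , keep = k ∷ ks , cong suc len , All.map (λ gk≢ e → gk≢ (cong g e)) (keep n∉l) ∷ uk , q ∷ ak , λ { (r ∷ rs) → r ∷ keep rs }

multiples-mono : ∀ {x x′} d → 1 ≤ d → x ≤ x′ → multiples x d ≤ multiples x′ d
multiples-mono {x} d 1≤d x≤x′ = multiples-max d 1≤d (≤-trans (≤-trans (≤-reflexive (*-comm (multiples x d) d)) (multiples-upper x d 1≤d)) x≤x′)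

multiples-≤ : ∀ x d → 1 ≤ d → multiples x d ≤ x
multiples-≤ x d 1≤d = ≤-trans (m≤n*m (multiples x d) d {{>-nonZero 1≤d}}) (multiples-upper x d 1≤d)

multiples-* : ∀ x y a b → 1 ≤ a → 1 ≤ b → multiples x a * multiples y b ≤ multiples (x * y) (a * b)
multiples-* x y a b 1≤a 1≤b = multiples-max (a * b) (*-mono-≤ 1≤a 1≤b) (≤-trans (≤-reflexive (regroup (multiples x a) (multiples y b) a b)) (*-mono-≤ (multiples-upper x a 1≤a) (multiples-upper y b 1≤b)))
  where
  regroup : ∀ m n a b → m * n * (a * b) ≡ a * m * (b * n)
  regroup = solve-∀

multiples-multiples : ∀ x a b → 1 ≤ a → 1 ≤ b → multiples (multiples x a) b ≤ multiples x (a * b)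
multiples-multiples x a b 1≤a 1≤b = multiples-max (a * b) (*-mono-≤ 1≤a 1≤b) (≤-trans (≤-reflexive (regroup (multiples (multiples x a) b) a b)) (≤-trans (*-monoʳ-≤ a (multiples-upper (multiples x a) b 1≤b)) (multiples-upper x a 1≤a)))
  where
  regroup : ∀ m a b → m * (a * b) ≡ a * (b * m)
  regroup = solve-∀

multiples-nested : ∀ x a b → 1 ≤ a → 1 ≤ b → multiples x (a * b) ≤ multiples (multiples x a) b
multiples-nested x a b 1≤a 1≤b = multiples-max b 1≤b (multiples-max a 1≤a (≤-trans (≤-reflexive (regroup (multiples x (a * b)) a b)) (multiples-upper x (a * b) (*-mono-≤ 1≤a 1≤b))))
  where
  regroup : ∀ m a b → m * b * a ≡ a * b * m
  regroup = solve-∀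

∤⇒^∣ : ∀ {p c} → Prime p → ¬ p ∣ c → ∀ e x → p ^ e ∣ c * x → p ^ e ∣ x
∤⇒^∣ pp p∤c zero x h = 1∣ x
∤⇒^∣ {p} {c} pp p∤c (suc e) x h with euclidsLemma c x pp (∣-trans (m∣m*n (p ^ e)) h)
... | inj₁ p∣c = contradiction p∣c p∤c
... | inj₂ (divides x′ refl) = subst (p * p ^ e ∣_) (*-comm p x′) (*-monoʳ-∣ p (∤⇒^∣ pp p∤c e x′ (*-cancelˡ-∣ p {{prime⇒nonZero pp}} (subst (p * p ^ e ∣_) (regroup c x′ p) h))))
  where
  regroup : ∀ c x p → c * (x * p) ≡ p * (c * x)
  regroup = solve-∀

-- The exponent of p is capped at e, which also covers n = 0, a value that `s 1` takes.
exact-power : ∀ p n e → ∃[ j ] (j ≤ e × p ^ j ∣ n × (j ≡ e ⊎ ∃[ c ] (n ≡ p ^ j * c × ¬ p ∣ c)))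
exact-power p n zero = 0 , z≤n , 1∣ n , inj₁ refl
exact-power p n (suc e) with exact-power p n e
... | j , j≤e , h , inj₂ exact = j , m≤n⇒m≤1+n j≤e , h , inj₂ exact
... | j , j≤e , h@(divides c eq) , inj₁ refl with p ∣? c
...   | yes p∣c = suc e , ≤-refl , subst (p ^ suc e ∣_) (sym eq) (*-monoˡ-∣ (p ^ e) p∣c) , inj₁ refl
...   | no p∤c = j , n≤1+n j , h , inj₂ (c , trans eq (*-comm c (p ^ j)) , p∤c)

p^k≥1 : ∀ {p} → Prime p → ∀ k → 1 ≤ p ^ k
p^k≥1 {p} pp k = m^n>0 p {{prime⇒nonZero pp}} k

linear-difference : ∀ {d} a b {x y} → x < y → d ∣ a * x + b → d ∣ a * y + b → d ∣ a * (y ∸ x)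
linear-difference {d} a b {x} {y} x<y hx hy = ∣m+n∣m⇒∣n (subst (d ∣_) (trans (cong (λ z → a * z + b) (sym (m+[n∸m]≡n (<⇒≤ x<y)))) (regroup a x (y ∸ x) b)) hy) hx
  where
  regroup : ∀ a x z b → a * (x + z) + b ≡ a * x + b + a * z
  regroup = solve-∀

∣s∣σ⇒∣ : ∀ {d} m → 1 ≤ m → d ∣ s m → d ∣ σ₁ m → d ∣ m
∣s∣σ⇒∣ {d} m 1≤m d∣s d∣σ = ∣m+n∣m⇒∣n (subst (d ∣_) (sym (s+n≡σ₁ m 1≤m)) d∣σ) d∣s

-- Let p^j be the power of p in s(m), capped at j = 4. It divides σ(m) as well and hence m, and P is
-- fixed modulo p^(4-j). The sum is over the possible j = 0, ..., 4, shifted by 1 since `∑` starts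
-- at 1.
few-classes : ∀ p m t → Prime p → 1 ≤ m → 
  Few (λ P → p ^ 4 ∣ s m * P + σ₁ m × 2 ^ t < P × P ≤ 2 ^ t + 2 ^ t) (∑ 5 (λ j → 𝟙 (p ^ pred j ∣? m) * (1 + multiples (2 ^ t) (p ^ (5 ∸ j)))))
few-classes p m t pp 1≤m = few-inhabited λ P (p⁴∣ , _) → by-exact P p⁴∣ (exact-power p (s m) 4)
  where
  by-exact : ∀ P → p ^ 4 ∣ s m * P + σ₁ m → ∃[ j ] (j ≤ 4 × p ^ j ∣ s m × (j ≡ 4 ⊎ ∃[ c ] (s m ≡ p ^ j * c × ¬ p ∣ c))) → Few _ _
  by-exact P p⁴∣ (j , j≤4 , h , exact) = few-mono
    (≤-trans (≤-reflexive (sym (trans (cong (_* (1 + multiples (2 ^ t) (p ^ (4 ∸ j)))) (𝟙-yes (p ^ j ∣? m) p^j∣m)) (*-identityˡ _)))) (term≤∑ {5} {suc j} (λ j → 𝟙 (p ^ pred j ∣? m) * (1 + multiples (2 ^ t) (p ^ (5 ∸ j)))) (s≤s z≤n) (s≤s j≤4)))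
    (few-mono (+-monoʳ-≤ 1 (multiples-max {2 ^ t / r} {2 ^ t} r (p^k≥1 pp (4 ∸ j)) (m/n*n≤m (2 ^ t) r)))
      (few-spaced (2 ^ t) (2 ^ t) r (λ { P (_ , a , b) → a , b }) (λ { P P′ (hP , _) (hP′ , _) P<P′ → spaced exact (linear-difference (s m) (σ₁ m) P<P′ hP hP′) })))
    where
    r = p ^ (4 ∸ j)
    instance
      r≢0 : NonZero r
      r≢0 = >-nonZero (p^k≥1 pp (4 ∸ j))
    p^j*r≡p⁴ : p ^ j * r ≡ p ^ 4
    p^j*r≡p⁴ = trans (sym (^-distribˡ-+-* p j (4 ∸ j))) (cong (p ^_) (m+[n∸m]≡n j≤4))
    p^j∣m : p ^ j ∣ m
    p^j∣m = ∣s∣σ⇒∣ m 1≤m h (∣m+n∣m⇒∣n (∣-trans (subst (p ^ j ∣_) p^j*r≡p⁴ (m∣m*n r)) p⁴∣) (∣m⇒∣m*n P h))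
    spaced : j ≡ 4 ⊎ ∃[ c ] (s m ≡ p ^ j * c × ¬ p ∣ c) → ∀ {z} → p ^ 4 ∣ s m * z → r ∣ z
    spaced (inj₁ refl) {z} _ = 1∣ z
    spaced (inj₂ (c , eq , p∤c)) {z} k = ∤⇒^∣ pp p∤c (4 ∸ j) z (*-cancelˡ-∣ (p ^ j) {{>-nonZero (p^k≥1 pp j)}} (subst₂ _∣_ (sym p^j*r≡p⁴) (trans (cong (_* z) eq) (*-assoc (p ^ j) c z)) k))

record PrimeFactor (n : ℕ) : Set where
  constructor primeFactor
  field
    {m P} : ℕ
    n≡mP : n ≡ m * P
    P-prime : Prime P
    P∤m : ¬ P ∣ m

-- For each j, a proportion p^(-j) of the m and a proportion p^(j-4) of the P combine to x / p⁴. The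
-- summand 1 in `few-classes` is incurred once for every m ≤ x / 2^t.
few-dyadic : ∀ x p t → Prime p →
  Few (λ n → (1 ≤ n × n ≤ x) × p ^ 4 ∣ s n × Σ (PrimeFactor n) (λ F → 2 ^ t < PrimeFactor.P F × PrimeFactor.P F ≤ 2 ^ t + 2 ^ t))
    (5 * (multiples x (2 ^ t) + multiples x (p ^ 4)))
few-dyadic x p t pp = few-mono total (few-⊆ (λ { n ((1≤n , n≤x) , p⁴∣ , primeFactor {m} {P} refl pP P∤m , N<P , P≤) →
      m , m*n≥1⇒m≥1 m P 1≤n , multiples-max N N≥1 (≤-trans (*-monoʳ-≤ m (<⇒≤ N<P)) n≤x) , P , (subst (p ^ 4 ∣_) (s-*-prime m P (m*n≥1⇒m≥1 m P 1≤n) pP P∤m) p⁴∣ , N<P , P≤) , refl })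
    (few-⋃ {λ m n → ∃[ P ] ((p ^ 4 ∣ s m * P + σ₁ m × N < P × P ≤ N + N) × n ≡ m * P)} M (λ m 1≤m _ → few-image (m *_) (λ n h → h) (few-classes p m t pp 1≤m))))
  where
  open ≤-Reasoning
  N = 2 ^ t
  N≥1 = m^n>0 2 t
  M = multiples x N
  m*n≥1⇒m≥1 : ∀ m n → 1 ≤ m * n → 1 ≤ m
  m*n≥1⇒m≥1 (suc m) n _ = s≤s z≤n
  MN≤x : M * N ≤ x
  MN≤x = ≤-trans (≤-reflexive (*-comm M N)) (multiples-upper x N N≥1)
  total : ∑ M (λ m → ∑ 5 (λ j → 𝟙 (p ^ pred j ∣? m) * (1 + multiples N (p ^ (5 ∸ j))))) ≤ 5 * (M + multiples x (p ^ 4))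
  total = begin
    ∑ M (λ m → ∑ 5 (λ j → 𝟙 (p ^ pred j ∣? m) * (1 + multiples N (p ^ (5 ∸ j)))))   ≡⟨ ∑-swap M 5 (λ m j → 𝟙 (p ^ pred j ∣? m) * (1 + multiples N (p ^ (5 ∸ j)))) ⟩
    ∑ 5 (λ j → ∑ M (λ m → 𝟙 (p ^ pred j ∣? m) * (1 + multiples N (p ^ (5 ∸ j)))))   ≤⟨ ∑-≤ 5 (M + multiples x (p ^ 4)) {λ j → ∑ M (λ m → 𝟙 (p ^ pred j ∣? m) * (1 + multiples N (p ^ (5 ∸ j))))} per-j ⟩
    5 * (M + multiples x (p ^ 4))                                                  ∎
    where
    per-j : ∀ j → 1 ≤ j → j ≤ 5 → ∑ M (λ m → 𝟙 (p ^ pred j ∣? m) * (1 + multiples N (p ^ (5 ∸ j)))) ≤ M + multiples x (p ^ 4)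
    per-j (suc j) _ (s≤s j≤4) = begin
      ∑ M (λ m → 𝟙 (p ^ j ∣? m) * (1 + b))     ≡⟨ trans (∑-cong M (λ m _ _ → *-comm (𝟙 (p ^ j ∣? m)) (1 + b))) (∑-* M (1 + b) _) ⟩
      (1 + b) * multiples M (p ^ j)            ≡⟨ *-comm (1 + b) (multiples M (p ^ j)) ⟩
      multiples M (p ^ j) * (1 + b)            ≡⟨ *-suc (multiples M (p ^ j)) b ⟩
      multiples M (p ^ j) + multiples M (p ^ j) * b   ≤⟨ +-mono-≤ (multiples-≤ M (p ^ j) (p^k≥1 pp j)) (≤-trans (multiples-* M N (p ^ j) (p ^ (4 ∸ j)) (p^k≥1 pp j) (p^k≥1 pp (4 ∸ j))) (multiples-mono _ (*-mono-≤ (p^k≥1 pp j) (p^k≥1 pp (4 ∸ j))) MN≤x)) ⟩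
      M + multiples x (p ^ j * p ^ (4 ∸ j))    ≡⟨ cong (λ z → M + multiples x z) (trans (sym (^-distribˡ-+-* p j (4 ∸ j))) (cong (p ^_) (m+[n∸m]≡n j≤4))) ⟩
      M + multiples x (p ^ 4)                  ∎
      where
      b = multiples N (p ^ (4 ∸ j))

dyadic-exponent : ∀ b c P → 2 ^ b < P → P ≤ 2 ^ c → ∃[ t ] (1 ≤ t × t ≤ c × b < t × 2 ^ pred t < P × P ≤ 2 ^ pred t + 2 ^ pred t)
dyadic-exponent b zero P b<P P≤1 = contradiction (≤-trans (s≤s (m^n>0 2 b)) (≤-trans b<P P≤1)) λ { (s≤s ()) }
dyadic-exponent b (suc c) P b<P P≤ with P ≤? 2 ^ c
... | yes P≤c = let (t , 1≤t , t≤c , rest) = dyadic-exponent b c P b<P P≤c in t , 1≤t , m≤n⇒m≤1+n t≤c , rest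
... | no P≰ = suc c , s≤s z≤n , ≤-refl , ≰⇒> (λ sc≤b → <⇒≱ b<P (≤-trans P≤ (^-monoʳ-≤ 2 sc≤b))) , ≰⇒> P≰ , ≤-trans P≤ (≤-reflexive (2^suc c))

geometric-tail : ∀ (M : ℕ → ℕ) → (∀ i → 2 * M (suc i) ≤ M i) → ∀ b c → ∑ c (λ t → 𝟙 (b <? t) * M (pred t)) ≤ 2 * M b
geometric-tail M halve b c with ≤-total c b
... | inj₁ c≤b = ≤-trans (≤-reflexive (trans (∑-cong c (λ t _ t≤c → cong (_* M (pred t)) (𝟙-no (b <? t) (≤⇒≯ (≤-trans t≤c c≤b))))) (∑-zero c))) z≤n
... | inj₂ b≤c = subst (λ k → ∑ k f ≤ 2 * M b) (m+[n∸m]≡n b≤c) (≤-trans (≤-reflexive (∑-split b (c ∸ b) f)) (≤-trans (≤-reflexive (cong (_+ ∑ (c ∸ b) (λ i → f (b + i))) (trans (∑-cong b (λ t _ t≤b → cong (_* M (pred t)) (𝟙-no (b <? t) (≤⇒≯ t≤b)))) (∑-zero b)))) (tail (c ∸ b))))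
  where
  f : ℕ → ℕ
  f t = 𝟙 (b <? t) * M (pred t)
  f≤ : ∀ k → f (b + suc k) ≤ M (b + k)
  f≤ k = ≤-trans (*-monoˡ-≤ _ (𝟙≤1 (b <? (b + suc k)))) (≤-reflexive (trans (*-identityˡ _) (cong (M ∘ pred) (+-suc b k))))
  tail′ : ∀ k → ∑ (suc k) (λ i → f (b + i)) + M (b + k) ≤ 2 * M b
  tail′ zero = ≤-trans (+-mono-≤ (f≤ 0) ≤-refl) (≤-reflexive (trans (cong₂ _+_ (cong M (+-identityʳ b)) (cong M (+-identityʳ b))) (cong (M b +_) (sym (+-identityʳ (M b))))))
  tail′ (suc k) = ≤-trans (+-monoˡ-≤ (M (b + suc k)) (+-monoʳ-≤ (∑ (suc k) (λ i → f (b + i))) (f≤ (suc k))))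
    (≤-trans (≤-reflexive (regroup (∑ (suc k) (λ i → f (b + i))) (M (b + suc k)))) (≤-trans (+-monoʳ-≤ (∑ (suc k) (λ i → f (b + i))) (≤-trans (≤-reflexive (cong (λ z → 2 * M z) (+-suc b k))) (halve (b + k)))) (tail′ k)))
    where
    regroup : ∀ s m → s + m + m ≡ s + 2 * m
    regroup = solve-∀
  tail : ∀ k → ∑ k (λ i → f (b + i)) ≤ 2 * M b
  tail zero = z≤n
  tail (suc k) = ≤-trans (m≤m+n _ (M (b + k))) (tail′ k)

fourth-power-tail : ∀ x y Z → 1 ≤ y → y * (y * (y * ∑ Z (λ q → 𝟙 (y <? q) * multiples x (q ^ 4)))) ≤ x
fourth-power-tail x y Z 1≤y = begin
  y * (y * (y * ∑ Z (λ q → 𝟙 (y <? q) * multiples x (q ^ 4))))                    ≤⟨ *-monoʳ-≤ y (*-monoʳ-≤ y (*-monoʳ-≤ y (∑-mono Z (λ q 1≤q _ → pointwise q 1≤q)))) ⟩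
  y * (y * (y * ∑ Z (λ q → 𝟙 (y <? q) * multiples (multiples x (y * y)) (q * q))))  ≤⟨ *-monoʳ-≤ y (*-monoʳ-≤ y (∑-tail-squares (multiples x (y * y)) y Z 1≤y)) ⟩
  y * (y * multiples x (y * y))                                                   ≡⟨ sym (*-assoc y y _) ⟩
  y * y * multiples x (y * y)                                                     ≤⟨ multiples-upper x (y * y) (*-mono-≤ 1≤y 1≤y) ⟩
  x                                                                               ∎
  where
  open ≤-Reasoning
  pointwise : ∀ q → 1 ≤ q → 𝟙 (y <? q) * multiples x (q ^ 4) ≤ 𝟙 (y <? q) * multiples (multiples x (y * y)) (q * q)
  pointwise q 1≤q with y <? q
  ... | no _ = z≤n
  ... | yes y<q = *-monoʳ-≤ 1 (≤-trans (multiples-anti x (*-mono-≤ (*-mono-≤ 1≤y 1≤y) (*-mono-≤ 1≤q 1≤q)) (≤-trans (*-monoˡ-≤ (q * q) (*-mono-≤ (<⇒≤ y<q) (<⇒≤ y<q))) (≤-reflexive (regroup q))))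
      (multiples-nested x (y * y) (q * q) (*-mono-≤ 1≤y 1≤y) (*-mono-≤ 1≤q 1≤q)))
    where
    regroup : ∀ q → q * q * (q * q) ≡ q * (q * (q * (q * 1)))
    regroup = solve-∀

MediumPrime : ℕ → ℕ → ℕ → ℕ → ℕ → ℕ → Set
MediumPrime x Y Y′ b c n = (1 ≤ n × n ≤ x) × (∃[ p ] (1 ≤ p × p ≤ Y′ × Prime p × Y < p × p ^ 4 ∣ s n)) ×
  Σ (PrimeFactor n) (λ F → 2 ^ b < PrimeFactor.P F × PrimeFactor.P F ≤ 2 ^ c)

-- The terms x / 2^t sum geometrically over the dyadic intervals but recur for every p ≤ Y′; the
-- terms x / p⁴ converge over p but recur for each of c intervals. So 2^b has to be large compared
-- with Y′, and c small compared with Y³.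
few-medium-prime : ∀ x Y Y′ b c → Few (MediumPrime x Y Y′ b c)
  (10 * (Y′ * multiples x (2 ^ b)) + 5 * (c * ∑ Y′ (λ p → 𝟙 (Y <? p) * multiples x (p ^ 4))))
few-medium-prime x Y Y′ b c = few-mono total (few-⊆ (λ { n (range , (p , 1≤p , p≤Y′ , pp , Y<p , p⁴∣) , F , lo , hi) →
      let (t , 1≤t , t≤c , b<t , lo′ , hi′) = dyadic-exponent b c (PrimeFactor.P F) lo hi in p , 1≤p , p≤Y′ , t , 1≤t , t≤c , pp , Y<p , b<t , range , p⁴∣ , F , lo′ , hi′ })
    (few-⋃ Y′ (λ p _ _ → few-⋃ c (λ t _ _ → per-index p t))))
  where
  open ≤-Reasoning
  K : ℕ → ℕ → ℕ
  K p t = 𝟙 (Y <? p) * (𝟙 (b <? t) * (5 * (multiples x (2 ^ pred t) + multiples x (p ^ 4))))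
  per-index : ∀ p t → Few (λ n → Prime p × Y < p × b < t × (1 ≤ n × n ≤ x) × p ^ 4 ∣ s n × Σ (PrimeFactor n) (λ F → 2 ^ pred t < PrimeFactor.P F × PrimeFactor.P F ≤ 2 ^ pred t + 2 ^ pred t)) (K p t)
  per-index p t = few-inhabited λ { n (pp , Y<p , b<t , _) → few-mono (≤-reflexive (sym (trans (cong₂ (λ u v → u * (v * (5 * (multiples x (2 ^ pred t) + multiples x (p ^ 4))))) (𝟙-yes (Y <? p) Y<p) (𝟙-yes (b <? t) b<t)) (trans (*-identityˡ _) (*-identityˡ _)))))
    (few-⊆ (λ { n (_ , _ , _ , rest) → rest }) (few-dyadic x p (pred t) pp)) }
  S₄ = ∑ Y′ (λ p → 𝟙 (Y <? p) * multiples x (p ^ 4))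
  halve : ∀ i → 2 * multiples x (2 ^ suc i) ≤ multiples x (2 ^ i)
  halve i = multiples-max (2 ^ i) (m^n>0 2 i) (≤-trans (≤-reflexive (regroup (multiples x (2 ^ suc i)) (2 ^ i))) (multiples-upper x (2 ^ suc i) (m^n>0 2 (suc i))))
    where
    regroup : ∀ m y → 2 * m * y ≡ 2 * y * m
    regroup = solve-∀
  per-prime : ∀ p → ∑ c (K p) ≤ 10 * multiples x (2 ^ b) + 5 * (c * (𝟙 (Y <? p) * multiples x (p ^ 4)))
  per-prime p with Y <? p
  ... | no _ = ≤-trans (≤-reflexive (∑-zero c)) z≤n
  ... | yes _ = begin
    ∑ c (λ t → 1 * (𝟙 (b <? t) * (5 * (multiples x (2 ^ pred t) + R))))      ≤⟨ ∑-mono c (λ t _ _ → split t) ⟩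
    ∑ c (λ t → 5 * (𝟙 (b <? t) * multiples x (2 ^ pred t)) + 5 * R)          ≡⟨ trans (∑-+ c _ _) (cong₂ _+_ (∑-* c 5 _) (∑-const c (5 * R))) ⟩
    5 * ∑ c (λ t → 𝟙 (b <? t) * multiples x (2 ^ pred t)) + c * (5 * R)      ≤⟨ +-monoˡ-≤ _ (*-monoʳ-≤ 5 (geometric-tail (λ i → multiples x (2 ^ i)) halve b c)) ⟩
    5 * (2 * multiples x (2 ^ b)) + c * (5 * R)                              ≡⟨ collect (multiples x (2 ^ b)) c R ⟩
    10 * multiples x (2 ^ b) + 5 * (c * (1 * R))                             ∎
    where
    R = multiples x (p ^ 4)
    collect : ∀ m c R → 5 * (2 * m) + c * (5 * R) ≡ 10 * m + 5 * (c * (1 * R))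
    collect = solve-∀
    split : ∀ t → 1 * (𝟙 (b <? t) * (5 * (multiples x (2 ^ pred t) + R))) ≤ 5 * (𝟙 (b <? t) * multiples x (2 ^ pred t)) + 5 * R
    split t with b <? t
    ... | no _ = z≤n
    ... | yes _ = ≤-reflexive (expand (multiples x (2 ^ pred t)) R)
      where
      expand : ∀ m R → 1 * (1 * (5 * (m + R))) ≡ 5 * (1 * m) + 5 * R
      expand = solve-∀
  total : ∑ Y′ (λ p → ∑ c (K p)) ≤ 10 * (Y′ * multiples x (2 ^ b)) + 5 * (c * S₄)
  total = begin
    ∑ Y′ (λ p → ∑ c (K p))                                                                         ≤⟨ ∑-mono Y′ (λ p _ _ → per-prime p) ⟩
    ∑ Y′ (λ p → 10 * multiples x (2 ^ b) + 5 * (c * (𝟙 (Y <? p) * multiples x (p ^ 4))))           ≡⟨ trans (∑-+ Y′ _ _) (cong₂ _+_ (∑-const Y′ _) (trans (∑-* Y′ 5 _) (cong (5 *_) (∑-* Y′ c _)))) ⟩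
    Y′ * (10 * multiples x (2 ^ b)) + 5 * (c * S₄)                                                 ≡⟨ cong (_+ 5 * (c * S₄)) (swap Y′ (multiples x (2 ^ b))) ⟩
    10 * (Y′ * multiples x (2 ^ b)) + 5 * (c * S₄)                                                 ∎
    where
    swap : ∀ y m → y * (10 * m) ≡ 10 * (y * m)
    swap = solve-∀

*≥1⇒≥1 : ∀ m n → 1 ≤ m * n → 1 ≤ m
*≥1⇒≥1 (suc m) n _ = s≤s z≤n

-- For p ∣ m the prime Q is at most p, so it is determined by m and p.
few-dividing : ∀ x K h e → x < 2 ^ K →
  Few (λ n → (1 ≤ n × n ≤ x) × (∃[ p ] (1 ≤ p × p ≤ x × Prime p × 2 ^ h < p × (p ∣ n) × ¬ (p * p ∣ n) × p ^ 4 ∣ s n)) ×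
    Σ (PrimeFactor n) (λ F → 2 ^ e < PrimeFactor.P F × PrimeFactor.P F ≤ 2 ^ h)) (K * multiples x (2 ^ e))
few-dividing x K h e x< = few-mono (≤-trans (∑-mono x (λ p 1≤p _ → ≤-refl)) (≤-trans (harmonic M K x x<) ≤-refl))
  (few-⊆ (λ { n (range , (p , 1≤p , p≤x , pp , rest) , F) → p , 1≤p , p≤x , pp , range , rest , F })
    (few-⋃ x (λ p 1≤p _ → few-inhabited λ { n (pp , _) → few-⊆ (λ { n (_ , rest) → rest }) (per-prime p pp) })))
  where
  M = multiples x (2 ^ e)
  per-prime : ∀ p → Prime p → Few (λ n → (1 ≤ n × n ≤ x) × (2 ^ h < p × (p ∣ n) × ¬ (p * p ∣ n) × p ^ 4 ∣ s n) × Σ (PrimeFactor n) (λ F → 2 ^ e < PrimeFactor.P F × PrimeFactor.P F ≤ 2 ^ h)) (multiples M p)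
  per-prime p pp = few-coded R (multiples M p) code same
    where
    Below : ℕ → ℕ → Set
    Below m Q = 1 ≤ m × Q < p × ¬ (p * p ∣ m) × p ^ 4 ∣ s m * Q + σ₁ m
    R : ℕ → ℕ → Set
    R i n = ∃[ Q ] (n ≡ i * p * Q × Below (i * p) Q)
    code : ∀ n → _ → ∃[ i ] (1 ≤ i × i ≤ multiples M p × R i n)
    code n ((1≤n , n≤x) , (h<p , p∣n , p²∤n , p⁴∣) , primeFactor {m} {Q} refl pQ Q∤m , e<Q , Q≤h) with euclidsLemma m Q pp p∣n
    ... | inj₂ p∣Q = contradiction (≤-<-trans Q≤h h<p) (≤⇒≯ (∣⇒≤ {{prime⇒nonZero pQ}} p∣Q))
    ... | inj₁ (divides i refl) = i , *≥1⇒≥1 i p 1≤m , multiples-max p (prime≥1 pp) (multiples-max (2 ^ e) (m^n>0 2 e) (≤-trans (*-monoʳ-≤ (i * p) (<⇒≤ e<Q)) n≤x)) , Q , refl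
          , 1≤m , ≤-<-trans Q≤h h<p , (λ h → p²∤n (∣m⇒∣m*n Q h)) , subst (p ^ 4 ∣_) (s-*-prime (i * p) Q 1≤m pQ Q∤m) p⁴∣
      where
      1≤m : 1 ≤ i * p
      1≤m = *≥1⇒≥1 (i * p) Q 1≤n
    p²∣p⁴ : p * p ∣ p ^ 4
    p²∣p⁴ = divides (p * p) (regroup p)
      where
      regroup : ∀ p → p * (p * (p * (p * 1))) ≡ p * p * (p * p)
      regroup = solve-∀
    ordered : ∀ {m Q Q′} → Below m Q → Below m Q′ → ¬ Q < Q′
    ordered {m} {Q} {Q′} (1≤m , _ , p²∤m , h) (_ , Q′<p , _ , h′) Q<Q′ = p²∤m (∣-trans p²∣p⁴ (∣s∣σ⇒∣ m 1≤m p⁴∣s (∣m+n∣m⇒∣n h (∣m⇒∣m*n Q p⁴∣s))))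
      where
      p∤diff : ¬ p ∣ Q′ ∸ Q
      p∤diff k = <⇒≱ (≤-<-trans (m∸n≤m Q′ Q) Q′<p) (∣⇒≤ {{>-nonZero (m<n⇒0<n∸m Q<Q′)}} k)
      p⁴∣s : p ^ 4 ∣ s m
      p⁴∣s = ∤⇒^∣ pp p∤diff 4 (s m) (subst (p ^ 4 ∣_) (*-comm (s m) (Q′ ∸ Q)) (linear-difference (s m) (σ₁ m) Q<Q′ h h′))
    same : ∀ i m n → _ → _ → R i m → R i n → m ≡ n
    same i _ _ _ _ (Q , refl , hQ) (Q′ , refl , hQ′) with <-cmp Q Q′
    ... | tri< Q<Q′ _ _ = contradiction Q<Q′ (ordered hQ hQ′)
    ... | tri≈ _ refl _ = refl
    ... | tri> _ _ Q′<Q = contradiction Q′<Q (ordered hQ′ hQ)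

∑-nested : ∀ x r K → x < 2 ^ K → 1 ≤ r → ∑ x (λ m → multiples (multiples x m) r) ≤ K * multiples x r
∑-nested x r K x< 1≤r = ≤-trans (∑-mono x (λ m 1≤m _ → ≤-trans (multiples-multiples x m r 1≤m 1≤r) (≤-trans (≤-reflexive (cong (multiples x) (*-comm m r))) (multiples-nested x r m 1≤r 1≤m)))) (harmonic (multiples x r) K x x<)

∑-multiples-* : ∀ x a K → x < 2 ^ K → 1 ≤ a → ∑ x (λ p → multiples x (p * a)) ≤ K * multiples x a
∑-multiples-* x a K x< 1≤a = ≤-trans (∑-mono x (λ p 1≤p _ → ≤-trans (≤-reflexive (cong (multiples x) (*-comm p a))) (multiples-nested x a p 1≤a 1≤p))) (harmonic (multiples x a) K x x<)

LargePrime : ℕ → ℕ → ℕ → ℕ → Set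
LargePrime x h n p = 1 ≤ p × p ≤ x × Prime p × 2 ^ h < p × ¬ (p ∣ n) × p ^ 4 ∣ s n

-- p ∤ m implies p ∤ s(m), so P ≤ x / m is fixed modulo p⁴, with at most 1 + x / (m p⁴) choices. The
-- condition P > p 2^e leaves only x / (p 2^e) values of m, which makes the summand 1 affordable.
few-large-cofactor : ∀ x K h e → x < 2 ^ K →
  Few (λ n → (1 ≤ n × n ≤ x) × ∃[ p ] (LargePrime x h n p × Σ (PrimeFactor n) (λ F → p * 2 ^ e < PrimeFactor.P F)))
    (K * multiples x (2 ^ e) + K * ∑ x (λ p → 𝟙 (2 ^ h <? p) * multiples x (p ^ 4)))
few-large-cofactor x K h e x< = few-mono total
  (few-⊆ (λ { n (range , p , (1≤p , p≤x , pp , h<p , rest) , F , lo) → p , 1≤p , p≤x , pp , h<p , range , rest , F , lo })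
    (few-⋃ x (λ p 1≤p _ → few-inhabited λ { n (pp , h<p , _) → few-mono (≤-reflexive (cong (M p +_) (sym (trans (cong (_* T p) (𝟙-yes (2 ^ h <? p) h<p)) (*-identityˡ (T p))))))
      (few-⊆ (λ { n (_ , _ , rest) → rest }) (per-prime p pp)) })))
  where
  open ≤-Reasoning
  M T : ℕ → ℕ
  M p = multiples x (p * 2 ^ e)
  T p = ∑ x (λ m → multiples (multiples x m) (p ^ 4))
  per-prime : ∀ p → Prime p → Few (λ n → (1 ≤ n × n ≤ x) × (¬ (p ∣ n) × p ^ 4 ∣ s n) × Σ (PrimeFactor n) (λ F → p * 2 ^ e < PrimeFactor.P F)) (M p + T p)
  per-prime p pp = few-mono sum≤ (few-⊆ code (few-⋃ {λ m n → ∃[ P ] ((0 < P × P ≤ multiples x m × ¬ (p ∣ m) × p ^ 4 ∣ s m * P + σ₁ m × 1 ≤ m) × n ≡ m * P)} (M p) (λ m 1≤m _ → few-image (m *_) (λ n h → h) (few-inhabited λ { P (_ , _ , p∤m , _) → classes m p∤m }))))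
    where
    U≥1 : 1 ≤ p * 2 ^ e
    U≥1 = *-mono-≤ (prime≥1 pp) (m^n>0 2 e)
    code : ∀ n → _ → _
    code n ((1≤n , n≤x) , (p∤n , p⁴∣) , primeFactor {m} {P} refl pP P∤m , lo) = m , 1≤m , multiples-max (p * 2 ^ e) U≥1 (≤-trans (*-monoʳ-≤ m (<⇒≤ lo)) n≤x)
        , P , (prime≥1 pP , multiples-max m 1≤m (≤-trans (≤-reflexive (*-comm P m)) n≤x) , (λ p∣m → p∤n (∣m⇒∣m*n P p∣m)) , subst (p ^ 4 ∣_) (s-*-prime m P 1≤m pP P∤m) p⁴∣ , 1≤m) , refl
      where
      1≤m : 1 ≤ m
      1≤m = *≥1⇒≥1 m P 1≤n
    instance
      p⁴≢0 : NonZero (p ^ 4)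
      p⁴≢0 = >-nonZero (p^k≥1 pp 4)
    classes : ∀ m → ¬ p ∣ m → Few (λ P → 0 < P × P ≤ multiples x m × ¬ (p ∣ m) × p ^ 4 ∣ s m * P + σ₁ m × 1 ≤ m) (1 + multiples (multiples x m) (p ^ 4))
    classes m p∤m = few-mono (+-monoʳ-≤ 1 (multiples-max (p ^ 4) (p^k≥1 pp 4) (m/n*n≤m (multiples x m) (p ^ 4))))
      (few-spaced 0 (multiples x m) (p ^ 4) (λ { P (a , b , _) → a , b }) (λ { P P′ (_ , _ , _ , hP , 1≤m) (_ , _ , _ , hP′ , _) P<P′ →
        ∤⇒^∣ pp (λ p∣s → p∤m (∣s∣σ⇒∣ m 1≤m p∣s (∣m+n∣m⇒∣n (∣-trans (m∣m*n (p ^ 3)) hP) (∣m⇒∣m*n P p∣s)))) 4 (P′ ∸ P) (linear-difference (s m) (σ₁ m) P<P′ hP hP′) }))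
    sum≤ : ∑ (M p) (λ m → 1 + multiples (multiples x m) (p ^ 4)) ≤ M p + T p
    sum≤ = begin
      ∑ (M p) (λ m → 1 + multiples (multiples x m) (p ^ 4))                   ≡⟨ trans (∑-+ (M p) (λ _ → 1) _) (cong (_+ ∑ (M p) _) (trans (∑-const (M p) 1) (*-identityʳ (M p)))) ⟩
      M p + ∑ (M p) f                                                         ≤⟨ +-monoʳ-≤ (M p) (m≤m+n _ _) ⟩
      M p + (∑ (M p) f + ∑ (x ∸ M p) (λ i → f (M p + i)))                     ≡⟨ cong (M p +_) (trans (sym (∑-split (M p) (x ∸ M p) f)) (cong (λ k → ∑ k f) (m+[n∸m]≡n (multiples-≤ x _ U≥1)))) ⟩
      M p + T p                                                               ∎
      where
      f : ℕ → ℕ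
      f m = multiples (multiples x m) (p ^ 4)
  total : ∑ x (λ p → M p + 𝟙 (2 ^ h <? p) * T p) ≤ K * multiples x (2 ^ e) + K * ∑ x (λ p → 𝟙 (2 ^ h <? p) * multiples x (p ^ 4))
  total = begin
    ∑ x (λ p → M p + 𝟙 (2 ^ h <? p) * T p)                              ≡⟨ ∑-+ x _ _ ⟩
    ∑ x M + ∑ x (λ p → 𝟙 (2 ^ h <? p) * T p)                            ≤⟨ +-mono-≤ (∑-multiples-* x (2 ^ e) K x< (m^n>0 2 e)) (∑-mono x (λ p 1≤p _ → *-monoʳ-≤ (𝟙 (2 ^ h <? p)) (∑-nested x (p ^ 4) K x< (m^n>0 p {{>-nonZero 1≤p}} 4)))) ⟩
    K * multiples x (2 ^ e) + ∑ x (λ p → 𝟙 (2 ^ h <? p) * (K * multiples x (p ^ 4)))  ≡⟨ cong (K * multiples x (2 ^ e) +_) (trans (∑-cong x (λ p _ _ → swap (𝟙 (2 ^ h <? p)) K (multiples x (p ^ 4)))) (∑-* x K _)) ⟩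
    K * multiples x (2 ^ e) + K * ∑ x (λ p → 𝟙 (2 ^ h <? p) * multiples x (p ^ 4))    ∎
    where
    swap : ∀ a K m → a * (K * m) ≡ K * (a * m)
    swap = solve-∀

-- Unitary divisors determined by the prime p and the cofactor

σ-product : List ℕ → ℕ
σ-product [] = 1
σ-product (q ∷ l) = suc q * σ-product l

σ₁-product : ∀ m l → 1 ≤ m → All Prime l → Unique l → All (λ q → ¬ q ∣ m) l → σ₁ (m * product l) ≡ σ₁ m * σ-product l
σ₁-product m [] 1≤m [] [] [] = trans (cong σ₁ (*-identityʳ m)) (sym (*-identityʳ (σ₁ m)))
σ₁-product m (q ∷ l) 1≤m (pq ∷ pl) (q∉l ∷ ul) (q∤m ∷ l∤m) = begin
  σ₁ (m * (q * product l))            ≡⟨ cong σ₁ (regroup m q (product l)) ⟩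
  σ₁ (m * product l * q)              ≡⟨ σ₁-*-prime (m * product l) q (*-mono-≤ 1≤m (product≥1 pl)) pq (λ h → [ q∤m , prime∤product pq pl q∉l ]′ (euclidsLemma m (product l) pq h)) ⟩
  σ₁ (m * product l) * suc q          ≡⟨ cong (_* suc q) (σ₁-product m l 1≤m pl ul l∤m) ⟩
  σ₁ m * σ-product l * suc q          ≡⟨ regroup′ (σ₁ m) (σ-product l) (suc q) ⟩
  σ₁ m * (suc q * σ-product l)        ∎
  where
  open ≡-Reasoning
  regroup : ∀ m q l → m * (q * l) ≡ m * l * q
  regroup = solve-∀
  regroup′ : ∀ a b c → a * b * c ≡ a * (c * b)
  regroup′ = solve-∀

-- A prime q exceeding all entries of an odd list divides none of the numbers r + 1, as r + 1 is even and at most q.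
prime∤σ-product : ∀ {q} l → Prime q → 2 < q → All (λ r → r < q × 2 ∣ suc r) l → ¬ q ∣ σ-product l
prime∤σ-product [] pq 2<q [] h = <-irrefl refl (≤-trans (prime≥2 pq) (∣⇒≤ h))
prime∤σ-product {q} (r ∷ l) pq 2<q ((r<q , even) ∷ a) h with euclidsLemma (suc r) (σ-product l) pq h
... | inj₂ k = prime∤σ-product l pq 2<q a k
... | inj₁ k = <-irrefl (prime∣prime prime[2] pq (subst (2 ∣_) (≤-antisym r<q (∣⇒≤ k)) even)) 2<q

-- σ(u)/u determines an odd squarefree u: the largest prime factor can be read off the denominator.
module _ {P P′ : ℕ → Set} (P? : ∀ n → Dec (P n)) (P′? : ∀ n → Dec (P′ n))
  (odd : ∀ {q} → P q → Prime q × 2 < q) (odd′ : ∀ {q} → P′ q → Prime q × 2 < q) where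

  private
    below : ∀ {Q : ℕ → Set} (Q? : ∀ n → Dec (Q n)) → (∀ {q} → Q q → Prime q × 2 < q) → ∀ n → All (λ r → r < suc n × 2 ∣ suc r) (select Q? n)
    below Q? oddQ n = All.map (λ { (_ , r≤n , q) → s≤s r≤n , 2∣suc-odd (proj₁ (oddQ q)) (proj₂ (oddQ q)) }) (select-all Q? n)

    primes : ∀ {Q : ℕ → Set} (Q? : ∀ n → Dec (Q n)) → (∀ {q} → Q q → Prime q × 2 < q) → ∀ n → All Prime (select Q? n)
    primes Q? oddQ n = All.map (λ { (_ , _ , q) → proj₁ (oddQ q) }) (select-all Q? n)

    absurd-top : ∀ {Q Q′ : ℕ → Set} (Q? : ∀ n → Dec (Q n)) (Q′? : ∀ n → Dec (Q′ n)) → (∀ {q} → Q q → Prime q × 2 < q) → (∀ {q} → Q′ q → Prime q × 2 < q) →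
      ∀ n → Prime (suc n) → 2 < suc n → suc (suc n) * σ-product (select Q? n) * product (select Q′? n) ≡ σ-product (select Q′? n) * (suc n * product (select Q? n)) → ⊥
    absurd-top Q? Q′? oddQ oddQ′ n pq 2<q e = [ [ (λ h → prime∤1 (∣m+n∣m⇒∣n (subst (suc n ∣_) (+-comm 1 (suc n)) h) ∣-refl)) , prime∤σ-product (select Q? n) pq 2<q (below Q? oddQ n) ]′ ∘ euclidsLemma (suc (suc n)) (σ-product (select Q? n)) pq
        , prime∤product pq (primes Q′? oddQ′ n) (All.map (λ { (_ , r≤n , _) refl → <-irrefl refl r≤n }) (select-all Q′? n)) ]′
      (euclidsLemma (suc (suc n) * σ-product (select Q? n)) (product (select Q′? n)) pq (subst (suc n ∣_) (sym e) (∣n⇒∣m*n (σ-product (select Q′? n)) (m∣m*n (product (select Q? n))))))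
      where
      prime∤1 : ¬ suc n ∣ 1
      prime∤1 h = <⇒≱ (≤-trans (s≤s (s≤s z≤n)) 2<q) (∣⇒≤ h)

  σ-ratio-injective : ∀ n → σ-product (select P? n) * product (select P′? n) ≡ σ-product (select P′? n) * product (select P? n) → product (select P? n) ≡ product (select P′? n)
  σ-ratio-injective zero e = refl
  σ-ratio-injective (suc n) e with P? (suc n) | P′? (suc n)
  ... | no _ | no _ = σ-ratio-injective n e
  ... | yes p | yes p′ = cong (suc n *_) (σ-ratio-injective n (*-cancelˡ-≡ _ _ (suc (suc n) * suc n) (trans (regroup (suc (suc n)) (σ-product (select P? n)) (suc n) (product (select P′? n))) (trans e (sym (regroup (suc (suc n)) (σ-product (select P′? n)) (suc n) (product (select P? n))))))))
    where
    regroup : ∀ a s b t → a * b * (s * t) ≡ a * s * (b * t)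
    regroup = solve-∀
  ... | yes p | no _ = ⊥-elim (absurd-top P? P′? odd odd′ n (proj₁ (odd p)) (proj₂ (odd p)) e)
  ... | no _ | yes p′ = ⊥-elim (absurd-top P′? P? odd′ odd n (proj₁ (odd′ p′)) (proj₂ (odd′ p′)) (sym e))

factor? : ∀ u q → Dec (Prime q × q ∣ u)
factor? u q = prime? q ×-dec (q ∣? u)

∈⇒∣-product : ∀ {q l} → q ∈ l → q ∣ product l
∈⇒∣-product {l = q ∷ l} (here refl) = m∣m*n (product l)
∈⇒∣-product {l = r ∷ l} (there q∈l) = ∣n⇒∣m*n r (∈⇒∣-product q∈l)

product-factors : ∀ {l} → All Prime l → Unique l → ∀ N → product l ≤ N → product (select (factor? (product l)) N) ≡ product l
product-factors {l} pl ul N u≤N = ∣-antisym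
  (product∣ (All.map (λ { (_ , _ , pq , _) → pq }) all) (select-unique (factor? (product l)) N) (All.map (λ { (_ , _ , _ , q∣) → q∣ }) all))
  (product∣ pl ul (All.tabulate (λ {q} q∈l → ∈⇒∣-product (select-complete (factor? (product l)) N (prime≥1 (All.lookup pl q∈l))
    (≤-trans (∣⇒≤ {{>-nonZero (product≥1 pl)}} (∈⇒∣-product q∈l)) u≤N) (All.lookup pl q∈l , ∈⇒∣-product q∈l)))))
  where
  all = select-all (factor? (product l)) N

-- The lower margin leaves at most x / (p 2^e) cofactors m; the upper margin absorbs the factor K of
-- σ(u) ≤ K u.
Unitary : ℕ → ℕ → ℕ → Set
Unitary p e n = ∃[ m ] ∃[ l ] (n ≡ m * product l × All (λ q → Prime q × 2 < q) l × Unique l × All (λ q → ¬ q ∣ m) l × p * 2 ^ e < product l × product l * 2 ^ e ≤ p * p)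

-- If n = m u and n′ = m u′ satisfy σ(n) ≡ n and σ(n′) ≡ n′ modulo p⁴, then σ(u) u′ ≡ σ(u′) u modulo p⁴;
-- both sides are less than p⁴, so u = u′.
few-unitary : ∀ x K h e → x < 2 ^ K → K < 2 ^ (e + e) →
  Few (λ n → (1 ≤ n × n ≤ x) × ∃[ p ] (LargePrime x h n p × Unitary p e n)) (K * multiples x (2 ^ e))
few-unitary x K h e x< K< = few-mono (∑-multiples-* x (2 ^ e) K x< (m^n>0 2 e))
  (few-⊆ (λ { n (range , p , (1≤p , p≤x , pp , _ , rest) , U) → p , 1≤p , p≤x , pp , range , rest , U })
    (few-⋃ x (λ p _ _ → few-inhabited λ { n (pp , _) → few-⊆ (λ { n (_ , rest) → rest }) (per-prime p pp) })))
  where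
  per-prime : ∀ p → Prime p → Few (λ n → (1 ≤ n × n ≤ x) × (¬ (p ∣ n) × p ^ 4 ∣ s n) × Unitary p e n) (multiples x (p * 2 ^ e))
  per-prime p pp = few-coded R (multiples x (p * 2 ^ e)) code same
    where
    Admissible : ℕ → List ℕ → Set
    Admissible m l = (1 ≤ m * product l × m * product l ≤ x) × (¬ (p ∣ m * product l) × p ^ 4 ∣ s (m * product l)) × All (λ q → Prime q × 2 < q) l × Unique l × All (λ q → ¬ q ∣ m) l × product l * 2 ^ e ≤ p * p
    R : ℕ → ℕ → Set
    R m n = ∃[ l ] (n ≡ m * product l × Admissible m l)
    code : ∀ n → _ → ∃[ m ] (1 ≤ m × m ≤ multiples x (p * 2 ^ e) × R m n)
    code n ((1≤n , n≤x) , rest , m , l , refl , odd , ul , ∤m , lo , hi) = m , *≥1⇒≥1 m (product l) 1≤n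
      , multiples-max (p * 2 ^ e) (*-mono-≤ (prime≥1 pp) (m^n>0 2 e)) (≤-trans (*-monoʳ-≤ m (<⇒≤ lo)) n≤x) , l , refl , (1≤n , n≤x) , rest , odd , ul , ∤m , hi
    module Compare (m : ℕ) (l : List ℕ) (adm : Admissible m l) where
      u = product l
      n = m * u
      odd = proj₁ (proj₂ (proj₂ adm))
      ul = proj₁ (proj₂ (proj₂ (proj₂ adm)))
      ∤m = proj₁ (proj₂ (proj₂ (proj₂ (proj₂ adm))))
      hi = proj₂ (proj₂ (proj₂ (proj₂ (proj₂ adm))))
      pl : All Prime l
      pl = All.map proj₁ odd
      n≥1 : 1 ≤ n
      n≥1 = proj₁ (proj₁ adm)
      m≥1 : 1 ≤ m
      m≥1 = *≥1⇒≥1 m u n≥1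
      u≥1 : 1 ≤ u
      u≥1 = product≥1 pl
      p∤n : ¬ p ∣ n
      p∤n = proj₁ (proj₁ (proj₂ adm))
      p⁴∣s : p ^ 4 ∣ s n
      p⁴∣s = proj₂ (proj₁ (proj₂ adm))
      in-list : ∀ {q} → Prime q × q ∣ u → q ∈ l
      in-list (pq , q∣u) = factorisationHasAllPrimeFactors pq q∣u pl
      -- The prime factors of u are listed in decreasing order from a bound N common to both
      -- divisors, the form that `σ-ratio-injective` compares.
      σu : ℕ → ℕ
      σu N = σ-product (select (factor? u) N)
      σ-multiplicative : ∀ k N → 1 ≤ k → All (λ q → ¬ q ∣ k) l → u ≤ N → σ₁ (k * u) ≡ σ₁ k * σu N
      σ-multiplicative k N 1≤k ∤k u≤N = trans (cong (λ z → σ₁ (k * z)) (sym (product-factors pl ul N u≤N)))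
        (σ₁-product k (select (factor? u) N) 1≤k (All.map (λ { (_ , _ , pq , _) → pq }) (select-all (factor? u) N)) (select-unique (factor? u) N)
          (All.map (λ { (_ , _ , f) → All.lookup ∤k (in-list f) }) (select-all (factor? u) N)))
      p∤σm : ¬ p ∣ σ₁ m
      p∤σm h = p∤n (∣m+n∣m⇒∣n (subst (p ∣_) (trans (sym (σ-multiplicative m u m≥1 ∤m ≤-refl)) (sym (s+n≡σ₁ n n≥1))) (∣m⇒∣m*n (σu u) h)) (∣-trans (m∣m*n (p ^ 3)) p⁴∣s))
      σu-bound : ∀ N → u ≤ N → σu N ≤ K * u
      σu-bound N u≤N = ≤-trans (≤-reflexive (sym (trans (sym (cong σ₁ (*-identityˡ u))) (trans (σ-multiplicative 1 N ≤-refl (All.map (λ { (pq , 2<q) q∣1 → <⇒≱ (≤-trans (s≤s (s≤s z≤n)) 2<q) (∣⇒≤ q∣1) }) odd) u≤N) (trans (cong (_* σu N) σ₁1) (*-identityˡ _))))))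
          (σ₁-bound K u (≤-<-trans (≤-trans (m≤n*m u m {{>-nonZero m≥1}}) (proj₂ (proj₁ adm))) x<))
        where
        σ₁1 : σ₁ 1 ≡ 1
        σ₁1 = trans (*-identityʳ _) (𝟙-yes (1 ∣? 1) ∣-refl)
    ordered : ∀ m l l′ (adm : Admissible m l) (adm′ : Admissible m l′) → let N = product l + product l′ in
      Compare.σu m l′ adm′ N * product l ≤ Compare.σu m l adm N * product l′ → Compare.σu m l adm N * product l′ ≡ Compare.σu m l′ adm′ N * product l
    ordered m l l′ adm adm′ X₂≤X₁ = ≤-antisym (m∸n≡0⇒m≤n D≡0) X₂≤X₁
      where
      open Compare m l adm
      module ′ = Compare m l′ adm′
      N = u + ′.u
      X₁ = σu N * ′.u
      X₂ = ′.σu N * u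
      D = X₁ ∸ X₂
      σn : σ₁ m * σu N ≡ s n + n
      σn = trans (sym (σ-multiplicative m N m≥1 ∤m (m≤m+n u ′.u))) (sym (s+n≡σ₁ n n≥1))
      σn′ : σ₁ m * ′.σu N ≡ s ′.n + ′.n
      σn′ = trans (sym (′.σ-multiplicative m N m≥1 ′.∤m (m≤n+m ′.u u))) (sym (s+n≡σ₁ ′.n ′.n≥1))
      -- The terms m u u′ cancel from σ(n) = s(n) + n and its analogue. As p⁴ divides s(n) and s(n′)
      -- and p does not divide σ(m), it follows that p⁴ divides D.
      balance : u * s ′.n + σ₁ m * D ≡ ′.u * s n
      balance = +-cancelʳ-≡ (m * u * ′.u) _ _ (begin
        u * s ′.n + σ₁ m * D + m * u * ′.u           ≡⟨ regroup u (s ′.n) (σ₁ m * D) m ′.u ⟩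
        u * (s ′.n + m * ′.u) + σ₁ m * D             ≡⟨ cong (λ z → u * z + σ₁ m * D) (sym σn′) ⟩
        u * (σ₁ m * ′.σu N) + σ₁ m * D               ≡⟨ regroup′ u (σ₁ m) (′.σu N) D ⟩
        σ₁ m * (X₂ + D)                              ≡⟨ cong (σ₁ m *_) (m+[n∸m]≡n X₂≤X₁) ⟩
        σ₁ m * (σu N * ′.u)                          ≡⟨ regroup″ (σ₁ m) (σu N) ′.u ⟩
        ′.u * (σ₁ m * σu N)                          ≡⟨ cong (′.u *_) σn ⟩
        ′.u * (s n + m * u)                          ≡⟨ regroup‴ ′.u (s n) m u ⟩
        ′.u * s n + m * u * ′.u                      ∎)
        where
        open ≡-Reasoning
        regroup : ∀ u a d m v → u * a + d + m * u * v ≡ u * (a + m * v) + d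
        regroup = solve-∀
        regroup′ : ∀ u a b d → u * (a * b) + a * d ≡ a * (b * u + d)
        regroup′ = solve-∀
        regroup″ : ∀ a b v → a * (b * v) ≡ v * (a * b)
        regroup″ = solve-∀
        regroup‴ : ∀ v a m u → v * (a + m * u) ≡ v * a + m * u * v
        regroup‴ = solve-∀
      p⁴∣D : p ^ 4 ∣ D
      p⁴∣D = ∤⇒^∣ pp p∤σm 4 D (∣m+n∣m⇒∣n (subst (p ^ 4 ∣_) (sym balance) (∣n⇒∣m*n ′.u p⁴∣s)) (∣n⇒∣m*n u ′.p⁴∣s))
      X₁<p⁴ : X₁ < p ^ 4
      X₁<p⁴ = begin-strict
        σu N * ′.u                          ≤⟨ *-monoˡ-≤ ′.u (σu-bound N (m≤m+n u ′.u)) ⟩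
        K * u * ′.u                         ≡⟨ *-assoc K u ′.u ⟩
        K * (u * ′.u)                       <⟨ *-monoˡ-< (u * ′.u) {{>-nonZero (*-mono-≤ u≥1 ′.u≥1)}} K< ⟩
        2 ^ (e + e) * (u * ′.u)             ≡⟨ cong (_* (u * ′.u)) (^-distribˡ-+-* 2 e e) ⟩
        2 ^ e * 2 ^ e * (u * ′.u)           ≡⟨ regroup (2 ^ e) u ′.u ⟩
        (u * 2 ^ e) * (′.u * 2 ^ e)         ≤⟨ *-mono-≤ hi ′.hi ⟩
        p * p * (p * p)                     ≡⟨ regroup′ p ⟩
        p ^ 4                               ∎
        where
        open ≤-Reasoning
        regroup : ∀ t u v → t * t * (u * v) ≡ (u * t) * (v * t)
        regroup = solve-∀
        regroup′ : ∀ p → p * p * (p * p) ≡ p * (p * (p * (p * 1)))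
        regroup′ = solve-∀
      D≡0 : D ≡ 0
      D≡0 = small D (≤-<-trans (m∸n≤m X₁ X₂) X₁<p⁴) p⁴∣D
        where
        small : ∀ D → D < p ^ 4 → p ^ 4 ∣ D → D ≡ 0
        small zero _ _ = refl
        small (suc D) lt h = contradiction (∣⇒≤ h) (<⇒≱ lt)
    same : ∀ m n n′ → _ → _ → R m n → R m n′ → n ≡ n′
    same m _ _ _ _ (l , refl , adm) (l′ , refl , adm′) = cong (m *_) (trans (sym (product-factors pl ul N (m≤m+n u ′.u)))
      (trans (σ-ratio-injective (factor? u) (factor? ′.u) (All.lookup odd ∘ in-list) (All.lookup ′.odd ∘ ′.in-list) N ratio) (product-factors ′.pl ′.ul N (m≤n+m ′.u u))))
      where
      open Compare m l adm
      module ′ = Compare m l′ adm′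
      N = u + ′.u
      ratio≡ : σu N * ′.u ≡ ′.σu N * u
      ratio≡ with ≤-total (′.σu N * u) (σu N * ′.u)
      ... | inj₁ X₂≤X₁ = ordered m l l′ adm adm′ X₂≤X₁
      ... | inj₂ X₁≤X₂ = sym (subst (λ k → ′.σu k * u ≡ σu k * ′.u) (+-comm ′.u u) (ordered m l′ l adm′ adm (subst (λ k → σu k * ′.u ≤ ′.σu k * u) (+-comm u ′.u) X₁≤X₂)))
      ratio : σu N * product (select (factor? ′.u) N) ≡ ′.σu N * product (select (factor? u) N)
      ratio = subst₂ (λ a b → σu N * a ≡ ′.σu N * b) (sym (product-factors ′.pl ′.ul N (m≤n+m ′.u u))) (sym (product-factors pl ul N (m≤m+n u ′.u))) ratio≡

-- Divisors of typical integers in a given range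

smooth-bound : ∀ y E n → 1 ≤ n → (∀ q → Prime q → q ∣ n → q ≤ y) → (∀ j → 2 ≤ j → j ≤ y → ¬ j ^ E ∣ n) → n ≤ 2 ^ (y * (y * E))
smooth-bound y E n 1≤n smooth no-power = ≤-trans (smooth-size n y y n (<⇒≤ (n<2^n y)) 1≤n (<⇒≤ (n<2^n n)) smooth)
  (^-monoʳ-≤ 2 (∑-≤ y (y * E) (λ q _ q≤y → per-prime q q≤y)))
  where
  open ≤-Reasoning
  valuation≤ : ∀ q → Prime q → q ≤ y → valuation n q n ≤ E
  valuation≤ q pq q≤y = begin
    ∑ n f                                     ≤⟨ m≤m+n _ _ ⟩
    ∑ n f + ∑ E (λ i → f (n + i))             ≡⟨ sym (∑-split n E f) ⟩
    ∑ (n + E) f                               ≡⟨ cong (λ k → ∑ k f) (+-comm n E) ⟩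
    ∑ (E + n) f                               ≡⟨ ∑-split E n f ⟩
    ∑ E f + ∑ n (λ i → f (E + i))             ≤⟨ +-mono-≤ (∑-≤ E 1 (λ a _ _ → 𝟙≤1 (q ^ a ∣? n))) (≤-reflexive (trans (∑-cong n (λ i _ _ → 𝟙-no (q ^ (E + i) ∣? n) (λ h → no-power q (prime≥2 pq) q≤y (∣-trans (subst (q ^ E ∣_) (sym (^-distribˡ-+-* q E i)) (m∣m*n (q ^ i))) h)))) (∑-zero n))) ⟩
    E * 1 + 0                                 ≡⟨ trans (+-identityʳ _) (*-identityʳ E) ⟩
    E                                         ∎
    where
    f : ℕ → ℕ
    f a = 𝟙 (q ^ a ∣? n)
  per-prime : ∀ q → q ≤ y → 𝟙 (prime? q) * (log y q * valuation n q n) ≤ y * E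
  per-prime q q≤y with prime? q
  ... | no _ = z≤n
  ... | yes pq = ≤-trans (≤-reflexive (*-identityˡ _)) (*-mono-≤ (log≤ y q y (≤-trans q≤y (<⇒≤ (n<2^n y)))) (valuation≤ q pq q≤y))

-- Primes above y divide n at most once, and the y-smooth part of n is bounded by `smooth-bound`.
Typical : ℕ → ℕ → ℕ → Set
Typical y E n = (∀ j → y < j → ¬ j * j ∣ n) × (∀ j → 2 ≤ j → j ≤ y → ¬ j ^ E ∣ n)

-- The divisor is built greedily from distinct primes > y.
module _ (y E : ℕ) (2≤y : 2 ≤ y) (n : ℕ) (n≥1 : 1 ≤ n) (typical : Typical y E n) where

  prime-cofactor : ∀ {q} → Prime q → y < q → q ∣ n → PrimeFactor n
  prime-cofactor {q} pq y<q (divides m eq) = primeFactor {m = m} {P = q} eq pq (λ q∣m → proj₁ typical q y<q (subst (q * q ∣_) (sym eq) (*-monoˡ-∣ q q∣m)))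

  list-cofactor : ∀ l → All (λ q → Prime q × y < q × q ∣ n) l → Unique l → ∃[ m ] (n ≡ m * product l × All (λ q → ¬ q ∣ m) l)
  list-cofactor l al ul with product∣ (All.map proj₁ al) ul (All.map (proj₂ ∘ proj₂) al)
  ... | divides m eq = m , eq , All.tabulate (λ {q} q∈l q∣m → proj₁ typical q (proj₁ (proj₂ (All.lookup al q∈l))) (subst (q * q ∣_) (sym eq) (*-pres-∣ q∣m (∈⇒∣-product q∈l))))

  unitary : ∀ p e l → All (λ q → Prime q × y < q × q ∣ n) l → Unique l → p * 2 ^ e < product l → product l * 2 ^ e ≤ p * p → Unitary p e n
  unitary p e l al ul lo hi = let (m , eq , ∤m) = list-cofactor l al ul in m , l , eq , All.map (λ { (pq , y<q , _) → pq , ≤-<-trans 2≤y y<q }) al , ul , ∤m , lo , hi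

  -- A prime factor is at most p / 2^(3e), so a product up to p 2^e cannot jump beyond p² / 2^e.
  -- While the product is that small, n is too large for the cofactor to be y-smooth, so a next
  -- prime exists. Each step at least doubles the product, which limits their number by f.
  greedy : ∀ p e → p * 2 ^ e * 2 ^ (y * (y * E)) < n → (∀ q → Prime q → q ∣ n → q * 2 ^ (3 * e) ≤ p) →
    ∀ f l → All (λ q → Prime q × y < q × q ∣ n) l → Unique l → product l ≤ p * 2 ^ e → p * 2 ^ e < 2 ^ f * product l → Unitary p e n
  greedy p e large small zero l al ul u≤ <u = contradiction (≤-trans (≤-reflexive (*-identityˡ (product l))) u≤) (<⇒≱ <u)
  greedy p e large small (suc f) l al ul u≤ <u with list-cofactor l al ul
  ... | m , eq , ∤m with search (λ q → (prime? q ×-dec (y <? q)) ×-dec (q ∣? m)) m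
  ...   | inj₂ none = contradiction n≤ (<⇒≱ large)
    where
    m≥1 : 1 ≤ m
    m≥1 = *≥1⇒≥1 m (product l) (subst (1 ≤_) eq n≥1)
    m≤ : m ≤ 2 ^ (y * (y * E))
    m≤ = smooth-bound y E m m≥1 (λ q pq q∣m → ≮⇒≥ (λ y<q → none q (prime≥1 pq) (∣⇒≤ {{>-nonZero m≥1}} q∣m) ((pq , y<q) , q∣m)))
      (λ j 2≤j j≤y h → proj₂ typical j 2≤j j≤y (∣-trans h (subst (m ∣_) (sym eq) (m∣m*n (product l)))))
    n≤ : n ≤ p * 2 ^ e * 2 ^ (y * (y * E))
    n≤ = ≤-trans (≤-reflexive (trans eq (*-comm m (product l)))) (*-mono-≤ u≤ m≤)
  ...   | inj₁ (q , _ , _ , (pq , y<q) , q∣m) = continue (product (q ∷ l) ≤? p * 2 ^ e)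
    where
    open ≤-Reasoning
    q∣n : q ∣ n
    q∣n = subst (q ∣_) (sym eq) (∣m⇒∣m*n (product l) q∣m)
    al′ : All (λ q → Prime q × y < q × q ∣ n) (q ∷ l)
    al′ = (pq , y<q , q∣n) ∷ al
    ul′ : Unique (q ∷ l)
    ul′ = All.map (λ { {r} r∤m refl → r∤m q∣m }) ∤m ∷ ul
    hi : q * product l * 2 ^ e ≤ p * p
    hi = ≤-trans (m≤m*n (q * product l * 2 ^ e) (2 ^ e) {{m^n≢0 2 e}}) (*-cancelʳ-≤ _ _ (2 ^ e) {{m^n≢0 2 e}} (begin
      q * product l * 2 ^ e * 2 ^ e * 2 ^ e      ≡⟨ regroup q (product l) (2 ^ e) ⟩
      q * (2 ^ e * (2 ^ e * 2 ^ e)) * product l  ≡⟨ cong (λ z → q * z * product l) (sym (trans (^-distribˡ-+-* 2 e (e + (e + 0))) (cong (2 ^ e *_) (trans (cong (2 ^_) (cong (e +_) (+-identityʳ e))) (^-distribˡ-+-* 2 e e))))) ⟩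
      q * 2 ^ (3 * e) * product l                ≤⟨ *-mono-≤ (small q pq q∣n) u≤ ⟩
      p * (p * 2 ^ e)                            ≡⟨ sym (*-assoc p p (2 ^ e)) ⟩
      p * p * 2 ^ e                              ∎))
      where
      regroup : ∀ q u t → q * u * t * t * t ≡ q * (t * (t * t)) * u
      regroup = solve-∀
    continue : Dec (q * product l ≤ p * 2 ^ e) → Unitary p e n
    continue (no u≰) = unitary p e (q ∷ l) al′ ul′ (≰⇒> u≰) hi
    continue (yes u≤′) = greedy p e large small f (q ∷ l) al′ ul′ u≤′ (<-≤-trans <u (begin
      2 * 2 ^ f * product l        ≡⟨ regroup (2 ^ f) (product l) ⟩
      2 ^ f * (2 * product l)      ≤⟨ *-monoʳ-≤ (2 ^ f) (*-monoˡ-≤ (product l) (prime≥2 pq)) ⟩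
      2 ^ f * (q * product l)      ∎))
      where
      regroup : ∀ t u → 2 * t * u ≡ t * (2 * u)
      regroup = solve-∀

  -- If no prime factor exceeds p 2^e and none exceeds p / 2^(3e), the greedy product works. A prime
  -- factor P between these bounds is multiplied by the given Q: Q > 2^(5e) lifts it above p 2^e,
  -- and Q ≤ 2^e₁ keeps it below p² / 2^e.
  large-prime-cases : ∀ p h e e₁ → 2 ^ h < p → e₁ + 3 * e ≤ h → p * 2 ^ e * 2 ^ (y * (y * E)) < n → y ≤ 2 ^ e →
    Σ (PrimeFactor n) (λ F → 2 ^ (5 * e) < PrimeFactor.P F × PrimeFactor.P F ≤ 2 ^ e₁) →
    Σ (PrimeFactor n) (λ F → p * 2 ^ e < PrimeFactor.P F) ⊎ Unitary p e n
  large-prime-cases p h e e₁ h<p e₁≤ large y≤ (primeFactor {m} {Q} eq pQ _ , lo , hi)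
    with search (λ q → (prime? q ×-dec (q ∣? n)) ×-dec (p * 2 ^ e <? q)) n | search (λ q → (prime? q ×-dec (q ∣? n)) ×-dec (p <? q * 2 ^ (3 * e))) n
  ... | inj₁ (P , _ , _ , (pP , P∣n) , big) | _ = inj₁ (prime-cofactor pP (≤-<-trans (≤-trans y≤ (m≤n*m (2 ^ e) p {{>-nonZero (≤-trans (s≤s z≤n) h<p)}})) big) P∣n , big)
  ... | inj₂ none | inj₂ none′ = inj₂ (greedy p e large (λ q pq q∣n → ≮⇒≥ (λ lt → none′ q (prime≥1 pq) (∣⇒≤ {{>-nonZero n≥1}} q∣n) ((pq , q∣n) , lt)))
        (p * 2 ^ e) [] [] [] (*-mono-≤ {1} {p} {1} {2 ^ e} (≤-trans (s≤s z≤n) h<p) (m^n>0 2 e)) (<-≤-trans (n<2^n (p * 2 ^ e)) (≤-reflexive (sym (*-identityʳ _)))))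
  ... | inj₂ none | inj₁ (P , 1≤P , P≤n , (pP , P∣n) , big) = inj₂ (unitary p e (P ∷ Q ∷ []) ((pP , y<P , P∣n) ∷ (pQ , y<Q , Q∣n) ∷ []) (((λ e → <⇒≢ Q<P (sym e)) ∷ []) ∷ [] ∷ []) low high)
    where
    open ≤-Reasoning
    t = 2 ^ e
    Q∣n : Q ∣ n
    Q∣n = subst (Q ∣_) (sym eq) (n∣m*n m)
    P≤ : P ≤ p * t
    P≤ = ≮⇒≥ (λ lt → none P 1≤P P≤n ((pP , P∣n) , lt))
    y<Q : y < Q
    y<Q = ≤-<-trans (≤-trans y≤ (^-monoʳ-≤ 2 (m≤n*m e 5))) lo
    Q<P : Q < P
    Q<P = *-cancelʳ-< (2 ^ (3 * e)) _ _ (begin-strict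
      Q * 2 ^ (3 * e)            ≤⟨ *-monoˡ-≤ (2 ^ (3 * e)) hi ⟩
      2 ^ e₁ * 2 ^ (3 * e)       ≡⟨ sym (^-distribˡ-+-* 2 e₁ (3 * e)) ⟩
      2 ^ (e₁ + 3 * e)           ≤⟨ ^-monoʳ-≤ 2 e₁≤ ⟩
      2 ^ h                      <⟨ h<p ⟩
      p                          <⟨ big ⟩
      P * 2 ^ (3 * e)            ∎)
    y<P : y < P
    y<P = <-trans y<Q Q<P
    low : p * t < P * (Q * 1)
    low = *-cancelʳ-< (2 ^ (3 * e)) _ _ (begin-strict
      p * t * 2 ^ (3 * e)                 ≤⟨ ≤-trans (≤-reflexive (*-assoc p t _)) (*-monoʳ-≤ p (≤-trans (≤-reflexive (sym (^-distribˡ-+-* 2 e (3 * e)))) (^-monoʳ-≤ 2 (*-monoˡ-≤ e (m≤m+n 4 1))))) ⟩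
      p * 2 ^ (5 * e)                     <⟨ *-mono-< big lo ⟩
      P * 2 ^ (3 * e) * Q                 ≡⟨ regroup P (2 ^ (3 * e)) Q ⟩
      P * (Q * 1) * 2 ^ (3 * e)           ∎)
      where
      regroup : ∀ P t Q → P * t * Q ≡ P * (Q * 1) * t
      regroup = solve-∀
    high : P * (Q * 1) * t ≤ p * p
    high = begin
      P * (Q * 1) * t                ≤⟨ *-monoˡ-≤ t (*-mono-≤ P≤ (≤-trans (≤-reflexive (*-identityʳ Q)) hi)) ⟩
      p * t * 2 ^ e₁ * t             ≡⟨ regroup p t (2 ^ e₁) ⟩
      p * (2 ^ e₁ * (t * t))         ≡⟨ cong (p *_) (trans (cong (2 ^ e₁ *_) (sym (^-distribˡ-+-* 2 e e))) (sym (^-distribˡ-+-* 2 e₁ (e + e)))) ⟩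
      p * 2 ^ (e₁ + (e + e))         ≤⟨ *-monoʳ-≤ p (≤-trans (^-monoʳ-≤ 2 (≤-trans (+-monoʳ-≤ e₁ (+-monoʳ-≤ e (m≤m+n e (e + 0)))) e₁≤)) (<⇒≤ h<p)) ⟩
      p * p                          ∎
      where
      regroup : ∀ p t z → p * t * z * t ≡ p * (z * (t * t))
      regroup = solve-∀

-- Density

-- A proportion of at most a / M up to x, with a common precision M so that numerators add.
Rare : ℕ → ℕ → ℕ → (ℕ → Set) → Set
Rare M a x P = ∃[ K ] (Few (λ n → (1 ≤ n × n ≤ x) × P n) K × K * M ≤ a * x)

rare-⊎ : ∀ {M a b x P Q} → Rare M a x P → Rare M b x Q → Rare M (a + b) x (λ n → P n ⊎ Q n)
rare-⊎ {M} {a} {b} {x} (K , few , K≤) (K′ , few′ , K′≤) = K + K′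
  , few-⊆ (λ { n (r , inj₁ p) → inj₁ (r , p) ; n (r , inj₂ q) → inj₂ (r , q) }) (few-⊎ few few′)
  , ≤-trans (≤-reflexive (*-distribʳ-+ M K K′)) (≤-trans (+-mono-≤ K≤ K′≤) (≤-reflexive (sym (*-distribʳ-+ x a b))))

rare-⊆ : ∀ {M a x P Q} → (∀ n → 1 ≤ n → n ≤ x → P n → Q n) → Rare M a x Q → Rare M a x P
rare-⊆ sub (K , few , K≤) = K , few-⊆ (λ { n (r@(1≤n , n≤x) , p) → r , sub n 1≤n n≤x p }) few , K≤

multiples-rare : ∀ {M w x} d → 1 ≤ d → w * M ≤ d → w * multiples x d * M ≤ 1 * x
multiples-rare {M} {w} {x} d 1≤d wM≤d = begin
  w * multiples x d * M       ≡⟨ regroup w (multiples x d) M ⟩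
  w * M * multiples x d       ≤⟨ *-monoˡ-≤ (multiples x d) wM≤d ⟩
  d * multiples x d           ≤⟨ multiples-upper x d 1≤d ⟩
  x                           ≡⟨ sym (*-identityˡ x) ⟩
  1 * x                       ∎
  where
  open ≤-Reasoning
  regroup : ∀ w m M → w * m * M ≡ w * M * m
  regroup = solve-∀

rare-squares : ∀ M x y → 1 ≤ y → M ≤ y → Rare M 1 x (λ n → ∃[ j ] (y < j × j * j ∣ n))
rare-squares M x y 1≤y M≤y = K , few-⊆ index (few-⋃ x per-j) , (begin
  K * M     ≤⟨ *-monoʳ-≤ K M≤y ⟩
  K * y     ≡⟨ *-comm K y ⟩
  y * K     ≤⟨ ∑-tail-squares x y x 1≤y ⟩
  x         ≡⟨ sym (*-identityˡ x) ⟩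
  1 * x     ∎)
  where
  open ≤-Reasoning
  K = ∑ x (λ j → 𝟙 (y <? j) * multiples x (j * j))
  index : ∀ n → (1 ≤ n × n ≤ x) × (∃[ j ] (y < j × j * j ∣ n)) → ∃[ j ] (1 ≤ j × j ≤ x × y < j × 1 ≤ n × n ≤ x × j * j ∣ n)
  index n ((1≤n , n≤x) , j , y<j , h) = j , 1≤j , ≤-trans (m≤m*n j j {{>-nonZero 1≤j}}) (≤-trans (∣⇒≤ {{>-nonZero 1≤n}} h) n≤x) , y<j , 1≤n , n≤x , h
    where
    1≤j : 1 ≤ j
    1≤j = ≤-trans (s≤s z≤n) y<j
  per-j : ∀ j → 1 ≤ j → j ≤ x → Few (λ n → y < j × 1 ≤ n × n ≤ x × j * j ∣ n) (𝟙 (y <? j) * multiples x (j * j))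
  per-j j 1≤j _ = few-inhabited λ { n (y<j , _) → few-mono (≤-reflexive (sym (trans (cong (_* multiples x (j * j)) (𝟙-yes (y <? j) y<j)) (*-identityˡ _))))
    (few-⊆ (λ { n (_ , r) → r }) (few-multiples x (j * j) (*-mono-≤ 1≤j 1≤j))) }

rare-powers : ∀ M x y E → y * M ≤ 2 ^ E → Rare M 1 x (λ n → ∃[ j ] (2 ≤ j × j ≤ y × j ^ E ∣ n))
rare-powers M x y E yM≤ = y * multiples x (2 ^ E)
  , few-⊆ (λ { n ((1≤n , n≤x) , j , 2≤j , j≤y , h) → j , ≤-trans (s≤s z≤n) 2≤j , j≤y , 2≤j , 1≤n , n≤x , h })
      (few-mono (≤-reflexive (∑-const y _)) (few-⋃ y (λ j 1≤j _ → few-inhabited λ { n (2≤j , _) → few-mono (multiples-anti x (m^n>0 2 E) (^-monoˡ-≤ E 2≤j))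
        (few-⊆ (λ { n (_ , r) → r }) (few-multiples x (j ^ E) (m^n>0 j {{>-nonZero 1≤j}} E))) })))
  , multiples-rare {M} {y} {x} (2 ^ E) (m^n>0 2 E) yM≤

Missing : ℕ → ℕ → ℕ → Set
Missing b c n = ∀ q → Prime q → 2 ^ b < q → q ≤ 2 ^ c → ¬ q ∣ n

missing-or-hit : ∀ b c n → 1 ≤ n → Missing b c n ⊎ ∃[ q ] (Prime q × 2 ^ b < q × q ≤ 2 ^ c × q ∣ n)
missing-or-hit b c n 1≤n with search (λ q → (prime? q ×-dec (2 ^ b <? q)) ×-dec ((q ≤? 2 ^ c) ×-dec (q ∣? n))) n
... | inj₁ (q , _ , _ , (pq , b<q) , q≤c , q∣n) = inj₂ (q , pq , b<q , q≤c , q∣n)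
... | inj₂ none = inj₁ (λ q pq b<q q≤c q∣n → none q (prime≥1 pq) (∣⇒≤ {{>-nonZero 1≤n}} q∣n) ((pq , b<q) , q≤c , q∣n))

rare-missing : ∀ M x L b c → 1 ≤ M → 3 * M ≤ L → 1 ≤ b → c ≡ 64 ^ (2 * L) * b → 2 ^ c ≤ x → Rare M 1 x (Missing b c)
rare-missing M x L b c 1≤M 3M≤L 1≤b refl top≤x = multiples (3 * x) L , few-without-prime L b x 1≤L 1≤b top≤x , *-cancelˡ-≤ 3 (begin
  3 * (multiples (3 * x) L * M)      ≡⟨ regroup (multiples (3 * x) L) M ⟩
  3 * M * multiples (3 * x) L        ≤⟨ *-monoˡ-≤ (multiples (3 * x) L) 3M≤L ⟩
  L * multiples (3 * x) L            ≤⟨ multiples-upper (3 * x) L 1≤L ⟩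
  3 * x                              ≡⟨ cong (3 *_) (sym (*-identityˡ x)) ⟩
  3 * (1 * x)                        ∎)
  where
  open ≤-Reasoning
  1≤L : 1 ≤ L
  1≤L = ≤-trans 1≤M (≤-trans (m≤n*m M 3) 3M≤L)
  regroup : ∀ m M → 3 * (m * M) ≡ 3 * M * m
  regroup = solve-∀

-- Both terms of `few-medium-prime` are at most x / (2M): the first is 10x / 2^h, and in the second
-- c ≤ Y² meets the tail Y^(-3) of Σ 1/p⁴, where Y = 2^a.
medium-total : ∀ M x a h c → 20 * M ≤ 2 ^ h → 10 * M ≤ 2 ^ a → c ≤ 2 ^ a * 2 ^ a →
  (10 * (2 ^ h * multiples x (2 ^ (2 * h))) + 5 * (c * ∑ (2 ^ h) (λ p → 𝟙 (2 ^ a <? p) * multiples x (p ^ 4)))) * M ≤ x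
medium-total M x a h c 20M≤ 10M≤ c≤ = *-cancelˡ-≤ 2 (begin
  2 * ((10 * (H * m) + 5 * (c * S₄)) * M)                   ≡⟨ expand H m c S₄ M ⟩
  20 * M * (H * m) + 10 * M * (c * S₄)                      ≤⟨ +-mono-≤ (*-monoˡ-≤ (H * m) 20M≤) (*-mono-≤ 10M≤ (*-monoˡ-≤ S₄ c≤)) ⟩
  H * (H * m) + Y * (Y * Y * S₄)                            ≡⟨ cong₂ _+_ (trans (sym (*-assoc H H m)) (cong (_* m) (trans (sym (^-distribˡ-+-* 2 h h)) (cong (λ z → 2 ^ (h + z)) (sym (+-identityʳ h)))))) (cong (Y *_) (*-assoc Y Y S₄)) ⟩
  2 ^ (2 * h) * m + Y * (Y * (Y * S₄))                      ≤⟨ +-mono-≤ (multiples-upper x (2 ^ (2 * h)) (m^n>0 2 (2 * h))) (fourth-power-tail x Y H (m^n>0 2 a)) ⟩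
  x + x                                                     ≡⟨ cong (x +_) (sym (+-identityʳ x)) ⟩
  2 * x                                                     ∎)
  where
  open ≤-Reasoning
  H = 2 ^ h
  Y = 2 ^ a
  m = multiples x (2 ^ (2 * h))
  S₄ = ∑ H (λ p → 𝟙 (Y <? p) * multiples x (p ^ 4))
  expand : ∀ H m c S M → 2 * ((10 * (H * m) + 5 * (c * S)) * M) ≡ 20 * M * (H * m) + 10 * M * (c * S)
  expand = solve-∀

few-range : ∀ {P : ℕ → Set} {x K} → Few P K → Few (λ n → (1 ≤ n × n ≤ x) × P n) K
few-range = few-⊆ (λ { n (_ , p) → p })

rare-medium : ∀ M x a h c → 20 * M ≤ 2 ^ h → 10 * M ≤ 2 ^ a → c ≤ 2 ^ a * 2 ^ a → Rare M 1 x (MediumPrime x (2 ^ a) (2 ^ h) (2 * h) c)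
rare-medium M x a h c 20M≤ 10M≤ c≤ = _ , few-range (few-medium-prime x (2 ^ a) (2 ^ h) (2 * h) c) , ≤-trans (medium-total M x a h c 20M≤ 10M≤ c≤) (≤-reflexive (sym (*-identityˡ x)))

scale : ℕ → ℕ → ℕ
scale r j = r * 2 ^ j

-- With L = 2^j, this is the exponent where 2L windows end that start at 2^(32L), the square of the
-- largest p of the scale.
top : ℕ → ℕ
top j = 64 ^ (2 * 2 ^ j) * scale 32 j

64^≡ : ∀ r → 64 ^ r ≡ 2 ^ (6 * r)
64^≡ r = ^-*-assoc 2 6 r

-- 64^(2L) is 2^(12L), and 32L ≤ 2^(4L).
top≤ : ∀ j → 1 ≤ j → top j ≤ 2 ^ scale 16 j
top≤ j 1≤j = begin
  64 ^ (2 * L) * (32 * L)            ≡⟨ cong₂ _*_ (64^≡ (2 * L)) (sym (^-distribˡ-+-* 2 5 j)) ⟩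
  2 ^ (6 * (2 * L)) * 2 ^ (5 + j)    ≡⟨ sym (^-distribˡ-+-* 2 (6 * (2 * L)) (5 + j)) ⟩
  2 ^ (6 * (2 * L) + (5 + j))        ≤⟨ ^-monoʳ-≤ 2 (≤-trans (+-monoʳ-≤ (6 * (2 * L)) (small j 1≤j)) (≤-reflexive (collect L))) ⟩
  2 ^ (16 * L)                       ∎
  where
  open ≤-Reasoning
  L = 2 ^ j
  collect : ∀ L → 6 * (2 * L) + 4 * L ≡ 16 * L
  collect = solve-∀
  small : ∀ j → 1 ≤ j → 5 + j ≤ 4 * 2 ^ j
  small (suc zero) _ = m≤m+n 6 2
  small (suc (suc j)) _ = begin
    5 + suc (suc j)            ≡⟨ +-suc 5 (suc j) ⟩
    suc (5 + suc j)            ≤⟨ +-mono-≤ (*-mono-≤ {1} {4} {1} {2 ^ suc j} (s≤s z≤n) (m^n>0 2 (suc j))) (small (suc j) (s≤s z≤n)) ⟩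
    4 * 2 ^ suc j + 4 * 2 ^ suc j  ≡⟨ double (2 ^ suc j) ⟩
    4 * 2 ^ suc (suc j)        ∎
    where
    double : ∀ z → 4 * z + 4 * z ≡ 4 * (2 * z)
    double = solve-∀

Scale : ℕ → ℕ → ℕ → Set
Scale x j n = Missing (scale 32 j) (top j) n ⊎ MediumPrime x (2 ^ scale 8 j) (2 ^ scale 16 j) (2 * scale 16 j) (top j) n

2^≥1 : ∀ j → 1 ≤ 2 ^ j
2^≥1 = m^n>0 2

-- At most 3x / L integers miss the window, and `medium-total` with precision L allows x / L others.
few-scale : ∀ x j → 1 ≤ j → 2 ^ top j ≤ x → Few (λ n → (1 ≤ n × n ≤ x) × Scale x j n) (multiples (4 * x) (2 ^ j))
few-scale x j 1≤j top≤x = few-mono total (few-⊆ (λ { n (r , inj₁ miss) → inj₁ (r , miss) ; n (_ , inj₂ med) → inj₂ med })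
    (few-⊎ (few-without-prime L (scale 32 j) x L≥1 (*-mono-≤ {1} {32} {1} {L} (s≤s z≤n) L≥1) top≤x) (few-medium-prime x (2 ^ scale 8 j) (2 ^ scale 16 j) (2 * scale 16 j) (top j))))
  where
  open ≤-Reasoning
  L = 2 ^ j
  L≥1 = 2^≥1 j
  K = 10 * (2 ^ scale 16 j * multiples x (2 ^ (2 * scale 16 j))) + 5 * (top j * ∑ (2 ^ scale 16 j) (λ p → 𝟙 (2 ^ scale 8 j <? p) * multiples x (p ^ 4)))
  power : ∀ r → 8 ≤ r → 20 * L ≤ 2 ^ scale r j
  power r 8≤r = begin
    20 * L             ≤⟨ *-mono-≤ {20} {32} {L} {2 ^ L} (m≤m+n 20 12) (<⇒≤ (n<2^n L)) ⟩
    2 ^ 5 * 2 ^ L      ≡⟨ sym (^-distribˡ-+-* 2 5 L) ⟩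
    2 ^ (5 + L)        ≤⟨ ^-monoʳ-≤ 2 (≤-trans (+-monoˡ-≤ L (≤-trans (m≤m+n 5 2) (≤-trans (≤-reflexive (sym (*-identityʳ 7))) (*-monoʳ-≤ 7 L≥1)))) (≤-trans (≤-reflexive (+-comm (7 * L) L)) (*-monoˡ-≤ L 8≤r))) ⟩
    2 ^ (r * L)        ∎
  top≤square : top j ≤ 2 ^ scale 8 j * 2 ^ scale 8 j
  top≤square = ≤-trans (top≤ j 1≤j) (≤-reflexive (trans (cong (2 ^_) (double L)) (^-distribˡ-+-* 2 (8 * L) (8 * L))))
    where
    double : ∀ L → 16 * L ≡ 8 * L + 8 * L
    double = solve-∀
  total : multiples (3 * x) L + K ≤ multiples (4 * x) L
  total = multiples-max L L≥1 (begin
    (multiples (3 * x) L + K) * L            ≡⟨ *-distribʳ-+ L (multiples (3 * x) L) K ⟩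
    multiples (3 * x) L * L + K * L          ≤⟨ +-mono-≤ (≤-trans (≤-reflexive (*-comm (multiples (3 * x) L) L)) (multiples-upper (3 * x) L L≥1)) (medium-total L x (scale 8 j) (scale 16 j) (top j) (power 16 (m≤m+n 8 8)) (≤-trans (*-monoˡ-≤ L (m≤m+n 10 10)) (power 8 ≤-refl)) top≤square) ⟩
    3 * x + x                                ≡⟨ +-comm (3 * x) x ⟩
    4 * x                                    ∎)

-- The bounds 4x / 2^j add up to at most 8x / 2^j₀, whatever the last scale J; so the number of
-- scales may grow with x.
rare-scales : ∀ M x j₀ J → 1 ≤ M → 1 ≤ j₀ → 8 * M ≤ 2 ^ j₀ → (∀ j → j₀ ≤ j → j < J → 2 ^ top j ≤ x) →
  Rare M 1 x (λ n → ∃[ j ] (j₀ ≤ j × j < J × Scale x j n))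
rare-scales M x j₀ J 1≤M 1≤j₀ 8M≤ tops = 2 * multiples (4 * x) (2 ^ j₀)
  , few-mono (geometric-tail (λ i → multiples (4 * x) (2 ^ i)) halve j₀ J)
      (few-⊆ (λ { n (r , j , j₀≤j , j<J , sc) → suc j , s≤s z≤n , j<J , s≤s j₀≤j , r , sc })
        (few-⋃ {λ t n → j₀ < t × (1 ≤ n × n ≤ x) × Scale x (pred t) n} J (λ t 1≤t t≤J → few-inhabited λ { n (j₀<t , _) → few-mono (≤-reflexive (sym (trans (cong (_* multiples (4 * x) (2 ^ pred t)) (𝟙-yes (j₀ <? t) j₀<t)) (*-identityˡ _))))
          (few-⊆ (λ { n (_ , rest) → rest }) (few-scale x (pred t) (≤-trans 1≤j₀ (≤-pred (≤-trans j₀<t (≤-reflexive (sym (suc-pred t {{>-nonZero 1≤t}})))))) (tops (pred t) (≤-pred (≤-trans j₀<t (≤-reflexive (sym (suc-pred t {{>-nonZero 1≤t}}))))) (≤-trans (≤-reflexive (suc-pred t {{>-nonZero 1≤t}})) t≤J)))) })))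
  , *-cancelˡ-≤ 4 (begin
      4 * (2 * multiples (4 * x) (2 ^ j₀) * M)     ≡⟨ regroup (multiples (4 * x) (2 ^ j₀)) M ⟩
      8 * M * multiples (4 * x) (2 ^ j₀)           ≤⟨ *-monoˡ-≤ (multiples (4 * x) (2 ^ j₀)) 8M≤ ⟩
      2 ^ j₀ * multiples (4 * x) (2 ^ j₀)          ≤⟨ multiples-upper (4 * x) (2 ^ j₀) (2^≥1 j₀) ⟩
      4 * x                                        ≡⟨ cong (4 *_) (sym (*-identityˡ x)) ⟩
      4 * (1 * x)                                  ∎)
  where
  open ≤-Reasoning
  regroup : ∀ m M → 4 * (2 * m * M) ≡ 8 * M * m
  regroup = solve-∀
  halve : ∀ i → 2 * multiples (4 * x) (2 ^ suc i) ≤ multiples (4 * x) (2 ^ i)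
  halve i = multiples-max (2 ^ i) (2^≥1 i) (≤-trans (≤-reflexive (regroup′ (multiples (4 * x) (2 ^ suc i)) (2 ^ i))) (multiples-upper (4 * x) (2 ^ suc i) (2^≥1 (suc i))))
    where
    regroup′ : ∀ m y → 2 * m * y ≡ 2 * y * m
    regroup′ = solve-∀

-- Scales are used while 2^(16 · 2^j) ≤ N, for then `top≤` keeps their windows below 2^N ≤ x.
last-scale : ∀ N f j₀ → N < 2 ^ scale 16 (f + j₀) → ∃[ J ] (j₀ ≤ J × N < 2 ^ scale 16 J × (∀ j → j₀ ≤ j → j < J → 2 ^ scale 16 j ≤ N))
last-scale N zero j₀ N< = j₀ , ≤-refl , N< , λ j j₀≤j j<j₀ → contradiction j₀≤j (<⇒≱ j<j₀)
last-scale N (suc f) j₀ N< with N <? 2 ^ scale 16 j₀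
... | yes N<′ = j₀ , ≤-refl , N<′ , λ j j₀≤j j<j₀ → contradiction j₀≤j (<⇒≱ j<j₀)
... | no N≮ = let (J , sj₀≤J , N<J , below) = last-scale N f (suc j₀) (subst (λ k → N < 2 ^ scale 16 k) (sym (+-suc f j₀)) N<) in
      J , ≤-trans (n≤1+n j₀) sj₀≤J , N<J , λ j j₀≤j j<J → [ (λ e → subst (λ k → 2 ^ scale 16 k ≤ N) e (≮⇒≥ N≮)) , (λ j₀<j → below j j₀<j j<J) ]′ (split-≤ j₀≤j)
  where
  split-≤ : ∀ {a b} → a ≤ b → a ≡ b ⊎ a < b
  split-≤ {a} {b} a≤b with a ≟ b
  ... | yes e = inj₁ e
  ... | no a≢b = inj₂ (≤∧≢⇒< a≤b a≢b)

locate-scale : ∀ p j₀ J → 2 ^ scale 8 j₀ < p → p ≤ 2 ^ scale 8 J → ∃[ j ] (j₀ ≤ j × j < J × 2 ^ scale 8 j < p × p ≤ 2 ^ scale 16 j)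
locate-scale p j₀ zero lo hi = contradiction (≤-trans hi (^-monoʳ-≤ 2 (*-monoʳ-≤ 8 (2^≥1 j₀)))) (<⇒≱ lo)
locate-scale p j₀ (suc J) lo hi with p ≤? 2 ^ scale 8 J
... | yes p≤ = let (j , a , b , rest) = locate-scale p j₀ J lo p≤ in j , a , m≤n⇒m≤1+n b , rest
... | no p≰ = J , ≮⇒≥ (λ J<j₀ → <⇒≱ lo (≤-trans hi (^-monoʳ-≤ 2 (*-monoʳ-≤ 8 (^-monoʳ-≤ 2 J<j₀))))) , ≤-refl , ≰⇒> p≰ , ≤-trans hi (≤-reflexive (cong (2 ^_) (double (2 ^ J))))
  where
  double : ∀ z → 8 * (2 * z) ≡ 16 * z
  double = solve-∀

s≥1 : ∀ n → 2 ≤ n → 1 ≤ s n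
s≥1 (suc zero) (s≤s ())
s≥1 (suc (suc n)) _ = subst (1 ≤_) (sym (sum-filter-upTo (suc (suc n)) (suc n)))
  (≤-trans (≤-reflexive (sym (trans (*-identityʳ _) (𝟙-yes (1 ∣? suc (suc n)) (1∣ _))))) (term≤∑ {suc n} {1} (λ d → 𝟙 (d ∣? suc (suc n)) * d) ≤-refl (s≤s z≤n)))

s≤ : ∀ K n → 1 ≤ n → n < 2 ^ K → s n ≤ K * n
s≤ K n 1≤n n< = ≤-trans (m≤m+n (s n) n) (≤-trans (≤-reflexive (s+n≡σ₁ n 1≤n)) (σ₁-bound K n n<))

-- Primes p beyond the last scale

module LargePrimes (M x K y E e e₁ h : ℕ) (x< : x < 2 ^ K) (M≥1 : 1 ≤ M) (KM≤ : K * M ≤ 2 ^ e) (e≥1 : 1 ≤ e)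
  (y≥2 : 2 ≤ y) (y≤ : y ≤ 2 ^ e) (smooth≤ : y * (y * E) ≤ e) (e₁≤ : e₁ + 3 * e ≤ h) (5e≤h : 5 * e ≤ h) where

  open ≤-Reasoning

  Event : ℕ → Set
  Event n = 2 ≤ n × Typical y E n × (∃[ p ] (Prime p × 2 ^ h < p × p ^ 4 ∣ s n)) × Σ (PrimeFactor n) (λ F → 2 ^ (5 * e) < PrimeFactor.P F × PrimeFactor.P F ≤ 2 ^ e₁)

  private
    K≤ : K ≤ 2 ^ e
    K≤ = ≤-trans (m≤m*n K M {{>-nonZero M≥1}}) KM≤

    e≤h : e ≤ h
    e≤h = ≤-trans (m≤n*m e 5) 5e≤h

    K< : K < 2 ^ (e + e)
    K< = ≤-<-trans K≤ (^-monoʳ-< 2 (s≤s (s≤s z≤n)) (m<m+n e e≥1))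

    -- Otherwise p⁴ ≤ s(n) ≤ K n with K ≤ 2^e would give p⁴ ≤ p 2^(3e) ≤ p 2^h, against p > 2^h.
    roomy : ∀ n p → 1 ≤ n → n ≤ x → Prime p → 2 ^ h < p → p ^ 4 ≤ s n → p * 2 ^ e * 2 ^ (y * (y * E)) < n
    roomy n p 1≤n n≤x pp h<p p⁴≤ = ≰⇒> λ n≤ → <⇒≱ h<p (cancelˡ-≤ p (prime≥1 pp) (begin
      p * p                                      ≤⟨ m≤m*n (p * p) (p * p) {{>-nonZero (*-mono-≤ (prime≥1 pp) (prime≥1 pp))}} ⟩
      p * p * (p * p)                            ≡⟨ regroup p ⟩
      p ^ 4                                      ≤⟨ p⁴≤ ⟩
      s n                                        ≤⟨ s≤ K n 1≤n (≤-<-trans n≤x x<) ⟩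
      K * n                                      ≤⟨ *-mono-≤ K≤ n≤ ⟩
      2 ^ e * (p * 2 ^ e * 2 ^ (y * (y * E)))    ≤⟨ *-monoʳ-≤ (2 ^ e) (*-monoʳ-≤ (p * 2 ^ e) (^-monoʳ-≤ 2 smooth≤)) ⟩
      2 ^ e * (p * 2 ^ e * 2 ^ e)                ≡⟨ regroup′ p (2 ^ e) ⟩
      p * (2 ^ e * (2 ^ e * 2 ^ e))              ≡⟨ cong (p *_) (trans (cong (2 ^ e *_) (sym (^-distribˡ-+-* 2 e e))) (sym (^-distribˡ-+-* 2 e (e + e)))) ⟩
      p * 2 ^ (e + (e + e))                      ≤⟨ *-monoʳ-≤ p (^-monoʳ-≤ 2 (≤-trans (≤-trans (≤-reflexive (cong (λ z → e + (e + z)) (sym (+-identityʳ e)))) (*-monoˡ-≤ e (m≤m+n 3 2))) 5e≤h)) ⟩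
      p * 2 ^ h                                  ∎))
      where
      regroup : ∀ p → p * p * (p * p) ≡ p * (p * (p * (p * 1)))
      regroup = solve-∀
      regroup′ : ∀ p t → t * (p * t * t) ≡ p * (t * (t * t))
      regroup′ = solve-∀

    Cases : ℕ → Set
    Cases n = ((∃[ p ] (1 ≤ p × p ≤ x × Prime p × 2 ^ h < p × (p ∣ n) × ¬ (p * p ∣ n) × p ^ 4 ∣ s n)) × Σ (PrimeFactor n) (λ F → 2 ^ (5 * e) < PrimeFactor.P F × PrimeFactor.P F ≤ 2 ^ h))
      ⊎ (∃[ p ] (LargePrime x h n p × Σ (PrimeFactor n) (λ F → p * 2 ^ e < PrimeFactor.P F)))
      ⊎ (∃[ p ] (LargePrime x h n p × Unitary p e n))

    cases : ∀ n → 1 ≤ n → n ≤ x → Event n → Cases n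
    cases n 1≤n n≤x (2≤n , typical , (p , pp , h<p , p⁴∣) , F , lo , hi) with p ∣? n
    ... | yes p∣n = inj₁ ((p , prime≥1 pp , ≤-trans (∣⇒≤ {{>-nonZero 1≤n}} p∣n) n≤x , pp , h<p , p∣n , proj₁ typical p (≤-<-trans (≤-trans y≤ (^-monoʳ-≤ 2 e≤h)) h<p) , p⁴∣)
          , F , lo , ≤-trans hi (^-monoʳ-≤ 2 (≤-trans (m≤m+n e₁ _) e₁≤)))
    ... | no p∤n = inj₂ ([ (λ G → inj₁ (p , large , G)) , (λ U → inj₂ (p , large , U)) ]′ (large-prime-cases y E y≥2 n 1≤n typical p h e e₁ h<p e₁≤ room y≤ (F , lo , hi)))
      where
      room : p * 2 ^ e * 2 ^ (y * (y * E)) < n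
      room = roomy n p 1≤n n≤x pp h<p (∣⇒≤ {{>-nonZero (s≥1 n 2≤n)}} p⁴∣)
      p≤x : p ≤ x
      p≤x = ≤-trans (≤-trans (m≤m*n p (2 ^ e * 2 ^ (y * (y * E))) {{m*n≢0 (2 ^ e) (2 ^ (y * (y * E))) {{m^n≢0 2 e}} {{m^n≢0 2 (y * (y * E))}}}}) (≤-reflexive (sym (*-assoc p _ _)))) (≤-trans (<⇒≤ room) n≤x)
      large : LargePrime x h n p
      large = prime≥1 pp , p≤x , pp , h<p , p∤n , p⁴∣

    S₄ = ∑ x (λ p → 𝟙 (2 ^ h <? p) * multiples x (p ^ 4))

    KS₄ : K * S₄ * M ≤ 1 * x
    KS₄ = begin
      K * S₄ * M                       ≡⟨ regroup K S₄ M ⟩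
      K * M * S₄                       ≤⟨ *-monoˡ-≤ S₄ (≤-trans KM≤ (^-monoʳ-≤ 2 e≤h)) ⟩
      H * S₄                           ≤⟨ m≤n*m (H * S₄) (H * H) {{m*n≢0 H H}} ⟩
      H * H * (H * S₄)                 ≡⟨ *-assoc H H (H * S₄) ⟩
      H * (H * (H * S₄))               ≤⟨ fourth-power-tail x H x (2^≥1 h) ⟩
      x                                ≡⟨ sym (*-identityˡ x) ⟩
      1 * x                            ∎
      where
      H = 2 ^ h
      instance
        H≢0 : NonZero (2 ^ h)
        H≢0 = m^n≢0 2 h
      regroup : ∀ K S M → K * S * M ≡ K * M * S
      regroup = solve-∀

    weight : ∀ d → e ≤ d → K * multiples x (2 ^ d) * M ≤ 1 * x
    weight d e≤d = multiples-rare {M} {K} {x} (2 ^ d) (2^≥1 d) (≤-trans KM≤ (^-monoʳ-≤ 2 e≤d))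

  rare-large : Rare M 4 x Event
  rare-large = rare-⊆ {M} {4} {x} cases (rare-⊎ {M} {1} {3} {x} (_ , few-dividing x K h (5 * e) x< , weight (5 * e) (m≤n*m e 5))
    (rare-⊎ {M} {2} {1} {x} (_ , few-large-cofactor x K h e x< , ≤-trans (≤-reflexive (*-distribʳ-+ M (K * multiples x (2 ^ e)) (K * S₄))) (≤-trans (+-mono-≤ (weight e ≤-refl) KS₄) (≤-reflexive (sym (*-distribʳ-+ x 1 1)))))
      (_ , few-unitary x K h e x< K< , weight e ≤-refl)))

-- Small primes p

hit-or-unhit : ∀ T n → (∃[ q ] (q ∈ T × q ∣ n)) ⊎ All (λ q → ¬ q ∣ n) T
hit-or-unhit [] n = inj₂ []
hit-or-unhit (q ∷ T) n with q ∣? n | hit-or-unhit T n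
... | yes q∣n | _ = inj₁ (q , here refl , q∣n)
... | no _ | inj₁ (r , r∈T , r∣n) = inj₁ (r , there r∈T , r∣n)
... | no q∤n | inj₂ none = inj₂ (q∤n ∷ none)

-- If n has a prime factor q ∥ n in each of k disjoint lists of primes q ≡ −1 modulo p, then p^k divides σ(n).
module _ {p : ℕ} (pp : Prime p) (L : ℕ) where

  private
    targets : ℕ → List ℕ
    targets y = proj₁ (heavy-minus-one pp L y)

    targets-all : ∀ y → All (λ q → (Prime q × p ∣ suc q) × y < q) (targets y)
    targets-all y = proj₁ (proj₂ (heavy-minus-one pp L y))

  -- The next list starts above the sum of the entries of the present one and hence above each of
  -- them, which keeps the lists disjoint.
  Unhit : ℕ → ℕ → ℕ → Set
  Unhit zero y n = ⊥
  Unhit (suc k) y n = All (λ q → ¬ q ∣ n) (targets y) ⊎ Unhit k (y + sum (targets y)) n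

  size : ℕ → ℕ → ℕ
  size zero y = 0
  size (suc k) y = length (targets y) + size k (y + sum (targets y))

  few-Unhit : ∀ x k y → 1 ≤ L → size k y ≤ x → Few (λ n → (1 ≤ n × n ≤ x) × Unhit k y n) (k * multiples (3 * x) L)
  few-Unhit x zero y 1≤L _ = few-∅ λ { n (_ , ()) }
  few-Unhit x (suc k) y 1≤L size≤ = few-⊆ (λ { n (r , inj₁ u) → inj₁ (r , u) ; n (r , inj₂ u) → inj₂ (r , u) })
    (few-⊎ {λ n → (1 ≤ n × n ≤ x) × All (λ q → ¬ q ∣ n) (targets y)} (λ l ul al → multiples-max {length l} {3 * x} L 1≤L (few-unhit x (targets y) L (All.map (λ { ((pq , _) , _) → pq }) (targets-all y))
        (proj₁ (proj₂ (proj₂ (heavy-minus-one pp L y)))) (≤-trans (m≤m+n _ _) size≤) (proj₂ (proj₂ (proj₂ (heavy-minus-one pp L y)))) l ul al))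
      (few-Unhit x k (y + sum (targets y)) 1≤L (≤-trans (m≤n+m _ (length (targets y))) size≤)))

  collect-hits : ∀ n k y → Unhit k y n ⊎ ∃[ l ] (All (λ q → (Prime q × p ∣ suc q) × y < q × (q ∣ n)) l × Unique l × length l ≡ k)
  collect-hits n zero y = inj₂ ([] , [] , [] , refl)
  collect-hits n (suc k) y with hit-or-unhit (targets y) n | collect-hits n k (y + sum (targets y))
  ... | inj₂ none | _ = inj₁ (inj₁ none)
  ... | inj₁ _ | inj₁ unhit = inj₁ (inj₂ unhit)
  ... | inj₁ (q , q∈T , q∣n) | inj₂ (l , al , ul , len) = inj₂ (q ∷ l
        , (proj₁ (All.lookup (targets-all y) q∈T) , proj₂ (All.lookup (targets-all y) q∈T) , q∣n) ∷ All.map (λ { (a , y<r , r∣n) → a , ≤-<-trans (m≤m+n y _) y<r , r∣n }) al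
        , All.map (λ { (_ , b<r , _) refl → <⇒≱ b<r (≤-trans (All.lookup (all-≤sum (targets y)) q∈T) (m≤n+m _ y)) }) al ∷ ul , cong suc len)

  power∣σ-product : ∀ l → All (λ q → p ∣ suc q) l → p ^ length l ∣ σ-product l
  power∣σ-product [] [] = ∣-refl
  power∣σ-product (q ∷ l) (h ∷ a) = *-pres-∣ h (power∣σ-product l a)

  unhit-or-power∣σ₁ : ∀ k y E n → 2 ≤ y → 1 ≤ n → Typical y E n → Unhit k y n ⊎ p ^ k ∣ σ₁ n
  unhit-or-power∣σ₁ k y E n 2≤y 1≤n typical with collect-hits n k y
  ... | inj₁ unhit = inj₁ unhit
  ... | inj₂ (l , al , ul , refl) = inj₂ (let (m , eq , ∤m) = list-cofactor y E 2≤y n 1≤n typical l (All.map (λ { ((pq , _) , y<q , q∣n) → pq , y<q , q∣n }) al) ul in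
        subst (p ^ length l ∣_) (sym (trans (cong σ₁ eq) (σ₁-product m l (*≥1⇒≥1 m (product l) (subst (1 ≤_) eq 1≤n)) (All.map (λ { ((pq , _) , _) → pq }) al) ul ∤m)))
          (∣n⇒∣m*n (σ₁ m) (power∣σ-product l (All.map (λ { ((_ , h) , _) → h }) al))))

-- The lists depend on a proof of primality. Taking it from `prime? p` fixes one choice and allows
-- sums over all p ≤ y.
UnhitAt : ∀ {p} → Dec (Prime p) → ℕ → ℕ → ℕ → ℕ → Set
UnhitAt (yes pp) L k y n = Unhit pp L k y n
UnhitAt (no _) L k y n = ⊥

sizeAt : ∀ {p} → Dec (Prime p) → ℕ → ℕ → ℕ → ℕ
sizeAt (yes pp) L k y = size pp L k y
sizeAt (no _) L k y = 0

-- There are k lists for each of at most y primes, and 3x / L integers miss a given list; this is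
-- the origin of L.
rare-unhit : ∀ M x k y → 1 ≤ M → 1 ≤ k → 1 ≤ y → let L = 3 * (y * k * M) in ∑ y (λ p → sizeAt (prime? p) L k y) ≤ x →
  Rare M 1 x (λ n → ∃[ p ] (1 ≤ p × p ≤ y × UnhitAt (prime? p) L k y n))
rare-unhit M x k y M≥1 k≥1 y≥1 sizes≤ = y * (k * multiples (3 * x) L)
  , few-⊆ (λ { n (r , p , 1≤p , p≤y , u) → p , 1≤p , p≤y , r , u }) (few-mono (≤-reflexive (∑-const y _)) (few-⋃ y (λ p 1≤p p≤y → per-prime p (prime? p) (≤-trans (term≤∑ (λ p → sizeAt (prime? p) L k y) 1≤p p≤y) sizes≤))))
  , *-cancelˡ-≤ 3 (begin
      3 * (y * (k * multiples (3 * x) L) * M)      ≡⟨ regroup y k (multiples (3 * x) L) M ⟩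
      L * multiples (3 * x) L                      ≤⟨ multiples-upper (3 * x) L L≥1 ⟩
      3 * x                                        ≡⟨ cong (3 *_) (sym (*-identityˡ x)) ⟩
      3 * (1 * x)                                  ∎)
  where
  open ≤-Reasoning
  L = 3 * (y * k * M)
  L≥1 : 1 ≤ L
  L≥1 = *-mono-≤ {1} {3} {1} {y * k * M} (s≤s z≤n) (*-mono-≤ {1} {y * k} {1} {M} (*-mono-≤ y≥1 k≥1) M≥1)
  regroup : ∀ y k m M → 3 * (y * (k * m) * M) ≡ 3 * (y * k * M) * m
  regroup = solve-∀
  per-prime : ∀ p (d : Dec (Prime p)) → sizeAt d L k y ≤ x → Few (λ n → (1 ≤ n × n ≤ x) × UnhitAt d L k y n) (k * multiples (3 * x) L)
  per-prime p (yes pp) size≤ = few-Unhit pp L x k y L≥1 size≤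
  per-prime p (no _) _ = few-mono z≤n (few-∅ λ { n (_ , ()) })

-- The union of the exceptional sets

Bad : ℕ → ℕ → Set
Bad k n = ∃[ p ] (Prime p × (((p ^ k ∣ n) × ¬ (p ^ k ∣ s n)) ⊎ ((p ^ k ∣ s n) × ¬ (p ^ k ∣ n))))

module Classification (k x N K M E L e j₀ J : ℕ) (k≥4 : 4 ≤ k) (M≥1 : 1 ≤ M) (3M≤L : 3 * M ≤ L) (j₀≥1 : 1 ≤ j₀) (8M≤ : 8 * M ≤ 2 ^ j₀)
  (2^N≤x : 2 ^ N ≤ x) (x< : x < 2 ^ K) (e≥1 : 1 ≤ e) (KM≤ : K * M ≤ 2 ^ e) (20M≤ : 20 * M ≤ 2 ^ e)
  (window≤N : 64 ^ (2 * L) * (2 * (2 * (64 ^ (2 * L) * (5 * e)))) ≤ N) where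

  y : ℕ
  y = 2 ^ scale 8 j₀

  -- The auxiliary prime Q for p > 2^h is sought between 2^(5e) and 2^e₁, and h = 2 e₁ makes room
  -- for e₁ + 3e ≤ h. The last window for p ≤ 2^h starts at 2^(2h), and the hypothesis `window≤N`
  -- says that it ends below 2^N.
  e₁ h : ℕ
  e₁ = 64 ^ (2 * L) * (5 * e)
  h = 2 * e₁

  module _ (yM≤ : y * M ≤ 2 ^ E) (10M≤y : 10 * M ≤ y) (y≤ : y ≤ 2 ^ e) (smooth≤ : y * (y * E) ≤ e)
    (j₀≤J : j₀ ≤ J) (N<J : N < 2 ^ scale 16 J) (below : ∀ j → j₀ ≤ j → j < J → 2 ^ scale 16 j ≤ N)
    (sizes≤ : ∑ y (λ p → sizeAt (prime? p) (3 * (y * k * M)) k y) ≤ x) where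

    y≥2 : 2 ≤ y
    y≥2 = ^-monoʳ-≤ 2 (*-mono-≤ {1} {8} {1} {2 ^ j₀} (s≤s z≤n) (2^≥1 j₀))

    c₀≥1 : 1 ≤ 64 ^ (2 * L)
    c₀≥1 = m^n>0 64 (2 * L)

    5e≤e₁ : 5 * e ≤ e₁
    5e≤e₁ = m≤n*m (5 * e) (64 ^ (2 * L)) {{>-nonZero c₀≥1}}

    e₁≤h : e₁ ≤ h
    e₁≤h = m≤m+n e₁ _

    e₁+3e≤h : e₁ + 3 * e ≤ h
    e₁+3e≤h = +-monoʳ-≤ e₁ (≤-trans (*-monoˡ-≤ e (m≤m+n 3 2)) (≤-trans 5e≤e₁ (m≤m+n e₁ 0)))

    e≤h : e ≤ h
    e≤h = ≤-trans (m≤n*m e 5) (≤-trans 5e≤e₁ e₁≤h)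

    last-top : ℕ
    last-top = 64 ^ (2 * L) * (2 * h)

    open LargePrimes M x K y E e e₁ h x< M≥1 KM≤ e≥1 y≥2 y≤ smooth≤ e₁+3e≤h (≤-trans 5e≤e₁ e₁≤h) using (rare-large) renaming (Event to LargeEvent)

    -- After two events for atypical n, the third deals with p ≤ y, the fourth with p ≤ 2^(8 · 2^J),
    -- the next two with p ≤ 2^h, and the last two with p > 2^h.
    Events : ℕ → Set
    Events n = (∃[ j ] (y < j × j * j ∣ n)) ⊎ (∃[ j ] (2 ≤ j × j ≤ y × j ^ E ∣ n)) ⊎ (∃[ p ] (1 ≤ p × p ≤ y × UnhitAt (prime? p) (3 * (y * k * M)) k y n))
      ⊎ (∃[ j ] (j₀ ≤ j × j < J × Scale x j n)) ⊎ Missing (2 * h) last-top n ⊎ MediumPrime x (2 ^ scale 8 J) (2 ^ h) (2 * h) last-top n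
      ⊎ Missing (5 * e) e₁ n ⊎ LargeEvent n

    y≤scale : ∀ r j → 8 ≤ r → j₀ ≤ j → y ≤ 2 ^ scale r j
    y≤scale r j 8≤r j₀≤j = ^-monoʳ-≤ 2 (*-mono-≤ 8≤r (^-monoʳ-≤ 2 j₀≤j))

    y≤2e : ∀ {b} → e ≤ b → y ≤ 2 ^ b
    y≤2e e≤b = ≤-trans y≤ (^-monoʳ-≤ 2 e≤b)

    PrimeIn : ℕ → ℕ → ℕ → Set
    PrimeIn b c n = Σ (PrimeFactor n) (λ F → 2 ^ b < PrimeFactor.P F × PrimeFactor.P F ≤ 2 ^ c)

    missing-or-cofactor : ∀ b c n → 1 ≤ n → Typical y E n → y ≤ 2 ^ b → Missing b c n ⊎ PrimeIn b c n
    missing-or-cofactor b c n 1≤n typical y≤b = cofactor (missing-or-hit b c n 1≤n)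
      where
      cofactor : Missing b c n ⊎ ∃[ q ] (Prime q × 2 ^ b < q × q ≤ 2 ^ c × q ∣ n) → Missing b c n ⊎ PrimeIn b c n
      cofactor (inj₁ miss) = inj₁ miss
      cofactor (inj₂ (q , pq , b<q , q≤c , q∣n)) = inj₂ (prime-cofactor y E y≥2 n 1≤n typical pq (≤-<-trans y≤b b<q) q∣n , b<q , q≤c)

    scale-or-missing : ∀ n → 1 ≤ n → n ≤ x → Typical y E n → ∀ p → Prime p → p ^ 4 ∣ s n → ∀ j → j₀ ≤ j → 2 ^ scale 8 j < p → p ≤ 2 ^ scale 16 j → Scale x j n
    scale-or-missing n 1≤n n≤x typical p pp p⁴∣ j j₀≤j lo hi = event (missing-or-cofactor (scale 32 j) (top j) n 1≤n typical (y≤scale 32 j (m≤m+n 8 24) j₀≤j))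
      where
      same : 2 ^ (2 * scale 16 j) ≤ 2 ^ scale 32 j
      same = ≤-reflexive (cong (2 ^_) (sym (*-assoc 2 16 (2 ^ j))))
      event : Missing (scale 32 j) (top j) n ⊎ PrimeIn (scale 32 j) (top j) n → Scale x j n
      event (inj₁ miss) = inj₁ miss
      event (inj₂ (F , b<q , q≤c)) = inj₂ ((1≤n , n≤x) , (p , prime≥1 pp , hi , pp , lo , p⁴∣) , F , ≤-<-trans same b<q , q≤c)

    medium-or-large : ∀ n → 2 ≤ n → n ≤ x → Typical y E n → ∀ p → Prime p → y < p → p ^ 4 ∣ s n →
      Dec (p ≤ 2 ^ scale 8 J) → Dec (p ≤ 2 ^ h) → Events n
    medium-or-large n 2≤n n≤x typical p pp y<p p⁴∣ (yes p≤) _ = let (j , j₀≤j , j<J , lo , hi) = locate-scale p j₀ J y<p p≤ in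
      inj₂ (inj₂ (inj₂ (inj₁ (j , j₀≤j , j<J , scale-or-missing n (≤-trans (s≤s z≤n) 2≤n) n≤x typical p pp p⁴∣ j j₀≤j lo hi))))
    medium-or-large n 2≤n n≤x typical p pp y<p p⁴∣ (no p≰) (yes p≤h) = event (missing-or-cofactor (2 * h) last-top n 1≤n typical (y≤2e (≤-trans e≤h (m≤m+n h _))))
      where
      1≤n : 1 ≤ n
      1≤n = ≤-trans (s≤s z≤n) 2≤n
      event : Missing (2 * h) last-top n ⊎ PrimeIn (2 * h) last-top n → Events n
      event (inj₁ miss) = inj₂ (inj₂ (inj₂ (inj₂ (inj₁ miss))))
      event (inj₂ F) = inj₂ (inj₂ (inj₂ (inj₂ (inj₂ (inj₁ ((1≤n , n≤x) , (p , prime≥1 pp , p≤h , pp , ≰⇒> p≰ , p⁴∣) , F))))))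
    medium-or-large n 2≤n n≤x typical p pp y<p p⁴∣ (no p≰) (no p≰h) = event (missing-or-cofactor (5 * e) e₁ n (≤-trans (s≤s z≤n) 2≤n) typical (y≤2e (m≤n*m e 5)))
      where
      event : Missing (5 * e) e₁ n ⊎ PrimeIn (5 * e) e₁ n → Events n
      event (inj₁ miss) = inj₂ (inj₂ (inj₂ (inj₂ (inj₂ (inj₂ (inj₁ miss))))))
      event (inj₂ F) = inj₂ (inj₂ (inj₂ (inj₂ (inj₂ (inj₂ (inj₂ (2≤n , typical , (p , pp , ≰⇒> p≰h , p⁴∣) , F)))))))

    ^-∣ : ∀ p {a b} → a ≤ b → p ^ a ∣ p ^ b
    ^-∣ p {a} {b} a≤b = subst (p ^ a ∣_) (trans (sym (^-distribˡ-+-* p a (b ∸ a))) (cong (p ^_) (m+[n∸m]≡n a≤b))) (m∣m*n (p ^ (b ∸ a)))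

    typical-bad : ∀ n → 2 ≤ n → n ≤ x → Typical y E n → ((p , _) : Bad k n) → Dec (p ≤ y) → Events n
    typical-bad n 2≤n n≤x typical (p , pp , bad) (no p≰y) = medium-or-large n 2≤n n≤x typical p pp (≰⇒> p≰y) (∣-trans (^-∣ p k≥4) (p^k∣s bad)) (p ≤? 2 ^ scale 8 J) (p ≤? 2 ^ h)
      where
      p^k∣s : ((p ^ k ∣ n) × ¬ (p ^ k ∣ s n)) ⊎ ((p ^ k ∣ s n) × ¬ (p ^ k ∣ n)) → p ^ k ∣ s n
      p^k∣s (inj₁ (h , _)) = contradiction (∣-trans (subst (_∣ p ^ k) (cong (p *_) (*-identityʳ p)) (^-∣ p (≤-trans (s≤s (s≤s z≤n)) k≥4))) h) (proj₁ typical p (≰⇒> p≰y))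
      p^k∣s (inj₂ (h , _)) = h
    typical-bad n 2≤n n≤x typical (p , pp , bad) (yes p≤y) = inj₂ (inj₂ (inj₁ (p , prime≥1 pp , p≤y , unhit (prime? p))))
      where
      1≤n : 1 ≤ n
      1≤n = ≤-trans (s≤s z≤n) 2≤n
      not-σ₁ : ((p ^ k ∣ n) × ¬ (p ^ k ∣ s n)) ⊎ ((p ^ k ∣ s n) × ¬ (p ^ k ∣ n)) → ¬ (p ^ k ∣ σ₁ n)
      not-σ₁ (inj₁ (h , ¬h)) σ∣ = ¬h (∣m+n∣m⇒∣n (subst (p ^ k ∣_) (trans (sym (s+n≡σ₁ n 1≤n)) (+-comm (s n) n)) σ∣) h)
      not-σ₁ (inj₂ (h , ¬h)) σ∣ = ¬h (∣m+n∣m⇒∣n (subst (p ^ k ∣_) (sym (s+n≡σ₁ n 1≤n)) σ∣) h)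
      unhit : (d : Dec (Prime p)) → UnhitAt d (3 * (y * k * M)) k y n
      unhit (no ¬pp) = contradiction pp ¬pp
      unhit (yes pp′) = [ id , (λ σ∣ → contradiction σ∣ (not-σ₁ bad)) ]′ (unhit-or-power∣σ₁ pp′ (3 * (y * k * M)) k y E n y≥2 1≤n typical)

    classify : ∀ n → 2 ≤ n → n ≤ x → Bad k n → Events n
    classify n 2≤n n≤x bad = [ (λ (j , _ , _ , y<j , j²∣n) → inj₁ (j , y<j , j²∣n)) , (λ no-square →
      [ (λ (j , _ , j≤y , 2≤j , j^E∣n) → inj₂ (inj₁ (j , 2≤j , j≤y , j^E∣n)))
      , (λ no-power → typical-bad n 2≤n n≤x (squarefree no-square , λ j 2≤j j≤y j^E∣n → no-power j (≤-trans (s≤s z≤n) 2≤j) j≤y (2≤j , j^E∣n)) bad (proj₁ bad ≤? y)) ]′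
        (search (λ j → (2 ≤? j) ×-dec (j ^ E ∣? n)) y)) ]′ (search (λ j → (y <? j) ×-dec (j * j ∣? n)) n)
      where
      squarefree : (∀ j → 1 ≤ j → j ≤ n → ¬ (y < j × j * j ∣ n)) → ∀ j → y < j → ¬ (j * j ∣ n)
      squarefree no-square j y<j j²∣n = no-square j 1≤j (≤-trans (m≤m*n j j {{>-nonZero 1≤j}}) (∣⇒≤ {{>-nonZero (≤-trans (s≤s z≤n) 2≤n)}} j²∣n)) (y<j , j²∣n)
        where
        1≤j : 1 ≤ j
        1≤j = ≤-trans (s≤s z≤n) y<j

    top≤x : ∀ j → j₀ ≤ j → j < J → 2 ^ top j ≤ x
    top≤x j j₀≤j j<J = ≤-trans (^-monoʳ-≤ 2 (≤-trans (top≤ j (≤-trans j₀≥1 j₀≤j)) (below j j₀≤j j<J))) 2^N≤x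

    last-top≤ : last-top ≤ 2 ^ scale 8 J * 2 ^ scale 8 J
    last-top≤ = ≤-trans window≤N (≤-trans (<⇒≤ N<J) (≤-reflexive (trans (cong (2 ^_) (double (2 ^ J))) (^-distribˡ-+-* 2 (scale 8 J) (scale 8 J)))))
      where
      double : ∀ z → 16 * z ≡ 8 * z + 8 * z
      double = solve-∀

    h≥1 : 1 ≤ h
    h≥1 = ≤-trans e≥1 e≤h

    -- Seven events of proportion 1 / M, and 4 / M for the large primes.
    rare-bad : Rare M 11 x (λ n → 2 ≤ n × Bad k n)
    rare-bad = rare-⊆ {M} {11} {x} (λ { n _ n≤x (2≤n , bad) → classify n 2≤n n≤x bad })
      (rare-⊎ {M} {1} {10} {x} (rare-squares M x y (≤-trans (s≤s z≤n) y≥2) (≤-trans (m≤n*m M 10) 10M≤y))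
      (rare-⊎ {M} {1} {9} {x} (rare-powers M x y E yM≤)
      (rare-⊎ {M} {1} {8} {x} (rare-unhit M x k y M≥1 (≤-trans (s≤s z≤n) k≥4) (≤-trans (s≤s z≤n) y≥2) sizes≤)
      (rare-⊎ {M} {1} {7} {x} (rare-scales M x j₀ J M≥1 j₀≥1 8M≤ top≤x)
      (rare-⊎ {M} {1} {6} {x} (rare-missing M x L (2 * h) last-top M≥1 3M≤L (≤-trans h≥1 (m≤m+n h _)) refl (≤-trans (^-monoʳ-≤ 2 window≤N) 2^N≤x))
      (rare-⊎ {M} {1} {5} {x} (rare-medium M x (scale 8 J) h last-top (≤-trans 20M≤ (^-monoʳ-≤ 2 e≤h)) (≤-trans 10M≤y (^-monoʳ-≤ 2 (*-monoʳ-≤ 8 (^-monoʳ-≤ 2 j₀≤J)))) last-top≤)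
      (rare-⊎ {M} {1} {4} {x} (rare-missing M x L (5 * e) e₁ M≥1 3M≤L (≤-trans e≥1 (m≤n*m e 5)) refl (≤-trans (^-monoʳ-≤ 2 (≤-trans (≤-trans e₁≤h (m≤m+n h _)) (≤-trans (m≤n*m (2 * h) (64 ^ (2 * L)) {{>-nonZero c₀≥1}}) window≤N))) 2^N≤x))
        rare-large)))))))

-- Choice of the parameters

floor-log : ∀ x → 1 ≤ x → ∃[ N ] (2 ^ N ≤ x × x < 2 ^ suc N)
floor-log (suc zero) _ = 0 , ≤-refl , ≤-refl
floor-log (suc (suc x)) _ with floor-log (suc x) (s≤s z≤n)
... | N , lo , hi with suc (suc x) <? 2 ^ suc N
...   | yes sx< = N , m≤n⇒m≤1+n lo , sx<
...   | no sx≮ = suc N , ≮⇒≥ sx≮ , ≤-<-trans hi (^-monoʳ-< 2 (s≤s (s≤s z≤n)) (n<1+n (suc N)))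

linear≤exp : ∀ C e → suc (2 * C) ≤ e → C * suc e ≤ 2 ^ e
linear≤exp C e C< = begin
  C * suc e            ≤⟨ *-mono-≤ (<⇒≤ (n<2^n C)) (≤-trans (≤-reflexive (trans (cong suc (sym e≡)) (sym (+-suc C b)))) C+sb≤) ⟩
  2 ^ C * 2 ^ b        ≡⟨ sym (^-distribˡ-+-* 2 C b) ⟩
  2 ^ (C + b)          ≡⟨ cong (2 ^_) e≡ ⟩
  2 ^ e                ∎
  where
  open ≤-Reasoning
  C≤e : C ≤ e
  C≤e = ≤-trans (m≤m+n C (C + 0)) (≤-trans (n≤1+n _) C<)
  b = e ∸ C
  e≡ : C + b ≡ e
  e≡ = m+[n∸m]≡n C≤e
  C<b : suc C ≤ b
  C<b = +-cancelˡ-≤ C (suc C) b (≤-trans (≤-reflexive (trans (+-suc C C) (cong (λ z → suc (C + z)) (sym (+-identityʳ C))))) (≤-trans C< (≤-reflexive (sym e≡))))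
  2b≤ : ∀ b → 1 ≤ b → b + b ≤ 2 ^ b
  2b≤ (suc b) _ = ≤-trans (+-mono-≤ (n<2^n b) (n<2^n b)) (≤-reflexive (cong (2 ^ b +_) (sym (+-identityʳ (2 ^ b)))))
  C+sb≤ : C + suc b ≤ 2 ^ b
  C+sb≤ = ≤-trans (≤-reflexive (+-suc C b)) (≤-trans (+-monoˡ-≤ b C<b) (2b≤ b (≤-trans (s≤s z≤n) C<b)))

module Threshold (k M : ℕ) (k≥4 : 4 ≤ k) (M≥1 : 1 ≤ M) where

  private
    -- The last window ends at the exponent c₀ · 2h = 20 c₀² e = D e, so e = ⌊N / D⌋ fits it below
    -- 2^N. The bound e₀ collects the requirements on e; among them, C is such that (N + 1) M ≤ C (e
    -- + 1) ≤ 2^e.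
    j₀ y E L c₀ D C e₀ sizes : ℕ
    j₀ = 8 * M
    y = 2 ^ scale 8 j₀
    E = y * M
    L = 3 * M
    c₀ = 64 ^ (2 * L)
    D = 20 * (c₀ * c₀)
    C = D * M
    e₀ = suc (2 * C) + (y * (y * E) + (y + 20 * M))
    sizes = ∑ y (λ p → sizeAt (prime? p) (3 * (y * k * M)) k y)

  threshold : ℕ
  threshold = 2 ^ (D * e₀) + (sizes + M)

  private
    D≥1 : 1 ≤ D
    D≥1 = *-mono-≤ {1} {20} (s≤s z≤n) (*-mono-≤ (m^n>0 64 (2 * L)) (m^n>0 64 (2 * L)))

    instance
      D≢0 : NonZero D
      D≢0 = >-nonZero D≥1

    window : ∀ c e → c * (2 * (2 * (c * (5 * e)))) ≡ 20 * (c * c) * e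
    window = solve-∀

    10M≤y : 10 * M ≤ y
    10M≤y = ≤-trans (*-monoˡ-≤ M (m≤m+n 10 54)) (≤-trans (≤-reflexive (*-assoc 8 8 M)) (≤-trans (<⇒≤ (n<2^n (8 * (8 * M)))) (^-monoʳ-≤ 2 (*-monoʳ-≤ 8 (<⇒≤ (n<2^n j₀))))))

    from-log : ∀ x N → threshold ≤ x → 2 ^ N ≤ x → x < 2 ^ suc N → Rare M 11 x (λ n → 2 ≤ n × Bad k n)
    from-log x N threshold≤ 2^N≤x x< = conclude (last-scale N N j₀ (≤-trans (n<2^n N) (^-monoʳ-≤ 2 N≤)))
      where
      e = N / D
      N≤ : N ≤ scale 16 (N + j₀)
      N≤ = ≤-trans (<⇒≤ (n<2^n N)) (≤-trans (^-monoʳ-≤ 2 (m≤m+n N j₀)) (m≤n*m (2 ^ (N + j₀)) 16))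
      De₀≤N : D * e₀ ≤ N
      De₀≤N = ≮⇒≥ λ N< → <⇒≱ x< (≤-trans (^-monoʳ-≤ 2 N<) (≤-trans (m≤m+n (2 ^ (D * e₀)) (sizes + M)) threshold≤))
      e₀≤e : e₀ ≤ e
      e₀≤e = m*n≤o⇒m≤o/n e₀ D N (≤-trans (≤-reflexive (*-comm e₀ D)) De₀≤N)
      De≤N : D * e ≤ N
      De≤N = ≤-trans (≤-reflexive (*-comm D e)) (m/n*n≤m N D)
      N<Dse : suc N ≤ D * suc e
      N<Dse = ≤-trans (≤-reflexive (cong suc (m≡m%n+[m/n]*n N D))) (≤-trans (+-monoˡ-≤ (e * D) (m%n<n N D)) (≤-reflexive (*-comm (suc e) D)))
      KM≤ : suc N * M ≤ 2 ^ e
      KM≤ = ≤-trans (*-monoˡ-≤ M N<Dse) (≤-trans (≤-reflexive (swap D (suc e) M)) (linear≤exp C e (≤-trans (m≤m+n (suc (2 * C)) _) e₀≤e)))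
        where
        swap : ∀ a b c → a * b * c ≡ a * c * b
        swap = solve-∀
      rest≤e : y * (y * E) + (y + 20 * M) ≤ e
      rest≤e = ≤-trans (m≤n+m _ (suc (2 * C))) e₀≤e
      y+20M≤e : y + 20 * M ≤ e
      y+20M≤e = ≤-trans (m≤n+m _ (y * (y * E))) rest≤e
      conclude : ∃[ J ] (j₀ ≤ J × N < 2 ^ scale 16 J × (∀ j → j₀ ≤ j → j < J → 2 ^ scale 16 j ≤ N)) → Rare M 11 x (λ n → 2 ≤ n × Bad k n)
      conclude (J , j₀≤J , N<J , below) = Classification.rare-bad k x N (suc N) M E L e j₀ J k≥4 M≥1 ≤-refl (≤-trans M≥1 (m≤n*m M 8)) (<⇒≤ (n<2^n j₀))
        2^N≤x x< (≤-trans (s≤s z≤n) e₀≤e) KM≤ (≤-trans (m≤n+m (20 * M) y) (≤-trans y+20M≤e (<⇒≤ (n<2^n e))))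
        (≤-trans (≤-reflexive (window c₀ e)) De≤N) (<⇒≤ (n<2^n E)) 10M≤y (≤-trans (m≤m+n y (20 * M)) (≤-trans y+20M≤e (<⇒≤ (n<2^n e))))
        (≤-trans (m≤m+n (y * (y * E)) _) rest≤e) j₀≤J N<J below
        (≤-trans (m≤m+n sizes M) (≤-trans (m≤n+m (sizes + M) (2 ^ (D * e₀))) threshold≤))

  -- The integer 1 is set apart because s(1) = 0 is divisible by every power; x ≥ M pays for it.
  rare-bad-or-1 : ∀ x → threshold ≤ x → Rare M 12 x (λ n → n ≡ 1 ⊎ (2 ≤ n × Bad k n))
  rare-bad-or-1 x threshold≤ = rare-⊎ {M} {1} {11} {x} (1 , few-single (λ { m n (_ , refl) (_ , refl) → refl })
      , *-monoʳ-≤ 1 (≤-trans (m≤n+m M sizes) (≤-trans (m≤n+m (sizes + M) (2 ^ (D * e₀))) threshold≤)))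
    (at (floor-log x (≤-trans M≥1 (≤-trans (m≤n+m M sizes) (≤-trans (m≤n+m (sizes + M) (2 ^ (D * e₀))) threshold≤)))))
    where
    at : ∃[ N ] (2 ^ N ≤ x × x < 2 ^ suc N) → Rare M 11 x (λ n → 2 ≤ n × Bad k n)
    at (N , lo , hi) = from-log x N threshold≤ lo hi

-- Deciding whether an integer is k-free, and the set S

^-monoˡ-∣ : ∀ k {m n} → m ∣ n → m ^ k ∣ n ^ k
^-monoˡ-∣ zero _ = ∣-refl
^-monoˡ-∣ (suc k) m∣n = *-pres-∣ m∣n (^-monoˡ-∣ k m∣n)

divisible-power : ∀ k n → 1 ≤ k → 1 ≤ n → KFree k n ⊎ ∃[ p ] (Prime p × p ^ k ∣ n)
divisible-power k n 1≤k 1≤n = found (search (λ m → (1 <? m) ×-dec (m ^ k ∣? n)) n)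
  where
  found : (∃[ m ] (1 ≤ m × m ≤ n × 1 < m × m ^ k ∣ n)) ⊎ (∀ m → 1 ≤ m → m ≤ n → ¬ (1 < m × m ^ k ∣ n)) → KFree k n ⊎ ∃[ p ] (Prime p × p ^ k ∣ n)
  found (inj₁ (m , _ , _ , 1<m , m^k∣n)) = let (p , pp , p∣m) = prime-factor m 1<m in inj₂ (p , pp , ∣-trans (^-monoˡ-∣ k p∣m) m^k∣n)
  found (inj₂ none) = inj₁ λ m 1<m m^k∣n → none m (<⇒≤ 1<m)
    (≤-trans (≤-trans (≤-reflexive (sym (*-identityʳ m))) (^-monoʳ-≤ m {{>-nonZero (<⇒≤ 1<m)}} 1≤k)) (∣⇒≤ {{>-nonZero 1≤n}} m^k∣n)) (1<m , m^k∣n)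

kfree? : ∀ k → 1 ≤ k → ∀ n → Dec (KFree k n)
-- The value 0 has to be decided because it occurs as `s 1`.
kfree? k 1≤k zero = no λ free → free 2 ≤-refl ((2 ^ k) ∣0)
kfree? k 1≤k (suc n) = decide (divisible-power k (suc n) 1≤k (s≤s z≤n))
  where
  decide : KFree k (suc n) ⊎ ∃[ p ] (Prime p × p ^ k ∣ suc n) → Dec (KFree k (suc n))
  decide (inj₁ free) = yes free
  decide (inj₂ (p , pp , p^k∣n)) = no λ free → free p (prime≥2 pp) p^k∣n

agree : ∀ {P Q : Set} → Dec P → Dec Q → Bool
agree (yes _) (yes _) = true
agree (yes _) (no _) = false
agree (no _) (yes _) = false
agree (no _) (no _) = true

agree-true : ∀ {P Q : Set} (p : Dec P) (q : Dec Q) → agree p q ≡ true → P ⇔ Q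
agree-true (yes p) (yes q) _ = mk⇔ (λ _ → q) (λ _ → p)
agree-true (no ¬p) (no ¬q) _ = mk⇔ (λ p → contradiction p ¬p) (λ q → contradiction q ¬q)

agree-false : ∀ {P Q : Set} (p : Dec P) (q : Dec Q) → agree p q ≡ false → (P × ¬ Q) ⊎ (¬ P × Q)
agree-false (yes p) (no ¬q) _ = inj₁ (p , ¬q)
agree-false (no ¬p) (yes q) _ = inj₂ (¬p , q)

prime-power : ∀ k n → 1 ≤ k → 1 ≤ n → ¬ KFree k n → ∃[ p ] (Prime p × p ^ k ∣ n)
prime-power k n 1≤k 1≤n ¬free = [ (λ free → contradiction free ¬free) , id ]′ (divisible-power k n 1≤k 1≤n)

mismatch⇒Bad : ∀ k n → 1 ≤ k → 2 ≤ n → (KFree k n × ¬ KFree k (s n)) ⊎ (¬ KFree k n × KFree k (s n)) → Bad k n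
mismatch⇒Bad k n 1≤k 2≤n (inj₁ (free , ¬free)) = let (p , pp , p^k∣s) = prime-power k (s n) 1≤k (s≥1 n 2≤n) ¬free in p , pp , inj₂ (p^k∣s , free p (prime≥2 pp))
mismatch⇒Bad k n 1≤k 2≤n (inj₂ (¬free , free)) = let (p , pp , p^k∣n) = prime-power k n 1≤k (≤-trans (s≤s z≤n) 2≤n) ¬free in p , pp , inj₁ (p^k∣n , free p (prime≥2 pp))

count-complement : ∀ S x → count S x + ∑ x (λ n → 𝟙 (S n Bool.≟ false)) ≡ x
count-complement S zero = refl
count-complement S (suc x) with S (suc x) | count-complement S x
... | true | eq = cong suc (trans (cong (count S x +_) (+-identityʳ _)) eq)
... | false | eq = trans (sym (+-assoc (count S x) _ 1)) (trans (cong (_+ 1) eq) (+-comm x 1))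

-- The precision 12 m reduces the proportion 12 / (12 m) to 1 / m.
density-1 : ∀ S → (∀ m → 1 ≤ m → ∃[ N ] (∀ x → N ≤ x → Rare (12 * m) 12 x (λ n → S n ≡ false))) → Density1 S
density-1 S rare m 1≤m = let (N , h) = rare m 1≤m in N , λ x N≤x → bound x (h x N≤x)
  where
  open ≤-Reasoning
  regroup : ∀ m K → 12 * (m * K) ≡ K * (12 * m)
  regroup = solve-∀
  bound : ∀ x → Rare (12 * m) 12 x (λ n → S n ≡ false) → m * (x ∸ count S x) ≤ x
  bound x (K , few , K≤) = *-cancelˡ-≤ 12 (begin
    12 * (m * (x ∸ count S x))   ≤⟨ *-monoʳ-≤ 12 (*-monoʳ-≤ m complement≤K) ⟩
    12 * (m * K)                 ≡⟨ regroup m K ⟩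
    K * (12 * m)                 ≤⟨ K≤ ⟩
    12 * x                       ∎)
    where
    complement≤K : x ∸ count S x ≤ K
    complement≤K = begin
      x ∸ count S x                                      ≡⟨ cong (_∸ count S x) (sym (count-complement S x)) ⟩
      count S x + ∑ x (λ n → 𝟙 (S n Bool.≟ false)) ∸ count S x  ≡⟨ m+n∸m≡n (count S x) _ ⟩
      ∑ x (λ n → 𝟙 (S n Bool.≟ false))                   ≤⟨ ∑-𝟙-few (λ n → S n Bool.≟ false) x (few-⊆ (λ { n (1≤n , n≤x , eq) → (1≤n , n≤x) , eq }) few) ⟩
      K                                                  ∎

theorem1p2 : (k : ℕ) → 4 ≤ k →
    ∃[ S ] (Density1 S × (∀ n → 1 ≤ n → S n ≡ true → (KFree k n ⇔ KFree k (s n))))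
theorem1p2 k k≥4 = S
  , density-1 S (λ m 1≤m → Threshold.threshold k (12 * m) k≥4 (12m≥1 m 1≤m)
      , λ x h → rare-⊆ {12 * m} {12} {x} (λ n 1≤n _ → exceptional n 1≤n) (Threshold.rare-bad-or-1 k (12 * m) k≥4 (12m≥1 m 1≤m) x h))
  , λ n _ → agree-true (kfree? k k≥1 n) (kfree? k k≥1 (s n))
  where
  k≥1 : 1 ≤ k
  k≥1 = ≤-trans (s≤s z≤n) k≥4
  -- With S defined by the equivalence itself, only its density is at stake.
  S : ℕ → Bool
  S n = agree (kfree? k k≥1 n) (kfree? k k≥1 (s n))
  12m≥1 : ∀ m → 1 ≤ m → 1 ≤ 12 * m
  12m≥1 m 1≤m = ≤-trans 1≤m (m≤n*m m 12)
  exceptional : ∀ n → 1 ≤ n → S n ≡ false → n ≡ 1 ⊎ (2 ≤ n × Bad k n)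
  exceptional (suc zero) _ _ = inj₁ refl
  exceptional (suc (suc n)) _ eq = inj₂ (s≤s (s≤s z≤n) , mismatch⇒Bad k (suc (suc n)) k≥1 (s≤s (s≤s z≤n)) (agree-false (kfree? k k≥1 (suc (suc n))) (kfree? k k≥1 (s (suc (suc n)))) eq))
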